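{- Let $\tau\in\mathbf C$ with $\operatorname{Im}\tau>0$ and $q=e^{\pi i\tau}$. For all $x,y,z\in\mathbf C$ the following four identities hold: $$3\vartheta_1(z+x|\tau)\vartheta_1(z+y|\tau)\vartheta_1(z-x-y|\tau)=A^{\dagger}\left(-x,-y\Big|\tfrac{\tau}{3}\right)\vartheta_1\left(z\Big|\tfrac{\tau}{3}\right)-C^{\dagger}\left(x,y\Big|\tfrac{\tau}{3}\right)\vartheta_1\left(z-\tfrac{\pi}{3}\Big|\tfrac{\tau}{3}\right)-C^{\dagger}\left(-x,-y\Big|\tfrac{\tau}{3}\right)\vartheta_1\left(z+\tfrac{\pi}{3}\Big|\tfrac{\tau}{3}\right),$$ $$3\vartheta_3(z+x|\tau)\vartheta_3(z+y|\tau)\vartheta_3(z-x-y|\tau)=A^{\dagger}\left(-x,-y\Big|\tfrac{\tau}{3}\right)\vartheta_3\left(z\Big|\tfrac{\tau}{3}\right)+C^{\dagger}\left(x,y\Big|\tfrac{\tau}{3}\right)\vartheta_3\left(z-\tfrac{\pi}{3}\Big|\tfrac{\tau}{3}\right)+C^{\dagger}\left(-x,-y\Big|\tfrac{\tau}{3}\right)\vartheta_3\left(z+\tfrac{\pi}{3}\Big|\tfrac{\tau}{3}\right),$$ $$\left(C^\dagger(x,y|\tau)\right)^3-\left(C^\dagger(-x,-y|\tau)\right)^3=q^2e^{4ix+2iy}\left(C^\dagger(x+\pi\tau,y|\tau)\right)^3-q^2e^{4ix+2iy}\left(C^\dagger(-x-\pi\tau,-y|\tau)\right)^3$$ and $$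\left(A^\dagger(x,y|\tau)\right)^3-\left(C^\dagger(x,y|\tau)\right)^3=q^2e^{4ix+2iy}\left(A^\dagger(x+\pi\tau,y|\tau)\right)^3-q^2e^{4ix+2iy}\left(C^\dagger(x+\pi\tau,y|\tau)\right)^3.$$
   Context: For $\operatorname{Im}\tau>0$ put $q=e^{\pi i\tau}$, with real powers $q^r=e^{\pi i r\tau}$, and $\omega=e^{2\pi i/3}$. The Jacobi theta functions used are $$\vartheta_1(z|\tau)=-i\sum_{n=-\infty}^{\infty}(-1)^nq^{(2n+1)^2/4}e^{(2n+1)iz},\qquad \vartheta_3(z|\tau)=\sum_{n=-\infty}^\infty q^{n^2}e^{2niz}.$$ The two-variable series are $$A^{\dagger}(x,y|\tau)=\sum_{m,n\in\mathbf Z}q^{2(m^2-mn+n^2)}e^{2imx}e^{2iny},\qquad C^{\dagger}(x,y|\tau)=\sum_{m,n\in\mathbf Z}\omega^{m+n}q^{2(m^2-mn+n^2)}e^{2imx}e^{2iny}.$$ When the last argument is $\tau/3$ instead of $\tau$, $q$ is replaced throughout the definition by $e^{\pi i\tau/3}$. -}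

module Defs where

open import Data.Nat as ℕ using (ℕ; zero; suc)
import Data.Nat.Properties as ℕ
open import Data.Integer as ℤ using (ℤ; +[1+_]; -[1+_])
import Data.Integer.Properties as ℤ
import Data.Nat.Coprimality as Coprime
open import Data.Rational as ℚ using (ℚ; mkℚ; 0ℚ; 1ℚ; ½)
import Data.Rational.Properties as ℚ
open import Data.Rational.Solver using (module +-*-Solver)
open import Data.List using (List; foldr)
open import Data.List.Relation.Unary.Unique.Propositional using (Unique)
open import Data.List.Relation.Binary.Subset.Propositional using (_⊆_)
open import Data.Product using (∃; _×_; _,_; proj₁; proj₂)
open import Data.Sum using (inj₁; inj₂)
open import Relation.Binary.PropositionalEquality
  using (_≡_; refl; sym; trans; cong; cong₂; subst; subst₂)

------------------------------------------------------------------------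
-- Auxiliary facts about ℚ

module ℚ-lemmas where

  open +-*-Solver

  ≤-by : ∀ {a b c d : ℚ} → a ≡ c → b ≡ d → c ℚ.≤ d → a ℚ.≤ b
  ≤-by p q = subst₂ ℚ._≤_ (sym p) (sym q)

  ∣∣-bound : ∀ {a b} → a ℚ.≤ b → ℚ.- a ℚ.≤ b → ℚ.∣ a ∣ ℚ.≤ b
  ∣∣-bound {a} p q with ℚ.∣p∣≡p∨∣p∣≡-p a
  ... | inj₁ e = subst (ℚ._≤ _) (sym e) p
  ... | inj₂ e = subst (ℚ._≤ _) (sym e) q

  ∣∣-swap : ∀ a b → ℚ.∣ a ℚ.- b ∣ ≡ ℚ.∣ b ℚ.- a ∣
  ∣∣-swap a b = trans (sym (ℚ.∣-p∣≡∣p∣ (a ℚ.- b)))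
    (cong ℚ.∣_∣ (solve 2 (λ a b → :- (a :- b) := b :- a) refl a b))

  ∣∣-triangle : ∀ a b c → ℚ.∣ a ℚ.- c ∣ ℚ.≤ ℚ.∣ a ℚ.- b ∣ ℚ.+ ℚ.∣ b ℚ.- c ∣
  ∣∣-triangle a b c = subst (λ t → ℚ.∣ t ∣ ℚ.≤ ℚ.∣ a ℚ.- b ∣ ℚ.+ ℚ.∣ b ℚ.- c ∣)
    (solve 3 (λ a b c → (a :- b) :+ (b :- c) := a :- c) refl a b c)
    (ℚ.∣p+q∣≤∣p∣+∣q∣ (a ℚ.- b) (b ℚ.- c))

  ∣∣-reverse : ∀ a b → ℚ.∣ ℚ.∣ a ∣ ℚ.- ℚ.∣ b ∣ ∣ ℚ.≤ ℚ.∣ a ℚ.- b ∣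
  ∣∣-reverse a b = ∣∣-bound (half a b)
    (≤-by (solve 2 (λ a b → :- (a :- b) := b :- a) refl ℚ.∣ a ∣ ℚ.∣ b ∣)
          (∣∣-swap a b) (half b a))
    where
    half : ∀ a b → ℚ.∣ a ∣ ℚ.- ℚ.∣ b ∣ ℚ.≤ ℚ.∣ a ℚ.- b ∣
    half a b = ≤-by refl
      (solve 2 (λ d b → d := (d :+ b) :- b) refl ℚ.∣ a ℚ.- b ∣ ℚ.∣ b ∣)
      (ℚ.+-monoˡ-≤ (ℚ.- ℚ.∣ b ∣)
        (subst (λ t → ℚ.∣ t ∣ ℚ.≤ ℚ.∣ a ℚ.- b ∣ ℚ.+ ℚ.∣ b ∣)
          (solve 2 (λ a b → (a :- b) :+ b := a) refl a b)
          (ℚ.∣p+q∣≤∣p∣+∣q∣ (a ℚ.- b) b)))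

  *-mono : ∀ {a b c d} → 0ℚ ℚ.≤ a → 0ℚ ℚ.≤ d → a ℚ.≤ b → c ℚ.≤ d →
           a ℚ.* c ℚ.≤ b ℚ.* d
  *-mono {a} {b} {c} {d} 0≤a 0≤d a≤b c≤d = ℚ.≤-trans
    (ℚ.*-monoˡ-≤-nonNeg a {{ℚ.nonNegative 0≤a}} c≤d)
    (ℚ.*-monoʳ-≤-nonNeg d {{ℚ.nonNegative 0≤d}} a≤b)

  0≤+ : ∀ {a b} → 0ℚ ℚ.≤ a → 0ℚ ℚ.≤ b → 0ℚ ℚ.≤ a ℚ.+ b
  0≤+ p q = ℚ.+-mono-≤ p q

  0≤* : ∀ {a b} → 0ℚ ℚ.≤ a → 0ℚ ℚ.≤ b → 0ℚ ℚ.≤ a ℚ.* b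
  0≤* {a} {b} p q = subst (ℚ._≤ a ℚ.* b) (ℚ.*-zeroʳ a)
    (ℚ.*-monoˡ-≤-nonNeg a {{ℚ.nonNegative p}} q)

  0<* : ∀ {a b} → 0ℚ ℚ.< a → 0ℚ ℚ.< b → 0ℚ ℚ.< a ℚ.* b
  0<* {a} {b} p q = subst (ℚ._< a ℚ.* b) (ℚ.*-zeroʳ a)
    (ℚ.*-monoʳ-<-pos a {{ℚ.positive p}} q)

  0<½ : 0ℚ ℚ.< ½
  0<½ = ℚ.positive⁻¹ ½

  halve : ∀ {ε} → 0ℚ ℚ.< ε → 0ℚ ℚ.< ½ ℚ.* ε
  halve = 0<* 0<½

  halves : ∀ ε → ½ ℚ.* ε ℚ.+ ½ ℚ.* ε ≡ ε
  halves ε = solve 1 (λ e → con ½ :* e :+ con ½ :* e := e) refl ε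

  split : ∀ {a b c} ε → a ℚ.≤ b ℚ.+ c → b ℚ.≤ ½ ℚ.* ε → c ℚ.≤ ½ ℚ.* ε → a ℚ.≤ ε
  split ε p q r = ℚ.≤-trans p (subst (_ ℚ.≤_) (halves ε) (ℚ.+-mono-≤ q r))

  -- a / c for positive c
  quotient : ∀ a c → 0ℚ ℚ.< a → 0ℚ ℚ.< c → ∃ λ d → 0ℚ ℚ.< d × c ℚ.* d ≡ a
  quotient a c 0<a 0<c = d , 0<* (ℚ.positive⁻¹ c⁻¹ {{pos}}) 0<a , eq
    where
    instance
      c-pos : ℚ.Positive c
      c-pos = ℚ.positive 0<c
      c-nz : ℚ.NonZero c
      c-nz = ℚ.pos⇒nonZero c
    c⁻¹ d : ℚ
    c⁻¹ = ℚ.1/ c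
    d = c⁻¹ ℚ.* a
    pos : ℚ.Positive c⁻¹
    pos = ℚ.1/pos⇒pos c
    eq : c ℚ.* d ≡ a
    eq = trans (sym (ℚ.*-assoc c c⁻¹ a))
           (trans (cong (ℚ._* a) (ℚ.*-inverseʳ c)) (ℚ.*-identityˡ a))

  nat : ℕ → ℚ
  nat n = mkℚ (ℤ.+ n) 0 (Coprime.sym (Coprime.1-coprimeTo n))

  nat≡ : ∀ n → ℤ.+ n ℚ./ 1 ≡ nat n
  nat≡ n = ℚ.↥p/↧p≡p (nat n)

  recip≡ : ∀ n → ℤ.+ 1 ℚ./ suc n ≡ ℚ.1/ nat (suc n)
  recip≡ n = ℚ.↥p/↧p≡p (ℚ.1/ nat (suc n))

  nat-mono : ∀ {m n} → m ℕ.≤ n → nat m ℚ.≤ nat n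
  nat-mono m≤n = ℚ.*≤* (ℤ.*-monoʳ-≤-nonNeg (ℤ.+ 1) (ℤ.+≤+ m≤n))

  archimedean : ∀ r → ∃ λ n → r ℚ.≤ nat n
  archimedean (mkℚ p d _) = ℤ.∣ p ∣ , ℚ.*≤* le
    where
    lem : ∀ p → p ℤ.≤ ℤ.+ ℤ.∣ p ∣
    lem (ℤ.+ n)  = ℤ.≤-refl
    lem -[1+ n ] = ℤ.-≤+
    le : p ℤ.* ℤ.1ℤ ℤ.≤ ℤ.+ ℤ.∣ p ∣ ℤ.* ℤ.+ suc d
    le = ℤ.≤-trans (ℤ.≤-reflexive (ℤ.*-identityʳ p))
         (ℤ.≤-trans (lem p)
           (subst (ℤ.+ ℤ.∣ p ∣ ℤ.≤_) (ℤ.pos-* ℤ.∣ p ∣ (suc d))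
             (ℤ.+≤+ (ℕ.m≤m*n ℤ.∣ p ∣ (suc d)))))

  recip : ℕ → ℚ
  recip n = ℤ.+ 1 ℚ./ suc n

  recip-inv : ∀ n → recip n ℚ.* nat (suc n) ≡ 1ℚ
  recip-inv n = trans (cong (ℚ._* nat (suc n)) (recip≡ n)) (ℚ.*-inverseˡ (nat (suc n)))

  0<nat : ∀ n → 0ℚ ℚ.< nat (suc n)
  0<nat n = ℚ.positive⁻¹ (nat (suc n))

  0<recip : ∀ n → 0ℚ ℚ.< recip n
  0<recip n = subst (0ℚ ℚ.<_) (sym (recip≡ n)) (ℚ.positive⁻¹ (ℚ.1/ nat (suc n)))

  -- b ≤ c / (n + 1) with c constant is eventually at most ε
  vanishing : ∀ c ε → 0ℚ ℚ.< ε → ∃ λ N → ∀ n b → N ℕ.≤ n →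
              b ℚ.* nat (suc n) ℚ.≤ c → b ℚ.≤ ε
  vanishing c ε 0<ε = N , λ n b N≤n h →
    ℚ.*-cancelʳ-≤-pos (nat (suc n)) (ℚ.≤-trans h (ℚ.≤-trans c≤ (mono n N≤n)))
    where
    instance
      ε-pos : ℚ.Positive ε
      ε-pos = ℚ.positive 0<ε
      ε-nz : ℚ.NonZero ε
      ε-nz = ℚ.pos⇒nonZero ε
      ε-nonNeg : ℚ.NonNegative ε
      ε-nonNeg = ℚ.pos⇒nonNeg ε
    N : ℕ
    N = proj₁ (archimedean (ℚ.1/ ε ℚ.* c))
    c≤ : c ℚ.≤ ε ℚ.* nat N
    c≤ = ≤-by (trans (sym (ℚ.*-identityˡ c))
                (trans (cong (ℚ._* c) (sym (ℚ.*-inverseʳ ε))) (ℚ.*-assoc ε (ℚ.1/ ε) c)))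
              refl
              (ℚ.*-monoˡ-≤-nonNeg ε (proj₂ (archimedean (ℚ.1/ ε ℚ.* c))))
    mono : ∀ n → N ℕ.≤ n → ε ℚ.* nat N ℚ.≤ ε ℚ.* nat (suc n)
    mono n N≤n = ℚ.*-monoˡ-≤-nonNeg ε (nat-mono (ℕ.m≤n⇒m≤1+n N≤n))

  recip-vanishes : ∀ ε → 0ℚ ℚ.< ε → ∃ λ N → ∀ n → N ℕ.≤ n → recip n ℚ.≤ ε
  recip-vanishes ε 0<ε = proj₁ v , λ n N≤n →
    proj₂ v n (recip n) N≤n (ℚ.≤-reflexive (recip-inv n))
    where v = vanishing 1ℚ ε 0<ε

open ℚ-lemmas

------------------------------------------------------------------------
-- Real numbers: Cauchy sequences of rationals carrying a modulus

record ℝ : Set where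
  constructor mkℝ
  field
    seq    : ℕ → ℚ
    cauchy : ∀ ε → 0ℚ ℚ.< ε →
             ∃ λ N → ∀ m n → N ℕ.≤ m → N ℕ.≤ n → ℚ.∣ seq m ℚ.- seq n ∣ ℚ.≤ ε

open ℝ public

infix 4 _≃ᴿ_ _≤ᴿ_ _<ᴿ_

_≃ᴿ_ : ℝ → ℝ → Set
x ≃ᴿ y = ∀ ε → 0ℚ ℚ.< ε → ∃ λ N → ∀ n → N ℕ.≤ n → ℚ.∣ seq x n ℚ.- seq y n ∣ ℚ.≤ ε

_≤ᴿ_ : ℝ → ℝ → Set
x ≤ᴿ y = ∀ ε → 0ℚ ℚ.< ε → ∃ λ N → ∀ n → N ℕ.≤ n → seq x n ℚ.≤ seq y n ℚ.+ ε

_<ᴿ_ : ℝ → ℝ → Set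
x <ᴿ y = ∃ λ ε → 0ℚ ℚ.< ε × ∃ λ N → ∀ n → N ℕ.≤ n → seq x n ℚ.+ ε ℚ.≤ seq y n

fromℚ : ℚ → ℝ
fromℚ r .seq _ = r
fromℚ r .cauchy ε 0<ε = 0 , λ _ _ _ _ →
  subst (ℚ._≤ ε) (sym (cong ℚ.∣_∣ (ℚ.+-inverseʳ r))) (ℚ.<⇒≤ 0<ε)

0ᴿ 1ᴿ : ℝ
0ᴿ = fromℚ 0ℚ
1ᴿ = fromℚ 1ℚ

-- Opaque; the value is irrelevant, only the bound is used.
abstract

  bounded : (x : ℝ) → ∃ λ B → 0ℚ ℚ.≤ B × ∀ n → ℚ.∣ seq x n ∣ ℚ.≤ B
  bounded x = B , 0≤B , bound
    where
    open +-*-Solver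
    N : ℕ
    N = proj₁ (cauchy x 1ℚ (ℚ.positive⁻¹ 1ℚ))
    total : ℕ → ℚ
    total zero    = ℚ.∣ seq x 0 ∣
    total (suc n) = total n ℚ.+ ℚ.∣ seq x (suc n) ∣
    0≤total : ∀ n → 0ℚ ℚ.≤ total n
    0≤total zero    = ℚ.0≤∣p∣ _
    0≤total (suc n) = 0≤+ (0≤total n) (ℚ.0≤∣p∣ _)
    grow : ∀ a {b} → 0ℚ ℚ.≤ b → a ℚ.≤ a ℚ.+ b
    grow a p = ℚ.≤-trans (ℚ.≤-reflexive (sym (ℚ.+-identityʳ a))) (ℚ.+-monoʳ-≤ a p)
    below : ∀ m n → m ℕ.≤ n → ℚ.∣ seq x m ∣ ℚ.≤ total n
    below m zero    ℕ.z≤n = ℚ.≤-refl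
    below m (suc n) m≤n with ℕ.m≤n⇒m<n∨m≡n m≤n
    ... | inj₁ m<n  = ℚ.≤-trans (below m n (ℕ.s≤s⁻¹ m<n)) (grow (total n) (ℚ.0≤∣p∣ _))
    ... | inj₂ refl = ≤-by refl (ℚ.+-comm (total n) ℚ.∣ seq x (suc n) ∣)
                        (grow ℚ.∣ seq x (suc n) ∣ (0≤total n))
    B : ℚ
    B = total N ℚ.+ 1ℚ
    0≤B : 0ℚ ℚ.≤ B
    0≤B = 0≤+ (0≤total N) (ℚ.nonNegative⁻¹ 1ℚ)
    bound : ∀ n → ℚ.∣ seq x n ∣ ℚ.≤ B
    bound n with ℕ.≤-total n N
    ... | inj₁ n≤N = ℚ.≤-trans (below n N n≤N) (grow (total N) (ℚ.nonNegative⁻¹ 1ℚ))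
    ... | inj₂ N≤n = ℚ.≤-trans
      (subst (λ t → ℚ.∣ t ∣ ℚ.≤ ℚ.∣ seq x N ∣ ℚ.+ ℚ.∣ seq x n ℚ.- seq x N ∣)
        (solve 2 (λ a b → b :+ (a :- b) := a) refl (seq x n) (seq x N))
        (ℚ.∣p+q∣≤∣p∣+∣q∣ (seq x N) (seq x n ℚ.- seq x N)))
      (ℚ.+-mono-≤ (below N N ℕ.≤-refl)
        (proj₂ (cauchy x 1ℚ (ℚ.positive⁻¹ 1ℚ)) n N N≤n ℕ.≤-refl))

infixl 6 _+ᴿ_ _-ᴿ_
infixl 7 _*ᴿ_
infix  8 -ᴿ_

_+ᴿ_ : ℝ → ℝ → ℝ
(x +ᴿ y) .seq n = seq x n ℚ.+ seq y n
(x +ᴿ y) .cauchy ε 0<ε =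
  let M , p = cauchy x (½ ℚ.* ε) (halve 0<ε)
      N , q = cauchy y (½ ℚ.* ε) (halve 0<ε)
  in M ℕ.⊔ N , λ m n h k → split ε
       (subst (λ t → ℚ.∣ t ∣ ℚ.≤ ℚ.∣ seq x m ℚ.- seq x n ∣ ℚ.+ ℚ.∣ seq y m ℚ.- seq y n ∣)
         (solve 4 (λ a b c d → (a :- b) :+ (c :- d) := (a :+ c) :- (b :+ d)) refl
           (seq x m) (seq x n) (seq y m) (seq y n))
         (ℚ.∣p+q∣≤∣p∣+∣q∣ (seq x m ℚ.- seq x n) (seq y m ℚ.- seq y n)))
       (p m n (ℕ.m⊔n≤o⇒m≤o M N h) (ℕ.m⊔n≤o⇒m≤o M N k))
       (q m n (ℕ.m⊔n≤o⇒n≤o M N h) (ℕ.m⊔n≤o⇒n≤o M N k))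
  where open +-*-Solver

-ᴿ_ : ℝ → ℝ
(-ᴿ x) .seq n = ℚ.- seq x n
(-ᴿ x) .cauchy ε 0<ε =
  let N , p = cauchy x ε 0<ε
  in N , λ m n h k → subst (λ t → ℚ.∣ t ∣ ℚ.≤ ε)
       (solve 2 (λ a b → b :- a := :- a :- (:- b)) refl (seq x m) (seq x n))
       (p n m k h)
  where open +-*-Solver

_-ᴿ_ : ℝ → ℝ → ℝ
x -ᴿ y = x +ᴿ (-ᴿ y)

∣_∣ᴿ : ℝ → ℝ
∣ x ∣ᴿ .seq n = ℚ.∣ seq x n ∣
∣ x ∣ᴿ .cauchy ε 0<ε =
  let N , p = cauchy x ε 0<ε
  in N , λ m n h k → ℚ.≤-trans (∣∣-reverse (seq x m) (seq x n)) (p m n h k)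

_*ᴿ_ : ℝ → ℝ → ℝ
(x *ᴿ y) .seq n = seq x n ℚ.* seq y n
(x *ᴿ y) .cauchy ε 0<ε =
  let A , 0≤A , x≤A   = bounded x
      B , 0≤B , y≤B   = bounded y
      C               = (A ℚ.+ B) ℚ.+ 1ℚ
      0<C             = ℚ.+-mono-≤-< (0≤+ 0≤A 0≤B) (ℚ.positive⁻¹ 1ℚ)
      δ , 0<δ , Cδ≡ε  = quotient ε C 0<ε 0<C
      0≤δ             = ℚ.<⇒≤ 0<δ
      M , p = cauchy x δ 0<δ
      N , q = cauchy y δ 0<δ
  in M ℕ.⊔ N , λ m n h k →
    let a = seq x m ; b = seq x n ; c = seq y m ; d = seq y n
        p′ = p m n (ℕ.m⊔n≤o⇒m≤o M N h) (ℕ.m⊔n≤o⇒m≤o M N k)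
        q′ = q m n (ℕ.m⊔n≤o⇒n≤o M N h) (ℕ.m⊔n≤o⇒n≤o M N k)
        s₁ : ℚ.∣ a ℚ.* c ℚ.- b ℚ.* d ∣ ℚ.≤ ℚ.∣ a ℚ.* (c ℚ.- d) ∣ ℚ.+ ℚ.∣ (a ℚ.- b) ℚ.* d ∣
        s₁ = subst
          (λ t → ℚ.∣ t ∣ ℚ.≤ ℚ.∣ a ℚ.* (c ℚ.- d) ∣ ℚ.+ ℚ.∣ (a ℚ.- b) ℚ.* d ∣)
          (solve 4 (λ a b c d → a :* (c :- d) :+ (a :- b) :* d := a :* c :- b :* d)
            refl a b c d)
          (ℚ.∣p+q∣≤∣p∣+∣q∣ (a ℚ.* (c ℚ.- d)) ((a ℚ.- b) ℚ.* d))
        s₂ = ℚ.+-mono-≤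
          (≤-by (ℚ.∣p*q∣≡∣p∣*∣q∣ a (c ℚ.- d)) refl
            (*-mono (ℚ.0≤∣p∣ a) 0≤δ (x≤A m) q′))
          (≤-by (ℚ.∣p*q∣≡∣p∣*∣q∣ (a ℚ.- b) d) refl
            (*-mono (ℚ.0≤∣p∣ (a ℚ.- b)) 0≤B p′ (y≤B n)))
        s₃ : A ℚ.* δ ℚ.+ δ ℚ.* B ℚ.≤ C ℚ.* δ
        s₃ = ≤-by
          (solve 3 (λ A B δ → A :* δ :+ δ :* B := (A :+ B) :* δ :+ con 0ℚ) refl A B δ)
          (solve 3 (λ A B δ → (A :+ B :+ con 1ℚ) :* δ := (A :+ B) :* δ :+ δ) refl A B δ)
          (ℚ.+-monoʳ-≤ ((A ℚ.+ B) ℚ.* δ) 0≤δ)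
    in subst (ℚ.∣ a ℚ.* c ℚ.- b ℚ.* d ∣ ℚ.≤_) Cδ≡ε (ℚ.≤-trans s₁ (ℚ.≤-trans s₂ s₃))
  where open +-*-Solver

------------------------------------------------------------------------
-- Completeness of ℝ

infix 4 _⟶ᴿ_

_⟶ᴿ_ : (ℕ → ℝ) → ℝ → Set
X ⟶ᴿ L = ∀ ε → 0ℚ ℚ.< ε → ∃ λ N → ∀ n → N ℕ.≤ n → ∣ X n -ᴿ L ∣ᴿ ≤ᴿ fromℚ ε

Cauchyᴿ : (ℕ → ℝ) → Set
Cauchyᴿ X = ∀ ε → 0ℚ ℚ.< ε →
  ∃ λ N → ∀ m n → N ℕ.≤ m → N ℕ.≤ n → ∣ X m -ᴿ X n ∣ᴿ ≤ᴿ fromℚ ε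

abstract

  complete : ∀ X → Cauchyᴿ X → ∃ λ L → X ⟶ᴿ L
  complete X cau = mkℝ L L-cauchy , converges
    where
    open +-*-Solver
    J : ℕ → ℕ
    J n = proj₁ (cauchy (X n) (recip n) (0<recip n))
    L : ℕ → ℚ
    L n = seq (X n) (J n)
    -- L n is within 1/(n+1) of all late terms of X n.
    near : ∀ n j → J n ℕ.≤ j → ℚ.∣ seq (X n) j ℚ.- L n ∣ ℚ.≤ recip n
    near n j J≤j = proj₂ (cauchy (X n) (recip n) (0<recip n)) j (J n) J≤j ℕ.≤-refl
    close : ∀ ε → 0ℚ ℚ.< ε → ∃ λ N → ∀ m n → N ℕ.≤ m → N ℕ.≤ n →
            ∃ λ I → ∀ i → I ℕ.≤ i → ℚ.∣ seq (X m) i ℚ.- seq (X n) i ∣ ℚ.≤ ε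
    close ε 0<ε = N , λ m n h k →
      let I , p = proj₂ (cau ε₂ (halve 0<ε)) m n h k ε₂ (halve 0<ε)
      in I , λ i I≤i → subst (ℚ.∣ seq (X m) i ℚ.- seq (X n) i ∣ ℚ.≤_) (halves ε) (p i I≤i)
      where
      ε₂ : ℚ
      ε₂ = ½ ℚ.* ε
      N : ℕ
      N = proj₁ (cau ε₂ (halve 0<ε))
    -- Late terms of X m are close to L n.
    mixed : ∀ ε → 0ℚ ℚ.< ε → ∃ λ N → ∀ m n → N ℕ.≤ m → N ℕ.≤ n →
            ∃ λ I → ∀ i → I ℕ.≤ i → ℚ.∣ seq (X m) i ℚ.- L n ∣ ℚ.≤ ε
    mixed ε 0<ε = M ℕ.⊔ N , λ m n h k →
      let I , p = proj₂ (close ε₂ (halve 0<ε)) m n (ℕ.m⊔n≤o⇒m≤o M N h) (ℕ.m⊔n≤o⇒m≤o M N k)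
      in I ℕ.⊔ J n , λ i I≤i → split ε
           (∣∣-triangle (seq (X m) i) (seq (X n) i) (L n))
           (p i (ℕ.m⊔n≤o⇒m≤o I (J n) I≤i))
           (ℚ.≤-trans (near n i (ℕ.m⊔n≤o⇒n≤o I (J n) I≤i))
                      (proj₂ (recip-vanishes ε₂ (halve 0<ε)) n (ℕ.m⊔n≤o⇒n≤o M N k)))
      where
      ε₂ : ℚ
      ε₂ = ½ ℚ.* ε
      M N : ℕ
      M = proj₁ (close ε₂ (halve 0<ε))
      N = proj₁ (recip-vanishes ε₂ (halve 0<ε))
    L-cauchy : ∀ ε → 0ℚ ℚ.< ε →
               ∃ λ N → ∀ m n → N ℕ.≤ m → N ℕ.≤ n → ℚ.∣ L m ℚ.- L n ∣ ℚ.≤ ε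
    L-cauchy ε 0<ε = N , λ m n h k →
      let I , p = proj₂ (mixed ε₂ (halve 0<ε)) m m h h
          K , q = proj₂ (mixed ε₂ (halve 0<ε)) m n h k
          i     = I ℕ.⊔ K
      in split ε (∣∣-triangle (L m) (seq (X m) i) (L n))
           (≤-by (∣∣-swap (L m) (seq (X m) i)) refl (p i (ℕ.m≤m⊔n I K)))
           (q i (ℕ.m≤n⊔m I K))
      where
      ε₂ : ℚ
      ε₂ = ½ ℚ.* ε
      N : ℕ
      N = proj₁ (mixed ε₂ (halve 0<ε))
    converges : X ⟶ᴿ mkℝ L L-cauchy
    converges ε 0<ε = N , λ n N≤n δ 0<δ →
      let M , p = cauchy (X n) δ 0<δ
      in M ℕ.⊔ N , λ j h →
        let I , q = proj₂ (mixed ε 0<ε) n j N≤n (ℕ.m⊔n≤o⇒n≤o M N h)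
            i     = I ℕ.⊔ M
        in ℚ.≤-trans (∣∣-triangle (seq (X n) j) (seq (X n) i) (L j))
             (≤-by refl (ℚ.+-comm ε δ) (ℚ.+-mono-≤
               (p j i (ℕ.m⊔n≤o⇒m≤o M N h) (ℕ.m≤n⊔m I M))
               (q i (ℕ.m≤m⊔n I M))))
      where
      N : ℕ
      N = proj₁ (mixed ε 0<ε)

------------------------------------------------------------------------
-- Complex numbers

record ℂ : Set where
  constructor _+𝕚_
  field
    re im : ℝ

open ℂ public

infix  4 _≃_
infixl 6 _+_ _-_
infixl 7 _*_ _·_ _⋅_
infix  8 -_
infixr 9 _^_

_≃_ : ℂ → ℂ → Set
z ≃ w = (re z ≃ᴿ re w) × (im z ≃ᴿ im w)

fromℝ : ℝ → ℂ
fromℝ x = x +𝕚 0ᴿ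

0ℂ 1ℂ 𝕚 : ℂ
0ℂ = fromℝ 0ᴿ
1ℂ = fromℝ 1ᴿ
𝕚  = 0ᴿ +𝕚 1ᴿ

_+_ : ℂ → ℂ → ℂ
z + w = (re z +ᴿ re w) +𝕚 (im z +ᴿ im w)

_*_ : ℂ → ℂ → ℂ
z * w = (re z *ᴿ re w -ᴿ im z *ᴿ im w) +𝕚 (re z *ᴿ im w +ᴿ im z *ᴿ re w)

-_ : ℂ → ℂ
- z = (-ᴿ re z) +𝕚 (-ᴿ im z)

_-_ : ℂ → ℂ → ℂ
z - w = z + (- w)

_^_ : ℂ → ℕ → ℂ
z ^ zero  = 1ℂ
z ^ suc n = z * z ^ n

_·_ : ℚ → ℂ → ℂ
r · z = (fromℚ r *ᴿ re z) +𝕚 (fromℚ r *ᴿ im z)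

_⋅_ : ℤ → ℂ → ℂ
k ⋅ z = (k ℚ./ 1) · z

-- The ℓ¹ norm |Re z| + |Im z|: it needs no square roots and defines the
-- same convergence as the modulus.
‖_‖ : ℂ → ℝ
‖ z ‖ = ∣ re z ∣ᴿ +ᴿ ∣ im z ∣ᴿ

infix 4 _⟶_

_⟶_ : (ℕ → ℂ) → ℂ → Set
Z ⟶ w = ∀ ε → 0ℚ ℚ.< ε → ∃ λ N → ∀ n → N ℕ.≤ n → ‖ Z n - w ‖ ≤ᴿ fromℚ ε

-- Unconditional convergence of a family indexed by I: the sums over finite
-- sets of indices (duplicate-free lists), directed by inclusion, tend to s.
∑ : ∀ {I : Set} → (I → ℂ) → List I → ℂ
∑ f T = foldr (λ i s → f i + s) 0ℂ T

HasSum : ∀ {I : Set} → (I → ℂ) → ℂ → Set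
HasSum {I} f s = ∀ ε → 0ℚ ℚ.< ε →
  ∃ λ (S : List I) → ∀ (T : List I) → Unique T → S ⊆ T → ‖ ∑ f T - s ‖ ≤ᴿ fromℚ ε

------------------------------------------------------------------------
-- The exponential function

-- z ^ k / k!
expTerm : ℂ → ℕ → ℂ
expTerm z zero    = 1ℂ
expTerm z (suc k) = (ℤ.+ 1 ℚ./ suc k) · (z * expTerm z k)

expPartial : ℂ → ℕ → ℂ
expPartial z zero    = 0ℂ
expPartial z (suc n) = expPartial z n + expTerm z n

module exp-lemmas (z : ℂ) where

  open +-*-Solver

  nrm : ℂ → ℕ → ℚ
  nrm w = seq ‖ w ‖

  0≤nrm : ∀ w j → 0ℚ ℚ.≤ nrm w j
  0≤nrm w j = 0≤+ (ℚ.0≤∣p∣ (seq (re w) j)) (ℚ.0≤∣p∣ (seq (im w) j))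

  nrm-* : ∀ v w j → nrm (v * w) j ℚ.≤ nrm v j ℚ.* nrm w j
  nrm-* v w j = ℚ.≤-trans
    (ℚ.+-mono-≤
      (ℚ.≤-trans (ℚ.∣p-q∣≤∣p∣+∣q∣ (a ℚ.* c) (b ℚ.* d))
        (ℚ.≤-reflexive (cong₂ ℚ._+_ (ℚ.∣p*q∣≡∣p∣*∣q∣ a c) (ℚ.∣p*q∣≡∣p∣*∣q∣ b d))))
      (ℚ.≤-trans (ℚ.∣p+q∣≤∣p∣+∣q∣ (a ℚ.* d) (b ℚ.* c))
        (ℚ.≤-reflexive (cong₂ ℚ._+_ (ℚ.∣p*q∣≡∣p∣*∣q∣ a d) (ℚ.∣p*q∣≡∣p∣*∣q∣ b c)))))
    (ℚ.≤-reflexive (solve 4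
      (λ a b c d → (a :* c :+ b :* d) :+ (a :* d :+ b :* c) := (a :+ b) :* (c :+ d))
      refl (ℚ.∣ a ∣) (ℚ.∣ b ∣) (ℚ.∣ c ∣) (ℚ.∣ d ∣)))
    where
    a b c d : ℚ
    a = seq (re v) j
    b = seq (im v) j
    c = seq (re w) j
    d = seq (im w) j

  nrm-· : ∀ r → 0ℚ ℚ.≤ r → ∀ w j → nrm (r · w) j ≡ r ℚ.* nrm w j
  nrm-· r 0≤r w j = trans
    (cong₂ ℚ._+_ (abs (seq (re w) j)) (abs (seq (im w) j)))
    (sym (ℚ.*-distribˡ-+ r ℚ.∣ seq (re w) j ∣ ℚ.∣ seq (im w) j ∣))
    where
    abs : ∀ a → ℚ.∣ r ℚ.* a ∣ ≡ r ℚ.* ℚ.∣ a ∣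
    abs a = trans (ℚ.∣p*q∣≡∣p∣*∣q∣ r a) (cong (ℚ._* ℚ.∣ a ∣) (ℚ.0≤p⇒∣p∣≡p 0≤r))

  B : ℚ
  B = proj₁ (bounded (re z)) ℚ.+ proj₁ (bounded (im z))

  0≤B : 0ℚ ℚ.≤ B
  0≤B = 0≤+ (proj₁ (proj₂ (bounded (re z)))) (proj₁ (proj₂ (bounded (im z))))

  z≤B : ∀ j → nrm z j ℚ.≤ B
  z≤B j = ℚ.+-mono-≤ (proj₂ (proj₂ (bounded (re z))) j) (proj₂ (proj₂ (bounded (im z))) j)

  b : ℕ → ℚ
  b zero    = 1ℚ
  b (suc k) = recip k ℚ.* (B ℚ.* b k)

  0≤b : ∀ k → 0ℚ ℚ.≤ b k
  0≤b zero    = ℚ.nonNegative⁻¹ 1ℚ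
  0≤b (suc k) = 0≤* (ℚ.<⇒≤ (0<recip k)) (0≤* 0≤B (0≤b k))

  term≤b : ∀ k j → nrm (expTerm z k) j ℚ.≤ b k
  term≤b zero    j = ℚ.≤-refl
  term≤b (suc k) j = ≤-by (nrm-· (recip k) (ℚ.<⇒≤ (0<recip k)) (z * expTerm z k) j) refl
    (ℚ.*-monoˡ-≤-nonNeg (recip k) {{ℚ.nonNegative (ℚ.<⇒≤ (0<recip k))}}
      (ℚ.≤-trans (nrm-* z (expTerm z k) j)
        (*-mono (0≤nrm z j) (0≤b k) (z≤B j) (term≤b k j))))

  K : ℕ
  K = proj₁ (archimedean (B ℚ.+ B))

  b-halves : ∀ k → K ℕ.≤ k → b (suc k) ℚ.+ b (suc k) ℚ.≤ b k
  b-halves k K≤k = ≤-by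
    (solve 3 (λ r B b → r :* (B :* b) :+ r :* (B :* b) := r :* ((B :+ B) :* b)) refl
      (recip k) B (b k))
    (trans (sym (ℚ.*-identityˡ (b k)))
      (trans (cong (ℚ._* b k) (sym (recip-inv k))) (ℚ.*-assoc (recip k) (nat (suc k)) (b k))))
    (ℚ.*-monoˡ-≤-nonNeg (recip k) {{ℚ.nonNegative (ℚ.<⇒≤ (0<recip k))}}
      (ℚ.*-monoʳ-≤-nonNeg (b k) {{ℚ.nonNegative (0≤b k)}}
        (ℚ.≤-trans (proj₂ (archimedean (B ℚ.+ B))) (nat-mono (ℕ.m≤n⇒m≤1+n K≤k)))))

  nat-double : ∀ i → nat (suc (suc i)) ℚ.≤ nat (suc i) ℚ.+ nat (suc i)
  nat-double i = ≤-by refl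
    (trans (cong (ℚ._/ 1) (cong₂ ℤ._+_ (ℤ.*-identityʳ (ℤ.+ suc i)) (ℤ.*-identityʳ (ℤ.+ suc i))))
           (nat≡ (suc i ℕ.+ suc i)))
    (nat-mono (ℕ.s≤s (ℕ.m≤n+m (suc i) i)))

  b-decay : ∀ i → b (i ℕ.+ K) ℚ.* nat (suc i) ℚ.≤ b K
  b-decay zero    = ℚ.≤-reflexive (ℚ.*-identityʳ (b K))
  b-decay (suc i) = ℚ.≤-trans
    (ℚ.*-monoˡ-≤-nonNeg b′ {{ℚ.nonNegative (0≤b (suc (i ℕ.+ K)))}} (nat-double i))
    (ℚ.≤-trans
      (≤-by (solve 2 (λ b n → b :* (n :+ n) := (b :+ b) :* n) refl b′ (nat (suc i))) refl
        (ℚ.*-monoʳ-≤-nonNeg (nat (suc i)) (b-halves (i ℕ.+ K) (ℕ.m≤n+m K i))))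
      (b-decay i))
    where
    b′ : ℚ
    b′ = b (suc (i ℕ.+ K))

  diff : ℕ → ℕ → ℂ
  diff m n = expPartial z m - expPartial z n

  tail : ∀ n → K ℕ.≤ n → ∀ d j →
         nrm (diff (d ℕ.+ n) n) j ℚ.+ (b (d ℕ.+ n) ℚ.+ b (d ℕ.+ n)) ℚ.≤ b n ℚ.+ b n
  tail n K≤n zero j = ℚ.≤-reflexive (trans
    (cong (ℚ._+ (b n ℚ.+ b n)) (cong₂ (λ s t → ℚ.∣ s ∣ ℚ.+ ℚ.∣ t ∣)
      (ℚ.+-inverseʳ (seq (re (expPartial z n)) j))
      (ℚ.+-inverseʳ (seq (im (expPartial z n)) j))))
    (ℚ.+-identityˡ (b n ℚ.+ b n)))
  tail n K≤n (suc d) j = ℚ.≤-trans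
    (ℚ.+-mono-≤ (ℚ.+-mono-≤ (add re) (add im)) (b-halves (d ℕ.+ n) (ℕ.m≤n⇒m≤o+n d K≤n)))
    (ℚ.≤-trans
      (≤-by
        (solve 5 (λ p q r s t → ((p :+ r) :+ (q :+ s)) :+ t := (r :+ s) :+ ((p :+ q) :+ t))
          refl ℚ.∣ seq (re D) j ∣ ℚ.∣ seq (im D) j ∣ ℚ.∣ seq (re t) j ∣ ℚ.∣ seq (im t) j ∣ bk)
        (solve 2 (λ D b → D :+ (b :+ b) := b :+ (D :+ b)) refl (nrm D j) bk)
        (ℚ.+-monoˡ-≤ (nrm D j ℚ.+ bk) (term≤b (d ℕ.+ n) j)))
      (tail n K≤n d j))
    where
    D t : ℂ
    D = diff (d ℕ.+ n) n
    t = expTerm z (d ℕ.+ n)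
    bk : ℚ
    bk = b (d ℕ.+ n)
    add : (π : ℂ → ℝ) →
          ℚ.∣ (seq (π (expPartial z (d ℕ.+ n))) j ℚ.+ seq (π t) j)
              ℚ.- seq (π (expPartial z n)) j ∣
          ℚ.≤ ℚ.∣ seq (π (expPartial z (d ℕ.+ n))) j ℚ.- seq (π (expPartial z n)) j ∣
              ℚ.+ ℚ.∣ seq (π t) j ∣
    add π = subst
      (λ v → ℚ.∣ v ∣ ℚ.≤ ℚ.∣ x ℚ.- y ∣ ℚ.+ ℚ.∣ u ∣)
      (solve 3 (λ x y u → (x :- y) :+ u := (x :+ u) :- y) refl x y u)
      (ℚ.∣p+q∣≤∣p∣+∣q∣ (x ℚ.- y) u)
      where
      x y u : ℚ
      x = seq (π (expPartial z (d ℕ.+ n))) j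
      y = seq (π (expPartial z n)) j
      u = seq (π t) j

  uniform : ∀ ε → 0ℚ ℚ.< ε →
            ∃ λ N → ∀ n j → N ℕ.≤ n → nrm (diff n N) j ℚ.≤ ε
  uniform ε 0<ε = N , λ n j N≤n → ℚ.≤-trans (grow (0≤+ (0≤b n) (0≤b n)))
    (subst (λ k → nrm (diff k N) j ℚ.+ (b k ℚ.+ b k) ℚ.≤ ε) (ℕ.m∸n+n≡m N≤n)
      (ℚ.≤-trans (tail N (ℕ.m≤n+m K M) (n ℕ.∸ N) j)
        (split ε ℚ.≤-refl bN≤ bN≤)))
    where
    grow : ∀ {a c} → 0ℚ ℚ.≤ c → a ℚ.≤ a ℚ.+ c
    grow {a} p = ℚ.≤-trans (ℚ.≤-reflexive (sym (ℚ.+-identityʳ a))) (ℚ.+-monoʳ-≤ a p)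
    v = vanishing (b K) (½ ℚ.* ε) (halve 0<ε)
    M N : ℕ
    M = proj₁ v
    N = M ℕ.+ K
    bN≤ : b N ℚ.≤ ½ ℚ.* ε
    bN≤ = proj₂ v M (b N) ℕ.≤-refl (b-decay M)

  component : (π : ℂ → ℝ) →
    (∀ m n j → ℚ.∣ seq (π (expPartial z m)) j ℚ.- seq (π (expPartial z n)) j ∣
               ℚ.≤ nrm (diff m n) j) →
    Cauchyᴿ (λ n → π (expPartial z n))
  component π ≤nrm ε 0<ε = N , λ m n h k δ 0<δ → 0 , λ j _ → ℚ.≤-trans
    (split ε
      (∣∣-triangle (s m j) (s N j) (s n j))
      (ℚ.≤-trans (≤nrm m N j) (proj₂ u m j h))
      (≤-by (∣∣-swap (s N j) (s n j)) refl (ℚ.≤-trans (≤nrm n N j) (proj₂ u n j k))))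
    (ℚ.≤-trans (ℚ.≤-reflexive (sym (ℚ.+-identityʳ ε))) (ℚ.+-monoʳ-≤ ε (ℚ.<⇒≤ 0<δ)))
    where
    u = uniform (½ ℚ.* ε) (halve 0<ε)
    N : ℕ
    N = proj₁ u
    s : ℕ → ℕ → ℚ
    s n j = seq (π (expPartial z n)) j

  re-limit : ∃ λ L → (λ n → re (expPartial z n)) ⟶ᴿ L
  re-limit = complete (λ n → re (expPartial z n)) (component re λ m n j → ≤-by (sym (ℚ.+-identityʳ _)) refl
    (ℚ.+-monoʳ-≤ ℚ.∣ seq (re (diff m n)) j ∣ (ℚ.0≤∣p∣ (seq (im (diff m n)) j))))

  im-limit : ∃ λ L → (λ n → im (expPartial z n)) ⟶ᴿ L
  im-limit = complete (λ n → im (expPartial z n)) (component im λ m n j → ≤-by (sym (ℚ.+-identityˡ _)) refl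
    (ℚ.+-monoˡ-≤ ℚ.∣ seq (im (diff m n)) j ∣ (ℚ.0≤∣p∣ (seq (re (diff m n)) j))))

-- exp is opaque; exp-converges characterises it.
abstract

  exp : ℂ → ℂ
  exp z = proj₁ re-limit +𝕚 proj₁ im-limit
    where open exp-lemmas z

  exp-converges : ∀ z → expPartial z ⟶ exp z
  exp-converges z ε 0<ε =
    let M , p = proj₂ re-limit (½ ℚ.* ε) (halve 0<ε)
        N , q = proj₂ im-limit (½ ℚ.* ε) (halve 0<ε)
    in M ℕ.⊔ N , λ n h δ 0<δ →
      let I , f = p n (ℕ.m⊔n≤o⇒m≤o M N h) (½ ℚ.* δ) (halve 0<δ)
          J , g = q n (ℕ.m⊔n≤o⇒n≤o M N h) (½ ℚ.* δ) (halve 0<δ)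
      in I ℕ.⊔ J , λ j k → ≤-by refl
           (solve 2 (λ e d → e :+ d := (con ½ :* e :+ con ½ :* d) :+ (con ½ :* e :+ con ½ :* d))
             refl ε δ)
           (ℚ.+-mono-≤ (f j (ℕ.m⊔n≤o⇒m≤o I J k)) (g j (ℕ.m⊔n≤o⇒n≤o I J k)))
    where
    open exp-lemmas z
    open +-*-Solver

------------------------------------------------------------------------
-- The number π

-- e^{it} = cos t + i sin t for real t
sin : ℝ → ℝ
sin t = im (exp (𝕚 * fromℝ t))

-- π is the least positive zero of sin; minimality is put in the constructively
-- useful form that sin is positive before π (equivalent since sin′ 0 = 1).
record IsPi (π : ℝ) : Set where
  field
    π-positive   : 0ᴿ <ᴿ π
    sin-π        : sin π ≃ᴿ 0ᴿ
    sin-positive : ∀ t → 0ᴿ <ᴿ t → t <ᴿ π → 0ᴿ <ᴿ sin t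

------------------------------------------------------------------------
-- The upper half-plane

record ℍ : Set where
  constructor mkℍ
  field
    point    : ℂ
    positive : 0ᴿ <ᴿ im point

open ℍ public

_/3 : ℍ → ℍ
mkℍ τ (ε , 0<ε , N , p) /3 = mkℍ (⅓ · τ) (⅓ ℚ.* ε , 0<* (ℚ.positive⁻¹ ⅓) 0<ε , N , λ n N≤n →
  subst (ℚ._≤ ⅓ ℚ.* seq (im τ) n)
    (solve 1 (λ e → con ⅓ :* (con 0ℚ :+ e) := con 0ℚ :+ con ⅓ :* e) refl ε)
    (ℚ.*-monoˡ-≤-nonNeg ⅓ (p n N≤n)))
  where
  open +-*-Solver
  ⅓ : ℚ
  ⅓ = ℤ.+ 1 ℚ./ 3

------------------------------------------------------------------------
-- The series

module _ (π : ℝ) where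

  -- q^r = e^{πirτ}
  q^ : ℚ → ℍ → ℂ
  q^ r τ = exp (r · (fromℝ π * 𝕚 * point τ))

  -- ω^k = e^{2πik/3}
  ω^ : ℤ → ℂ
  ω^ k = exp (k ⋅ ((ℤ.+ 2 ℚ./ 3) · (fromℝ π * 𝕚)))

  -1^ : ℤ → ℂ
  -1^ n = (- 1ℂ) ^ ℤ.∣ n ∣

  ϑ₁-term : ℂ → ℍ → ℤ → ℂ
  ϑ₁-term z τ n =
    -1^ n * q^ ((2n+1 ℤ.* 2n+1) ℚ./ 4) τ * exp (2n+1 ⋅ (𝕚 * z))
    where
    2n+1 : ℤ
    2n+1 = ℤ.+ 2 ℤ.* n ℤ.+ ℤ.+ 1

  ϑ₃-term : ℂ → ℍ → ℤ → ℂ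
  ϑ₃-term z τ n = q^ ((n ℤ.* n) ℚ./ 1) τ * exp ((ℤ.+ 2 ℤ.* n) ⋅ (𝕚 * z))

  A†-term : ℂ → ℂ → ℍ → ℤ × ℤ → ℂ
  A†-term x y τ (m , n) =
    q^ ((ℤ.+ 2 ℤ.* (m ℤ.* m ℤ.- m ℤ.* n ℤ.+ n ℤ.* n)) ℚ./ 1) τ
      * exp ((ℤ.+ 2 ℤ.* m) ⋅ (𝕚 * x)) * exp ((ℤ.+ 2 ℤ.* n) ⋅ (𝕚 * y))

  C†-term : ℂ → ℂ → ℍ → ℤ × ℤ → ℂ
  C†-term x y τ (m , n) = ω^ (m ℤ.+ n) * A†-term x y τ (m , n)

  -- The four functions defined by the series. An element contains a proof
  -- that all the series converge, and is unique up to _≃_ since sums are.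
  record ThetaFunctions : Set where
    field
      ϑ₁ ϑ₃ : ℂ → ℍ → ℂ
      A† C† : ℂ → ℂ → ℍ → ℂ
      ϑ₁-series : ∀ z τ → ∃ λ s → HasSum (ϑ₁-term z τ) s × ϑ₁ z τ ≃ (- 𝕚) * s
      ϑ₃-series : ∀ z τ → HasSum (ϑ₃-term z τ) (ϑ₃ z τ)
      A†-series : ∀ x y τ → HasSum (A†-term x y τ) (A† x y τ)
      C†-series : ∀ x y τ → HasSum (C†-term x y τ) (C† x y τ)

{-# OPTIONS --safe #-}

-- With p = πi, u = πiτ and X, Y, Z = ix, iy, iz, every term of every series is
-- the exponential of a rational linear combination of p, u, X, Y, Z. The series
-- converge absolutely, so each identity is a rearrangement of lattice sums.
--
-- Products of three thetas: put a = n₁ − n₃, b = n₂ − n₃ and N = n₁ + n₂ + n₃.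
-- Then 3 ∑ nᵢ² = N² + 2 (a² − a b + b²), and (a , b , N) ranges over the triples
-- with N ≡ a + b (mod 3). On the right, the three products sum over all (a , b , N)
-- with the weight 1 + ω^k + ω^{−k}, k = a + b − N, which is 3 on that sublattice and
-- 0 off it.
--
-- Cubes: let w be the sum of the three lattice vectors of a term of the expanded
-- cube. If w ∈ √−3 ℤ[ω], the cubes of A† and C† have the same term there. Otherwise
-- rotating each vector by 120° about w/3 keeps w and maps the lattice to a translate,
-- which matches the terms on the left with those at the arguments shifted by πτ.
--
-- The values e^{πi} = −1 and 1 + ω + ω² = 0 come from sin π = 0 and the positivity
-- of the sine on (0 , π).

module Submission where

open import Algebra.Bundles using (CommutativeRing)
import Algebra.Solver.Ring as RingSolver
import Algebra.Solver.Ring.AlmostCommutativeRing as ACR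
open import Algebra.Structures using (IsCommutativeRing)
open import Data.Empty using (⊥-elim)
open import Data.Integer as ℤ using (ℤ)
open import Data.Integer using () renaming (+_ to pos)
open import Data.Integer.DivMod using (_/ℕ_; _%ℕ_; a≡a%ℕn+[a/ℕn]*n; n%ℕd<d)
import Data.Integer.Properties as ℤ
import Data.Integer.Solver as ℤSolver
open import Data.List using (List; []; _∷_; _++_; map; foldr; filter; deduplicate; cartesianProduct; downFrom)
import Data.List.Membership.DecPropositional as DecMembership
open import Data.List.Membership.Propositional using (_∈_; _∉_)
open import Data.List.Membership.Propositional.Properties
open import Data.List.Membership.Propositional.Properties.WithK using (unique∧set⇒bag)
open import Data.List.Relation.Binary.BagAndSetEquality using (∼bag⇒↭)
open import Data.List.Relation.Binary.Permutation.Propositional as ↭ using (_↭_)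
open import Data.List.Relation.Binary.Subset.Propositional using (_⊆_)
open import Data.List.Relation.Unary.All as All using (All; []; _∷_)
open import Data.List.Relation.Unary.AllPairs using ([]; _∷_)
open import Data.List.Relation.Unary.Any using (here; there)
open import Data.List.Relation.Unary.Unique.DecPropositional.Properties using (deduplicate-!)
open import Data.List.Relation.Unary.Unique.Propositional using (Unique)
import Data.List.Relation.Unary.Unique.Propositional.Properties as Unique
open import Data.Maybe using (Maybe; just; nothing)
open import Data.Nat as ℕ using (ℕ; zero; suc)
import Data.Nat.Coprimality as Coprime
import Data.Nat.Properties as ℕ
open import Data.Product using (∃; _×_; _,_; proj₁; proj₂)
open import Data.Product.Properties using (≡-dec)
open import Data.Rational as ℚ using (ℚ; 0ℚ; 1ℚ; ½; _/_)
import Data.Rational.Properties as ℚ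
open import Data.Rational.Solver using (module +-*-Solver)
open import Data.Sum using (_⊎_; inj₁; inj₂; map₁)
open import Function using (_∘_; id; mk⇔)
open import Level using (0ℓ)
open import Relation.Binary using (DecidableEquality)
import Relation.Binary.Reasoning.Setoid as SetoidReasoning
open import Relation.Binary.PropositionalEquality
  using (_≡_; _≢_; refl; sym; trans; cong; cong₂; subst; module ≡-Reasoning)
open import Relation.Nullary using (yes; no; ¬?)
open import Defs using (module ℚ-lemmas)
open ℚ-lemmas
open +-*-Solver using (solve; _:=_; _:+_; _:*_; _:-_; :-_; con)

-- Summable families of rationals

-- Equality of reals is not decidable constructively, and a sum is a limit over duplicate-free
-- lists, so every rearrangement needs explicit maps on indices. Hence the central tool
-- `hasSum-transfer` takes two maps that are mutually inverse only where terms do not vanish, an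
-- alternative that is decided on integer indices. All majorants are rational: |q| ≤ 1/(1 + δ)
-- follows from 1 + t ≤ e^t, and Bernoulli's inequality makes ρ^(n²) E^|n| summable without
-- logarithms. Sums are treated over an abstract algebra with rational bounds, which keeps Cauchy
-- sequences from being unfolded; ℂ enters as an instance afterwards. A parameter d treats both
-- theta functions at once (1 for ϑ₁, 0 for ϑ₃), and a twist ε treats A† (0), C†(x, y) (1) and
-- C†(-x, -y) (-1), so that each of the two pairs of formulas is a single rearrangement.

module Deduplication {I : Set} (_≟_ : DecidableEquality I) where

  open DecMembership _≟_ public using (_∈?_)

  nub : List I → List I
  nub = deduplicate _≟_

  nub-unique : ∀ T → Unique (nub T)
  nub-unique = deduplicate-! _≟_

  ∈-nub⁺ : ∀ {T i} → i ∈ T → i ∈ nub T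
  ∈-nub⁺ = ∈-deduplicate⁺ _≟_

  ∈-nub⁻ : ∀ T {i} → i ∈ nub T → i ∈ T
  ∈-nub⁻ = ∈-deduplicate⁻ _≟_

  infixl 6 _∖_

  _∖_ : List I → List I → List I
  T ∖ S = filter (λ i → ¬? (i ∈? S)) T

  ∖-unique : ∀ {T} S → Unique T → Unique (T ∖ S)
  ∖-unique S = Unique.filter⁺ (λ i → ¬? (i ∈? S))

  ∈-∖⁻ : ∀ {T S i} → i ∈ T ∖ S → i ∈ T × i ∉ S
  ∈-∖⁻ {S = S} = ∈-filter⁻ (λ i → ¬? (i ∈? S))

  ∈-∖⁺ : ∀ {T S i} → i ∈ T → i ∉ S → i ∈ T ∖ S
  ∈-∖⁺ {S = S} = ∈-filter⁺ (λ i → ¬? (i ∈? S))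

  -- Duplicate-free lists with the same members are permutations of one another; this isolates the
  -- remainder of a sum over `T` beyond `S`.
  ↭-∖ : ∀ {S T} → Unique S → Unique T → S ⊆ T → T ↭ S ++ (T ∖ S)
  ↭-∖ {S} {T} uS uT S⊆T = ∼bag⇒↭ (unique∧set⇒bag uT
    (Unique.++⁺ uS (∖-unique S uT) (λ { (i∈S , i∈T∖S) → proj₂ (∈-∖⁻ {T} {S} i∈T∖S) i∈S }))
    (mk⇔ into from))
    where
    into : ∀ {i} → i ∈ T → i ∈ S ++ (T ∖ S)
    into {i} i∈T with i ∈? S
    ... | yes i∈S = ∈-++⁺ˡ i∈S
    ... | no  i∉S = ∈-++⁺ʳ S (∈-∖⁺ i∈T i∉S)
    from : ∀ {i} → i ∈ S ++ (T ∖ S) → i ∈ T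
    from i∈ with ∈-++⁻ S i∈
    ... | inj₁ i∈S = S⊆T i∈S
    ... | inj₂ i∈R = proj₁ (∈-∖⁻ {T} {S} i∈R)

total : {I : Set} → (I → ℚ) → List I → ℚ
total a = foldr (λ i s → a i ℚ.+ s) 0ℚ

module _ {I : Set} (a : I → ℚ) where

  total-++ : ∀ S T → total a (S ++ T) ≡ total a S ℚ.+ total a T
  total-++ []      T = sym (ℚ.+-identityˡ (total a T))
  total-++ (i ∷ S) T = trans (cong (a i ℚ.+_) (total-++ S T))
    (sym (ℚ.+-assoc (a i) (total a S) (total a T)))

  module _ (0≤a : ∀ i → 0ℚ ℚ.≤ a i) where

    0≤total : ∀ T → 0ℚ ℚ.≤ total a T
    0≤total []      = ℚ.≤-refl
    0≤total (i ∷ T) = 0≤+ (0≤a i) (0≤total T)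

    -- The head of `T` occurs somewhere in `U`; removing that occurrence keeps the tail of `T`
    -- inside, because `T` has no repetition. Repetitions in `U` are harmless for non-negative
    -- terms.
    total-mono : ∀ {T U} → Unique T → T ⊆ U → total a T ℚ.≤ total a U
    total-mono {[]}    {U} _          _   = 0≤total U
    total-mono {i ∷ T} {U} (i∉T ∷ uT) T⊆U with ∈-∃++ (T⊆U (here refl))
    ... | V , W , refl = ≤-by refl
      (trans (total-++ V (i ∷ W))
        (trans (solve 3 (λ v i w → v :+ (i :+ w) := i :+ (v :+ w)) refl
                 (total a V) (a i) (total a W))
               (cong (a i ℚ.+_) (sym (total-++ V W)))))
      (ℚ.+-monoʳ-≤ (a i) (total-mono uT sub))
      where
      sub : T ⊆ V ++ W
      sub j∈T with ∈-++⁻ V (T⊆U (there j∈T))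
      ... | inj₁ j∈V          = ∈-++⁺ˡ j∈V
      ... | inj₂ (here refl)  = ⊥-elim (All.lookup i∉T j∈T refl)
      ... | inj₂ (there j∈W)  = ∈-++⁺ʳ V j∈W

total-map : ∀ {I J : Set} (a : J → ℚ) (φ : I → J) T → total a (map φ T) ≡ total (a ∘ φ) T
total-map a φ []      = refl
total-map a φ (i ∷ T) = cong (a (φ i) ℚ.+_) (total-map a φ T)

total-*ˡ : ∀ {I : Set} (a : I → ℚ) c T → total (λ i → c ℚ.* a i) T ≡ c ℚ.* total a T
total-*ˡ a c []      = sym (ℚ.*-zeroʳ c)
total-*ˡ a c (i ∷ T) = trans (cong (c ℚ.* a i ℚ.+_) (total-*ˡ a c T))
  (sym (ℚ.*-distribˡ-+ c (a i) (total a T)))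

infixr 7 _⊗_

_⊗_ : {I J : Set} → (I → ℚ) → (J → ℚ) → I × J → ℚ
(a ⊗ b) (i , j) = a i ℚ.* b j

total-⊗ : ∀ {I J : Set} (a : I → ℚ) (b : J → ℚ) S T →
          total (a ⊗ b) (cartesianProduct S T) ≡ total a S ℚ.* total b T
total-⊗ a b []      T = sym (ℚ.*-zeroˡ (total b T))
total-⊗ a b (i ∷ S) T = trans (total-++ (a ⊗ b) (map (i ,_) T) (cartesianProduct S T))
  (trans (cong₂ ℚ._+_ (trans (total-map (a ⊗ b) (i ,_) T) (total-*ˡ b (a i) T)) (total-⊗ a b S T))
         (sym (ℚ.*-distribʳ-+ (total b T) (a i) (total a S))))

-- The Cauchy criterion alone: a finite list outside of which all finite totals are small. No value
-- of the sum is mentioned, so the notion lives in ℚ.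
record Summable {I : Set} (a : I → ℚ) : Set where
  field
    0≤a  : ∀ i → 0ℚ ℚ.≤ a i
    tail : ∀ ε → 0ℚ ℚ.< ε → ∃ λ (S : List I) →
           ∀ T → Unique T → (∀ {i} → i ∈ T → i ∉ S) → total a T ℚ.≤ ε

open Summable

module _ {I : Set} (_≟_ : DecidableEquality I) {a : I → ℚ} (σ : Summable a) where

  open Deduplication _≟_

  opaque

    -- Off the finite list belonging to ε = 1, every total is at most 1.
    total-bounded : ∃ λ B → 0ℚ ℚ.≤ B × ∀ T → Unique T → total a T ℚ.≤ B
    total-bounded = B , 0≤+ (0≤total a (0≤a σ) S) (ℚ.nonNegative⁻¹ 1ℚ) , λ T uT → ℚ.≤-trans
      (total-mono a (0≤a σ) uT (covers T))
      (≤-by (total-++ a S (T ∖ S)) refl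
        (ℚ.+-monoʳ-≤ (total a S)
          (proj₂ tl (T ∖ S) (∖-unique S uT) (λ i∈ → proj₂ (∈-∖⁻ {T} {S} i∈)))))
      where
      tl : ∃ λ (S : List I) → ∀ T → Unique T → (∀ {i} → i ∈ T → i ∉ S) → total a T ℚ.≤ 1ℚ
      tl = tail σ 1ℚ (ℚ.positive⁻¹ 1ℚ)
      S : List I
      S = proj₁ tl
      B : ℚ
      B = total a S ℚ.+ 1ℚ
      covers : ∀ T → T ⊆ S ++ (T ∖ S)
      covers T {i} i∈T with i ∈? S
      ... | yes i∈S = ∈-++⁺ˡ i∈S
      ... | no  i∉S = ∈-++⁺ʳ S (∈-∖⁺ i∈T i∉S)

estimate : ∀ A B δ {ε} → 0ℚ ℚ.≤ δ → (A ℚ.+ B ℚ.+ 1ℚ) ℚ.* δ ≡ ε → δ ℚ.* B ℚ.+ A ℚ.* δ ℚ.≤ ε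
estimate A B δ 0≤δ e = ≤-by
  (solve 3 (λ A B δ → δ :* B :+ A :* δ := (A :+ B) :* δ :+ con 0ℚ) refl A B δ)
  (trans (sym e) (solve 3 (λ A B δ → (A :+ B :+ con 1ℚ) :* δ := (A :+ B) :* δ :+ δ) refl A B δ))
  (ℚ.+-monoʳ-≤ ((A ℚ.+ B) ℚ.* δ) 0≤δ)

module _ {I J : Set} (_≟ᴵ_ : DecidableEquality I) (_≟ᴶ_ : DecidableEquality J)
         {a : I → ℚ} {b : J → ℚ} (0≤a : ∀ i → 0ℚ ℚ.≤ a i) (0≤b : ∀ j → 0ℚ ℚ.≤ b j) where

  private
    module DI = Deduplication _≟ᴵ_
    module DJ = Deduplication _≟ᴶ_

  -- A pair outside `S` × `T` has its first entry outside `S` or its second outside `T`. Hence `U`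
  -- is covered by the rectangles (`P` ∖ `S`) × `Q` and `P` × (`Q` ∖ `T`), with `P` and `Q` the
  -- projections of `U`.
  ⊗-tail : ∀ A B δ → 0ℚ ℚ.≤ B → 0ℚ ℚ.≤ δ → ∀ S T →
    (∀ P → Unique P → total a P ℚ.≤ A) → (∀ Q → Unique Q → total b Q ℚ.≤ B) →
    (∀ P → Unique P → (∀ {i} → i ∈ P → i ∉ S) → total a P ℚ.≤ δ) →
    (∀ Q → Unique Q → (∀ {j} → j ∈ Q → j ∉ T) → total b Q ℚ.≤ δ) →
    ∀ U → Unique U → (∀ {ij} → ij ∈ U → ij ∉ cartesianProduct S T) →
    total (a ⊗ b) U ℚ.≤ δ ℚ.* B ℚ.+ A ℚ.* δ
  ⊗-tail A B δ 0≤B 0≤δ S T boundA boundB tailA tailB U uU U∩ST = ℚ.≤-trans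
    (total-mono (a ⊗ b) (λ (i , j) → 0≤* (0≤a i) (0≤b j)) uU covers)
    (≤-by (total-++ (a ⊗ b) left right) refl
      (ℚ.+-mono-≤
        (≤-by (total-⊗ a b (P DI.∖ S) Q) refl
          (*-mono (0≤total a 0≤a (P DI.∖ S)) 0≤B
            (tailA (P DI.∖ S) (DI.∖-unique S uP) (λ i∈ → proj₂ (DI.∈-∖⁻ {P} {S} i∈)))
            (boundB Q uQ)))
        (≤-by (total-⊗ a b P (Q DJ.∖ T)) refl
          (*-mono (0≤total a 0≤a P) 0≤δ
            (boundA P uP)
            (tailB (Q DJ.∖ T) (DJ.∖-unique T uQ) (λ i∈ → proj₂ (DJ.∈-∖⁻ {Q} {T} i∈)))))))
    where
    P : List I
    P = DI.nub (map proj₁ U)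
    Q : List J
    Q = DJ.nub (map proj₂ U)
    uP : Unique P
    uP = DI.nub-unique (map proj₁ U)
    uQ : Unique Q
    uQ = DJ.nub-unique (map proj₂ U)
    left right : List (I × J)
    left  = cartesianProduct (P DI.∖ S) Q
    right = cartesianProduct P (Q DJ.∖ T)
    covers : U ⊆ left ++ right
    covers {i , j} ij∈U with i DI.∈? S | j DJ.∈? T
    ... | no i∉S  | _       = ∈-++⁺ˡ (∈-cartesianProduct⁺
      (DI.∈-∖⁺ (DI.∈-nub⁺ (∈-map⁺ proj₁ ij∈U)) i∉S) (DJ.∈-nub⁺ (∈-map⁺ proj₂ ij∈U)))
    ... | yes _   | no j∉T  = ∈-++⁺ʳ left (∈-cartesianProduct⁺
      (DI.∈-nub⁺ (∈-map⁺ proj₁ ij∈U)) (DJ.∈-∖⁺ (DJ.∈-nub⁺ (∈-map⁺ proj₂ ij∈U)) j∉T))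
    ... | yes i∈S | yes j∈T = ⊥-elim (U∩ST ij∈U (∈-cartesianProduct⁺ i∈S j∈T))

  summable-⊗ : Summable a → Summable b → Summable (a ⊗ b)
  summable-⊗ σ τ .Summable.0≤a (i , j) = 0≤* (0≤a i) (0≤b j)
  summable-⊗ σ τ .tail ε 0<ε =
    let A , 0≤A , boundA = total-bounded _≟ᴵ_ σ
        B , 0≤B , boundB = total-bounded _≟ᴶ_ τ
        -- The summand 1 makes the divisor positive even when both bounds are 0.
        δ , 0<δ , Cδ≡ε = quotient ε (A ℚ.+ B ℚ.+ 1ℚ) 0<ε (ℚ.+-mono-≤-< (0≤+ 0≤A 0≤B) (ℚ.positive⁻¹ 1ℚ))
        S , tailA = tail σ δ 0<δ
        T , tailB = tail τ δ 0<δ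
    in cartesianProduct S T , λ U uU U∩ → ℚ.≤-trans
      (⊗-tail A B δ 0≤B (ℚ.<⇒≤ 0<δ) S T boundA boundB tailA tailB U uU U∩)
      (estimate A B δ (ℚ.<⇒≤ 0<δ) Cδ≡ε)

-- The terms b k of index k ≥ K at least halve at each step, hence b k · k stays bounded.
module Halving (b : ℕ → ℚ) (0≤b : ∀ k → 0ℚ ℚ.≤ b k)
               (K : ℕ) (halves-b : ∀ k → K ℕ.≤ k → b (suc k) ℚ.+ b (suc k) ℚ.≤ b k) where

  b-decay : ∀ i → b (i ℕ.+ K) ℚ.* nat (suc i) ℚ.≤ b K
  b-decay zero    = ℚ.≤-reflexive (ℚ.*-identityʳ (b K))
  b-decay (suc i) = ℚ.≤-trans
    (ℚ.*-monoˡ-≤-nonNeg b′ {{ℚ.nonNegative (0≤b (suc (i ℕ.+ K)))}} nat-double)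
    (ℚ.≤-trans
      (≤-by (solve 2 (λ b n → b :* (n :+ n) := (b :+ b) :* n) refl b′ (nat (suc i))) refl
        (ℚ.*-monoʳ-≤-nonNeg (nat (suc i)) (halves-b (i ℕ.+ K) (ℕ.m≤n+m K i))))
      (b-decay i))
    where
    b′ : ℚ
    b′ = b (suc (i ℕ.+ K))
    nat-double : nat (suc (suc i)) ℚ.≤ nat (suc i) ℚ.+ nat (suc i)
    nat-double = ≤-by refl
      (trans (cong (ℚ._/ 1) (cong₂ ℤ._+_ (ℤ.*-identityʳ (ℤ.+ suc i)) (ℤ.*-identityʳ (ℤ.+ suc i))))
             (nat≡ (suc i ℕ.+ suc i)))
      (nat-mono (ℕ.s≤s (ℕ.m≤n+m (suc i) i)))

  interval : ℕ → ℕ → List ℕ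
  interval N zero    = []
  interval N (suc d) = (d ℕ.+ N) ∷ interval N d

  ∈-interval : ∀ N d k → N ℕ.≤ k → k ℕ.< d ℕ.+ N → k ∈ interval N d
  ∈-interval N zero    k N≤k k<N = ⊥-elim (ℕ.<⇒≱ k<N N≤k)
  ∈-interval N (suc d) k N≤k k<  with ℕ.m≤n⇒m<n∨m≡n (ℕ.s≤s⁻¹ k<)
  ... | inj₁ k<′  = there (∈-interval N d k N≤k k<′)
  ... | inj₂ refl = here refl

  -- Carrying twice the next term along makes the induction close: if 2 b(k + 1) ≤ b(k), then b(k) +
  -- 2 b(k + 1) ≤ 2 b(k).
  interval-total : ∀ N → K ℕ.≤ N → ∀ d →
    total b (interval N d) ℚ.+ (b (d ℕ.+ N) ℚ.+ b (d ℕ.+ N)) ℚ.≤ b N ℚ.+ b N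
  interval-total N K≤N zero    = ℚ.≤-reflexive (ℚ.+-identityˡ (b N ℚ.+ b N))
  interval-total N K≤N (suc d) = ℚ.≤-trans
    (≤-by refl (solve 2 (λ t b → t :+ (b :+ b) := (b :+ t) :+ b) refl (total b (interval N d)) (b (d ℕ.+ N)))
      (ℚ.+-monoʳ-≤ (b (d ℕ.+ N) ℚ.+ total b (interval N d))
        (halves-b (d ℕ.+ N) (ℕ.m≤n⇒m≤o+n d K≤N))))
    (interval-total N K≤N d)

  upper : List ℕ → ℕ
  upper = foldr (λ k m → suc k ℕ.⊔ m) 0

  <upper : ∀ {T k} → k ∈ T → k ℕ.< upper T
  <upper {j ∷ T} (here refl) = ℕ.m≤m⊔n (suc j) (upper T)
  <upper {j ∷ T} (there k∈T) = ℕ.≤-trans (<upper k∈T) (ℕ.m≤n⊔m (suc j) (upper T))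

  summable : Summable b
  summable .0≤a = 0≤b
  summable .tail ε 0<ε = downFrom N , λ T uT T∩ → ℚ.≤-trans
    (total-mono b 0≤b uT (λ {k} k∈T → ∈-interval N (upper T) k
      (ℕ.≮⇒≥ (λ k<N → T∩ k∈T (∈-downFrom⁺ k<N)))
      (ℕ.≤-trans (<upper k∈T) (ℕ.m≤m+n (upper T) N))))
    (ℚ.≤-trans
      (≤-by (sym (ℚ.+-identityʳ _)) refl
        (ℚ.+-monoʳ-≤ (total b (interval N (upper T))) (0≤+ (0≤b (upper T ℕ.+ N)) (0≤b (upper T ℕ.+ N)))))
      (ℚ.≤-trans (interval-total N (ℕ.m≤n+m K M) (upper T)) (split ε ℚ.≤-refl bN≤ bN≤)))
    where
    M N : ℕ
    M = proj₁ (vanishing (b K) (½ ℚ.* ε) (halve 0<ε))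
    N = M ℕ.+ K
    bN≤ : b N ℚ.≤ ½ ℚ.* ε
    bN≤ = proj₂ (vanishing (b K) (½ ℚ.* ε) (halve 0<ε)) M (b N) ℕ.≤-refl (b-decay M)

-- Each modulus comes from at most two integers. The list `both` may contain 0 twice, which
-- `total-mono` allows in the larger list.
summable-∣∣ : ∀ {b : ℕ → ℚ} → Summable b → Summable (b ∘ ℤ.∣_∣)
summable-∣∣ σ .0≤a n = 0≤a σ ℤ.∣ n ∣
summable-∣∣ {b} σ .tail ε 0<ε = both S , λ T uT T∩ →
  let P = nub (map ℤ.∣_∣ T)
      half = proj₂ (tail σ (½ ℚ.* ε) (halve 0<ε)) P (nub-unique (map ℤ.∣_∣ T)) (avoids T T∩)
  in ℚ.≤-trans
    (total-mono (b ∘ ℤ.∣_∣) (λ n → 0≤a σ ℤ.∣ n ∣) uT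
      (λ {n} n∈T → ∈-both n (∈-nub⁺ (∈-map⁺ ℤ.∣_∣ n∈T))))
    (split ε (ℚ.≤-reflexive (total-both P)) half half)
  where
  open Deduplication ℕ._≟_
  S : List ℕ
  S = proj₁ (tail σ (½ ℚ.* ε) (halve 0<ε))
  both : List ℕ → List ℤ
  both P = map ℤ.+_ P ++ map (ℤ.-_ ∘ ℤ.+_) P
  ∈-both : ∀ n {P} → ℤ.∣ n ∣ ∈ P → n ∈ both P
  ∈-both (ℤ.+ k)      k∈P = ∈-++⁺ˡ (∈-map⁺ ℤ.+_ k∈P)
  ∈-both ℤ.-[1+ k ] {P} k∈P = ∈-++⁺ʳ (map ℤ.+_ P) (∈-map⁺ (ℤ.-_ ∘ ℤ.+_) k∈P)
  avoids : ∀ T → (∀ {n} → n ∈ T → n ∉ both S) → ∀ {k} → k ∈ nub (map ℤ.∣_∣ T) → k ∉ S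
  avoids T T∩ k∈ k∈S with ∈-map⁻ ℤ.∣_∣ (∈-nub⁻ (map ℤ.∣_∣ T) k∈)
  ... | n , n∈T , refl = T∩ n∈T (∈-both n k∈S)
  negatives : ∀ P → total (b ∘ ℤ.∣_∣) (map (ℤ.-_ ∘ ℤ.+_) P) ≡ total b P
  negatives []      = refl
  negatives (k ∷ P) = cong₂ ℚ._+_ (cong b (ℤ.∣-i∣≡∣i∣ (ℤ.+ k))) (negatives P)
  total-both : ∀ P → total (b ∘ ℤ.∣_∣) (both P) ≡ total b P ℚ.+ total b P
  total-both P = trans (total-++ (b ∘ ℤ.∣_∣) (map ℤ.+_ P) (map (ℤ.-_ ∘ ℤ.+_) P))
    (cong₂ ℚ._+_ (total-map (b ∘ ℤ.∣_∣) ℤ.+_ P) (negatives P))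

-- Unconditional sums in a complete normed ℚ-algebra

-- The interface of ℂ over which all sums are treated, so that terms never unfold to Cauchy
-- sequences. The rational bounds `Small` replace a real-valued norm.
record NormedAlgebra : Set₁ where
  field
    commutativeRing : CommutativeRing 0ℓ 0ℓ

  open CommutativeRing commutativeRing

  field
    ι        : ℚ → Carrier
    ι-+      : ∀ r s → ι (r ℚ.+ s) ≈ ι r + ι s
    ι-*      : ∀ r s → ι (r ℚ.* s) ≈ ι r * ι s
    ι-neg    : ∀ r → ι (ℚ.- r) ≈ - ι r
    ι-0      : ι 0ℚ ≈ 0#
    ι-1      : ι 1ℚ ≈ 1#
    -- Small ε x means ‖x‖ ≤ ε
    Small    : ℚ → Carrier → Set
    ι-small  : ∀ {r} → 0ℚ ℚ.≤ r → Small r (ι r)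
    small-≈  : ∀ {ε x y} → x ≈ y → Small ε x → Small ε y
    small-≤  : ∀ {δ ε x} → δ ℚ.≤ ε → Small δ x → Small ε x
    small-0  : Small 0ℚ 0#
    small-+  : ∀ {δ ε x y} → Small δ x → Small ε y → Small (δ ℚ.+ ε) (x + y)
    small-neg : ∀ {ε x} → Small ε x → Small ε (- x)
    small-*  : ∀ {δ ε x y} → 0ℚ ℚ.≤ δ → 0ℚ ℚ.≤ ε → Small δ x → Small ε y → Small (δ ℚ.* ε) (x * y)
    small⇒≈0 : ∀ {x} → (∀ ε → 0ℚ ℚ.< ε → Small ε x) → x ≈ 0#
    size     : ∀ x → ∃ λ B → 0ℚ ℚ.≤ B × Small B x
    complete : ∀ (X : ℕ → Carrier) →
      (∀ ε → 0ℚ ℚ.< ε → ∃ λ N → ∀ m n → N ℕ.≤ m → N ℕ.≤ n → Small ε (X m - X n)) →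
      ∃ λ L → ∀ ε → 0ℚ ℚ.< ε → ∃ λ N → ∀ n → N ℕ.≤ n → Small ε (X n - L)

-- A ring solver with coefficients in ℚ, embedded by `ι`: rational constants are normalised in ℚ,
-- whose equality is decidable.
module AlgebraSolver (K : NormedAlgebra) where

  open NormedAlgebra K
  open CommutativeRing commutativeRing

  morphism : CommutativeRing.rawRing ℚ.+-*-commutativeRing
               ACR.-Raw-AlmostCommutative⟶ ACR.fromCommutativeRing commutativeRing
  morphism = record
    { ⟦_⟧ = ι ; +-homo = ι-+ ; *-homo = ι-* ; -‿homo = ι-neg ; 0-homo = ι-0 ; 1-homo = ι-1 }

  coeff≟ : ∀ r s → Maybe (ι r ≈ ι s)
  coeff≟ r s with r ℚ.≟ s
  ... | yes refl = just (CommutativeRing.refl commutativeRing)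
  ... | no  _    = nothing

  open RingSolver (CommutativeRing.rawRing ℚ.+-*-commutativeRing)
    (ACR.fromCommutativeRing commutativeRing) morphism coeff≟ public
    using (Polynomial) renaming (solve to solveᴷ; _:=_ to _⊜_; _:+_ to _⊕_; _:*_ to _⊛_; _:-_ to _⊖_; :-_ to ⊝_; con to κ)

module Sums (K : NormedAlgebra) where

  open NormedAlgebra K
  open CommutativeRing commutativeRing
    renaming (refl to ≈-refl; sym to ≈-sym; trans to ≈-trans)
  open AlgebraSolver K
  open SetoidReasoning setoid

  infix 4 _⟶_
  _⟶_ : (ℕ → Carrier) → Carrier → Set
  X ⟶ L = ∀ ε → 0ℚ ℚ.< ε → ∃ λ N → ∀ n → N ℕ.≤ n → Small ε (X n - L)

  small-triangle : ∀ {δ ε x} y {z} → Small δ (x - y) → Small ε (y - z) → Small (δ ℚ.+ ε) (x - z)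
  small-triangle {x = x} y {z} p q =
    small-≈ (solveᴷ 3 (λ x y z → (x ⊖ y) ⊕ (y ⊖ z) ⊜ x ⊖ z) ≈-refl x y z) (small-+ p q)

  small-swap : ∀ {ε x y} → Small ε (x - y) → Small ε (y - x)
  small-swap {x = x} {y} p = small-≈ (solveᴷ 2 (λ x y → ⊝ (x ⊖ y) ⊜ y ⊖ x) ≈-refl x y) (small-neg p)

  small-halves : ∀ {ε x} y {z} → Small (½ ℚ.* ε) (x - y) → Small (½ ℚ.* ε) (y - z) → Small ε (x - z)
  small-halves {ε} y p q = subst (λ e → Small e _) (halves ε) (small-triangle y p q)

  close⇒≈ : ∀ {x y} → (∀ ε → 0ℚ ℚ.< ε → Small ε (x - y)) → x ≈ y
  close⇒≈ {x} {y} p = begin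
    x           ≈⟨ solveᴷ 2 (λ x y → x ⊜ (x ⊖ y) ⊕ y) ≈-refl x y ⟩
    (x - y) + y ≈⟨ +-congʳ (small⇒≈0 p) ⟩
    0# + y      ≈⟨ +-identityˡ y ⟩
    y           ∎

  -- u v - x y = x (v - y) + (u - x) y + (u - x)(v - y); cutting δ off at 1 turns the quadratic
  -- error into a linear one.
  *-continuous : ∀ x y ε → 0ℚ ℚ.< ε → ∃ λ δ → 0ℚ ℚ.< δ ×
    (∀ {u v} → Small δ (u - x) → Small δ (v - y) → Small ε (u * v - x * y))
  *-continuous x y ε 0<ε =
    let A , 0≤A , sA = size x
        B , 0≤B , sB = size y
        C            = A ℚ.+ B ℚ.+ 1ℚ
        0<C          = ℚ.+-mono-≤-< (0≤+ 0≤A 0≤B) (ℚ.positive⁻¹ 1ℚ)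
        δ′ , 0<δ′ , e = quotient ε C 0<ε 0<C
        δ            = δ′ ℚ.⊓ 1ℚ
        0<δ          = ⊓-pos 0<δ′ (ℚ.positive⁻¹ 1ℚ)
        0≤δ          = ℚ.<⇒≤ 0<δ
    in δ , 0<δ , λ {u} {v} p q → small-≈
      (solveᴷ 4 (λ u v x y → (x ⊛ (v ⊖ y) ⊕ (u ⊖ x) ⊛ y) ⊕ (u ⊖ x) ⊛ (v ⊖ y) ⊜ u ⊛ v ⊖ x ⊛ y)
        ≈-refl u v x y)
      (small-≤
        (bound A B δ δ′ 0≤A 0≤B 0≤δ (ℚ.p⊓q≤p δ′ 1ℚ) (ℚ.p⊓q≤q δ′ 1ℚ) e)
        (small-+ (small-+ (small-* 0≤A 0≤δ sA q) (small-* 0≤δ 0≤B p sB))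
          (small-* 0≤δ 0≤δ p q)))
    where
    ⊓-pos : ∀ {a b} → 0ℚ ℚ.< a → 0ℚ ℚ.< b → 0ℚ ℚ.< a ℚ.⊓ b
    ⊓-pos {a} {b} p q with ℚ.⊓-sel a b
    ... | inj₁ e = subst (0ℚ ℚ.<_) (sym e) p
    ... | inj₂ e = subst (0ℚ ℚ.<_) (sym e) q
    bound : ∀ A B δ δ′ → 0ℚ ℚ.≤ A → 0ℚ ℚ.≤ B → 0ℚ ℚ.≤ δ → δ ℚ.≤ δ′ → δ ℚ.≤ 1ℚ →
      (A ℚ.+ B ℚ.+ 1ℚ) ℚ.* δ′ ≡ ε → A ℚ.* δ ℚ.+ δ ℚ.* B ℚ.+ δ ℚ.* δ ℚ.≤ ε
    bound A B δ δ′ 0≤A 0≤B 0≤δ δ≤δ′ δ≤1 e = ≤-by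
      (solve 3 (λ A B δ → A :* δ :+ δ :* B :+ δ :* δ := (A :+ B :+ δ) :* δ) refl A B δ)
      (sym e)
      (*-mono (0≤+ (0≤+ 0≤A 0≤B) 0≤δ) (ℚ.≤-trans 0≤δ δ≤δ′) (ℚ.+-monoʳ-≤ (A ℚ.+ B) δ≤1) δ≤δ′)

  ⟶-unique : ∀ {X L M} → X ⟶ L → X ⟶ M → L ≈ M
  ⟶-unique {X} p q = close⇒≈ λ ε 0<ε →
    let M , p′ = p (½ ℚ.* ε) (halve 0<ε)
        N , q′ = q (½ ℚ.* ε) (halve 0<ε)
    in small-halves (X (M ℕ.⊔ N)) (small-swap (p′ (M ℕ.⊔ N) (ℕ.m≤m⊔n M N))) (q′ (M ℕ.⊔ N) (ℕ.m≤n⊔m M N))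

  ⟶-cong : ∀ {X Y L} → (∀ n → X n ≈ Y n) → X ⟶ L → Y ⟶ L
  ⟶-cong e p ε 0<ε = let N , p′ = p ε 0<ε in N , λ n h → small-≈ (+-congʳ (e n)) (p′ n h)

  ∑ : {I : Set} → (I → Carrier) → List I → Carrier
  ∑ f = foldr (λ i s → f i + s) 0#

  module _ {I : Set} where

    ∑-cong : ∀ {f g : I → Carrier} → (∀ i → f i ≈ g i) → ∀ T → ∑ f T ≈ ∑ g T
    ∑-cong e []      = ≈-refl
    ∑-cong e (i ∷ T) = +-cong (e i) (∑-cong e T)

    ∑-+ : ∀ (f g : I → Carrier) T → ∑ (λ i → f i + g i) T ≈ ∑ f T + ∑ g T
    ∑-+ f g []      = ≈-sym (+-identityˡ 0#)
    ∑-+ f g (i ∷ T) = ≈-trans (+-congˡ (∑-+ f g T))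
      (solveᴷ 4 (λ a b s t → (a ⊕ b) ⊕ (s ⊕ t) ⊜ (a ⊕ s) ⊕ (b ⊕ t)) ≈-refl (f i) (g i) (∑ f T) (∑ g T))

    ∑-*ˡ : ∀ c (f : I → Carrier) T → ∑ (λ i → c * f i) T ≈ c * ∑ f T
    ∑-*ˡ c f []      = ≈-sym (zeroʳ c)
    ∑-*ˡ c f (i ∷ T) = ≈-trans (+-congˡ (∑-*ˡ c f T)) (≈-sym (distribˡ c (f i) (∑ f T)))

    ∑-++ : ∀ (f : I → Carrier) S T → ∑ f (S ++ T) ≈ ∑ f S + ∑ f T
    ∑-++ f []      T = ≈-sym (+-identityˡ (∑ f T))
    ∑-++ f (i ∷ S) T = ≈-trans (+-congˡ (∑-++ f S T)) (≈-sym (+-assoc (f i) (∑ f S) (∑ f T)))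

    ∑-↭ : ∀ (f : I → Carrier) {S T} → S ↭ T → ∑ f S ≈ ∑ f T
    ∑-↭ f ↭.refl         = ≈-refl
    ∑-↭ f (↭.prep i p)   = +-congˡ (∑-↭ f p)
    ∑-↭ f (↭.swap {S} {T} i j p) = ≈-trans (+-congˡ (+-congˡ (∑-↭ f p)))
      (solveᴷ 3 (λ a b s → a ⊕ (b ⊕ s) ⊜ b ⊕ (a ⊕ s)) ≈-refl (f i) (f j) (∑ f T))
    ∑-↭ f (↭.trans p q)  = ≈-trans (∑-↭ f p) (∑-↭ f q)

    ∑-≈0 : ∀ (f : I → Carrier) T → (∀ {i} → i ∈ T → f i ≈ 0#) → ∑ f T ≈ 0#
    ∑-≈0 f []      e = ≈-refl
    ∑-≈0 f (i ∷ T) e = ≈-trans (+-cong (e (here refl)) (∑-≈0 f T (e ∘ there))) (+-identityˡ 0#)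

    ∑-small : ∀ {f : I → Carrier} {a : I → ℚ} → (∀ i → Small (a i) (f i)) → ∀ T → Small (total a T) (∑ f T)
    ∑-small p []      = small-0
    ∑-small p (i ∷ T) = small-+ (p i) (∑-small p T)

  ∑-map : ∀ {I J : Set} (f : J → Carrier) (φ : I → J) T → ∑ f (map φ T) ≡ ∑ (f ∘ φ) T
  ∑-map f φ []      = refl
  ∑-map f φ (i ∷ T) = cong (f (φ i) +_) (∑-map f φ T)

  ∑-× : ∀ {I J : Set} (f : I → Carrier) (g : J → Carrier) S T →
        ∑ (λ (i , j) → f i * g j) (cartesianProduct S T) ≈ ∑ f S * ∑ g T
  ∑-× f g []      T = ≈-sym (zeroˡ (∑ g T))
  ∑-× f g (i ∷ S) T = begin
    ∑ h (map (i ,_) T ++ cartesianProduct S T)         ≈⟨ ∑-++ h (map (i ,_) T) (cartesianProduct S T) ⟩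
    ∑ h (map (i ,_) T) + ∑ h (cartesianProduct S T)    ≈⟨ +-cong (≈-trans (reflexive (∑-map h (i ,_) T)) (∑-*ˡ (f i) g T)) (∑-× f g S T) ⟩
    f i * ∑ g T + ∑ f S * ∑ g T                        ≈⟨ distribʳ (∑ g T) (f i) (∑ f S) ⟨
    (f i + ∑ f S) * ∑ g T                              ∎
    where
    h = λ ij → f (proj₁ ij) * g (proj₂ ij)

  record HasSum {I : Set} (f : I → Carrier) (s : Carrier) : Set where
    constructor mk
    field
      approximate : ∀ ε → 0ℚ ℚ.< ε →
        ∃ λ (S : List I) → ∀ (T : List I) → Unique T → S ⊆ T → Small ε (∑ f T - s)

  open HasSum public

  -- φ and ψ need to be mutually inverse only off the zeros of f and g.
  module _ {I J : Set} (_≟ᴵ_ : DecidableEquality I) (_≟ᴶ_ : DecidableEquality J)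
           (f : I → Carrier) (g : J → Carrier) (φ : I → J) (ψ : J → I) where

    private
      module DI = Deduplication _≟ᴵ_
      module DJ = Deduplication _≟ᴶ_

    -- Given `S` and `T`, let `U` collect `S` and the preimages of `T` under `ψ`. Its part `P` of
    -- indices not declared zero is mapped injectively by `φ`; adding to the image the entries of
    -- `T` that it misses, where `g` vanishes, gives `V` with the same sum. Both limits are thus
    -- approximated by a common value.
    hasSum-transfer :
      (∀ i → f i ≈ 0# ⊎ (ψ (φ i) ≡ i × f i ≈ g (φ i))) →
      (∀ j → g j ≈ 0# ⊎ (φ (ψ j) ≡ j × g j ≈ f (ψ j))) →
      ∀ {s t} → HasSum f s → HasSum g t → s ≈ t
    hasSum-transfer F G {s} {t} (mk p) (mk q) = close⇒≈ λ ε 0<ε →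
      let S , p′ = p (½ ℚ.* ε) (halve 0<ε)
          T , q′ = q (½ ℚ.* ε) (halve 0<ε)
          U , V , uU , uV , S⊆U , T⊆V , e = common S T
      in small-halves (∑ f U) (small-swap (p′ U uU S⊆U)) (small-≈ (+-congʳ (≈-sym e)) (q′ V uV T⊆V))
      where
      NonZero : I → Set
      NonZero i = ψ (φ i) ≡ i × f i ≈ g (φ i)
      partition : ∀ U → Unique U → ∃ λ P → Unique P × All NonZero P ×
        P ⊆ U × (∀ {i} → i ∈ U → i ∈ P ⊎ f i ≈ 0#) × ∑ f U ≈ ∑ f P
      partition []      []         = [] , [] , [] , id , (λ ()) , ≈-refl
      partition (i ∷ U) (i∉U ∷ uU) with F i | partition U uU
      ... | inj₁ fi≈0 | P , uP , nz , P⊆U , c , e = P , uP , nz , there ∘ P⊆U ,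
            (λ { (here refl) → inj₂ fi≈0 ; (there j∈) → c j∈ }) ,
            ≈-trans (+-cong fi≈0 e) (+-identityˡ (∑ f P))
      ... | inj₂ ne   | P , uP , nz , P⊆U , c , e = i ∷ P ,
            All.tabulate (λ j∈P i≡j → All.lookup i∉U (P⊆U j∈P) i≡j) ∷ uP , ne ∷ nz ,
            (λ { (here e) → here e ; (there j∈) → there (P⊆U j∈) }) ,
            (λ { (here refl) → inj₁ (here refl) ; (there j∈) → map₁ there (c j∈) }) ,
            +-congˡ e
      unique-map : ∀ {P} → Unique P → All NonZero P → Unique (map φ P)
      unique-map []         []       = []
      unique-map {i ∷ P} (i∉P ∷ uP) (n ∷ nz) = All.tabulate fresh ∷ unique-map uP nz
        where
        fresh : ∀ {j} → j ∈ map φ P → φ i ≢ j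
        fresh j∈ e with ∈-map⁻ φ j∈
        ... | k , k∈P , refl = All.lookup i∉P k∈P
              (trans (sym (proj₁ n)) (trans (cong ψ e) (proj₁ (All.lookup nz k∈P))))
      common : ∀ S T → ∃ λ U → ∃ λ V → Unique U × Unique V × S ⊆ U × T ⊆ V × ∑ f U ≈ ∑ g V
      common S T = U , V , uU , uV , (λ i∈ → DI.∈-nub⁺ (∈-++⁺ˡ i∈)) , T⊆V , eq
        where
        U : List I
        U = DI.nub (S ++ map ψ T)
        uU : Unique U
        uU = DI.nub-unique (S ++ map ψ T)
        part = partition U uU
        P : List I
        P = proj₁ part
        uP : Unique P
        uP = proj₁ (proj₂ part)
        nz : All NonZero P
        nz = proj₁ (proj₂ (proj₂ part))
        covered : ∀ {i} → i ∈ U → i ∈ P ⊎ f i ≈ 0#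
        covered = proj₁ (proj₂ (proj₂ (proj₂ (proj₂ part))))
        R : List J
        R = DJ.nub T DJ.∖ map φ P
        V : List J
        V = map φ P ++ R
        uV : Unique V
        uV = Unique.++⁺ (unique-map uP nz) (DJ.∖-unique (map φ P) (DJ.nub-unique T))
          (λ { (j∈P , j∈R) → proj₂ (DJ.∈-∖⁻ {DJ.nub T} {map φ P} j∈R) j∈P })
        T⊆V : T ⊆ V
        T⊆V {j} j∈T with j DJ.∈? map φ P
        ... | yes j∈ = ∈-++⁺ˡ j∈
        ... | no  j∉ = ∈-++⁺ʳ (map φ P) (DJ.∈-∖⁺ (DJ.∈-nub⁺ j∈T) j∉)
        -- If `g j` is not declared zero, `ψ j` lies in `U`. It cannot lie in `P`, for then `j`
        -- would be in the image of `P`; so `f (ψ j)` vanishes and with it `g j`.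
        rest : ∀ {j} → j ∈ R → g j ≈ 0#
        rest {j} j∈R with DJ.∈-∖⁻ {DJ.nub T} {map φ P} j∈R | G j
        ... | j∈T , j∉ | inj₁ gj≈0 = gj≈0
        ... | j∈T , j∉ | inj₂ (φψj≡j , e)
          with covered (DI.∈-nub⁺ (∈-++⁺ʳ S (∈-map⁺ ψ (DJ.∈-nub⁻ T j∈T))))
        ...   | inj₁ ψj∈P = ⊥-elim (j∉ (subst (_∈ map φ P) φψj≡j (∈-map⁺ φ ψj∈P)))
        ...   | inj₂ fψj≈0 = ≈-trans e fψj≈0
        image : ∀ {P} → All NonZero P → ∑ f P ≈ ∑ g (map φ P)
        image []       = ≈-refl
        image (n ∷ nz) = +-cong (proj₂ n) (image nz)
        eq : ∑ f U ≈ ∑ g V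
        eq = begin
          ∑ f U                 ≈⟨ proj₂ (proj₂ (proj₂ (proj₂ (proj₂ part)))) ⟩
          ∑ f P                 ≈⟨ image nz ⟩
          ∑ g (map φ P)         ≈⟨ +-identityʳ (∑ g (map φ P)) ⟨
          ∑ g (map φ P) + 0#    ≈⟨ +-congˡ (∑-≈0 g R rest) ⟨
          ∑ g (map φ P) + ∑ g R ≈⟨ ∑-++ g (map φ P) R ⟨
          ∑ g V                 ∎

  module _ {I : Set} where

    hasSum-cong : ∀ {f g : I → Carrier} {s t} → (∀ i → f i ≈ g i) → s ≈ t → HasSum f s → HasSum g t
    hasSum-cong e e′ (mk p) = mk λ ε 0<ε → let S , p′ = p ε 0<ε in S , λ T uT S⊆T →
      small-≈ (+-cong (∑-cong e T) (-‿cong e′)) (p′ T uT S⊆T)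

    hasSum-+ : ∀ {f g : I → Carrier} {s t} → HasSum f s → HasSum g t → HasSum (λ i → f i + g i) (s + t)
    hasSum-+ {f} {g} {s} {t} (mk p) (mk q) = mk λ ε 0<ε →
      let S , p′ = p (½ ℚ.* ε) (halve 0<ε)
          T , q′ = q (½ ℚ.* ε) (halve 0<ε)
      in S ++ T , λ U uU h → subst (λ e → Small e _) (halves ε) (small-≈
        (≈-trans
          (solveᴷ 4 (λ a s b t → (a ⊖ s) ⊕ (b ⊖ t) ⊜ (a ⊕ b) ⊖ (s ⊕ t)) ≈-refl (∑ f U) s (∑ g U) t)
          (+-congʳ (≈-sym (∑-+ f g U))))
        (small-+ (p′ U uU (h ∘ ∈-++⁺ˡ)) (q′ U uU (h ∘ ∈-++⁺ʳ S))))

    hasSum-*ˡ : ∀ c {f : I → Carrier} {s} → HasSum f s → HasSum (λ i → c * f i) (c * s)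
    hasSum-*ˡ c {f} {s} (mk p) = mk λ ε 0<ε →
      let B , 0≤B , sB = size c
          δ , 0<δ , e  = quotient ε (B ℚ.+ 1ℚ) 0<ε (ℚ.+-mono-≤-< 0≤B (ℚ.positive⁻¹ 1ℚ))
          S , p′       = p δ 0<δ
      in S , λ T uT S⊆T → small-≈
        (≈-trans
          (solveᴷ 3 (λ c a s → c ⊛ (a ⊖ s) ⊜ c ⊛ a ⊖ c ⊛ s) ≈-refl c (∑ f T) s)
          (+-congʳ (≈-sym (∑-*ˡ c f T))))
        (small-≤
          (≤-by (sym (ℚ.+-identityʳ (B ℚ.* δ)))
            (trans (sym e) (solve 2 (λ B d → (B :+ con 1ℚ) :* d := B :* d :+ d) refl B δ))
            (ℚ.+-monoʳ-≤ (B ℚ.* δ) (ℚ.<⇒≤ 0<δ)))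
          (small-* 0≤B (ℚ.<⇒≤ 0<δ) sB (p′ T uT S⊆T)))

    -- Recovers limits of ordinary partial sums: the lists of the sequence eventually contain the
    -- finite set that `approximate` supplies.
    hasSum-exhaustion : ∀ {f : I → Carrier} {s} → HasSum f s → (T : ℕ → List I) →
      (∀ n → Unique (T n)) → (∀ i → ∃ λ N → ∀ n → N ℕ.≤ n → i ∈ T n) → (λ n → ∑ f (T n)) ⟶ s
    hasSum-exhaustion {f} {s} (mk p) T uT exhausts ε 0<ε =
      let S , p′ = p ε 0<ε
          N , h  = eventually⊆ S
      in N , λ n N≤n → p′ (T n) (uT n) (h n N≤n)
      where
      eventually⊆ : ∀ S → ∃ λ N → ∀ n → N ℕ.≤ n → S ⊆ T n
      eventually⊆ []      = 0 , λ n _ ()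
      eventually⊆ (i ∷ S) =
        let M , p = exhausts i
            N , q = eventually⊆ S
        in M ℕ.⊔ N , λ { n h (here refl) → p n (ℕ.m⊔n≤o⇒m≤o M N h)
                       ; n h (there j∈S) → q n (ℕ.m⊔n≤o⇒n≤o M N h) j∈S }

  -- Finite rectangles are cofinal: one can be chosen large enough for both factors and, containing
  -- the projections of `U`, for the double sum. Its sum is the product of the two partial sums.
  hasSum-× : ∀ {I J : Set} → DecidableEquality I → DecidableEquality J →
    {f : I → Carrier} {g : J → Carrier} → ∀ {s t u} → HasSum f s → HasSum g t →
    HasSum (λ (i , j) → f i * g j) u → s * t ≈ u
  hasSum-× {I} {J} _≟ᴵ_ _≟ᴶ_ {f} {g} {s} {t} {u} (mk p) (mk q) (mk r) = close⇒≈ λ ε 0<ε →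
    let δ , 0<δ , near = *-continuous s t (½ ℚ.* ε) (halve 0<ε)
        S , p′ = p δ 0<δ
        T , q′ = q δ 0<δ
        U , r′ = r (½ ℚ.* ε) (halve 0<ε)
        V = DI.nub (S ++ map proj₁ U)
        W = DJ.nub (T ++ map proj₂ U)
        uV = DI.nub-unique (S ++ map proj₁ U)
        uW = DJ.nub-unique (T ++ map proj₂ U)
    in small-halves (∑ f V * ∑ g W)
      (small-swap (near (p′ V uV (DI.∈-nub⁺ ∘ ∈-++⁺ˡ)) (q′ W uW (DJ.∈-nub⁺ ∘ ∈-++⁺ˡ))))
      (small-≈ (+-congʳ (∑-× f g V W)) (r′ (cartesianProduct V W) (Unique.cartesianProduct⁺ uV uW)
        (λ {(i , j)} ij∈U → ∈-cartesianProduct⁺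
          (DI.∈-nub⁺ (∈-++⁺ʳ S (∈-map⁺ proj₁ ij∈U))) (DJ.∈-nub⁺ (∈-++⁺ʳ T (∈-map⁺ proj₂ ij∈U))))))
    where
    module DI = Deduplication _≟ᴵ_
    module DJ = Deduplication _≟ᴶ_

  module _ {I : Set} (_≟_ : DecidableEquality I) {a : I → ℚ} (σ : Summable a)
           (f : I → Carrier) (dominated : ∀ i → Small (a i) (f i)) where

    open Deduplication _≟_

    -- `S n` is a list with tails at most 1/(n + 1), so every finite list containing it has a sum
    -- within 1/(n + 1) of that over `S n`. Comparing `S m` and `S n` through their union gives a
    -- Cauchy sequence.
    dominated⇒hasSum : ∃ λ s → HasSum f s
    dominated⇒hasSum = proj₁ lim , mk λ ε 0<ε →
      let N , p = proj₂ lim (½ ℚ.* ε) (halve 0<ε)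
          M , r = recip-vanishes (½ ℚ.* ε) (halve 0<ε)
          n     = M ℕ.⊔ N
      in S n , λ T uT S⊆T → small-halves (∑ f (S n))
        (small-≤ (r n (ℕ.m≤m⊔n M N)) (near n T uT S⊆T)) (p n (ℕ.m≤n⊔m M N))
      where
      S₀ : ℕ → List I
      S₀ n = proj₁ (tail σ (recip n) (0<recip n))
      S : ℕ → List I
      S n = nub (S₀ n)
      near : ∀ n T → Unique T → S n ⊆ T → Small (recip n) (∑ f T - ∑ f (S n))
      near n T uT S⊆T = small-≈
        (≈-trans
          (solveᴷ 2 (λ r s → r ⊜ (s ⊕ r) ⊖ s) ≈-refl (∑ f (T ∖ S n)) (∑ f (S n)))
          (+-congʳ (≈-trans (≈-sym (∑-++ f (S n) (T ∖ S n)))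
            (≈-sym (∑-↭ f (↭-∖ (nub-unique (S₀ n)) uT S⊆T))))))
        (small-≤ (proj₂ (tail σ (recip n) (0<recip n)) (T ∖ S n) (∖-unique (S n) uT)
            (λ i∈ i∈S₀ → proj₂ (∈-∖⁻ {T} {S n} i∈) (∈-nub⁺ i∈S₀)))
          (∑-small dominated (T ∖ S n)))
      lim : ∃ λ L → (λ n → ∑ f (S n)) ⟶ L
      lim = complete (λ n → ∑ f (S n)) λ ε 0<ε →
        let N , r = recip-vanishes (½ ℚ.* ε) (halve 0<ε)
        in N , λ m n N≤m N≤n →
          let T = nub (S m ++ S n)
              uT = nub-unique (S m ++ S n)
          in small-halves (∑ f T)
            (small-swap (small-≤ (r m N≤m) (near m T uT (∈-nub⁺ ∘ ∈-++⁺ˡ))))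
            (small-≤ (r n N≤n) (near n T uT (∈-nub⁺ ∘ ∈-++⁺ʳ (S m))))

-- The exponential series

nat-suc : ∀ n → nat (suc n) ≡ 1ℚ ℚ.+ nat n
nat-suc n = sym (trans
  (cong (ℚ._/ 1) (cong₂ ℤ._+_ (ℤ.*-identityʳ (ℤ.+ 1)) (ℤ.*-identityʳ (ℤ.+ n))))
  (nat≡ (suc n)))

antidiagonal : ℕ → List (ℕ × ℕ)
antidiagonal zero    = (0 , 0) ∷ []
antidiagonal (suc n) = (0 , suc n) ∷ map (λ (i , j) → suc i , j) (antidiagonal n)

antidiagonal-sum : ∀ n {i j} → (i , j) ∈ antidiagonal n → i ℕ.+ j ≡ n
antidiagonal-sum zero    (here refl) = refl
antidiagonal-sum (suc n) (here refl) = refl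
antidiagonal-sum (suc n) (there ij∈) with ∈-map⁻ (λ (i , j) → suc i , j) ij∈
... | (i , j) , ij∈′ , refl = cong suc (antidiagonal-sum n ij∈′)

∈-antidiagonal : ∀ i j → (i , j) ∈ antidiagonal (i ℕ.+ j)
∈-antidiagonal zero    zero    = here refl
∈-antidiagonal zero    (suc j) = here refl
∈-antidiagonal (suc i) j       = there (∈-map⁺ (λ (i , j) → suc i , j) (∈-antidiagonal i j))

antidiagonal-unique : ∀ n → Unique (antidiagonal n)
antidiagonal-unique zero    = [] ∷ []
antidiagonal-unique (suc n) = All.tabulate fresh ∷
  Unique.map⁺ (λ { refl → refl }) (antidiagonal-unique n)
  where
  fresh : ∀ {ij} → ij ∈ map (λ (i , j) → suc i , j) (antidiagonal n) → (0 , suc n) ≢ ij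
  fresh ij∈ refl with ∈-map⁻ (λ (i , j) → suc i , j) ij∈
  ... | _ , _ , ()

-- The pairs with i + j < n. They exhaust ℕ × ℕ, and the double series of e^z e^w summed over them
-- has the partial sums of e^(z + w).
triangle : ℕ → List (ℕ × ℕ)
triangle zero    = []
triangle (suc n) = antidiagonal n ++ triangle n

triangle-sum : ∀ n {i j} → (i , j) ∈ triangle n → i ℕ.+ j ℕ.< n
triangle-sum (suc n) ij∈ with ∈-++⁻ (antidiagonal n) ij∈
... | inj₁ p = ℕ.s≤s (ℕ.≤-reflexive (antidiagonal-sum n p))
... | inj₂ p = ℕ.m≤n⇒m≤1+n (triangle-sum n p)

∈-triangle : ∀ n {i j} → i ℕ.+ j ℕ.< n → (i , j) ∈ triangle n
∈-triangle (suc n) {i} {j} p with ℕ.m≤n⇒m<n∨m≡n (ℕ.s≤s⁻¹ p)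
... | inj₁ q    = ∈-++⁺ʳ (antidiagonal n) (∈-triangle n q)
... | inj₂ refl = ∈-++⁺ˡ (∈-antidiagonal i j)

triangle-unique : ∀ n → Unique (triangle n)
triangle-unique zero    = []
triangle-unique (suc n) = Unique.++⁺ (antidiagonal-unique n) (triangle-unique n)
  λ { (p , q) → ℕ.<-irrefl (antidiagonal-sum n p) (triangle-sum n q) }

module ExpBound (B : ℚ) (0≤B : 0ℚ ℚ.≤ B) where

  bound : ℕ → ℚ
  bound zero    = 1ℚ
  bound (suc k) = recip k ℚ.* (B ℚ.* bound k)

  0≤recip : ∀ k → 0ℚ ℚ.≤ recip k
  0≤recip k = ℚ.<⇒≤ (0<recip k)

  0≤bound : ∀ k → 0ℚ ℚ.≤ bound k
  0≤bound zero    = ℚ.nonNegative⁻¹ 1ℚ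
  0≤bound (suc k) = 0≤* (0≤recip k) (0≤* 0≤B (0≤bound k))

  -- `bound k` is B^k / k!. Consecutive terms have the ratio B / (k + 1), which is at most 1/2 once
  -- k ≥ 2B.
  bound-summable : Summable bound
  bound-summable = Halving.summable bound 0≤bound (proj₁ arch) λ k K≤k → ≤-by
    (solve 3 (λ r B b → r :* (B :* b) :+ r :* (B :* b) := r :* ((B :+ B) :* b)) refl
      (recip k) B (bound k))
    (trans (sym (ℚ.*-identityˡ (bound k)))
      (trans (cong (ℚ._* bound k) (sym (recip-inv k))) (ℚ.*-assoc (recip k) (nat (suc k)) (bound k))))
    (ℚ.*-monoˡ-≤-nonNeg (recip k) {{ℚ.nonNegative (0≤recip k)}}
      (ℚ.*-monoʳ-≤-nonNeg (bound k) {{ℚ.nonNegative (0≤bound k)}}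
        (ℚ.≤-trans (proj₂ arch) (nat-mono (ℕ.m≤n⇒m≤1+n K≤k)))))
    where
    arch = archimedean (B ℚ.+ B)

-- Specified by recursion and limit rather than defined, so that the exponential function of the
-- definitions is an instance.
record ExponentialSeries (K : NormedAlgebra) : Set where
  open NormedAlgebra K
  open CommutativeRing commutativeRing using (Carrier; _≈_; _*_; 1#)
  open Sums K

  field
    E       : Carrier → ℕ → Carrier
    E-zero  : ∀ z → E z 0 ≈ 1#
    E-suc   : ∀ z k → E z (suc k) ≈ ι (recip k) * (z * E z k)
    exp     : Carrier → Carrier
    exp-lim : ∀ z → (λ n → ∑ (E z) (downFrom n)) ⟶ exp z

module Exponential (K : NormedAlgebra) (series : ExponentialSeries K) where

  open NormedAlgebra K
  open CommutativeRing commutativeRing using (Carrier; _≈_; _+_; _*_; 0#; 1#)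
  open Sums K
  open ExponentialSeries series
  open AlgebraSolver K
  private
    module R = CommutativeRing commutativeRing
  open SetoidReasoning R.setoid

  E-cong : ∀ {z w} → z ≈ w → ∀ k → E z k ≈ E w k
  E-cong {z} {w} e zero    = R.trans (E-zero z) (R.sym (E-zero w))
  E-cong {z} {w} e (suc k) = R.trans (E-suc z k)
    (R.trans (R.*-congˡ (R.*-cong e (E-cong e k))) (R.sym (E-suc w k)))

  exp-cong : ∀ {z w} → z ≈ w → exp z ≈ exp w
  exp-cong {z} {w} e = ⟶-unique (⟶-cong (λ n → ∑-cong (E-cong e) (downFrom n)) (exp-lim z)) (exp-lim w)

  exp-0 : exp 0# ≈ 1#
  exp-0 = close⇒≈ λ ε 0<ε →
    let N , p = exp-lim 0# ε 0<ε
    -- `suc N` and not `N`: the partial sum must contain the term of index 0 even for N = 0.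
    in small-swap (small-≈ (R.+-congʳ (partial N)) (p (suc N) (ℕ.n≤1+n N)))
    where
    E-0 : ∀ k → E 0# (suc k) ≈ 0#
    E-0 k = R.trans (E-suc 0# k) (R.trans (R.*-congˡ (R.zeroˡ (E 0# k))) (R.zeroʳ (ι (recip k))))
    partial : ∀ n → ∑ (E 0#) (downFrom (suc n)) ≈ 1#
    partial zero    = R.trans (R.+-identityʳ (E 0# 0)) (E-zero 0#)
    partial (suc n) = R.trans (R.+-cong (E-0 n) (partial n)) (R.+-identityˡ 1#)

  -- The Cauchy product, with the terms i + j = n.
  conv : (ℕ → Carrier) → (ℕ → Carrier) → ℕ → Carrier
  conv f g zero    = f 0 * g 0
  conv f g (suc n) = f 0 * g (suc n) + conv (f ∘ suc) g n

  conv-cong : ∀ {f f′ g g′} → (∀ k → f k ≈ f′ k) → (∀ k → g k ≈ g′ k) → ∀ n → conv f g n ≈ conv f′ g′ n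
  conv-cong e e′ zero    = R.*-cong (e 0) (e′ 0)
  conv-cong e e′ (suc n) = R.+-cong (R.*-cong (e 0) (e′ (suc n))) (conv-cong (e ∘ suc) e′ n)

  conv-*ˡ : ∀ c f g n → conv (λ k → c * f k) g n ≈ c * conv f g n
  conv-*ˡ c f g zero    = R.*-assoc c (f 0) (g 0)
  conv-*ˡ c f g (suc n) = R.trans (R.+-congˡ (conv-*ˡ c (f ∘ suc) g n))
    (solveᴷ 4 (λ c a b s → (c ⊛ a) ⊛ b ⊕ c ⊛ s ⊜ c ⊛ (a ⊛ b ⊕ s)) R.refl c (f 0) (g (suc n)) (conv (f ∘ suc) g n))

  conv-*ʳ : ∀ c f g n → conv f (λ k → c * g k) n ≈ c * conv f g n
  conv-*ʳ c f g zero    = solveᴷ 3 (λ c a b → a ⊛ (c ⊛ b) ⊜ c ⊛ (a ⊛ b)) R.refl c (f 0) (g 0)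
  conv-*ʳ c f g (suc n) = R.trans (R.+-congˡ (conv-*ʳ c (f ∘ suc) g n))
    (solveᴷ 4 (λ c a b s → a ⊛ (c ⊛ b) ⊕ c ⊛ s ⊜ c ⊛ (a ⊛ b ⊕ s)) R.refl c (f 0) (g (suc n)) (conv (f ∘ suc) g n))

  conv-last : ∀ f g n → conv f g (suc n) ≈ f (suc n) * g 0 + conv f (g ∘ suc) n
  conv-last f g zero    = R.+-comm (f 0 * g 1) (f 1 * g 0)
  conv-last f g (suc n) = R.trans (R.+-congˡ (conv-last (f ∘ suc) g n))
    (solveᴷ 3 (λ a b s → a ⊕ (b ⊕ s) ⊜ b ⊕ (a ⊕ s)) R.refl
      (f 0 * g (suc (suc n))) (f (suc (suc n)) * g 0) (conv (f ∘ suc) (g ∘ suc) n))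

  -- Each term has k + l = n, so its two weights add up to a + n. The offset `a` absorbs the shift
  -- of `f` in the inductive step.
  conv-weight : ∀ n a f g →
    conv (λ k → ι (a ℚ.+ nat k) * f k) g n + conv f (λ l → ι (nat l) * g l) n ≈ ι (a ℚ.+ nat n) * conv f g n
  conv-weight zero    a f g = begin
    ι (a ℚ.+ 0ℚ) * f 0 * g 0 + f 0 * (ι 0ℚ * g 0)
      ≈⟨ R.+-congˡ (R.*-congˡ (R.*-congʳ ι-0)) ⟩
    ι (a ℚ.+ 0ℚ) * f 0 * g 0 + f 0 * (0# * g 0)
      ≈⟨ R.+-congˡ (R.trans (R.*-congˡ (R.zeroˡ (g 0))) (R.zeroʳ (f 0))) ⟩
    ι (a ℚ.+ 0ℚ) * f 0 * g 0 + 0#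
      ≈⟨ R.trans (R.+-identityʳ _) (R.*-assoc _ (f 0) (g 0)) ⟩
    ι (a ℚ.+ 0ℚ) * (f 0 * g 0) ∎
  conv-weight (suc n) a f g = begin
    (ι (a ℚ.+ 0ℚ) * f 0 * g (suc n) + conv (λ k → ι (a ℚ.+ nat (suc k)) * f (suc k)) g n)
      + (f 0 * (N * g (suc n)) + conv (f ∘ suc) (λ l → ι (nat l) * g l) n)
      ≈⟨ R.+-congʳ (R.+-congˡ (conv-cong (λ k → R.*-congʳ (R.reflexive (cong ι (shift-nat k)))) (λ _ → R.refl) n)) ⟩
    (ι (a ℚ.+ 0ℚ) * f 0 * g (suc n) + S)
      + (f 0 * (N * g (suc n)) + T)
      ≈⟨ solveᴷ 6 (λ A N f g s t → (A ⊛ f ⊛ g ⊕ s) ⊕ (f ⊛ (N ⊛ g) ⊕ t) ⊜ (A ⊕ N) ⊛ (f ⊛ g) ⊕ (s ⊕ t)) R.refl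
           (ι (a ℚ.+ 0ℚ)) N (f 0) (g (suc n)) S T ⟩
    (ι (a ℚ.+ 0ℚ) + N) * (f 0 * g (suc n)) + (S + T)
      ≈⟨ R.+-cong (R.*-congʳ (R.trans (R.sym (ι-+ (a ℚ.+ 0ℚ) (nat (suc n))))
           (R.reflexive (cong (λ r → ι (r ℚ.+ nat (suc n))) (ℚ.+-identityʳ a)))))
           (R.trans (conv-weight n (a ℚ.+ 1ℚ) (f ∘ suc) g)
             (R.*-congʳ (R.reflexive (cong ι (sym (shift-nat n)))))) ⟩
    ι (a ℚ.+ nat (suc n)) * (f 0 * g (suc n)) + ι (a ℚ.+ nat (suc n)) * conv (f ∘ suc) g n
      ≈⟨ R.distribˡ (ι (a ℚ.+ nat (suc n))) (f 0 * g (suc n)) (conv (f ∘ suc) g n) ⟨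
    ι (a ℚ.+ nat (suc n)) * conv f g (suc n) ∎
    where
    N S T : Carrier
    N = ι (nat (suc n))
    S = conv (λ k → ι (a ℚ.+ 1ℚ ℚ.+ nat k) * f (suc k)) g n
    T = conv (f ∘ suc) (λ l → ι (nat l) * g l) n
    shift-nat : ∀ k → a ℚ.+ nat (suc k) ≡ a ℚ.+ 1ℚ ℚ.+ nat k
    shift-nat k = trans (cong (a ℚ.+_) (nat-suc k)) (sym (ℚ.+-assoc a 1ℚ (nat k)))

  nat*E : ∀ z k → ι (nat (suc k)) * E z (suc k) ≈ z * E z k
  nat*E z k = begin
    ι (nat (suc k)) * E z (suc k)                     ≈⟨ R.*-congˡ (E-suc z k) ⟩
    ι (nat (suc k)) * (ι (recip k) * (z * E z k))     ≈⟨ R.*-assoc _ _ _ ⟨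
    ι (nat (suc k)) * ι (recip k) * (z * E z k)       ≈⟨ R.*-congʳ (R.*-comm _ _) ⟩
    ι (recip k) * ι (nat (suc k)) * (z * E z k)       ≈⟨ R.*-congʳ (ι-* (recip k) (nat (suc k))) ⟨
    ι (recip k ℚ.* nat (suc k)) * (z * E z k)         ≈⟨ R.*-congʳ (R.trans (R.reflexive (cong ι (recip-inv k))) ι-1) ⟩
    1# * (z * E z k)                                  ≈⟨ R.*-identityˡ _ ⟩
    z * E z k                                         ∎

  -- A product rule: on the terms with k + l = n + 1 the factor n + 1 splits as k + l, and k z^k /
  -- k! = z · z^(k - 1) / (k - 1)!.
  conv-E-suc : ∀ z w n → ι (nat (suc n)) * conv (E z) (E w) (suc n) ≈ (z + w) * conv (E z) (E w) n
  conv-E-suc z w n = begin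
    ι (nat (suc n)) * conv (E z) (E w) (suc n)
      ≈⟨ R.*-congʳ (R.reflexive (cong ι (sym (ℚ.+-identityˡ (nat (suc n)))))) ⟩
    ι (0ℚ ℚ.+ nat (suc n)) * conv (E z) (E w) (suc n)
      ≈⟨ conv-weight (suc n) 0ℚ (E z) (E w) ⟨
    (ι 0ℚ * E z 0 * E w (suc n) + conv (λ k → ι (0ℚ ℚ.+ nat (suc k)) * E z (suc k)) (E w) n)
      + conv (E z) (λ l → ι (nat l) * E w l) (suc n)
      ≈⟨ R.+-cong
           (R.+-cong (vanish (E z 0) (E w (suc n)))
             (R.trans (conv-cong (λ k → R.trans (R.*-congʳ (R.reflexive (cong ι (ℚ.+-identityˡ (nat (suc k))))))
                (nat*E z k)) (λ _ → R.refl) n)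
               (conv-*ˡ z (E z) (E w) n)))
           (R.trans (conv-last (E z) (λ l → ι (nat l) * E w l) n)
             (R.+-cong (R.trans (R.*-comm _ _) (vanish (E w 0) (E z (suc n))))
               (R.trans (conv-cong (λ _ → R.refl) (nat*E w) n) (conv-*ʳ w (E z) (E w) n)))) ⟩
    (0# + z * C) + (0# + w * C)
      ≈⟨ R.+-cong (R.+-identityˡ _) (R.+-identityˡ _) ⟩
    z * C + w * C
      ≈⟨ R.distribʳ C z w ⟨
    (z + w) * C ∎
    where
    C : Carrier
    C = conv (E z) (E w) n
    vanish : ∀ x y → ι 0ℚ * x * y ≈ 0#
    vanish x y = R.trans (R.*-congʳ (R.trans (R.*-congʳ ι-0) (R.zeroˡ x))) (R.zeroˡ y)

  -- The binomial theorem (z + w)ⁿ / n! = ∑_{i + j = n} (zⁱ / i!) (wʲ / j!)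
  E-+ : ∀ z w n → E (z + w) n ≈ conv (E z) (E w) n
  E-+ z w zero    = R.trans (E-zero (z + w))
    (R.sym (R.trans (R.*-cong (E-zero z) (E-zero w)) (R.*-identityˡ 1#)))
  E-+ z w (suc n) = begin
    E (z + w) (suc n)                                            ≈⟨ E-suc (z + w) n ⟩
    ι (recip n) * ((z + w) * E (z + w) n)                        ≈⟨ R.*-congˡ (R.*-congˡ (E-+ z w n)) ⟩
    ι (recip n) * ((z + w) * conv (E z) (E w) n)                 ≈⟨ R.*-congˡ (conv-E-suc z w n) ⟨
    ι (recip n) * (ι (nat (suc n)) * conv (E z) (E w) (suc n))   ≈⟨ R.*-assoc _ _ _ ⟨
    ι (recip n) * ι (nat (suc n)) * conv (E z) (E w) (suc n)     ≈⟨ R.*-congʳ (ι-* (recip n) (nat (suc n))) ⟨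
    ι (recip n ℚ.* nat (suc n)) * conv (E z) (E w) (suc n)       ≈⟨ R.*-congʳ (R.trans (R.reflexive (cong ι (recip-inv n))) ι-1) ⟩
    1# * conv (E z) (E w) (suc n)                                ≈⟨ R.*-identityˡ _ ⟩
    conv (E z) (E w) (suc n)                                     ∎

  ∑-antidiagonal : ∀ n f g → ∑ (λ (i , j) → f i * g j) (antidiagonal n) ≈ conv f g n
  ∑-antidiagonal zero    f g = R.+-identityʳ (f 0 * g 0)
  ∑-antidiagonal (suc n) f g = R.+-congˡ (R.trans
    (R.reflexive (∑-map (λ (i , j) → f i * g j) (λ (i , j) → suc i , j) (antidiagonal n)))
    (∑-antidiagonal n (f ∘ suc) g))

  ∑-triangle : ∀ z w n → ∑ (λ (i , j) → E z i * E w j) (triangle n) ≈ ∑ (E (z + w)) (downFrom n)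
  ∑-triangle z w zero    = R.refl
  ∑-triangle z w (suc n) = R.trans (∑-++ _ (antidiagonal n) (triangle n))
    (R.+-cong (R.trans (∑-antidiagonal n (E z) (E w)) (R.sym (E-+ z w n))) (∑-triangle z w n))

  module _ (z : Carrier) where

    open ExpBound (proj₁ (size z)) (proj₁ (proj₂ (size z))) public

    E-small : ∀ k → Small (bound k) (E z k)
    E-small zero    = small-≈ (R.sym (R.trans (E-zero z) (R.sym ι-1))) (ι-small (ℚ.nonNegative⁻¹ 1ℚ))
    E-small (suc k) = small-≈ (R.sym (E-suc z k)) (small-* (0≤recip k)
      (0≤* (proj₁ (proj₂ (size z))) (0≤bound k)) (ι-small (0≤recip k))
      (small-* (proj₁ (proj₂ (size z))) (0≤bound k) (proj₂ (proj₂ (size z))) (E-small k)))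

  exp-hasSum : ∀ z → HasSum (E z) (exp z)
  exp-hasSum z =
    let s , h = dominated⇒hasSum ℕ._≟_ (bound-summable z) (E z) (E-small z)
    in hasSum-cong (λ _ → R.refl)
         (⟶-unique (hasSum-exhaustion h downFrom Unique.downFrom⁺
           (λ i → suc i , λ n i<n → ∈-downFrom⁺ i<n)) (exp-lim z)) h

  -- The double family is absolutely summable, so summation by triangles and by rectangles gives the
  -- same value.
  exp-+ : ∀ z w → exp (z + w) ≈ exp z * exp w
  exp-+ z w =
    let u , h = dominated⇒hasSum (≡-dec ℕ._≟_ ℕ._≟_)
          (summable-⊗ ℕ._≟_ ℕ._≟_ (0≤bound z) (0≤bound w) (bound-summable z) (bound-summable w))
          (λ (i , j) → E z i * E w j)
          (λ (i , j) → small-* (0≤bound z i) (0≤bound w j) (E-small z i) (E-small w j))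
        exhausts = hasSum-exhaustion h triangle triangle-unique
          (λ (i , j) → suc (i ℕ.+ j) , λ n p → ∈-triangle n p)
    in R.trans (⟶-unique (exp-lim (z + w)) (⟶-cong (∑-triangle z w) exhausts))
         (R.sym (hasSum-× ℕ._≟_ ℕ._≟_ (exp-hasSum z) (exp-hasSum w) h))

-- Integers as rationals

int : ℤ → ℚ
int n = n ℚ./ 1

int≡ : ∀ n → int n ≡ ℚ.mkℚ n 0 (Coprime.sym (Coprime.1-coprimeTo ℤ.∣ n ∣))
int≡ n = ℚ.↥p/↧p≡p (ℚ.mkℚ n 0 (Coprime.sym (Coprime.1-coprimeTo ℤ.∣ n ∣)))

int-+ : ∀ m n → int (m ℤ.+ n) ≡ int m ℚ.+ int n
int-+ m n = sym (trans (cong₂ ℚ._+_ (int≡ m) (int≡ n))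
  (cong int (cong₂ ℤ._+_ (ℤ.*-identityʳ m) (ℤ.*-identityʳ n))))

int-* : ∀ m n → int (m ℤ.* n) ≡ int m ℚ.* int n
int-* m n = sym (cong₂ ℚ._*_ (int≡ m) (int≡ n))

int-neg : ∀ n → int (ℤ.- n) ≡ ℚ.- int n
int-neg n = begin
  int (ℤ.- n)                                  ≡⟨ ℚ.+-identityʳ _ ⟨
  int (ℤ.- n) ℚ.+ 0ℚ                           ≡⟨ cong (int (ℤ.- n) ℚ.+_) (ℚ.+-inverseʳ (int n)) ⟨
  int (ℤ.- n) ℚ.+ (int n ℚ.- int n)            ≡⟨ ℚ.+-assoc (int (ℤ.- n)) (int n) (ℚ.- int n) ⟨
  int (ℤ.- n) ℚ.+ int n ℚ.- int n              ≡⟨ cong (ℚ._- int n) (int-+ (ℤ.- n) n) ⟨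
  int (ℤ.- n ℤ.+ n) ℚ.- int n                  ≡⟨ cong (λ k → int k ℚ.- int n) (ℤ.+-inverseˡ n) ⟩
  0ℚ ℚ.- int n                                 ≡⟨ ℚ.+-identityˡ _ ⟩
  ℚ.- int n                                    ∎
  where open ≡-Reasoning

¼ ⅓ ⅔ : ℚ
¼ = ℤ.+ 1 ℚ./ 4
⅓ = ℤ.+ 1 ℚ./ 3
⅔ = ℤ.+ 2 ℚ./ 3

quarter : ∀ n → n ℚ./ 4 ≡ int n ℚ.* ¼
quarter n = sym (trans (cong (ℚ._* ¼) (int≡ n)) (cong (ℚ._/ 4) (ℤ.*-identityʳ n)))

square-∣∣ : ∀ n → n ℤ.* n ≡ ℤ.+ (ℤ.∣ n ∣ ℕ.* ℤ.∣ n ∣)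
square-∣∣ (ℤ.+ k)    = sym (ℤ.pos-* k k)
square-∣∣ ℤ.-[1+ k ] = refl

-- Gaussian bounds ρ^(k²) E^k

pow : ℚ → ℕ → ℚ
pow r zero    = 1ℚ
pow r (suc k) = r ℚ.* pow r k

pow-+ : ∀ r j k → pow r (j ℕ.+ k) ≡ pow r j ℚ.* pow r k
pow-+ r zero    k = sym (ℚ.*-identityˡ (pow r k))
pow-+ r (suc j) k = trans (cong (r ℚ.*_) (pow-+ r j k)) (sym (ℚ.*-assoc r (pow r j) (pow r k)))

0≤pow : ∀ {r} → 0ℚ ℚ.≤ r → ∀ k → 0ℚ ℚ.≤ pow r k
0≤pow 0≤r zero    = ℚ.nonNegative⁻¹ 1ℚ
0≤pow 0≤r (suc k) = 0≤* 0≤r (0≤pow 0≤r k)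

module Gaussian (ρ δ E : ℚ) (0≤ρ : 0ℚ ℚ.≤ ρ) (0<δ : 0ℚ ℚ.< δ) (ρ-inv : (1ℚ ℚ.+ δ) ℚ.* ρ ≡ 1ℚ)
                (0≤E : 0ℚ ℚ.≤ E) where

  0≤δ : 0ℚ ℚ.≤ δ
  0≤δ = ℚ.<⇒≤ 0<δ

  -- Bernoulli's inequality 1 + m δ ≤ (1 + δ)^m, multiplied by ρ^m = (1 + δ)^(-m).
  bernoulli : ∀ m → (1ℚ ℚ.+ nat m ℚ.* δ) ℚ.* pow ρ m ℚ.≤ 1ℚ
  bernoulli zero    = ℚ.≤-reflexive (solve 1 (λ d → (con 1ℚ :+ con 0ℚ :* d) :* con 1ℚ := con 1ℚ) refl δ)
  bernoulli (suc m) = ℚ.≤-trans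
    (≤-by
      (trans (cong (λ k → (1ℚ ℚ.+ k ℚ.* δ) ℚ.* (ρ ℚ.* pow ρ m)) (nat-suc m))
        (sym (ℚ.+-identityʳ X)))
      (solve 4 (λ k d r p → ((con 1ℚ :+ d) :* r) :* ((con 1ℚ :+ k :* d) :* p)
                := (con 1ℚ :+ (con 1ℚ :+ k) :* d) :* (r :* p) :+ d :* ((k :* d) :* (r :* p))) refl
        (nat m) δ ρ (pow ρ m))
      (ℚ.+-monoʳ-≤ X {0ℚ} {δ ℚ.* ((nat m ℚ.* δ) ℚ.* (ρ ℚ.* pow ρ m))}
        (0≤* 0≤δ (0≤* (0≤* (ℚ.nonNegative⁻¹ (nat m)) 0≤δ) (0≤pow 0≤ρ (suc m))))))
    (≤-by (trans (cong (ℚ._* ((1ℚ ℚ.+ nat m ℚ.* δ) ℚ.* pow ρ m)) ρ-inv) (ℚ.*-identityˡ _)) refl (bernoulli m))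
    where
    X : ℚ
    X = (1ℚ ℚ.+ (1ℚ ℚ.+ nat m) ℚ.* δ) ℚ.* (ρ ℚ.* pow ρ m)

  b : ℕ → ℚ
  b k = pow ρ (k ℕ.* k) ℚ.* pow E k

  0≤b : ∀ k → 0ℚ ℚ.≤ b k
  0≤b k = 0≤* (0≤pow 0≤ρ (k ℕ.* k)) (0≤pow 0≤E k)

  ratio : ℕ → ℚ
  ratio k = pow ρ (suc (k ℕ.+ k)) ℚ.* E

  b-suc : ∀ k → b (suc k) ≡ ratio k ℚ.* b k
  b-suc k = trans
    (cong (ℚ._* pow E (suc k)) (trans (cong (pow ρ) (index k)) (pow-+ ρ (suc (k ℕ.+ k)) (k ℕ.* k))))
    (solve 4 (λ p q E e → (p :* q) :* (E :* e) := (p :* E) :* (q :* e)) refl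
      (pow ρ (suc (k ℕ.+ k))) (pow ρ (k ℕ.* k)) E (pow E k))
    where
    index : ∀ k → suc k ℕ.* suc k ≡ suc (k ℕ.+ k) ℕ.+ k ℕ.* k
    index k = cong suc (trans (cong (k ℕ.+_) (ℕ.*-suc k k)) (sym (ℕ.+-assoc k k (k ℕ.* k))))

  -- At least (1 + 2E) / δ; the summand 1 makes the numerator positive, as `quotient` demands.
  K : ℕ
  K = proj₁ (archimedean (proj₁ (quotient (1ℚ ℚ.+ (E ℚ.+ E)) δ (ℚ.+-mono-<-≤ (ℚ.positive⁻¹ 1ℚ) (0≤+ 0≤E 0≤E)) 0<δ)))

  2E≤Kδ : E ℚ.+ E ℚ.≤ nat K ℚ.* δ
  2E≤Kδ =
    let c , 0<c , δc≡ = quotient (1ℚ ℚ.+ (E ℚ.+ E)) δ (ℚ.+-mono-<-≤ (ℚ.positive⁻¹ 1ℚ) (0≤+ 0≤E 0≤E)) 0<δ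
    in ℚ.≤-trans
      (≤-by (sym (ℚ.+-identityˡ (E ℚ.+ E))) (trans (ℚ.*-comm c δ) δc≡) (ℚ.+-monoˡ-≤ (E ℚ.+ E) (ℚ.nonNegative⁻¹ 1ℚ)))
      (ℚ.*-monoʳ-≤-nonNeg δ {{ℚ.nonNegative 0≤δ}} (proj₂ (archimedean c)))

  -- Consecutive terms have the ratio ρ^m E with m = 2k + 1, and 2E ≤ m δ gives 2E ρ^m ≤ 1 by
  -- Bernoulli's inequality.
  b-halves : ∀ k → K ℕ.≤ k → b (suc k) ℚ.+ b (suc k) ℚ.≤ b k
  b-halves k K≤k = ≤-by
    (trans (cong₂ ℚ._+_ (b-suc k) (b-suc k))
      (solve 3 (λ p E b → (p :* E) :* b :+ (p :* E) :* b := ((E :+ E) :* p) :* b) refl (pow ρ m) E (b k)))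
    (sym (ℚ.*-identityˡ (b k)))
    (ℚ.*-monoʳ-≤-nonNeg (b k) {{ℚ.nonNegative (0≤b k)}}
      (ℚ.≤-trans
        (ℚ.*-monoʳ-≤-nonNeg (pow ρ m) {{ℚ.nonNegative (0≤pow 0≤ρ m)}}
          (ℚ.≤-trans 2E≤Kδ (ℚ.≤-trans
            (ℚ.*-monoʳ-≤-nonNeg δ {{ℚ.nonNegative 0≤δ}}
              (nat-mono (ℕ.≤-trans K≤k (ℕ.≤-trans (ℕ.m≤m+n k k) (ℕ.n≤1+n (k ℕ.+ k))))))
            (≤-by (sym (ℚ.+-identityˡ (nat m ℚ.* δ))) refl
              (ℚ.+-monoˡ-≤ (nat m ℚ.* δ) (ℚ.nonNegative⁻¹ 1ℚ))))))
        (bernoulli m)))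
    where
    m : ℕ
    m = suc (k ℕ.+ k)

  gaussian-summable : Summable b
  gaussian-summable = Halving.summable b 0≤b K b-halves

summable-* : ∀ {I : Set} {a : I → ℚ} c → 0ℚ ℚ.≤ c → Summable a → Summable (λ i → a i ℚ.* c)
summable-* c 0≤c σ .Summable.0≤a i = 0≤* (Summable.0≤a σ i) 0≤c
summable-* {a = a} c 0≤c σ .tail ε 0<ε =
  let δ , 0<δ , e = quotient ε (c ℚ.+ 1ℚ) 0<ε (ℚ.+-mono-≤-< 0≤c (ℚ.positive⁻¹ 1ℚ))
      S , p = tail σ δ 0<δ
  in S , λ T uT T∩ → ℚ.≤-trans
    (≤-by (trans (total-cong T) (total-*ˡ a c T)) refl
      (ℚ.*-monoˡ-≤-nonNeg c {{ℚ.nonNegative 0≤c}} (p T uT T∩)))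
    (≤-by (sym (ℚ.+-identityʳ (c ℚ.* δ)))
      (trans (sym e) (solve 2 (λ c d → (c :+ con 1ℚ) :* d := c :* d :+ d) refl c δ))
      (ℚ.+-monoʳ-≤ (c ℚ.* δ) (ℚ.<⇒≤ 0<δ)))
  where
  total-cong : ∀ T → total (λ i → a i ℚ.* c) T ≡ total (λ i → c ℚ.* a i) T
  total-cong []      = refl
  total-cong (i ∷ T) = cong₂ ℚ._+_ (ℚ.*-comm (a i) c) (total-cong T)

-- Dominated families

record ExponentialAlgebra : Set₁ where
  field
    algebra : NormedAlgebra

  open NormedAlgebra algebra public
  open CommutativeRing commutativeRing public
    using (Carrier; _≈_; _+_; _*_; -_; _-_; 0#; 1#)

  field
    exp           : Carrier → Carrier
    exp-cong      : ∀ {z w} → z ≈ w → exp z ≈ exp w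
    exp-+         : ∀ z w → exp (z + w) ≈ exp z * exp w
    exp-0         : exp 0# ≈ 1#
    -- Growth r w means e^{Re w} ≤ r
    Growth        : ℚ → Carrier → Set
    growth-≈      : ∀ {r w v} → w ≈ v → Growth r w → Growth r v
    growth-≤      : ∀ {r s w} → r ℚ.≤ s → Growth r w → Growth s w
    growth-0      : Growth 1ℚ 0#
    growth-+      : ∀ {r s w v} → 0ℚ ℚ.≤ r → 0ℚ ℚ.≤ s → Growth r w → Growth s v → Growth (r ℚ.* s) (w + v)
    growth-exists : ∀ w → ∃ λ r → 0ℚ ℚ.≤ r × Growth r w
    -- The norm of ℂ is the ℓ¹ norm, so a number on the unit circle is bounded by |cos| + |sin| ≤ 2.
    growth-small  : ∀ {r} w → 0ℚ ℚ.≤ r → Growth r w → Small (r ℚ.* nat 2) (exp w)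

module Domination (A : ExponentialAlgebra) where

  open ExponentialAlgebra A
  open AlgebraSolver algebra
  open Sums algebra
  private
    module R = CommutativeRing commutativeRing

  record Dominated {I : Set} (f : I → Carrier) : Set where
    field
      bound     : I → ℚ
      summable  : Summable bound
      dominated : ∀ i → Small (bound i) (f i)

  open Dominated

  dominated-cong : ∀ {I : Set} {f g : I → Carrier} → (∀ i → f i ≈ g i) → Dominated f → Dominated g
  dominated-cong e D .bound = bound D
  dominated-cong e D .summable = summable D
  dominated-cong e D .dominated i = small-≈ (e i) (dominated D i)

  dominated-× : ∀ {I J : Set} → DecidableEquality I → DecidableEquality J →
    {f : I → Carrier} {g : J → Carrier} → Dominated f → Dominated g → Dominated (λ (i , j) → f i * g j)
  dominated-× _≟ᴵ_ _≟ᴶ_ D D′ .bound = bound D ⊗ bound D′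
  dominated-× _≟ᴵ_ _≟ᴶ_ D D′ .summable =
    summable-⊗ _≟ᴵ_ _≟ᴶ_ (Summable.0≤a (summable D)) (Summable.0≤a (summable D′)) (summable D) (summable D′)
  dominated-× _≟ᴵ_ _≟ᴶ_ D D′ .dominated (i , j) =
    small-* (Summable.0≤a (summable D) i) (Summable.0≤a (summable D′) j) (dominated D i) (dominated D′ j)

  -- Absolute convergence is kept with the value: it passes to products of families, where it
  -- provides the sum over pairs.
  record Converges {I : Set} (f : I → Carrier) (s : Carrier) : Set where
    constructor _,_
    field
      dom    : Dominated f
      hasSum : HasSum f s

  open Converges public

  dominated⇒converges : ∀ {I : Set} → DecidableEquality I → {f : I → Carrier} → Dominated f → ∃ (Converges f)
  dominated⇒converges _≟_ {f} D =
    let s , h = dominated⇒hasSum _≟_ (summable D) f (dominated D) in s , (D , h)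

  converges-× : ∀ {I J : Set} → DecidableEquality I → DecidableEquality J →
    ∀ {f : I → Carrier} {g : J → Carrier} {s t} → Converges f s → Converges g t →
    Converges (λ (i , j) → f i * g j) (s * t)
  converges-× _≟ᴵ_ _≟ᴶ_ (D , h) (D′ , h′) =
    let D× = dominated-× _≟ᴵ_ _≟ᴶ_ D D′
        u , (_ , h×) = dominated⇒converges (≡-dec _≟ᴵ_ _≟ᴶ_) D×
    in D× , hasSum-cong (λ _ → R.refl) (R.sym (hasSum-× _≟ᴵ_ _≟ᴶ_ h h′ h×)) h×

  growth-nat : ∀ {r w} → 0ℚ ℚ.≤ r → Growth r w → ∀ k → Growth (pow r k) (ι (nat k) * w)
  growth-nat {r} {w} 0≤r g zero    = growth-≈ (R.sym (R.trans (R.*-congʳ ι-0) (R.zeroˡ w))) growth-0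
  growth-nat {r} {w} 0≤r g (suc k) = growth-≈
    (R.trans (solveᴷ 2 (λ k w → w ⊕ k ⊛ w ⊜ (κ 1ℚ ⊕ k) ⊛ w) R.refl (ι (nat k)) w)
      (R.*-congʳ (R.trans (R.sym (ι-+ 1ℚ (nat k))) (R.reflexive (cong ι (sym (nat-suc k)))))))
    (growth-+ 0≤r (0≤pow 0≤r k) g (growth-nat 0≤r g k))

  pow≤1 : ∀ {r} → 0ℚ ℚ.≤ r → r ℚ.≤ 1ℚ → ∀ k → pow r k ℚ.≤ 1ℚ
  pow≤1 0≤r r≤1 zero    = ℚ.≤-refl
  pow≤1 0≤r r≤1 (suc k) = *-mono 0≤r (ℚ.nonNegative⁻¹ 1ℚ) r≤1 (pow≤1 0≤r r≤1 k)

  -- Stands for |e^u| ≤ ρ < 1. The form ρ = 1/(1 + δ) is what 1 + t ≤ e^t delivers and what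
  -- Bernoulli's inequality consumes.
  record Decaying (u : Carrier) : Set where
    field
      ρ δ   : ℚ
      0≤ρ   : 0ℚ ℚ.≤ ρ
      0<δ   : 0ℚ ℚ.< δ
      ρ-inv : (1ℚ ℚ.+ δ) ℚ.* ρ ≡ 1ℚ
      decay : Growth ρ u

    ρ≤1 : ρ ℚ.≤ 1ℚ
    ρ≤1 = ≤-by (sym (ℚ.+-identityʳ ρ))
      (trans (sym ρ-inv) (solve 2 (λ d r → (con 1ℚ :+ d) :* r := r :+ d :* r) refl δ ρ))
      (ℚ.+-monoʳ-≤ ρ (0≤* (ℚ.<⇒≤ 0<δ) 0≤ρ))

  module _ {u : Carrier} (D : Decaying u) where

    open Decaying D

    growth-square : ∀ n → Growth (pow ρ (ℤ.∣ n ∣ ℕ.* ℤ.∣ n ∣)) (ι (int (n ℤ.* n)) * u)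
    growth-square n = growth-≈
      (R.*-congʳ (R.reflexive (cong ι (trans (sym (nat≡ (ℤ.∣ n ∣ ℕ.* ℤ.∣ n ∣))) (cong int (sym (square-∣∣ n)))))))
      (growth-nat 0≤ρ decay (ℤ.∣ n ∣ ℕ.* ℤ.∣ n ∣))

    module _ (v : Carrier) where

      -- Bounds e^(Re v) and e^(-Re v) at once, hence e^(n Re v) ≤ E^|n| for both signs of n.
      E : ℚ
      E = proj₁ (growth-exists v) ℚ.+ proj₁ (growth-exists (- v))

      0≤E : 0ℚ ℚ.≤ E
      0≤E = 0≤+ (proj₁ (proj₂ (growth-exists v))) (proj₁ (proj₂ (growth-exists (- v))))

      growth-linear : ∀ n → Growth (pow E ℤ.∣ n ∣) (ι (int n) * v)
      growth-linear (ℤ.+ k)    = growth-≈ (R.*-congʳ (R.reflexive (cong ι (sym (nat≡ k)))))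
        (growth-nat 0≤E (growth-≤ v≤E (proj₂ (proj₂ (growth-exists v)))) k)
        where
        v≤E : proj₁ (growth-exists v) ℚ.≤ E
        v≤E = ≤-by (sym (ℚ.+-identityʳ (proj₁ (growth-exists v)))) refl (ℚ.+-monoʳ-≤ (proj₁ (growth-exists v)) (proj₁ (proj₂ (growth-exists (- v)))))
      growth-linear ℤ.-[1+ k ] = growth-≈
        (R.trans (R.*-congʳ (R.reflexive (cong ι (sym (nat≡ (suc k))))))
          (R.trans (solveᴷ 2 (λ k v → k ⊛ (⊝ v) ⊜ (⊝ k) ⊛ v) R.refl (ι (int (ℤ.+ suc k))) v)
            (R.*-congʳ (R.trans (R.sym (ι-neg (int (ℤ.+ suc k))))
              (R.reflexive (cong ι (sym (int-neg (ℤ.+ suc k)))))))))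
        (growth-nat 0≤E (growth-≤ -v≤E (proj₂ (proj₂ (growth-exists (- v))))) (suc k))
        where
        -v≤E : proj₁ (growth-exists (- v)) ℚ.≤ E
        -v≤E = ≤-by (sym (ℚ.+-identityˡ (proj₁ (growth-exists (- v))))) refl (ℚ.+-monoˡ-≤ (proj₁ (growth-exists (- v))) (proj₁ (proj₂ (growth-exists v))))

      open Gaussian ρ δ E 0≤ρ 0<δ ρ-inv 0≤E public
        renaming (b to gaussian; 0≤b to 0≤gaussian) using (gaussian-summable)

      growth-quadratic : ∀ n → Growth (gaussian ℤ.∣ n ∣) (ι (int (n ℤ.* n)) * u + ι (int n) * v)
      growth-quadratic n = growth-+ (0≤pow 0≤ρ (ℤ.∣ n ∣ ℕ.* ℤ.∣ n ∣)) (0≤pow 0≤E ℤ.∣ n ∣)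
        (growth-square n) (growth-linear n)

    dominated-line : ∀ v w → Dominated (λ n → exp (ι (int (n ℤ.* n)) * u + ι (int n) * v + w))
    dominated-line v w =
      let C , 0≤C , g = growth-exists w in record
      { bound     = λ n → gaussian v ℤ.∣ n ∣ ℚ.* C ℚ.* nat 2
      ; summable  = summable-* (nat 2) (ℚ.nonNegative⁻¹ (nat 2))
                      (summable-* C 0≤C (summable-∣∣ (gaussian-summable v)))
      ; dominated = λ n → growth-small _ (0≤* (0≤gaussian v ℤ.∣ n ∣) 0≤C)
                      (growth-+ (0≤gaussian v ℤ.∣ n ∣) 0≤C (growth-quadratic v n) g)
      }

    -- 2 (m² − m n + n²) = m² + n² + (m − n)²
    dominated-plane : ∀ v w → Dominated {ℤ × ℤ} (λ (m , n) →
      exp ((ι (int (m ℤ.* m)) * u + ι (int m) * v) + (ι (int (n ℤ.* n)) * u + ι (int n) * w)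
           + ι (int ((m ℤ.- n) ℤ.* (m ℤ.- n))) * u))
    dominated-plane v w = record
      { bound     = λ (m , n) → gaussian v ℤ.∣ m ∣ ℚ.* gaussian w ℤ.∣ n ∣ ℚ.* nat 2
      ; summable  = summable-* (nat 2) (ℚ.nonNegative⁻¹ (nat 2))
          (summable-⊗ ℤ._≟_ ℤ._≟_ (λ n → 0≤gaussian v ℤ.∣ n ∣) (λ n → 0≤gaussian w ℤ.∣ n ∣)
            (summable-∣∣ (gaussian-summable v)) (summable-∣∣ (gaussian-summable w)))
      ; dominated = λ (m , n) →
          let 0≤g = 0≤* (0≤gaussian v ℤ.∣ m ∣) (0≤gaussian w ℤ.∣ n ∣) in
          growth-small _ 0≤g (subst (λ r → Growth r _) (ℚ.*-identityʳ _)
            (growth-+ 0≤g (ℚ.nonNegative⁻¹ 1ℚ)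
              (growth-+ (0≤gaussian v ℤ.∣ m ∣) (0≤gaussian w ℤ.∣ n ∣) (growth-quadratic v m) (growth-quadratic w n))
              -- The factor belonging to (m - n)² is bounded by 1; the squares m² and n² already
              -- ensure convergence.
              (growth-≤ (pow≤1 0≤ρ ρ≤1 (ℤ.∣ m ℤ.- n ∣ ℕ.* ℤ.∣ m ℤ.- n ∣)) (growth-square (m ℤ.- n)))))
      }

-- Division by three

open ℤSolver.+-*-Solver using ()
  renaming (solve to solveℤ; _:=_ to _≐_; _:+_ to _∔_; _:*_ to _⋇_; _:-_ to _∸_; :-_ to ∸_; con to #)

-- Two representations satisfy 3 (k - k′) = r′ - r, and remainders below 3 differ by less than 3.
div3-unique : ∀ s r k → r ℕ.< 3 → s ≡ ℤ.+ r ℤ.+ k ℤ.* ℤ.+ 3 → s %ℕ 3 ≡ r × s /ℕ 3 ≡ k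
div3-unique s r k r<3 e = ℤ.+-injective (ℤ.i-j≡0⇒i≡j (ℤ.+ r′) (ℤ.+ r)
  (trans (ℤ.m-n≡m⊖n r′ r) (trans (sym difference)
    (cong (ℤ._* ℤ.+ 3) (ℤ.i≡j⇒i-j≡0 (sym k′≡k)))))) , k′≡k
  where
  r′ : ℕ
  r′ = s %ℕ 3
  k′ : ℤ
  k′ = s /ℕ 3
  e′ : s ≡ ℤ.+ r′ ℤ.+ k′ ℤ.* ℤ.+ 3
  e′ = a≡a%ℕn+[a/ℕn]*n s 3
  difference : (k ℤ.- k′) ℤ.* ℤ.+ 3 ≡ r′ ℤ.⊖ r
  difference = begin
    (k ℤ.- k′) ℤ.* ℤ.+ 3
      ≡⟨ solveℤ 4 (λ r r′ k k′ → (k ∸ k′) ⋇ # (ℤ.+ 3) ≐ (r ∔ k ⋇ # (ℤ.+ 3)) ∸ (r′ ∔ k′ ⋇ # (ℤ.+ 3)) ∔ (r′ ∸ r)) refl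
           (ℤ.+ r) (ℤ.+ r′) k k′ ⟩
    (ℤ.+ r ℤ.+ k ℤ.* ℤ.+ 3) ℤ.- (ℤ.+ r′ ℤ.+ k′ ℤ.* ℤ.+ 3) ℤ.+ (ℤ.+ r′ ℤ.- ℤ.+ r)
      ≡⟨ cong (ℤ._+ (ℤ.+ r′ ℤ.- ℤ.+ r)) (trans (cong₂ ℤ._-_ (sym e) (sym e′)) (ℤ.+-inverseʳ s)) ⟩
    ℤ.0ℤ ℤ.+ (ℤ.+ r′ ℤ.- ℤ.+ r)
      ≡⟨ ℤ.+-identityˡ _ ⟩
    ℤ.+ r′ ℤ.- ℤ.+ r
      ≡⟨ ℤ.m-n≡m⊖n r′ r ⟩
    r′ ℤ.⊖ r ∎
    where open ≡-Reasoning
  small : ℤ.∣ k ℤ.- k′ ∣ ℕ.* 3 ℕ.< 3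
  small = ℕ.<-≤-trans
    (ℕ.≤-<-trans (ℕ.≤-reflexive (trans (sym (ℤ.∣i*j∣≡∣i∣*∣j∣ (k ℤ.- k′) (ℤ.+ 3))) (cong ℤ.∣_∣ difference)))
      (ℕ.≤-<-trans (ℤ.∣m⊝n∣≤m⊔n r′ r) (ℕ.⊔-lub (n%ℕd<d s 3) r<3)))
    ℕ.≤-refl
  zero-of : ∀ m → m ℕ.* 3 ℕ.< 3 → m ≡ 0
  zero-of zero    _ = refl
  zero-of (suc m) p = ⊥-elim (ℕ.<⇒≱ p (ℕ.m≤m+n 3 (m ℕ.* 3)))
  k′≡k : k′ ≡ k
  k′≡k = sym (ℤ.i-j≡0⇒i≡j k k′ (ℤ.∣i∣≡0⇒i≡0 (zero-of ℤ.∣ k ℤ.- k′ ∣ small)))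

div3 : ∀ s → s ≡ ℤ.+ (s %ℕ 3) ℤ.+ (s /ℕ 3) ℤ.* ℤ.+ 3
div3 s = a≡a%ℕn+[a/ℕn]*n s 3

-- Each case keeps the decomposition, for the arithmetic, and the values of `%ℕ` and `/ℕ`, from
-- which `φ`, `ψ` and `to` are built.
data Residue (s : ℤ) : Set where
  residue0 : ∀ k → s ≡ k ℤ.* ℤ.+ 3 → s %ℕ 3 ≡ 0 → s /ℕ 3 ≡ k → Residue s
  residue1 : ∀ k → s ≡ ℤ.+ 1 ℤ.+ k ℤ.* ℤ.+ 3 → s %ℕ 3 ≡ 1 → s /ℕ 3 ≡ k → Residue s
  residue2 : ∀ k → s ≡ ℤ.+ 2 ℤ.+ k ℤ.* ℤ.+ 3 → s %ℕ 3 ≡ 2 → s /ℕ 3 ≡ k → Residue s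

residue : ∀ s → Residue s
residue s with s %ℕ 3 in e | n%ℕd<d s 3
... | 0 | _ = residue0 (s /ℕ 3) (trans (div3 s) (trans (cong (λ r → ℤ.+ r ℤ.+ (s /ℕ 3) ℤ.* ℤ.+ 3) e) (ℤ.+-identityˡ _))) e refl
... | 1 | _ = residue1 (s /ℕ 3) (trans (div3 s) (cong (λ r → ℤ.+ r ℤ.+ (s /ℕ 3) ℤ.* ℤ.+ 3) e)) e refl
... | 2 | _ = residue2 (s /ℕ 3) (trans (div3 s) (cong (λ r → ℤ.+ r ℤ.+ (s /ℕ 3) ℤ.* ℤ.+ 3) e)) e refl
... | suc (suc (suc _)) | ℕ.s≤s (ℕ.s≤s (ℕ.s≤s ()))

-- Exponentials of rational linear combinations

-- Coordinates of an exponent with respect to p, u, X, Y, Z: terms are compared as vectors in ℚ⁵,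
-- hence by ring identities.
record Lin : Set where
  constructor lin
  field
    p̂ û x̂ ŷ ẑ : ℚ

infixl 6 _⊞_
infixl 7 _⊡_

_⊞_ : Lin → Lin → Lin
lin a b c d e ⊞ lin a′ b′ c′ d′ e′ = lin (a ℚ.+ a′) (b ℚ.+ b′) (c ℚ.+ c′) (d ℚ.+ d′) (e ℚ.+ e′)

_⊡_ : ℚ → Lin → Lin
r ⊡ lin a b c d e = lin (r ℚ.* a) (r ℚ.* b) (r ℚ.* c) (r ℚ.* d) (r ℚ.* e)

lin-≡ : ∀ {a a′ b b′ c c′ d d′ e e′} → a ≡ a′ → b ≡ b′ → c ≡ c′ → d ≡ d′ → e ≡ e′ →
        lin a b c d e ≡ lin a′ b′ c′ d′ e′
lin-≡ refl refl refl refl refl = refl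

2ℚ 3ℚ 4ℚ : ℚ
2ℚ = int (ℤ.+ 2)
3ℚ = int (ℤ.+ 3)
4ℚ = int (ℤ.+ 4)

p⟨_⟩ : ℚ → Lin
p⟨ a ⟩ = lin a 0ℚ 0ℚ 0ℚ 0ℚ

-- p = πi, u = πiτ, and X, Y, Z stand for ix, iy, iz.
record Arguments (A : ExponentialAlgebra) : Set where
  open ExponentialAlgebra A

  field
    p u X Y Z : Carrier
    exp-p     : exp p ≈ - 1#
    ω-sum     : 1# + exp (ι ⅔ * p) + exp (ι (ℚ.- ⅔) * p) ≈ 0#

module Lattice (A : ExponentialAlgebra) (arguments : Arguments A) where

  open ExponentialAlgebra A
  open Arguments arguments

  open AlgebraSolver algebra
  open Sums algebra
  open Domination A
  private
    module R = CommutativeRing commutativeRing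
  open SetoidReasoning R.setoid

  ⟦_⟧ : Lin → Carrier
  ⟦ lin a b c d e ⟧ = ι a * p + (ι b * u + (ι c * X + (ι d * Y + ι e * Z)))

  𝐞 : Lin → Carrier
  𝐞 l = exp ⟦ l ⟧

  𝐞-≡ : ∀ {l l′} → l ≡ l′ → 𝐞 l ≈ 𝐞 l′
  𝐞-≡ e = R.reflexive (cong 𝐞 e)

  ⟦⟧-⊞ : ∀ l l′ → ⟦ l ⊞ l′ ⟧ ≈ ⟦ l ⟧ + ⟦ l′ ⟧
  ⟦⟧-⊞ (lin a b c d e) (lin a′ b′ c′ d′ e′) =
    add a a′ p (add b b′ u (add c c′ X (add d d′ Y
      (R.trans (R.*-congʳ (ι-+ e e′)) (R.distribʳ Z (ι e) (ι e′))))))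
    where
    add : ∀ r r′ g {s s′ t} → t ≈ s + s′ → ι (r ℚ.+ r′) * g + t ≈ (ι r * g + s) + (ι r′ * g + s′)
    add r r′ g {s} {s′} h = R.trans (R.+-cong (R.*-congʳ (ι-+ r r′)) h)
      (solveᴷ 5 (λ r r′ g s s′ → (r ⊕ r′) ⊛ g ⊕ (s ⊕ s′) ⊜ (r ⊛ g ⊕ s) ⊕ (r′ ⊛ g ⊕ s′)) R.refl (ι r) (ι r′) g s s′)

  ⟦⟧-⊡ : ∀ r l → ⟦ r ⊡ l ⟧ ≈ ι r * ⟦ l ⟧
  ⟦⟧-⊡ r (lin a b c d e) = scale a p (scale b u (scale c X (scale d Y
      (R.trans (R.*-congʳ (ι-* r e)) (R.*-assoc (ι r) (ι e) Z)))))
    where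
    scale : ∀ a g {s t} → t ≈ ι r * s → ι (r ℚ.* a) * g + t ≈ ι r * (ι a * g + s)
    scale a g {s} h = R.trans (R.+-cong (R.*-congʳ (ι-* r a)) h)
      (solveᴷ 4 (λ r a g s → (r ⊛ a) ⊛ g ⊕ r ⊛ s ⊜ r ⊛ (a ⊛ g ⊕ s)) R.refl (ι r) (ι a) g s)

  0*≈ : ∀ g {s t} → s ≈ t → ι 0ℚ * g + s ≈ t
  0*≈ g {s} {t} h = R.trans (R.+-cong (R.trans (R.*-congʳ ι-0) (R.zeroˡ g)) h) (R.+-identityˡ t)

  ⟦u⟧ : ∀ r → ⟦ lin 0ℚ r 0ℚ 0ℚ 0ℚ ⟧ ≈ ι r * u
  ⟦u⟧ r = 0*≈ p (R.trans (R.+-congˡ (0*≈ X (0*≈ Y (R.trans (R.*-congʳ ι-0) (R.zeroˡ Z))))) (R.+-identityʳ _))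

  ⟦p⟧ : ∀ r → ⟦ p⟨ r ⟩ ⟧ ≈ ι r * p
  ⟦p⟧ r = R.trans (R.+-congˡ (0*≈ u (0*≈ X (0*≈ Y (R.trans (R.*-congʳ ι-0) (R.zeroˡ Z)))))) (R.+-identityʳ _)

  𝐞-⊞ : ∀ l l′ → 𝐞 (l ⊞ l′) ≈ 𝐞 l * 𝐞 l′
  𝐞-⊞ l l′ = R.trans (exp-cong (⟦⟧-⊞ l l′)) (exp-+ ⟦ l ⟧ ⟦ l′ ⟧)

  exp-inverse : ∀ w → exp (- w) * exp w ≈ 1#
  exp-inverse w = R.trans (R.sym (exp-+ (- w) w)) (R.trans (exp-cong (R.-‿inverseˡ w)) exp-0)

  period-nat : ∀ k → exp (ι (nat k) * (p + p)) ≈ 1#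
  period-nat zero    = R.trans (exp-cong (R.trans (R.*-congʳ ι-0) (R.zeroˡ (p + p)))) exp-0
  period-nat (suc k) = begin
    exp (ι (nat (suc k)) * (p + p))
      ≈⟨ exp-cong (R.trans (R.*-congʳ (R.trans (R.reflexive (cong ι (nat-suc k))) (ι-+ 1ℚ (nat k))))
           (solveᴷ 2 (λ k p → (κ 1ℚ ⊕ k) ⊛ (p ⊕ p) ⊜ p ⊕ (p ⊕ k ⊛ (p ⊕ p))) R.refl (ι (nat k)) p)) ⟩
    exp (p + (p + ι (nat k) * (p + p)))
      ≈⟨ R.trans (exp-+ p _) (R.*-congˡ (exp-+ p _)) ⟩
    exp p * (exp p * exp (ι (nat k) * (p + p)))
      ≈⟨ R.*-cong exp-p (R.*-cong exp-p (period-nat k)) ⟩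
    (- 1#) * ((- 1#) * 1#)
      ≈⟨ solveᴷ 1 (λ o → (⊝ o) ⊛ ((⊝ o) ⊛ o) ⊜ o ⊛ (o ⊛ o)) R.refl 1# ⟩
    1# * (1# * 1#)
      ≈⟨ R.trans (R.*-identityˡ _) (R.*-identityˡ 1#) ⟩
    1# ∎

  period : ∀ k → exp (ι (int k) * (p + p)) ≈ 1#
  period (ℤ.+ k)    = R.trans (exp-cong (R.*-congʳ (R.reflexive (cong ι (nat≡ k))))) (period-nat k)
  period ℤ.-[1+ k ] = begin
    exp (ι (int ℤ.-[1+ k ]) * (p + p))
      ≈⟨ exp-cong (R.trans (R.*-congʳ (R.trans (R.reflexive (cong ι (trans (int-neg (ℤ.+ suc k)) (cong ℚ.-_ (nat≡ (suc k))))))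
           (ι-neg (nat (suc k))))) (solveᴷ 2 (λ k p → (⊝ k) ⊛ p ⊜ ⊝ (k ⊛ p)) R.refl (ι (nat (suc k))) (p + p))) ⟩
    exp (- (ι (nat (suc k)) * (p + p)))
      ≈⟨ R.trans (R.sym (R.*-identityʳ _)) (R.*-congˡ (R.sym (period-nat (suc k)))) ⟩
    exp (- (ι (nat (suc k)) * (p + p))) * exp (ι (nat (suc k)) * (p + p))
      ≈⟨ exp-inverse _ ⟩
    1# ∎

  𝐞-period : ∀ k l → 𝐞 (p⟨ 2ℚ ℚ.* int k ⟩ ⊞ l) ≈ 𝐞 l
  𝐞-period k l = R.trans (𝐞-⊞ p⟨ 2ℚ ℚ.* int k ⟩ l)
    (R.trans (R.*-congʳ (R.trans (exp-cong (R.trans (⟦p⟧ (2ℚ ℚ.* int k))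
      (R.trans (R.*-congʳ (R.trans (ι-* 2ℚ (int k)) (R.*-congʳ R.refl)))
        (solveᴷ 2 (λ k p → (κ 2ℚ ⊛ k) ⊛ p ⊜ k ⊛ (p ⊕ p)) R.refl (ι (int k)) p)))) (period k)))
      (R.*-identityˡ (𝐞 l)))

  module _ {r : ℚ} (D : Decaying (ι r * u)) where

    -- The exponents are r u n² plus an affine function of n, the shape to which `dominated-line`
    -- applies.
    line : (ℤ → Lin) → Lin → Lin → Set
    line L v w = ∀ n → L n ≡ lin 0ℚ (int (n ℤ.* n) ℚ.* r) 0ℚ 0ℚ 0ℚ ⊞ int n ⊡ v ⊞ w

    dominated-𝐞-line : ∀ L v w → line L v w → Dominated (λ n → 𝐞 (L n))
    dominated-𝐞-line L v w e = dominated-cong (λ n → exp-cong (R.sym (begin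
      ⟦ L n ⟧
        ≡⟨ cong ⟦_⟧ (e n) ⟩
      ⟦ lin 0ℚ (int (n ℤ.* n) ℚ.* r) 0ℚ 0ℚ 0ℚ ⊞ int n ⊡ v ⊞ w ⟧
        ≈⟨ R.trans (⟦⟧-⊞ (lin 0ℚ (int (n ℤ.* n) ℚ.* r) 0ℚ 0ℚ 0ℚ ⊞ int n ⊡ v) w)
             (R.+-congʳ (R.trans (⟦⟧-⊞ (lin 0ℚ (int (n ℤ.* n) ℚ.* r) 0ℚ 0ℚ 0ℚ) (int n ⊡ v))
               (R.+-cong (square n) (⟦⟧-⊡ (int n) v)))) ⟩
      ι (int (n ℤ.* n)) * (ι r * u) + ι (int n) * ⟦ v ⟧ + ⟦ w ⟧ ∎)))
      (dominated-line D ⟦ v ⟧ ⟦ w ⟧)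
      where
      square : ∀ n → ⟦ lin 0ℚ (int (n ℤ.* n) ℚ.* r) 0ℚ 0ℚ 0ℚ ⟧ ≈ ι (int (n ℤ.* n)) * (ι r * u)
      square n = R.trans (⟦u⟧ _) (R.trans (R.*-congʳ (ι-* (int (n ℤ.* n)) r)) (R.*-assoc _ _ _))

    plane : (ℤ × ℤ → Lin) → Lin → Lin → Set
    plane L v w = ∀ m n → L (m , n) ≡
      (lin 0ℚ (int (m ℤ.* m) ℚ.* r) 0ℚ 0ℚ 0ℚ ⊞ int m ⊡ v) ⊞ (lin 0ℚ (int (n ℤ.* n) ℚ.* r) 0ℚ 0ℚ 0ℚ ⊞ int n ⊡ w)
        ⊞ lin 0ℚ (int ((m ℤ.- n) ℤ.* (m ℤ.- n)) ℚ.* r) 0ℚ 0ℚ 0ℚ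

    dominated-𝐞-plane : ∀ L v w → plane L v w → Dominated (λ mn → 𝐞 (L mn))
    dominated-𝐞-plane L v w e = dominated-cong (λ (m , n) → exp-cong (R.sym (R.trans (R.reflexive (cong ⟦_⟧ (e m n)))
      (R.trans (⟦⟧-⊞ _ _) (R.+-cong (R.trans (⟦⟧-⊞ _ _) (R.+-cong (half m v) (half n w))) (square (m ℤ.- n)))))))
      (dominated-plane D ⟦ v ⟧ ⟦ w ⟧)
      where
      square : ∀ n → ⟦ lin 0ℚ (int (n ℤ.* n) ℚ.* r) 0ℚ 0ℚ 0ℚ ⟧ ≈ ι (int (n ℤ.* n)) * (ι r * u)
      square n = R.trans (⟦u⟧ _) (R.trans (R.*-congʳ (ι-* (int (n ℤ.* n)) r)) (R.*-assoc _ _ _))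
      half : ∀ n v → ⟦ lin 0ℚ (int (n ℤ.* n) ℚ.* r) 0ℚ 0ℚ 0ℚ ⊞ int n ⊡ v ⟧ ≈ ι (int (n ℤ.* n)) * (ι r * u) + ι (int n) * ⟦ v ⟧
      half n v = R.trans (⟦⟧-⊞ _ _) (R.+-cong (square n) (⟦⟧-⊡ (int n) v))

-- The theta series as lattice sums

-- The norm of m + n ω in ℤ[ω], invariant under multiplication by ω.
form : ℤ → ℤ → ℤ
form m n = m ℤ.* m ℤ.- m ℤ.* n ℤ.+ n ℤ.* n

odd : ℤ → ℤ → ℤ
odd d n = ℤ.+ 2 ℤ.* n ℤ.+ d

-- Exponent of the n-th term of ϑ₁ (d = 1, using (−1)ⁿ = e^{πin}) or ϑ₃ (d = 0),
-- twisted by ω^{δ(n − d)}, at the argument xX + yY + zZ and with q replaced by q^r.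
θ-exponent : ℤ → ℤ → ℚ → ℤ → ℤ → ℤ → ℤ → Lin
θ-exponent d δ r x y z n = lin
  (int (d ℤ.* n) ℚ.+ ⅔ ℚ.* int (δ ℤ.* (n ℤ.- d)))
  (int (odd d n ℤ.* odd d n) ℚ.* ¼ ℚ.* r)
  (int (x ℤ.* odd d n)) (int (y ℤ.* odd d n)) (int (z ℤ.* odd d n))

-- Exponent of the (m, n)-th term of A† (ε = 0) or C† (ε = 1), with the
-- additional factor q^{σm}.
C-exponent : ℤ → ℤ → ℚ → ℤ × ℤ → Lin
C-exponent ε σ r (m , n) = lin
  (⅔ ℚ.* int (ε ℤ.* (m ℤ.+ n)))
  (int (ℤ.+ 2 ℤ.* form m n ℤ.+ σ ℤ.* m) ℚ.* r)
  (int (ℤ.+ 2 ℤ.* m)) (int (ℤ.+ 2 ℤ.* n)) 0ℚ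

p⊞-assoc : ∀ a b l → p⟨ a ℚ.+ b ⟩ ⊞ l ≡ p⟨ a ⟩ ⊞ (p⟨ b ⟩ ⊞ l)
p⊞-assoc a b l = lin-≡ (ℚ.+-assoc a b _) (sym (ℚ.+-identityˡ _)) (sym (ℚ.+-identityˡ _))
  (sym (ℚ.+-identityˡ _)) (sym (ℚ.+-identityˡ _))

-- Lets the ring solver exploit a hypothesis s ≡ e: the solver proves an identity that contains (s -
-- e) C with an explicit cofactor C, and this term is then removed.
vanishing-term : ∀ a {s e} C → s ≡ e → a ℤ.+ (s ℤ.- e) ℤ.* C ≡ a
vanishing-term a {s} C refl = trans (cong (λ t → a ℤ.+ t ℤ.* C) (ℤ.+-inverseʳ s)) (ℤ.+-identityʳ a)

⅔-multiple : ∀ k → ⅔ ℚ.* int (k ℤ.* ℤ.+ 3) ≡ 2ℚ ℚ.* int k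
⅔-multiple k = trans (cong (⅔ ℚ.*_) (int-* k (ℤ.+ 3)))
  (solve 1 (λ x → con ⅔ :* (x :* con 3ℚ) := con 2ℚ :* x) refl (int k))

⅔-residue : ∀ r k → ⅔ ℚ.* int (r ℤ.+ k ℤ.* ℤ.+ 3) ≡ 2ℚ ℚ.* int k ℚ.+ ⅔ ℚ.* int r
⅔-residue r k = trans (cong (⅔ ℚ.*_) (int-+ r (k ℤ.* ℤ.+ 3)))
  (trans (ℚ.*-distribˡ-+ ⅔ (int r) (int (k ℤ.* ℤ.+ 3)))
    (trans (ℚ.+-comm (⅔ ℚ.* int r) (⅔ ℚ.* int (k ℤ.* ℤ.+ 3))) (cong (ℚ._+ ⅔ ℚ.* int r) (⅔-multiple k))))

-- Triples of lattice vectors and their rotation by 120°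

V : Set
V = ℤ × ℤ

_≟ⱽ_ : DecidableEquality V
_≟ⱽ_ = ≡-dec ℤ._≟_ ℤ._≟_

-- m + n ω ≡ m + n modulo √-3, so divisibility of the weight by 3 decides whether the sum of the
-- three vectors lies in √-3 ℤ[ω]. The weight is also the exponent of ω in a product of three terms
-- of C†.
m-total n-total weight : V × V × V → ℤ
m-total ((m₁ , _) , (m₂ , _) , (m₃ , _)) = m₁ ℤ.+ m₂ ℤ.+ m₃
n-total ((_ , n₁) , (_ , n₂) , (_ , n₃)) = n₁ ℤ.+ n₂ ℤ.+ n₃
weight v = m-total v ℤ.+ n-total v

form-total : V × V × V → ℤ
form-total ((m₁ , n₁) , (m₂ , n₂) , (m₃ , n₃)) = form m₁ n₁ ℤ.+ form m₂ n₂ ℤ.+ form m₃ n₃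

map³ : (V → V) → V × V × V → V × V × V
map³ f (v₁ , v₂ , v₃) = f v₁ , f v₂ , f v₃

-- On triples of total w ∉ √−3 ℤ[ω] (weight not divisible by 3), rotation of
-- each vector by 120° about w/3, followed by the translation by −(2/3 , 1/3),
-- preserves the lattice. The sense of the rotation depends on the residue of the weight.
rotate₁ rotate₂ unrotate₁ unrotate₂ : ℤ → V × V × V → V × V × V
rotate₁ k v = map³ (λ (m , n) → n ℤ.- m ℤ.+ m-total v ℤ.- k ℤ.- ℤ.+ 1 , k ℤ.- m) v
rotate₂ k v = map³ (λ (m , n) → k ℤ.- n , m ℤ.- n ℤ.+ n-total v ℤ.- k ℤ.- ℤ.+ 1) v
unrotate₁ k v = map³ (λ (m , n) → k ℤ.+ ℤ.+ 1 ℤ.- n , m ℤ.- n ℤ.- m-total v ℤ.+ ℤ.+ 2 ℤ.* k ℤ.+ ℤ.+ 1) v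
unrotate₂ k v = map³ (λ (m , n) → n ℤ.- m ℤ.- n-total v ℤ.+ ℤ.+ 2 ℤ.* k ℤ.+ ℤ.+ 2 , k ℤ.+ ℤ.+ 1 ℤ.- m) v

-- The first argument is the residue of the weight modulo 3 and the second its quotient. At residue
-- 0 the differences of cubes vanish, and the identity map serves as a default.
rotate unrotate : ℕ → ℤ → V × V × V → V × V × V
rotate 0 k v = v
rotate 1 k v = rotate₁ k v
rotate _ k v = rotate₂ k v
unrotate 0 k v = v
unrotate 1 k v = unrotate₁ k v
unrotate _ k v = unrotate₂ k v

triple-≡ : ∀ {m₁ n₁ m₂ n₂ m₃ n₃ m₁′ n₁′ m₂′ n₂′ m₃′ n₃′ : ℤ} →
  m₁ ≡ m₁′ → n₁ ≡ n₁′ → m₂ ≡ m₂′ → n₂ ≡ n₂′ → m₃ ≡ m₃′ → n₃ ≡ n₃′ →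
  ((m₁ , n₁) , (m₂ , n₂) , (m₃ , n₃)) ≡ ((m₁′ , n₁′) , (m₂′ , n₂′) , (m₃′ , n₃′))
triple-≡ refl refl refl refl refl refl = refl

module _ (m₁ n₁ m₂ n₂ m₃ n₃ k : ℤ) where

  private
    v : V × V × V
    v = (m₁ , n₁) , (m₂ , n₂) , (m₃ , n₃)
    M N : ℤ
    M = m-total v
    N = n-total v

  -- The linear part (m , n) ↦ (n - m , -m) is multiplication by ω². Rotation about w/3 preserves
  -- the sum of the three norms. Adding (2/3 , 1/3) to a vector (m , n) raises its norm by m + 1/3,
  -- so undoing the three translations accounts for `m-total` + 1.
  form-rotate₁ : weight v ≡ ℤ.+ 1 ℤ.+ k ℤ.* ℤ.+ 3 →
    form-total (rotate₁ k v) ℤ.+ m-total (rotate₁ k v) ℤ.+ ℤ.+ 1 ≡ form-total v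
  form-rotate₁ e = trans (solveℤ 7 (λ m₁ n₁ m₂ n₂ m₃ n₃ k →
      let M = m₁ ∔ m₂ ∔ m₃
          N = n₁ ∔ n₂ ∔ n₃
          Q = λ m n → m ⋇ m ∸ m ⋇ n ∔ n ⋇ n
          m′ = λ m n → n ∸ m ∔ M ∸ k ∸ # (ℤ.+ 1)
          n′ = λ m → k ∸ m
      in (Q (m′ m₁ n₁) (n′ m₁) ∔ Q (m′ m₂ n₂) (n′ m₂) ∔ Q (m′ m₃ n₃) (n′ m₃)) ∔ (m′ m₁ n₁ ∔ m′ m₂ n₂ ∔ m′ m₃ n₃) ∔ # (ℤ.+ 1)
         ≐ (Q m₁ n₁ ∔ Q m₂ n₂ ∔ Q m₃ n₃)
           ∔ ((M ∔ N) ∸ (# (ℤ.+ 1) ∔ k ⋇ # (ℤ.+ 3))) ⋇ (# (ℤ.+ 2) ⋇ M ∸ # (ℤ.+ 3) ⋇ k ∸ # (ℤ.+ 1)))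
    refl m₁ n₁ m₂ n₂ m₃ n₃ k)
    (vanishing-term (form-total v) (ℤ.+ 2 ℤ.* M ℤ.- ℤ.+ 3 ℤ.* k ℤ.- ℤ.+ 1) e)

  -- As for `form-rotate₁`, with the opposite rotation: the linear part (m , n) ↦ (-n , m - n) is
  -- multiplication by ω.
  form-rotate₂ : weight v ≡ ℤ.+ 2 ℤ.+ k ℤ.* ℤ.+ 3 →
    form-total (rotate₂ k v) ℤ.+ m-total (rotate₂ k v) ℤ.+ ℤ.+ 1 ≡ form-total v
  form-rotate₂ e = trans (solveℤ 7 (λ m₁ n₁ m₂ n₂ m₃ n₃ k →
      let M = m₁ ∔ m₂ ∔ m₃
          N = n₁ ∔ n₂ ∔ n₃
          Q = λ m n → m ⋇ m ∸ m ⋇ n ∔ n ⋇ n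
          m′ = λ n → k ∸ n
          n′ = λ m n → m ∸ n ∔ N ∸ k ∸ # (ℤ.+ 1)
      in (Q (m′ n₁) (n′ m₁ n₁) ∔ Q (m′ n₂) (n′ m₂ n₂) ∔ Q (m′ n₃) (n′ m₃ n₃)) ∔ (m′ n₁ ∔ m′ n₂ ∔ m′ n₃) ∔ # (ℤ.+ 1)
         ≐ (Q m₁ n₁ ∔ Q m₂ n₂ ∔ Q m₃ n₃)
           ∔ ((M ∔ N) ∸ (# (ℤ.+ 2) ∔ k ⋇ # (ℤ.+ 3))) ⋇ (# (ℤ.+ 2) ⋇ N ∸ # (ℤ.+ 3) ⋇ k ∸ # (ℤ.+ 2)))
    refl m₁ n₁ m₂ n₂ m₃ n₃ k)
    (vanishing-term (form-total v) (ℤ.+ 2 ℤ.* N ℤ.- ℤ.+ 3 ℤ.* k ℤ.- ℤ.+ 2) e)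

  -- Rotation about w/3 fixes the total, and three translations by -(2/3 , 1/3) subtract (2 , 1).
  totals-rotate₁ : weight v ≡ ℤ.+ 1 ℤ.+ k ℤ.* ℤ.+ 3 →
    m-total (rotate₁ k v) ℤ.+ ℤ.+ 2 ≡ M × n-total (rotate₁ k v) ℤ.+ ℤ.+ 1 ≡ N
  totals-rotate₁ e =
    trans (solveℤ 7 (λ m₁ n₁ m₂ n₂ m₃ n₃ k → let M = m₁ ∔ m₂ ∔ m₃ ; N = n₁ ∔ n₂ ∔ n₃ in
        ((n₁ ∸ m₁ ∔ M ∸ k ∸ # (ℤ.+ 1)) ∔ (n₂ ∸ m₂ ∔ M ∸ k ∸ # (ℤ.+ 1)) ∔ (n₃ ∸ m₃ ∔ M ∸ k ∸ # (ℤ.+ 1))) ∔ # (ℤ.+ 2)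
          ≐ M ∔ ((M ∔ N) ∸ (# (ℤ.+ 1) ∔ k ⋇ # (ℤ.+ 3))) ⋇ # (ℤ.+ 1)) refl m₁ n₁ m₂ n₂ m₃ n₃ k)
      (vanishing-term M (ℤ.+ 1) e) ,
    trans (solveℤ 7 (λ m₁ n₁ m₂ n₂ m₃ n₃ k → let M = m₁ ∔ m₂ ∔ m₃ ; N = n₁ ∔ n₂ ∔ n₃ in
        ((k ∸ m₁) ∔ (k ∸ m₂) ∔ (k ∸ m₃)) ∔ # (ℤ.+ 1)
          ≐ N ∔ ((M ∔ N) ∸ (# (ℤ.+ 1) ∔ k ⋇ # (ℤ.+ 3))) ⋇ # (ℤ.-[1+ 0 ])) refl m₁ n₁ m₂ n₂ m₃ n₃ k)
      (vanishing-term N ℤ.-[1+ 0 ] e)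

  totals-rotate₂ : weight v ≡ ℤ.+ 2 ℤ.+ k ℤ.* ℤ.+ 3 →
    m-total (rotate₂ k v) ℤ.+ ℤ.+ 2 ≡ M × n-total (rotate₂ k v) ℤ.+ ℤ.+ 1 ≡ N
  totals-rotate₂ e =
    trans (solveℤ 7 (λ m₁ n₁ m₂ n₂ m₃ n₃ k → let M = m₁ ∔ m₂ ∔ m₃ ; N = n₁ ∔ n₂ ∔ n₃ in
        ((k ∸ n₁) ∔ (k ∸ n₂) ∔ (k ∸ n₃)) ∔ # (ℤ.+ 2)
          ≐ M ∔ ((M ∔ N) ∸ (# (ℤ.+ 2) ∔ k ⋇ # (ℤ.+ 3))) ⋇ # (ℤ.-[1+ 0 ])) refl m₁ n₁ m₂ n₂ m₃ n₃ k)
      (vanishing-term M ℤ.-[1+ 0 ] e) ,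
    trans (solveℤ 7 (λ m₁ n₁ m₂ n₂ m₃ n₃ k → let M = m₁ ∔ m₂ ∔ m₃ ; N = n₁ ∔ n₂ ∔ n₃ in
        ((m₁ ∸ n₁ ∔ N ∸ k ∸ # (ℤ.+ 1)) ∔ (m₂ ∸ n₂ ∔ N ∸ k ∸ # (ℤ.+ 1)) ∔ (m₃ ∸ n₃ ∔ N ∸ k ∸ # (ℤ.+ 1))) ∔ # (ℤ.+ 1)
          ≐ N ∔ ((M ∔ N) ∸ (# (ℤ.+ 2) ∔ k ⋇ # (ℤ.+ 3))) ⋇ # (ℤ.+ 1)) refl m₁ n₁ m₂ n₂ m₃ n₃ k)
      (vanishing-term N (ℤ.+ 1) e)

  totals-unrotate₁ : weight v ≡ ℤ.+ 1 ℤ.+ k ℤ.* ℤ.+ 3 →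
    m-total (unrotate₁ k v) ≡ M ℤ.+ ℤ.+ 2 × n-total (unrotate₁ k v) ≡ N ℤ.+ ℤ.+ 1
  totals-unrotate₁ e =
    trans (solveℤ 7 (λ m₁ n₁ m₂ n₂ m₃ n₃ k → let M = m₁ ∔ m₂ ∔ m₃ ; N = n₁ ∔ n₂ ∔ n₃ ; m′ = λ n → k ∔ # (ℤ.+ 1) ∸ n in
        m′ n₁ ∔ m′ n₂ ∔ m′ n₃ ≐ (M ∔ # (ℤ.+ 2)) ∔ ((M ∔ N) ∸ (# (ℤ.+ 1) ∔ k ⋇ # (ℤ.+ 3))) ⋇ # (ℤ.-[1+ 0 ])) refl m₁ n₁ m₂ n₂ m₃ n₃ k)
      (vanishing-term (M ℤ.+ ℤ.+ 2) ℤ.-[1+ 0 ] e) ,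
    trans (solveℤ 7 (λ m₁ n₁ m₂ n₂ m₃ n₃ k → let M = m₁ ∔ m₂ ∔ m₃ ; N = n₁ ∔ n₂ ∔ n₃ ; n′ = λ m n → m ∸ n ∸ M ∔ # (ℤ.+ 2) ⋇ k ∔ # (ℤ.+ 1) in
        n′ m₁ n₁ ∔ n′ m₂ n₂ ∔ n′ m₃ n₃ ≐ (N ∔ # (ℤ.+ 1)) ∔ ((M ∔ N) ∸ (# (ℤ.+ 1) ∔ k ⋇ # (ℤ.+ 3))) ⋇ # (ℤ.-[1+ 1 ])) refl m₁ n₁ m₂ n₂ m₃ n₃ k)
      (vanishing-term (N ℤ.+ ℤ.+ 1) ℤ.-[1+ 1 ] e)

  totals-unrotate₂ : weight v ≡ ℤ.+ 2 ℤ.+ k ℤ.* ℤ.+ 3 →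
    m-total (unrotate₂ k v) ≡ M ℤ.+ ℤ.+ 2 × n-total (unrotate₂ k v) ≡ N ℤ.+ ℤ.+ 1
  totals-unrotate₂ e =
    trans (solveℤ 7 (λ m₁ n₁ m₂ n₂ m₃ n₃ k → let M = m₁ ∔ m₂ ∔ m₃ ; N = n₁ ∔ n₂ ∔ n₃ ; m′ = λ m n → n ∸ m ∸ N ∔ # (ℤ.+ 2) ⋇ k ∔ # (ℤ.+ 2) in
        m′ m₁ n₁ ∔ m′ m₂ n₂ ∔ m′ m₃ n₃ ≐ (M ∔ # (ℤ.+ 2)) ∔ ((M ∔ N) ∸ (# (ℤ.+ 2) ∔ k ⋇ # (ℤ.+ 3))) ⋇ # (ℤ.-[1+ 1 ])) refl m₁ n₁ m₂ n₂ m₃ n₃ k)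
      (vanishing-term (M ℤ.+ ℤ.+ 2) ℤ.-[1+ 1 ] e) ,
    trans (solveℤ 7 (λ m₁ n₁ m₂ n₂ m₃ n₃ k → let M = m₁ ∔ m₂ ∔ m₃ ; N = n₁ ∔ n₂ ∔ n₃ ; n′ = λ m → k ∔ # (ℤ.+ 1) ∸ m in
        n′ m₁ ∔ n′ m₂ ∔ n′ m₃ ≐ (N ∔ # (ℤ.+ 1)) ∔ ((M ∔ N) ∸ (# (ℤ.+ 2) ∔ k ⋇ # (ℤ.+ 3))) ⋇ # (ℤ.-[1+ 0 ])) refl m₁ n₁ m₂ n₂ m₃ n₃ k)
      (vanishing-term (N ℤ.+ ℤ.+ 1) ℤ.-[1+ 0 ] e)

-- The vector identities below involve a component pair (m , n) and the totals M, N only.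
-- In each, the total of the image is expressed through the hypothesis on the weight.
module _ (m n M N k : ℤ) where

  unrotate-rotate₁-m : (k ℤ.- ℤ.+ 1) ℤ.+ ℤ.+ 1 ℤ.- (k ℤ.- m) ≡ m
  unrotate-rotate₁-m = solveℤ 2 (λ m k → (k ∸ # (ℤ.+ 1)) ∔ # (ℤ.+ 1) ∸ (k ∸ m) ≐ m) refl m k

  unrotate-rotate₁-n : ∀ {M′} → M′ ℤ.+ ℤ.+ 2 ≡ M →
    (n ℤ.- m ℤ.+ M ℤ.- k ℤ.- ℤ.+ 1) ℤ.- (k ℤ.- m) ℤ.- M′ ℤ.+ ℤ.+ 2 ℤ.* (k ℤ.- ℤ.+ 1) ℤ.+ ℤ.+ 1 ≡ n
  unrotate-rotate₁-n {M′} refl = solveℤ 4 (λ m n M′ k →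
    (n ∸ m ∔ (M′ ∔ # (ℤ.+ 2)) ∸ k ∸ # (ℤ.+ 1)) ∸ (k ∸ m) ∸ M′ ∔ # (ℤ.+ 2) ⋇ (k ∸ # (ℤ.+ 1)) ∔ # (ℤ.+ 1) ≐ n) refl m n M′ k

  unrotate-rotate₂-n : (k ℤ.- ℤ.+ 1) ℤ.+ ℤ.+ 1 ℤ.- (k ℤ.- n) ≡ n
  unrotate-rotate₂-n = solveℤ 2 (λ n k → (k ∸ # (ℤ.+ 1)) ∔ # (ℤ.+ 1) ∸ (k ∸ n) ≐ n) refl n k

  unrotate-rotate₂-m : ∀ {N′} → N′ ℤ.+ ℤ.+ 1 ≡ N →
    (m ℤ.- n ℤ.+ N ℤ.- k ℤ.- ℤ.+ 1) ℤ.- (k ℤ.- n) ℤ.- N′ ℤ.+ ℤ.+ 2 ℤ.* (k ℤ.- ℤ.+ 1) ℤ.+ ℤ.+ 2 ≡ m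
  unrotate-rotate₂-m {N′} refl = solveℤ 4 (λ m n N′ k →
    (m ∸ n ∔ (N′ ∔ # (ℤ.+ 1)) ∸ k ∸ # (ℤ.+ 1)) ∸ (k ∸ n) ∸ N′ ∔ # (ℤ.+ 2) ⋇ (k ∸ # (ℤ.+ 1)) ∔ # (ℤ.+ 2) ≐ m) refl m n N′ k

  rotate-unrotate₁-n : (k ℤ.+ ℤ.+ 1) ℤ.- (k ℤ.+ ℤ.+ 1 ℤ.- n) ≡ n
  rotate-unrotate₁-n = solveℤ 2 (λ n k → (k ∔ # (ℤ.+ 1)) ∸ (k ∔ # (ℤ.+ 1) ∸ n) ≐ n) refl n k

  rotate-unrotate₁-m : ∀ {M′} → M′ ≡ M ℤ.+ ℤ.+ 2 →
    (m ℤ.- n ℤ.- M ℤ.+ ℤ.+ 2 ℤ.* k ℤ.+ ℤ.+ 1) ℤ.- (k ℤ.+ ℤ.+ 1 ℤ.- n) ℤ.+ M′ ℤ.- (k ℤ.+ ℤ.+ 1) ℤ.- ℤ.+ 1 ≡ m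
  rotate-unrotate₁-m refl = solveℤ 4 (λ m n M k →
    (m ∸ n ∸ M ∔ # (ℤ.+ 2) ⋇ k ∔ # (ℤ.+ 1)) ∸ (k ∔ # (ℤ.+ 1) ∸ n) ∔ (M ∔ # (ℤ.+ 2)) ∸ (k ∔ # (ℤ.+ 1)) ∸ # (ℤ.+ 1) ≐ m) refl m n M k

  rotate-unrotate₂-m : (k ℤ.+ ℤ.+ 1) ℤ.- (k ℤ.+ ℤ.+ 1 ℤ.- m) ≡ m
  rotate-unrotate₂-m = solveℤ 2 (λ m k → (k ∔ # (ℤ.+ 1)) ∸ (k ∔ # (ℤ.+ 1) ∸ m) ≐ m) refl m k

  rotate-unrotate₂-n : ∀ {N′} → N′ ≡ N ℤ.+ ℤ.+ 1 →
    (n ℤ.- m ℤ.- N ℤ.+ ℤ.+ 2 ℤ.* k ℤ.+ ℤ.+ 2) ℤ.- (k ℤ.+ ℤ.+ 1 ℤ.- m) ℤ.+ N′ ℤ.- (k ℤ.+ ℤ.+ 1) ℤ.- ℤ.+ 1 ≡ n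
  rotate-unrotate₂-n refl = solveℤ 4 (λ m n N k →
    (n ∸ m ∸ N ∔ # (ℤ.+ 2) ⋇ k ∔ # (ℤ.+ 2)) ∸ (k ∔ # (ℤ.+ 1) ∸ m) ∔ (N ∔ # (ℤ.+ 1)) ∸ (k ∔ # (ℤ.+ 1)) ∸ # (ℤ.+ 1) ≐ n) refl m n N k

-- The total loses (2 , 1), hence the weight loses 3: its residue stays and its quotient becomes k -
-- 1.
unrotate-rotate₁ : ∀ k v → weight v ≡ ℤ.+ 1 ℤ.+ k ℤ.* ℤ.+ 3 → unrotate₁ (k ℤ.- ℤ.+ 1) (rotate₁ k v) ≡ v
unrotate-rotate₁ k v@((m₁ , n₁) , (m₂ , n₂) , (m₃ , n₃)) e = triple-≡
  (unrotate-rotate₁-m m₁ n₁ M N k) (unrotate-rotate₁-n m₁ n₁ M N k t)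
  (unrotate-rotate₁-m m₂ n₂ M N k) (unrotate-rotate₁-n m₂ n₂ M N k t)
  (unrotate-rotate₁-m m₃ n₃ M N k) (unrotate-rotate₁-n m₃ n₃ M N k t)
  where
  M N : ℤ
  M = m-total v
  N = n-total v
  t : m-total (rotate₁ k v) ℤ.+ ℤ.+ 2 ≡ M
  t = proj₁ (totals-rotate₁ m₁ n₁ m₂ n₂ m₃ n₃ k e)

unrotate-rotate₂ : ∀ k v → weight v ≡ ℤ.+ 2 ℤ.+ k ℤ.* ℤ.+ 3 → unrotate₂ (k ℤ.- ℤ.+ 1) (rotate₂ k v) ≡ v
unrotate-rotate₂ k v@((m₁ , n₁) , (m₂ , n₂) , (m₃ , n₃)) e = triple-≡
  (unrotate-rotate₂-m m₁ n₁ M N k t) (unrotate-rotate₂-n m₁ n₁ M N k)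
  (unrotate-rotate₂-m m₂ n₂ M N k t) (unrotate-rotate₂-n m₂ n₂ M N k)
  (unrotate-rotate₂-m m₃ n₃ M N k t) (unrotate-rotate₂-n m₃ n₃ M N k)
  where
  M N : ℤ
  M = m-total v
  N = n-total v
  t : n-total (rotate₂ k v) ℤ.+ ℤ.+ 1 ≡ N
  t = proj₂ (totals-rotate₂ m₁ n₁ m₂ n₂ m₃ n₃ k e)

rotate-unrotate₁ : ∀ k v → weight v ≡ ℤ.+ 1 ℤ.+ k ℤ.* ℤ.+ 3 → rotate₁ (k ℤ.+ ℤ.+ 1) (unrotate₁ k v) ≡ v
rotate-unrotate₁ k v@((m₁ , n₁) , (m₂ , n₂) , (m₃ , n₃)) e = triple-≡
  (rotate-unrotate₁-m m₁ n₁ M N k t) (rotate-unrotate₁-n m₁ n₁ M N k)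
  (rotate-unrotate₁-m m₂ n₂ M N k t) (rotate-unrotate₁-n m₂ n₂ M N k)
  (rotate-unrotate₁-m m₃ n₃ M N k t) (rotate-unrotate₁-n m₃ n₃ M N k)
  where
  M N : ℤ
  M = m-total v
  N = n-total v
  t : m-total (unrotate₁ k v) ≡ M ℤ.+ ℤ.+ 2
  t = proj₁ (totals-unrotate₁ m₁ n₁ m₂ n₂ m₃ n₃ k e)

rotate-unrotate₂ : ∀ k v → weight v ≡ ℤ.+ 2 ℤ.+ k ℤ.* ℤ.+ 3 → rotate₂ (k ℤ.+ ℤ.+ 1) (unrotate₂ k v) ≡ v
rotate-unrotate₂ k v@((m₁ , n₁) , (m₂ , n₂) , (m₃ , n₃)) e = triple-≡
  (rotate-unrotate₂-m m₁ n₁ M N k) (rotate-unrotate₂-n m₁ n₁ M N k t)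
  (rotate-unrotate₂-m m₂ n₂ M N k) (rotate-unrotate₂-n m₂ n₂ M N k t)
  (rotate-unrotate₂-m m₃ n₃ M N k) (rotate-unrotate₂-n m₃ n₃ M N k t)
  where
  M N : ℤ
  M = m-total v
  N = n-total v
  t : n-total (unrotate₂ k v) ≡ N ℤ.+ ℤ.+ 1
  t = proj₂ (totals-unrotate₂ m₁ n₁ m₂ n₂ m₃ n₃ k e)

φ ψ : V × V × V → V × V × V
φ v = rotate (weight v %ℕ 3) (weight v /ℕ 3) v
ψ v = unrotate (weight v %ℕ 3) (weight v /ℕ 3) v

-- All that the exponents see of the rotation: a product of three terms depends on the vectors only
-- through their total and the sum of their norms.
record Rotated (v v′ : V × V × V) : Set where
  field
    m-shift    : m-total v′ ℤ.+ ℤ.+ 2 ≡ m-total v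
    n-shift    : n-total v′ ℤ.+ ℤ.+ 1 ≡ n-total v
    form-shift : form-total v′ ℤ.+ m-total v′ ℤ.+ ℤ.+ 1 ≡ form-total v

weight-shift : ∀ {v v′} → m-total v′ ℤ.+ ℤ.+ 2 ≡ m-total v → n-total v′ ℤ.+ ℤ.+ 1 ≡ n-total v →
               weight v′ ≡ weight v ℤ.- ℤ.+ 3
weight-shift {v} {v′} e f = trans
  (solveℤ 2 (λ M N → M ∔ N ≐ (M ∔ # (ℤ.+ 2)) ∔ (N ∔ # (ℤ.+ 1)) ∸ # (ℤ.+ 3)) refl (m-total v′) (n-total v′))
  (cong₂ (λ M N → M ℤ.+ N ℤ.- ℤ.+ 3) e f)

residue-down : ∀ r k {s s′} → s ≡ ℤ.+ r ℤ.+ k ℤ.* ℤ.+ 3 → s′ ≡ s ℤ.- ℤ.+ 3 → s′ ≡ ℤ.+ r ℤ.+ (k ℤ.- ℤ.+ 1) ℤ.* ℤ.+ 3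
residue-down r k refl refl = solveℤ 2 (λ r k → r ∔ k ⋇ # (ℤ.+ 3) ∸ # (ℤ.+ 3) ≐ r ∔ (k ∸ # (ℤ.+ 1)) ⋇ # (ℤ.+ 3)) refl (ℤ.+ r) k

residue-up : ∀ r k {s s′} → s ≡ ℤ.+ r ℤ.+ k ℤ.* ℤ.+ 3 → s ≡ s′ ℤ.- ℤ.+ 3 → s′ ≡ ℤ.+ r ℤ.+ (k ℤ.+ ℤ.+ 1) ℤ.* ℤ.+ 3
residue-up r k {s} {s′} e f = trans (solveℤ 1 (λ s → s ≐ (s ∸ # (ℤ.+ 3)) ∔ # (ℤ.+ 3)) refl s′)
  (trans (cong (ℤ._+ ℤ.+ 3) (trans (sym f) e))
    (solveℤ 2 (λ r k → r ∔ k ⋇ # (ℤ.+ 3) ∔ # (ℤ.+ 3) ≐ r ∔ (k ∔ # (ℤ.+ 1)) ⋇ # (ℤ.+ 3)) refl (ℤ.+ r) k))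

unrotate-at : ∀ {r k v w} → weight v %ℕ 3 ≡ r × weight v /ℕ 3 ≡ k → unrotate r k v ≡ w → ψ v ≡ w
unrotate-at (refl , refl) e = e

rotate-at : ∀ {r k v w} → weight v %ℕ 3 ≡ r × weight v /ℕ 3 ≡ k → rotate r k v ≡ w → φ v ≡ w
rotate-at (refl , refl) e = e

rotated₁ : ∀ k v → weight v ≡ ℤ.+ 1 ℤ.+ k ℤ.* ℤ.+ 3 → Rotated v (rotate₁ k v)
rotated₁ k ((m₁ , n₁) , (m₂ , n₂) , (m₃ , n₃)) e = record
  { m-shift    = proj₁ (totals-rotate₁ m₁ n₁ m₂ n₂ m₃ n₃ k e)
  ; n-shift    = proj₂ (totals-rotate₁ m₁ n₁ m₂ n₂ m₃ n₃ k e)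
  ; form-shift = form-rotate₁ m₁ n₁ m₂ n₂ m₃ n₃ k e }

rotated₂ : ∀ k v → weight v ≡ ℤ.+ 2 ℤ.+ k ℤ.* ℤ.+ 3 → Rotated v (rotate₂ k v)
rotated₂ k ((m₁ , n₁) , (m₂ , n₂) , (m₃ , n₃)) e = record
  { m-shift    = proj₁ (totals-rotate₂ m₁ n₁ m₂ n₂ m₃ n₃ k e)
  ; n-shift    = proj₂ (totals-rotate₂ m₁ n₁ m₂ n₂ m₃ n₃ k e)
  ; form-shift = form-rotate₂ m₁ n₁ m₂ n₂ m₃ n₃ k e }

rotated-weight : ∀ r k {v v′} → Rotated v v′ → weight v ≡ ℤ.+ r ℤ.+ k ℤ.* ℤ.+ 3 →
                 weight v′ ≡ ℤ.+ r ℤ.+ (k ℤ.- ℤ.+ 1) ℤ.* ℤ.+ 3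
rotated-weight r k {v} {v′} R e = residue-down r k e (weight-shift {v} {v′} (Rotated.m-shift R) (Rotated.n-shift R))

-- In the shape that `hasSum-transfer` asks for; the first alternative covers the triples on which
-- the differences of cubes vanish.
ψ∘φ : ∀ v → (∃ λ k → weight v ≡ k ℤ.* ℤ.+ 3) ⊎ (ψ (φ v) ≡ v × Rotated v (φ v))
ψ∘φ v with residue (weight v)
... | residue0 k e _ _ = inj₁ (k , e)
... | residue1 k e r≡ k≡ = inj₂ (subst (λ w → ψ w ≡ v × Rotated v w) (sym (rotate-at {1} {k} {v} (r≡ , k≡) refl))
  (unrotate-at {1} {k ℤ.- ℤ.+ 1} {rotate₁ k v}
     (div3-unique (weight (rotate₁ k v)) 1 (k ℤ.- ℤ.+ 1) (ℕ.s≤s (ℕ.s≤s ℕ.z≤n)) (rotated-weight 1 k (rotated₁ k v e) e))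
     (unrotate-rotate₁ k v e) , rotated₁ k v e))
... | residue2 k e r≡ k≡ = inj₂ (subst (λ w → ψ w ≡ v × Rotated v w) (sym (rotate-at {2} {k} {v} (r≡ , k≡) refl))
  (unrotate-at {2} {k ℤ.- ℤ.+ 1} {rotate₂ k v}
     (div3-unique (weight (rotate₂ k v)) 2 (k ℤ.- ℤ.+ 1) (ℕ.s≤s (ℕ.s≤s (ℕ.s≤s ℕ.z≤n))) (rotated-weight 2 k (rotated₂ k v e) e))
     (unrotate-rotate₂ k v e) , rotated₂ k v e))

φ∘ψ : ∀ v → (∃ λ k → weight v ≡ k ℤ.* ℤ.+ 3) ⊎ (φ (ψ v) ≡ v × Rotated (ψ v) v)
φ∘ψ v@((m₁ , n₁) , (m₂ , n₂) , (m₃ , n₃)) with residue (weight v)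
... | residue0 k e _ _ = inj₁ (k , e)
... | residue1 k e r≡ k≡ = inj₂ (subst (λ w → φ w ≡ v × Rotated w v) (sym (unrotate-at {1} {k} {v} (r≡ , k≡) refl))
  (rotate-at {1} {k ℤ.+ ℤ.+ 1} {w} (div3-unique (weight w) 1 (k ℤ.+ ℤ.+ 1) (ℕ.s≤s (ℕ.s≤s ℕ.z≤n)) e′) (rotate-unrotate₁ k v e) ,
   subst (Rotated w) (rotate-unrotate₁ k v e) (rotated₁ (k ℤ.+ ℤ.+ 1) w e′)))
  where
  w : V × V × V
  w = unrotate₁ k v
  t = totals-unrotate₁ m₁ n₁ m₂ n₂ m₃ n₃ k e
  e′ : weight w ≡ ℤ.+ 1 ℤ.+ (k ℤ.+ ℤ.+ 1) ℤ.* ℤ.+ 3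
  e′ = residue-up 1 k e (weight-shift {w} {v} (sym (proj₁ t)) (sym (proj₂ t)))
... | residue2 k e r≡ k≡ = inj₂ (subst (λ w → φ w ≡ v × Rotated w v) (sym (unrotate-at {2} {k} {v} (r≡ , k≡) refl))
  (rotate-at {2} {k ℤ.+ ℤ.+ 1} {w} (div3-unique (weight w) 2 (k ℤ.+ ℤ.+ 1) (ℕ.s≤s (ℕ.s≤s (ℕ.s≤s ℕ.z≤n))) e′) (rotate-unrotate₂ k v e) ,
   subst (Rotated w) (rotate-unrotate₂ k v e) (rotated₂ (k ℤ.+ ℤ.+ 1) w e′)))
  where
  w : V × V × V
  w = unrotate₂ k v
  t = totals-unrotate₂ m₁ n₁ m₂ n₂ m₃ n₃ k e
  e′ : weight w ≡ ℤ.+ 2 ℤ.+ (k ℤ.+ ℤ.+ 1) ℤ.* ℤ.+ 3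
  e′ = residue-up 2 k e (weight-shift {w} {v} (sym (proj₁ t)) (sym (proj₂ t)))

-- The identities as rearrangements of lattice sums

int-⅔-sum : ∀ q a b c → q ℚ.* int a ℚ.+ (q ℚ.* int b ℚ.+ q ℚ.* int c) ≡ q ℚ.* int (a ℤ.+ b ℤ.+ c)
int-⅔-sum q a b c = trans
  (solve 4 (λ q a b c → q :* a :+ (q :* b :+ q :* c) := q :* (a :+ b :+ c)) refl q (int a) (int b) (int c))
  (cong (q ℚ.*_) (trans (cong (ℚ._+ int c) (sym (int-+ a b))) (sym (int-+ (a ℤ.+ b) c))))

int-sum : ∀ a b c → int a ℚ.+ (int b ℚ.+ int c) ≡ int (a ℤ.+ b ℤ.+ c)
int-sum a b c = trans (sym (ℚ.+-assoc (int a) (int b) (int c)))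
  (trans (cong (ℚ._+ int c) (sym (int-+ a b))) (sym (int-+ (a ℤ.+ b) c)))

-- The exponent of a product of three terms. The case σ = 2 is the shift of x by πτ, since e^(2imπτ)
-- = q^(2m).
total-exponent : ℤ → ℤ → V × V × V → Lin
total-exponent ε σ v = lin
  (⅔ ℚ.* int (ε ℤ.* weight v))
  (1ℚ ℚ.* int (ℤ.+ 2 ℤ.* form-total v ℤ.+ σ ℤ.* m-total v))
  (int (ℤ.+ 2 ℤ.* m-total v)) (int (ℤ.+ 2 ℤ.* n-total v)) 0ℚ

C-exponent-total : ∀ ε σ v₁ v₂ v₃ →
  C-exponent ε σ 1ℚ v₁ ⊞ (C-exponent ε σ 1ℚ v₂ ⊞ C-exponent ε σ 1ℚ v₃) ≡ total-exponent ε σ (v₁ , v₂ , v₃)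
C-exponent-total ε σ (m₁ , n₁) (m₂ , n₂) (m₃ , n₃) = lin-≡
  (trans (int-⅔-sum ⅔ (ε ℤ.* (m₁ ℤ.+ n₁)) (ε ℤ.* (m₂ ℤ.+ n₂)) (ε ℤ.* (m₃ ℤ.+ n₃))) (cong (λ k → ⅔ ℚ.* int k)
    (solveℤ 7 (λ ε m₁ n₁ m₂ n₂ m₃ n₃ → ε ⋇ (m₁ ∔ n₁) ∔ ε ⋇ (m₂ ∔ n₂) ∔ ε ⋇ (m₃ ∔ n₃) ≐ ε ⋇ ((m₁ ∔ m₂ ∔ m₃) ∔ (n₁ ∔ n₂ ∔ n₃)))
      refl ε m₁ n₁ m₂ n₂ m₃ n₃)))
  (trans (solve 3 (λ a b c → a :* con 1ℚ :+ (b :* con 1ℚ :+ c :* con 1ℚ) := con 1ℚ :* a :+ (con 1ℚ :* b :+ con 1ℚ :* c)) refl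
      (int (part m₁ n₁)) (int (part m₂ n₂)) (int (part m₃ n₃)))
    (trans (int-⅔-sum 1ℚ (part m₁ n₁) (part m₂ n₂) (part m₃ n₃)) (cong (λ k → 1ℚ ℚ.* int k)
      (solveℤ 7 (λ σ m₁ m₂ m₃ q₁ q₂ q₃ → (# (ℤ.+ 2) ⋇ q₁ ∔ σ ⋇ m₁) ∔ (# (ℤ.+ 2) ⋇ q₂ ∔ σ ⋇ m₂) ∔ (# (ℤ.+ 2) ⋇ q₃ ∔ σ ⋇ m₃)
          ≐ # (ℤ.+ 2) ⋇ (q₁ ∔ q₂ ∔ q₃) ∔ σ ⋇ (m₁ ∔ m₂ ∔ m₃)) refl σ m₁ m₂ m₃ (form m₁ n₁) (form m₂ n₂) (form m₃ n₃)))))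
  (double m₁ m₂ m₃) (double n₁ n₂ n₃) refl
  where
  part : ℤ → ℤ → ℤ
  part m n = ℤ.+ 2 ℤ.* form m n ℤ.+ σ ℤ.* m
  double : ∀ a b c → int (ℤ.+ 2 ℤ.* a) ℚ.+ (int (ℤ.+ 2 ℤ.* b) ℚ.+ int (ℤ.+ 2 ℤ.* c)) ≡ int (ℤ.+ 2 ℤ.* (a ℤ.+ b ℤ.+ c))
  double a b c = trans (int-sum (ℤ.+ 2 ℤ.* a) (ℤ.+ 2 ℤ.* b) (ℤ.+ 2 ℤ.* c)) (cong int
    (solveℤ 3 (λ a b c → # (ℤ.+ 2) ⋇ a ∔ # (ℤ.+ 2) ⋇ b ∔ # (ℤ.+ 2) ⋇ c ≐ # (ℤ.+ 2) ⋇ (a ∔ b ∔ c)) refl a b c))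

-- The exponent of q² e^(4ix + 2iy).
prefactor : Lin
prefactor = lin 0ℚ 2ℚ 4ℚ 2ℚ 0ℚ

-- ω^(3εk) = 1, so on such triples all twists ε give the same term.
total-exponent-divisible : ∀ ε σ v k → weight v ≡ k ℤ.* ℤ.+ 3 →
  total-exponent ε σ v ≡ p⟨ 2ℚ ℚ.* int (ε ℤ.* k) ⟩ ⊞ total-exponent (ℤ.+ 0) σ v
total-exponent-divisible ε σ v k e = lin-≡
  (trans (cong (λ w → ⅔ ℚ.* int w) (trans (cong (ε ℤ.*_) e) (sym (ℤ.*-assoc ε k (ℤ.+ 3)))))
    (trans (⅔-multiple (ε ℤ.* k)) (sym (ℚ.+-identityʳ _))))
  (sym (ℚ.+-identityˡ _)) (sym (ℚ.+-identityˡ _)) (sym (ℚ.+-identityˡ _)) refl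

-- The lost total (2 , 1) becomes e^(4ix + 2iy), the change of the norms becomes q² and the factors
-- q^(2m) of the shifted argument, and the lost weight 3 contributes ω^(3ε) = 1.
total-exponent-rotated : ∀ ε v v′ → Rotated v v′ →
  total-exponent ε (ℤ.+ 0) v ≡ p⟨ 2ℚ ℚ.* int ε ⟩ ⊞ (prefactor ⊞ total-exponent ε (ℤ.+ 2) v′)
total-exponent-rotated ε v v′ R = lin-≡
  (trans (cong (λ w → ⅔ ℚ.* int w)
      (trans (solveℤ 2 (λ ε w → ε ⋇ w ≐ ε ⋇ (w ∸ # (ℤ.+ 3)) ∔ ε ⋇ # (ℤ.+ 3)) refl ε (weight v))
        (cong (λ w → ε ℤ.* w ℤ.+ ε ℤ.* ℤ.+ 3) (sym (weight-shift {v} {v′} m-shift n-shift)))))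
    (trans (⅔-residue (ε ℤ.* weight v′) ε) (cong (2ℚ ℚ.* int ε ℚ.+_) (sym (ℚ.+-identityˡ _)))))
  (trans (cong (λ w → 1ℚ ℚ.* int w)
      (trans (cong₂ (λ q m → ℤ.+ 2 ℤ.* q ℤ.+ ℤ.+ 0 ℤ.* m) (sym form-shift) (sym m-shift))
        (solveℤ 2 (λ q m → # (ℤ.+ 2) ⋇ (q ∔ m ∔ # (ℤ.+ 1)) ∔ # (ℤ.+ 0) ⋇ (m ∔ # (ℤ.+ 2)) ≐ # (ℤ.+ 2) ∔ (# (ℤ.+ 2) ⋇ q ∔ # (ℤ.+ 2) ⋇ m)) refl
          (form-total v′) (m-total v′))))
    (trans (cong (1ℚ ℚ.*_) (int-+ (ℤ.+ 2) y))
      (solve 1 (λ y → con 1ℚ :* (con 2ℚ :+ y) := con 0ℚ :+ (con 2ℚ :+ con 1ℚ :* y)) refl (int y))))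
  (double-shift (ℤ.+ 4) (ℤ.+ 2) (m-total v) (m-total v′) refl m-shift)
  (double-shift (ℤ.+ 2) (ℤ.+ 1) (n-total v) (n-total v′) refl n-shift)
  refl
  where
  open Rotated R
  y : ℤ
  y = ℤ.+ 2 ℤ.* form-total v′ ℤ.+ ℤ.+ 2 ℤ.* m-total v′
  double-shift : ∀ a b m m′ → a ≡ ℤ.+ 2 ℤ.* b → m′ ℤ.+ b ≡ m → int (ℤ.+ 2 ℤ.* m) ≡ 0ℚ ℚ.+ (int a ℚ.+ int (ℤ.+ 2 ℤ.* m′))
  double-shift a b m m′ refl refl = trans
    (cong int (solveℤ 2 (λ b m → # (ℤ.+ 2) ⋇ (m ∔ b) ≐ # (ℤ.+ 2) ⋇ b ∔ # (ℤ.+ 2) ⋇ m) refl b m′))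
    (trans (int-+ (ℤ.+ 2 ℤ.* b) (ℤ.+ 2 ℤ.* m′)) (sym (ℚ.+-identityˡ _)))

-- At a = n₁ − n₃, b = n₂ − n₃ and n = n₁ + n₂ + n₃ + d:
-- 8 (a² − a b + b²) + (2n + d)² = 3 ∑ (2nᵢ + d)².
substitution : ∀ d n₁ n₂ n₃ →
  C-exponent (ℤ.+ 0) (ℤ.+ 0) ⅓ (n₁ ℤ.- n₃ , n₂ ℤ.- n₃) ⊞ θ-exponent d (ℤ.+ 0) ⅓ (ℤ.+ 0) (ℤ.+ 0) (ℤ.+ 1) (n₁ ℤ.+ n₂ ℤ.+ n₃ ℤ.+ d)
  ≡ p⟨ int (d ℤ.* d) ⟩ ⊞ (θ-exponent d (ℤ.+ 0) 1ℚ (ℤ.+ 1) (ℤ.+ 0) (ℤ.+ 1) n₁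
      ⊞ (θ-exponent d (ℤ.+ 0) 1ℚ (ℤ.+ 0) (ℤ.+ 1) (ℤ.+ 1) n₂ ⊞ θ-exponent d (ℤ.+ 0) 1ℚ ℤ.-1ℤ ℤ.-1ℤ (ℤ.+ 1) n₃))
substitution d n₁ n₂ n₃ = lin-≡
  -- In the coordinate of p, d n = d² + d (n₁ + n₂ + n₃): the sign of the single theta term is the
  -- product of the three signs and of e^(πi d²).
  (trans (cong (λ k → 0ℚ ℚ.+ (int k ℚ.+ 0ℚ))
      (solveℤ 4 (λ d a b c → d ⋇ (a ∔ b ∔ c ∔ d) ≐ d ⋇ d ∔ (d ⋇ a ∔ d ⋇ b ∔ d ⋇ c)) refl d n₁ n₂ n₃))
    (trans (cong (λ r → 0ℚ ℚ.+ (r ℚ.+ 0ℚ)) (trans (int-+ (d ℤ.* d) (d ℤ.* n₁ ℤ.+ d ℤ.* n₂ ℤ.+ d ℤ.* n₃))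
        (cong (int (d ℤ.* d) ℚ.+_) (sym (int-sum (d ℤ.* n₁) (d ℤ.* n₂) (d ℤ.* n₃))))))
      (solve 4 (λ s a b c → con 0ℚ :+ ((s :+ (a :+ (b :+ c))) :+ con 0ℚ) := s :+ ((a :+ con 0ℚ) :+ ((b :+ con 0ℚ) :+ (c :+ con 0ℚ)))) refl
        (int (d ℤ.* d)) (int (d ℤ.* n₁)) (int (d ℤ.* n₂)) (int (d ℤ.* n₃)))))
  (trans (solve 2 (λ F O → F :* con ⅓ :+ O :* con ¼ :* con ⅓ := (con 4ℚ :* F :+ O) :* (con ¼ :* con ⅓)) refl (int F) (int (O n)))
    (trans (cong (ℚ._* (¼ ℚ.* ⅓)) (trans (cong (ℚ._+ int (O n)) (sym (int-* (ℤ.+ 4) F))) (trans (sym (int-+ (ℤ.+ 4 ℤ.* F) (O n)))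
        (trans (cong int squares) (trans (int-* (ℤ.+ 3) (O n₁ ℤ.+ O n₂ ℤ.+ O n₃)) (cong (3ℚ ℚ.*_) (sym (int-sum (O n₁) (O n₂) (O n₃)))))))))
      (solve 3 (λ a b c → con 3ℚ :* (a :+ (b :+ c)) :* (con ¼ :* con ⅓)
          := con 0ℚ :+ (a :* con ¼ :* con 1ℚ :+ (b :* con ¼ :* con 1ℚ :+ c :* con ¼ :* con 1ℚ))) refl
        (int (O n₁)) (int (O n₂)) (int (O n₃)))))
  (linear (ℤ.+ 2 ℤ.* (n₁ ℤ.- n₃)) (ℤ.+ 0) (ℤ.+ 1 ℤ.* odd d n₁) (ℤ.+ 0) (ℤ.-1ℤ ℤ.* odd d n₃)
    (solveℤ 3 (λ d a c → # (ℤ.+ 2) ⋇ (a ∸ c) ∔ # (ℤ.+ 0) ≐ # (ℤ.+ 1) ⋇ (# (ℤ.+ 2) ⋇ a ∔ d) ∔ # (ℤ.+ 0) ∔ # ℤ.-1ℤ ⋇ (# (ℤ.+ 2) ⋇ c ∔ d)) refl d n₁ n₃))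
  (linear (ℤ.+ 2 ℤ.* (n₂ ℤ.- n₃)) (ℤ.+ 0) (ℤ.+ 0) (ℤ.+ 1 ℤ.* odd d n₂) (ℤ.-1ℤ ℤ.* odd d n₃)
    (solveℤ 3 (λ d a c → # (ℤ.+ 2) ⋇ (a ∸ c) ∔ # (ℤ.+ 0) ≐ # (ℤ.+ 0) ∔ # (ℤ.+ 1) ⋇ (# (ℤ.+ 2) ⋇ a ∔ d) ∔ # ℤ.-1ℤ ⋇ (# (ℤ.+ 2) ⋇ c ∔ d)) refl d n₂ n₃))
  (linear (ℤ.+ 0) (ℤ.+ 1 ℤ.* odd d n) (ℤ.+ 1 ℤ.* odd d n₁) (ℤ.+ 1 ℤ.* odd d n₂) (ℤ.+ 1 ℤ.* odd d n₃)
    (solveℤ 4 (λ d a b c → # (ℤ.+ 0) ∔ # (ℤ.+ 1) ⋇ (# (ℤ.+ 2) ⋇ (a ∔ b ∔ c ∔ d) ∔ d)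
      ≐ # (ℤ.+ 1) ⋇ (# (ℤ.+ 2) ⋇ a ∔ d) ∔ # (ℤ.+ 1) ⋇ (# (ℤ.+ 2) ⋇ b ∔ d) ∔ # (ℤ.+ 1) ⋇ (# (ℤ.+ 2) ⋇ c ∔ d)) refl d n₁ n₂ n₃))
  where
  n F : ℤ
  -- The summand d makes 2n + d the sum of the three numbers 2nᵢ + d.
  n = n₁ ℤ.+ n₂ ℤ.+ n₃ ℤ.+ d
  F = ℤ.+ 2 ℤ.* form (n₁ ℤ.- n₃) (n₂ ℤ.- n₃) ℤ.+ ℤ.+ 0
  O : ℤ → ℤ
  O n = odd d n ℤ.* odd d n
  squares : ℤ.+ 4 ℤ.* F ℤ.+ O n ≡ ℤ.+ 3 ℤ.* (O n₁ ℤ.+ O n₂ ℤ.+ O n₃)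
  squares = solveℤ 4 (λ d a b c →
    let S = λ n → (# (ℤ.+ 2) ⋇ n ∔ d) ⋇ (# (ℤ.+ 2) ⋇ n ∔ d)
        x = a ∸ c
        y = b ∸ c
    in # (ℤ.+ 4) ⋇ (# (ℤ.+ 2) ⋇ (x ⋇ x ∸ x ⋇ y ∔ y ⋇ y) ∔ # (ℤ.+ 0)) ∔ S (a ∔ b ∔ c ∔ d) ≐ # (ℤ.+ 3) ⋇ (S a ∔ S b ∔ S c))
    refl d n₁ n₂ n₃
  linear : ∀ a b x y z → a ℤ.+ b ≡ x ℤ.+ y ℤ.+ z → int a ℚ.+ int b ≡ 0ℚ ℚ.+ (int x ℚ.+ (int y ℚ.+ int z))
  linear a b x y z e = trans (sym (int-+ a b)) (trans (cong int e) (trans (sym (int-sum x y z)) (sym (ℚ.+-identityˡ _))))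

-- The twists of the two factors combine to ω^{ε(a + b − (n − d))}.
twisted-exponent : ∀ ε d a b n →
  C-exponent ε (ℤ.+ 0) ⅓ (a , b) ⊞ θ-exponent d (ℤ.- ε) ⅓ (ℤ.+ 0) (ℤ.+ 0) (ℤ.+ 1) n
  ≡ p⟨ ⅔ ℚ.* int (ε ℤ.* (a ℤ.+ b ℤ.- (n ℤ.- d))) ⟩
    ⊞ (C-exponent (ℤ.+ 0) (ℤ.+ 0) ⅓ (a , b) ⊞ θ-exponent d (ℤ.+ 0) ⅓ (ℤ.+ 0) (ℤ.+ 0) (ℤ.+ 1) n)
twisted-exponent ε d a b n = lin-≡
  (trans (solve 3 (λ x y z → con ⅔ :* x :+ (y :+ con ⅔ :* z) := con ⅔ :* (x :+ z) :+ (con 0ℚ :+ (y :+ con 0ℚ))) refl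
      (int (ε ℤ.* (a ℤ.+ b))) (int (d ℤ.* n)) (int ((ℤ.- ε) ℤ.* (n ℤ.- d))))
    (cong (λ r → ⅔ ℚ.* r ℚ.+ (0ℚ ℚ.+ (int (d ℤ.* n) ℚ.+ 0ℚ))) (trans (sym (int-+ (ε ℤ.* (a ℤ.+ b)) ((ℤ.- ε) ℤ.* (n ℤ.- d))))
      (cong int (solveℤ 5 (λ ε d a b n → ε ⋇ (a ∔ b) ∔ (∸ ε) ⋇ (n ∸ d) ≐ ε ⋇ (a ∔ b ∸ (n ∸ d))) refl ε d a b n)))))
  (sym (ℚ.+-identityˡ _)) (sym (ℚ.+-identityˡ _)) (sym (ℚ.+-identityˡ _)) (sym (ℚ.+-identityˡ _))

module Identities (A : ExponentialAlgebra) (arguments : Arguments A) where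

  open ExponentialAlgebra A
  open Arguments arguments

  open AlgebraSolver algebra
  open Sums algebra
  open Domination A
  open Lattice A arguments
  private
    module R = CommutativeRing commutativeRing
  open SetoidReasoning R.setoid

  term : ℤ → ℤ → V × V × V → Carrier
  term ε σ (v₁ , v₂ , v₃) = 𝐞 (C-exponent ε σ 1ℚ v₁) * (𝐞 (C-exponent ε σ 1ℚ v₂) * 𝐞 (C-exponent ε σ 1ℚ v₃))

  term≈ : ∀ ε σ v → term ε σ v ≈ 𝐞 (total-exponent ε σ v)
  term≈ ε σ (v₁ , v₂ , v₃) = R.sym (R.trans (𝐞-≡ (sym (C-exponent-total ε σ v₁ v₂ v₃)))
    (R.trans (𝐞-⊞ (C-exponent ε σ 1ℚ v₁) _) (R.*-congˡ (𝐞-⊞ (C-exponent ε σ 1ℚ v₂) (C-exponent ε σ 1ℚ v₃)))))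

  converges-cube : ∀ {f : V → Carrier} {s} → Converges f s →
    Converges (λ (v₁ , v₂ , v₃) → f v₁ * (f v₂ * f v₃)) (s * (s * s))
  converges-cube h = converges-× _≟ⱽ_ (≡-dec _≟ⱽ_ _≟ⱽ_) h (converges-× _≟ⱽ_ _≟ⱽ_ h h)

  -- Differences of cubes

  module _ (ε ε′ : ℤ) where

    -- Subtraction is written with the factor -1, the form in which `hasSum-+` and `hasSum-*ˡ`
    -- produce it.
    difference : ℤ → V × V × V → Carrier
    difference σ v = term ε σ v + (- 1#) * term ε′ σ v

    difference-divisible : ∀ σ v k → weight v ≡ k ℤ.* ℤ.+ 3 → difference σ v ≈ 0#
    difference-divisible σ v k e = begin
      term ε σ v + (- 1#) * term ε′ σ v ≈⟨ R.+-cong (reduce ε) (R.*-congˡ (reduce ε′)) ⟩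
      t + (- 1#) * t                    ≈⟨ R.+-congˡ (R.trans (-‿distribˡ 1# t) (R.-‿cong (R.*-identityˡ t))) ⟩
      t - t                             ≈⟨ R.-‿inverseʳ t ⟩
      0#                                ∎
      where
      t : Carrier
      t = 𝐞 (total-exponent (ℤ.+ 0) σ v)
      reduce : ∀ ε → term ε σ v ≈ t
      reduce ε = R.trans (term≈ ε σ v)
        (R.trans (𝐞-≡ (total-exponent-divisible ε σ v k e)) (𝐞-period (ε ℤ.* k) (total-exponent (ℤ.+ 0) σ v)))
      -‿distribˡ : ∀ x y → (- x) * y ≈ - (x * y)
      -‿distribˡ x y = solveᴷ 2 (λ x y → (⊝ x) ⊛ y ⊜ ⊝ (x ⊛ y)) R.refl x y

    difference-rotated : ∀ v v′ → Rotated v v′ → difference (ℤ.+ 0) v ≈ 𝐞 prefactor * difference (ℤ.+ 2) v′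
    difference-rotated v v′ r = begin
      term ε (ℤ.+ 0) v + (- 1#) * term ε′ (ℤ.+ 0) v
        ≈⟨ R.+-cong (move ε) (R.*-congˡ (move ε′)) ⟩
      𝐞 prefactor * term ε (ℤ.+ 2) v′ + (- 1#) * (𝐞 prefactor * term ε′ (ℤ.+ 2) v′)
        ≈⟨ solveᴷ 4 (λ c x o y → c ⊛ x ⊕ o ⊛ (c ⊛ y) ⊜ c ⊛ (x ⊕ o ⊛ y)) R.refl
             (𝐞 prefactor) (term ε (ℤ.+ 2) v′) (- 1#) (term ε′ (ℤ.+ 2) v′) ⟩
      𝐞 prefactor * difference (ℤ.+ 2) v′ ∎
      where
      move : ∀ ε → term ε (ℤ.+ 0) v ≈ 𝐞 prefactor * term ε (ℤ.+ 2) v′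
      move ε = begin
        term ε (ℤ.+ 0) v                                     ≈⟨ term≈ ε (ℤ.+ 0) v ⟩
        𝐞 (total-exponent ε (ℤ.+ 0) v)                       ≈⟨ 𝐞-≡ (total-exponent-rotated ε v v′ r) ⟩
        𝐞 (p⟨ 2ℚ ℚ.* int ε ⟩ ⊞ (prefactor ⊞ total-exponent ε (ℤ.+ 2) v′))  ≈⟨ 𝐞-period ε _ ⟩
        𝐞 (prefactor ⊞ total-exponent ε (ℤ.+ 2) v′)          ≈⟨ 𝐞-⊞ prefactor _ ⟩
        𝐞 prefactor * 𝐞 (total-exponent ε (ℤ.+ 2) v′)        ≈⟨ R.*-congˡ (term≈ ε (ℤ.+ 2) v′) ⟨
        𝐞 prefactor * term ε (ℤ.+ 2) v′                      ∎

    -- The twists (1 , -1) give the identity for the two cubes of C†, and (0 , 1) the one for A† and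
    -- C†.
    cube-identity : ∀ {s s′ t t′} →
      Converges (λ v → 𝐞 (C-exponent ε  (ℤ.+ 0) 1ℚ v)) s →
      Converges (λ v → 𝐞 (C-exponent ε′ (ℤ.+ 0) 1ℚ v)) s′ →
      Converges (λ v → 𝐞 (C-exponent ε  (ℤ.+ 2) 1ℚ v)) t →
      Converges (λ v → 𝐞 (C-exponent ε′ (ℤ.+ 2) 1ℚ v)) t′ →
      s * (s * s) + (- 1#) * (s′ * (s′ * s′)) ≈ 𝐞 prefactor * (t * (t * t) + (- 1#) * (t′ * (t′ * t′)))
    cube-identity hs hs′ ht ht′ = hasSum-transfer _≟³_ _≟³_
      (difference (ℤ.+ 0)) (λ v → 𝐞 prefactor * difference (ℤ.+ 2) v) φ ψ F G
      (hasSum-+ (hasSum (converges-cube hs)) (hasSum-*ˡ (- 1#) (hasSum (converges-cube hs′))))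
      (hasSum-*ˡ (𝐞 prefactor) (hasSum-+ (hasSum (converges-cube ht)) (hasSum-*ˡ (- 1#) (hasSum (converges-cube ht′)))))
      where
      _≟³_ : DecidableEquality (V × V × V)
      _≟³_ = ≡-dec _≟ⱽ_ (≡-dec _≟ⱽ_ _≟ⱽ_)
      F : ∀ v → difference (ℤ.+ 0) v ≈ 0# ⊎ (ψ (φ v) ≡ v × difference (ℤ.+ 0) v ≈ 𝐞 prefactor * difference (ℤ.+ 2) (φ v))
      F v with ψ∘φ v
      ... | inj₁ (k , e) = inj₁ (difference-divisible (ℤ.+ 0) v k e)
      ... | inj₂ (e , r) = inj₂ (e , difference-rotated v (φ v) r)
      G : ∀ v → 𝐞 prefactor * difference (ℤ.+ 2) v ≈ 0# ⊎ (φ (ψ v) ≡ v × 𝐞 prefactor * difference (ℤ.+ 2) v ≈ difference (ℤ.+ 0) (ψ v))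
      G v with φ∘ψ v
      ... | inj₁ (k , e) = inj₁ (R.trans (R.*-congˡ (difference-divisible (ℤ.+ 2) v k e)) (R.zeroʳ (𝐞 prefactor)))
      ... | inj₂ (e , r) = inj₂ (e , R.sym (difference-rotated (ψ v) v r))

  -- Sieving by residues modulo 3

  twist : ∀ r q {k} l → k ≡ r ℤ.+ q ℤ.* ℤ.+ 3 → 𝐞 (p⟨ ⅔ ℚ.* int k ⟩ ⊞ l) ≈ exp (ι (⅔ ℚ.* int r) * p) * 𝐞 l
  twist r q l refl = begin
    𝐞 (p⟨ ⅔ ℚ.* int (r ℤ.+ q ℤ.* ℤ.+ 3) ⟩ ⊞ l)
      ≈⟨ 𝐞-≡ (trans (cong (λ a → p⟨ a ⟩ ⊞ l) (⅔-residue r q)) (p⊞-assoc (2ℚ ℚ.* int q) (⅔ ℚ.* int r) l)) ⟩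
    𝐞 (p⟨ 2ℚ ℚ.* int q ⟩ ⊞ (p⟨ ⅔ ℚ.* int r ⟩ ⊞ l)) ≈⟨ 𝐞-period q _ ⟩
    𝐞 (p⟨ ⅔ ℚ.* int r ⟩ ⊞ l)                       ≈⟨ 𝐞-⊞ p⟨ ⅔ ℚ.* int r ⟩ l ⟩
    𝐞 p⟨ ⅔ ℚ.* int r ⟩ * 𝐞 l                       ≈⟨ R.*-congʳ (exp-cong (⟦p⟧ (⅔ ℚ.* int r))) ⟩
    exp (ι (⅔ ℚ.* int r) * p) * 𝐞 l                ∎

  sieve : ℤ → Lin → Carrier
  sieve j l = (𝐞 l + 𝐞 (p⟨ ⅔ ℚ.* int j ⟩ ⊞ l)) + 𝐞 (p⟨ ⅔ ℚ.* int (ℤ.- j) ⟩ ⊞ l)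

  private
    ω⁺ ω⁻ : Carrier
    ω⁺ = exp (ι ⅔ * p)
    ω⁻ = exp (ι (ℚ.- ⅔) * p)

  sieve-0 : ∀ {j} q l → j ≡ q ℤ.* ℤ.+ 3 → sieve j l ≈ ι 3ℚ * 𝐞 l
  sieve-0 q l refl = begin
    sieve (q ℤ.* ℤ.+ 3) l         ≈⟨ R.+-cong (R.+-congˡ (periodic q refl)) (periodic (ℤ.- q) (ℤ.neg-distribˡ-* q (ℤ.+ 3))) ⟩
    (𝐞 l + 𝐞 l) + 𝐞 l            ≈⟨ solveᴷ 1 (λ x → (x ⊕ x) ⊕ x ⊜ κ 3ℚ ⊛ x) R.refl (𝐞 l) ⟩
    ι 3ℚ * 𝐞 l                    ∎
    where
    periodic : ∀ q {j} → j ≡ q ℤ.* ℤ.+ 3 → 𝐞 (p⟨ ⅔ ℚ.* int j ⟩ ⊞ l) ≈ 𝐞 l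
    periodic q refl = R.trans (𝐞-≡ (cong (λ a → p⟨ a ⟩ ⊞ l) (⅔-multiple q))) (𝐞-period q l)

  sieve-1 : ∀ {j} q l → j ≡ ℤ.+ 1 ℤ.+ q ℤ.* ℤ.+ 3 → sieve j l ≈ 0#
  sieve-1 q l refl = begin
    sieve (ℤ.+ 1 ℤ.+ q ℤ.* ℤ.+ 3) l
      ≈⟨ R.+-cong (R.+-congˡ (twist (ℤ.+ 1) q l refl)) (twist ℤ.-1ℤ (ℤ.- q) l
           (solveℤ 1 (λ q → ∸ (# (ℤ.+ 1) ∔ q ⋇ # (ℤ.+ 3)) ≐ # ℤ.-1ℤ ∔ (∸ q) ⋇ # (ℤ.+ 3)) refl q)) ⟩
    (𝐞 l + ω⁺ * 𝐞 l) + ω⁻ * 𝐞 l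
      ≈⟨ R.+-congʳ (R.+-congʳ (R.*-identityˡ (𝐞 l))) ⟨
    (1# * 𝐞 l + ω⁺ * 𝐞 l) + ω⁻ * 𝐞 l
      ≈⟨ solveᴷ 4 (λ o a b x → (o ⊛ x ⊕ a ⊛ x) ⊕ b ⊛ x ⊜ (o ⊕ a ⊕ b) ⊛ x) R.refl 1# ω⁺ ω⁻ (𝐞 l) ⟩
    (1# + ω⁺ + ω⁻) * 𝐞 l
      ≈⟨ R.trans (R.*-congʳ ω-sum) (R.zeroˡ (𝐞 l)) ⟩
    0# ∎

  sieve-swap : ∀ {j} l → sieve (ℤ.- j) l ≈ sieve j l
  sieve-swap {j} l = R.trans
    (R.+-congˡ (𝐞-≡ (cong (λ k → p⟨ ⅔ ℚ.* int k ⟩ ⊞ l) (ℤ.neg-involutive j))))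
    (solveᴷ 3 (λ x y z → (x ⊕ y) ⊕ z ⊜ (x ⊕ z) ⊕ y) R.refl
      (𝐞 l) (𝐞 (p⟨ ⅔ ℚ.* int (ℤ.- j) ⟩ ⊞ l)) (𝐞 (p⟨ ⅔ ℚ.* int j ⟩ ⊞ l)))

  -- -2 ≡ 1 modulo 3, and the sieve is even in j.
  sieve-2 : ∀ {j} q l → j ≡ ℤ.+ 2 ℤ.+ q ℤ.* ℤ.+ 3 → sieve j l ≈ 0#
  sieve-2 {j} q l refl = R.trans (R.sym (sieve-swap {j} l)) (sieve-1 (ℤ.- q ℤ.- ℤ.+ 1) l
    (solveℤ 1 (λ q → ∸ (# (ℤ.+ 2) ∔ q ⋇ # (ℤ.+ 3)) ≐ # (ℤ.+ 1) ∔ (∸ q ∸ # (ℤ.+ 1)) ⋇ # (ℤ.+ 3)) refl q))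

  -- Products of three theta functions

  module _ (d : ℤ) where

    private
      C θ : ℤ → _ → Carrier
      C ε ab = 𝐞 (C-exponent ε (ℤ.+ 0) ⅓ ab)
      θ δ n = 𝐞 (θ-exponent d δ ⅓ (ℤ.+ 0) (ℤ.+ 0) (ℤ.+ 1) n)
      θ₁ θ₂ θ₃ : ℤ → Carrier
      θ₁ n = 𝐞 (θ-exponent d (ℤ.+ 0) 1ℚ (ℤ.+ 1) (ℤ.+ 0) (ℤ.+ 1) n)
      θ₂ n = 𝐞 (θ-exponent d (ℤ.+ 0) 1ℚ (ℤ.+ 0) (ℤ.+ 1) (ℤ.+ 1) n)
      θ₃ n = 𝐞 (θ-exponent d (ℤ.+ 0) 1ℚ ℤ.-1ℤ ℤ.-1ℤ (ℤ.+ 1) n)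

      base : V × ℤ → Lin
      base ((a , b) , n) = C-exponent (ℤ.+ 0) (ℤ.+ 0) ⅓ (a , b) ⊞ θ-exponent d (ℤ.+ 0) ⅓ (ℤ.+ 0) (ℤ.+ 0) (ℤ.+ 1) n

      -- At the points a = n₁ - n₃, b = n₂ - n₃, n = n₁ + n₂ + n₃ + d this is 3 n₃, so its residue
      -- modulo 3 singles out the image of `from`.
      gap : V × ℤ → ℤ
      gap ((a , b) , n) = n ℤ.- d ℤ.- (a ℤ.+ b)

      f : V × ℤ → Carrier
      f (ab , n) = C (ℤ.+ 0) ab * θ (ℤ.+ 0) n + C (ℤ.+ 1) ab * θ ℤ.-1ℤ n + C ℤ.-1ℤ ab * θ (ℤ.+ 1) n

      g : ℤ × ℤ × ℤ → Carrier
      g (n₁ , n₂ , n₃) = ι 3ℚ * (𝐞 p⟨ int (d ℤ.* d) ⟩ * (θ₁ n₁ * (θ₂ n₂ * θ₃ n₃)))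

      -- Where the gap is not divisible by 3 the rounded quotient is a mere default; `f` vanishes
      -- there.
      to : V × ℤ → ℤ × ℤ × ℤ
      to i@((a , b) , n) = a ℤ.+ gap i /ℕ 3 , b ℤ.+ gap i /ℕ 3 , gap i /ℕ 3

      from : ℤ × ℤ × ℤ → V × ℤ
      from (n₁ , n₂ , n₃) = (n₁ ℤ.- n₃ , n₂ ℤ.- n₃) , n₁ ℤ.+ n₂ ℤ.+ n₃ ℤ.+ d

      f≈sieve : ∀ i → f i ≈ sieve (ℤ.- gap i) (base i)
      f≈sieve ((a , b) , n) = R.+-cong (R.+-cong
        (R.sym (𝐞-⊞ (C-exponent (ℤ.+ 0) (ℤ.+ 0) ⅓ (a , b)) _))
        (R.trans (R.sym (𝐞-⊞ (C-exponent (ℤ.+ 1) (ℤ.+ 0) ⅓ (a , b)) _)) (𝐞-≡ (trans (twisted-exponent (ℤ.+ 1) d a b n)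
          (cong (λ j → p⟨ ⅔ ℚ.* int j ⟩ ⊞ base ((a , b) , n))
            (solveℤ 4 (λ d a b n → # (ℤ.+ 1) ⋇ (a ∔ b ∸ (n ∸ d)) ≐ ∸ (n ∸ d ∸ (a ∔ b))) refl d a b n))))))
        (R.trans (R.sym (𝐞-⊞ (C-exponent ℤ.-1ℤ (ℤ.+ 0) ⅓ (a , b)) _)) (𝐞-≡ (trans (twisted-exponent ℤ.-1ℤ d a b n)
          (cong (λ j → p⟨ ⅔ ℚ.* int j ⟩ ⊞ base ((a , b) , n))
            (solveℤ 4 (λ d a b n → # ℤ.-1ℤ ⋇ (a ∔ b ∸ (n ∸ d)) ≐ ∸ (∸ (n ∸ d ∸ (a ∔ b)))) refl d a b n)))))

      gap-from : ∀ j → gap (from j) ≡ proj₂ (proj₂ j) ℤ.* ℤ.+ 3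
      gap-from (n₁ , n₂ , n₃) = solveℤ 4 (λ d a b c → (a ∔ b ∔ c ∔ d) ∸ d ∸ ((a ∸ c) ∔ (b ∸ c)) ≐ c ⋇ # (ℤ.+ 3)) refl d n₁ n₂ n₃

      f-from : ∀ j → f (from j) ≈ g j
      f-from j@(n₁ , n₂ , n₃) = begin
        f (from j)
          ≈⟨ R.trans (f≈sieve (from j)) (R.trans (sieve-swap {gap (from j)} (base (from j))) (sieve-0 n₃ (base (from j)) (gap-from j))) ⟩
        ι 3ℚ * 𝐞 (base (from j))
          ≈⟨ R.*-congˡ (R.trans (𝐞-≡ (substitution d n₁ n₂ n₃))
               (R.trans (𝐞-⊞ p⟨ int (d ℤ.* d) ⟩ _) (R.*-congˡ (R.trans (𝐞-⊞ _ _) (R.*-congˡ (𝐞-⊞ _ _)))))) ⟩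
        g j ∎

      F : ∀ i → f i ≈ 0# ⊎ (from (to i) ≡ i × f i ≈ g (to i))
      F i@((a , b) , n) with residue (gap i)
      ... | residue0 q e _ q≡ = inj₂ (back , R.trans (R.reflexive (cong f (sym back))) (f-from (to i)))
        where
        n₃ : ℤ
        n₃ = gap i /ℕ 3
        back : from (to i) ≡ i
        back = cong₂ _,_
          (cong₂ _,_ (solveℤ 2 (λ a c → a ∔ c ∸ c ≐ a) refl a n₃) (solveℤ 2 (λ b c → b ∔ c ∸ c ≐ b) refl b n₃))
          (trans (solveℤ 4 (λ d a b c → (a ∔ c) ∔ (b ∔ c) ∔ c ∔ d ≐ a ∔ b ∔ d ∔ c ⋇ # (ℤ.+ 3)) refl d a b n₃)
            (trans (cong (λ x → a ℤ.+ b ℤ.+ d ℤ.+ x) (sym (trans e (cong (ℤ._* ℤ.+ 3) (sym q≡)))))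
              (solveℤ 4 (λ d a b n → a ∔ b ∔ d ∔ (n ∸ d ∸ (a ∔ b)) ≐ n) refl d a b n)))
      ... | residue1 q e _ _ = inj₁ (R.trans (f≈sieve i) (R.trans (sieve-swap {gap i} (base i)) (sieve-1 q (base i) e)))
      ... | residue2 q e _ _ = inj₁ (R.trans (f≈sieve i) (R.trans (sieve-swap {gap i} (base i)) (sieve-2 q (base i) e)))

      G : ∀ j → g j ≈ 0# ⊎ (to (from j) ≡ j × g j ≈ f (from j))
      G j@(n₁ , n₂ , n₃) = inj₂ (there-and-back , R.sym (f-from j))
        where
        third : gap (from j) /ℕ 3 ≡ n₃
        third = proj₂ (div3-unique (gap (from j)) 0 n₃ (ℕ.s≤s ℕ.z≤n) (trans (gap-from j) (sym (ℤ.+-identityˡ _))))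
        there-and-back : to (from j) ≡ j
        there-and-back = cong₂ _,_
          (trans (cong (λ x → n₁ ℤ.- n₃ ℤ.+ x) third) (solveℤ 2 (λ a c → a ∸ c ∔ c ≐ a) refl n₁ n₃))
          (cong₂ _,_ (trans (cong (λ x → n₂ ℤ.- n₃ ℤ.+ x) third) (solveℤ 2 (λ a c → a ∸ c ∔ c ≐ a) refl n₂ n₃)) third)

    -- The right side is summed termwise by the sieve, whence the factor 3. Opposite twists are
    -- paired, and e^(πi d²) is -1 for d = 1 and 1 for d = 0.
    product-identity : ∀ {s₁ s₂ s₃ a c⁺ c⁻ t t⁺ t⁻} →
      Converges (λ n → 𝐞 (θ-exponent d (ℤ.+ 0) 1ℚ (ℤ.+ 1) (ℤ.+ 0) (ℤ.+ 1) n)) s₁ →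
      Converges (λ n → 𝐞 (θ-exponent d (ℤ.+ 0) 1ℚ (ℤ.+ 0) (ℤ.+ 1) (ℤ.+ 1) n)) s₂ →
      Converges (λ n → 𝐞 (θ-exponent d (ℤ.+ 0) 1ℚ ℤ.-1ℤ ℤ.-1ℤ (ℤ.+ 1) n)) s₃ →
      Converges (λ v → 𝐞 (C-exponent (ℤ.+ 0) (ℤ.+ 0) ⅓ v)) a →
      Converges (λ v → 𝐞 (C-exponent (ℤ.+ 1) (ℤ.+ 0) ⅓ v)) c⁺ →
      Converges (λ v → 𝐞 (C-exponent ℤ.-1ℤ (ℤ.+ 0) ⅓ v)) c⁻ →
      Converges (λ n → 𝐞 (θ-exponent d (ℤ.+ 0) ⅓ (ℤ.+ 0) (ℤ.+ 0) (ℤ.+ 1) n)) t →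
      Converges (λ n → 𝐞 (θ-exponent d (ℤ.+ 1) ⅓ (ℤ.+ 0) (ℤ.+ 0) (ℤ.+ 1) n)) t⁺ →
      Converges (λ n → 𝐞 (θ-exponent d ℤ.-1ℤ ⅓ (ℤ.+ 0) (ℤ.+ 0) (ℤ.+ 1) n)) t⁻ →
      ι 3ℚ * (𝐞 p⟨ int (d ℤ.* d) ⟩ * (s₁ * (s₂ * s₃))) ≈ a * t + c⁺ * t⁻ + c⁻ * t⁺
    product-identity h₁ h₂ h₃ ha hc⁺ hc⁻ ht ht⁺ ht⁻ = R.sym (hasSum-transfer (≡-dec _≟ⱽ_ ℤ._≟_) (≡-dec ℤ._≟_ _≟ⱽ_)
      f g to from F G
      (hasSum-+ (hasSum-+ (product ha ht) (product hc⁺ ht⁻)) (product hc⁻ ht⁺))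
      (hasSum-*ˡ (ι 3ℚ) (hasSum-*ˡ (𝐞 p⟨ int (d ℤ.* d) ⟩)
        (hasSum (converges-× ℤ._≟_ _≟ⱽ_ h₁ (converges-× ℤ._≟_ ℤ._≟_ h₂ h₃))))))
      where
      product : ∀ {f : V → Carrier} {g : ℤ → Carrier} {s t} → Converges f s → Converges g t →
                HasSum (λ (v , n) → f v * g n) (s * t)
      product h h′ = hasSum (converges-× _≟ⱽ_ ℤ._≟_ h h′)

-- Comparison of the exponents with those of the definitions

θ-line : ∀ d δ r x y z n → θ-exponent d δ r x y z n ≡
  lin 0ℚ (int (n ℤ.* n) ℚ.* r) 0ℚ 0ℚ 0ℚ
    ⊞ int n ⊡ lin (int d ℚ.+ ⅔ ℚ.* int δ) (int d ℚ.* r) (2ℚ ℚ.* int x) (2ℚ ℚ.* int y) (2ℚ ℚ.* int z)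
    ⊞ lin (ℚ.- ⅔ ℚ.* (int δ ℚ.* int d)) (int d ℚ.* int d ℚ.* ¼ ℚ.* r) (int x ℚ.* int d) (int y ℚ.* int d) (int z ℚ.* int d)
θ-line d δ r x y z n = lin-≡
  (trans (cong₂ (λ a b → a ℚ.+ ⅔ ℚ.* b) (int-* d n) (trans (int-* δ (n ℤ.- d)) (cong (int δ ℚ.*_) int-n-d)))
    (solve 3 (λ d δ n → d :* n :+ con ⅔ :* (δ :* (n :- d))
      := con 0ℚ :+ n :* (d :+ con ⅔ :* δ) :+ con (ℚ.- ⅔) :* (δ :* d)) refl (int d) (int δ) (int n)))
  (trans (cong (λ a → a ℚ.* ¼ ℚ.* r) (trans (int-* (odd d n) (odd d n)) (cong₂ ℚ._*_ int-odd int-odd)))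
    (trans (solve 3 (λ d n r → (con 2ℚ :* n :+ d) :* (con 2ℚ :* n :+ d) :* con ¼ :* r
        := (n :* n) :* r :+ n :* (d :* r) :+ d :* d :* con ¼ :* r) refl (int d) (int n) r)
      (cong (λ a → a ℚ.* r ℚ.+ int n ℚ.* (int d ℚ.* r) ℚ.+ int d ℚ.* int d ℚ.* ¼ ℚ.* r) (sym (int-* n n)))))
  (multiple x) (multiple y) (multiple z)
  where
  int-odd : int (odd d n) ≡ 2ℚ ℚ.* int n ℚ.+ int d
  int-odd = trans (int-+ (ℤ.+ 2 ℤ.* n) d) (cong (ℚ._+ int d) (int-* (ℤ.+ 2) n))
  int-n-d : int (n ℤ.- d) ≡ int n ℚ.- int d
  int-n-d = trans (int-+ n (ℤ.- d)) (cong (int n ℚ.+_) (int-neg d))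
  multiple : ∀ x → int (x ℤ.* odd d n) ≡ 0ℚ ℚ.+ int n ℚ.* (2ℚ ℚ.* int x) ℚ.+ int x ℚ.* int d
  multiple x = trans (trans (int-* x (odd d n)) (cong (int x ℚ.*_) int-odd))
    (solve 3 (λ x d n → x :* (con 2ℚ :* n :+ d) := con 0ℚ :+ n :* (con 2ℚ :* x) :+ x :* d) refl (int x) (int d) (int n))

int-form : ∀ m n → int (form m n) ≡ int m ℚ.* int m ℚ.- int m ℚ.* int n ℚ.+ int n ℚ.* int n
int-form m n = trans (int-+ (m ℤ.* m ℤ.- m ℤ.* n) (n ℤ.* n)) (cong₂ ℚ._+_
  (trans (int-+ (m ℤ.* m) (ℤ.- (m ℤ.* n))) (cong₂ ℚ._+_ (int-* m m) (trans (int-neg (m ℤ.* n)) (cong ℚ.-_ (int-* m n)))))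
  (int-* n n))

C-plane : ∀ ε σ r m n → C-exponent ε σ r (m , n) ≡
  (lin 0ℚ (int (m ℤ.* m) ℚ.* r) 0ℚ 0ℚ 0ℚ ⊞ int m ⊡ lin (⅔ ℚ.* int ε) (int σ ℚ.* r) 2ℚ 0ℚ 0ℚ)
  ⊞ (lin 0ℚ (int (n ℤ.* n) ℚ.* r) 0ℚ 0ℚ 0ℚ ⊞ int n ⊡ lin (⅔ ℚ.* int ε) 0ℚ 0ℚ 2ℚ 0ℚ)
  ⊞ lin 0ℚ (int ((m ℤ.- n) ℤ.* (m ℤ.- n)) ℚ.* r) 0ℚ 0ℚ 0ℚ
C-plane ε σ r m n = lin-≡
  (trans (cong (⅔ ℚ.*_) (trans (int-* ε (m ℤ.+ n)) (cong (int ε ℚ.*_) (int-+ m n))))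
    (solve 3 (λ ε m n → con ⅔ :* (ε :* (m :+ n))
      := (con 0ℚ :+ m :* (con ⅔ :* ε)) :+ (con 0ℚ :+ n :* (con ⅔ :* ε)) :+ con 0ℚ) refl (int ε) (int m) (int n)))
  (trans (cong (ℚ._* r) (trans (int-+ (ℤ.+ 2 ℤ.* form m n) (σ ℤ.* m))
      (cong₂ ℚ._+_ (trans (int-* (ℤ.+ 2) (form m n)) (cong (2ℚ ℚ.*_) (int-form m n))) (int-* σ m))))
    (trans (solve 4 (λ σ r m n → (con 2ℚ :* (m :* m :- m :* n :+ n :* n) :+ σ :* m) :* r
        := ((m :* m) :* r :+ m :* (σ :* r)) :+ ((n :* n) :* r :+ n :* con 0ℚ) :+ ((m :- n) :* (m :- n)) :* r) refl
        (int σ) r (int m) (int n))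
      (sym (cong₂ ℚ._+_ (cong₂ (λ a b → (a ℚ.* r ℚ.+ int m ℚ.* (int σ ℚ.* r)) ℚ.+ (b ℚ.* r ℚ.+ int n ℚ.* 0ℚ)) (int-* m m) (int-* n n))
        (cong (ℚ._* r) (trans (int-* (m ℤ.- n) (m ℤ.- n)) (cong (λ a → a ℚ.* a) int-m-n)))))))
  (trans (int-* (ℤ.+ 2) m) (solve 2 (λ m n → con 2ℚ :* m := (con 0ℚ :+ m :* con 2ℚ) :+ (con 0ℚ :+ n :* con 0ℚ) :+ con 0ℚ) refl (int m) (int n)))
  (trans (int-* (ℤ.+ 2) n) (solve 2 (λ m n → con 2ℚ :* n := (con 0ℚ :+ m :* con 0ℚ) :+ (con 0ℚ :+ n :* con 2ℚ) :+ con 0ℚ) refl (int m) (int n)))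
  (solve 2 (λ m n → con 0ℚ := (con 0ℚ :+ m :* con 0ℚ) :+ (con 0ℚ :+ n :* con 0ℚ) :+ con 0ℚ) refl (int m) (int n))
  where
  int-m-n : int (m ℤ.- n) ≡ int m ℚ.- int n
  int-m-n = trans (int-+ m (ℤ.- n)) (cong (int m ℚ.+_) (int-neg n))

-- The argument of θ is xX + yY + zZ + δp/3; d is 0 or 1.
θ-match : ∀ d δ r x y z n →
  int n ⊡ p⟨ int d ⟩ ⊞ (int (odd d n ℤ.* odd d n) ℚ.* ¼) ⊡ lin 0ℚ r 0ℚ 0ℚ 0ℚ
    ⊞ int (odd d n) ⊡ lin (⅓ ℚ.* int δ) 0ℚ (int x) (int y) (int z)
  ≡ p⟨ int (δ ℤ.* d) ⟩ ⊞ θ-exponent d δ r x y z n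
θ-match d δ r x y z n = lin-≡
  (trans (cong (λ a → int n ℚ.* int d ℚ.+ O ℚ.* 0ℚ ℚ.+ a ℚ.* (⅓ ℚ.* int δ)) (trans (int-+ (ℤ.+ 2 ℤ.* n) d) (cong (ℚ._+ int d) (int-* (ℤ.+ 2) n))))
    (trans (solve 4 (λ n d δ O → n :* d :+ O :* con 0ℚ :+ (con 2ℚ :* n :+ d) :* (con ⅓ :* δ)
        := δ :* d :+ (d :* n :+ con ⅔ :* (δ :* (n :- d)))) refl (int n) (int d) (int δ) O)
      (sym (cong₂ ℚ._+_ (int-* δ d) (cong₂ (λ a b → a ℚ.+ ⅔ ℚ.* b) (int-* d n)
        (trans (int-* δ (n ℤ.- d)) (cong (int δ ℚ.*_) (trans (int-+ n (ℤ.- d)) (cong (int n ℚ.+_) (int-neg d))))))))))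
  (solve 4 (λ n O r o → n :* con 0ℚ :+ O :* r :+ o :* con 0ℚ := con 0ℚ :+ O :* r) refl (int n) O r (int (odd d n)))
  (multiple x) (multiple y) (multiple z)
  where
  O : ℚ
  O = int (odd d n ℤ.* odd d n) ℚ.* ¼
  multiple : ∀ x → int n ℚ.* 0ℚ ℚ.+ O ℚ.* 0ℚ ℚ.+ int (odd d n) ℚ.* int x ≡ 0ℚ ℚ.+ int (x ℤ.* odd d n)
  multiple x = trans (solve 4 (λ n O o x → n :* con 0ℚ :+ O :* con 0ℚ :+ o :* x := con 0ℚ :+ x :* o) refl (int n) O (int (odd d n)) (int x))
    (cong (0ℚ ℚ.+_) (sym (int-* x (odd d n))))

-- The arguments are s(X + κu) and sY with s = ±1, and κ = σr/2.
C-match : ∀ s ε σ r κ m n → s ℤ.* s ≡ ℤ.+ 1 → 2ℚ ℚ.* κ ≡ int σ ℚ.* r →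
  p⟨ ⅔ ℚ.* int (ε ℤ.* (m ℤ.+ n)) ⟩ ⊞ (int (ℤ.+ 2 ℤ.* form m n) ⊡ lin 0ℚ r 0ℚ 0ℚ 0ℚ
    ⊞ int (ℤ.+ 2 ℤ.* m) ⊡ lin 0ℚ (int s ℚ.* κ) (int s) 0ℚ 0ℚ
    ⊞ int (ℤ.+ 2 ℤ.* n) ⊡ lin 0ℚ 0ℚ 0ℚ (int s) 0ℚ)
  ≡ C-exponent (s ℤ.* ε) σ r (s ℤ.* m , s ℤ.* n)
C-match s ε σ r κ m n s² 2κ = lin-≡
  (trans (solve 4 (λ a F m n → a :+ (F :* con 0ℚ :+ m :* con 0ℚ :+ n :* con 0ℚ) := a) refl
      (⅔ ℚ.* int (ε ℤ.* (m ℤ.+ n))) F (int (ℤ.+ 2 ℤ.* m)) (int (ℤ.+ 2 ℤ.* n)))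
    (cong (λ k → ⅔ ℚ.* int k) (trans (sym (ℤ.*-identityˡ (ε ℤ.* (m ℤ.+ n)))) (trans (cong (ℤ._* (ε ℤ.* (m ℤ.+ n))) (sym s²))
      (solveℤ 4 (λ s ε m n → s ⋇ s ⋇ (ε ⋇ (m ∔ n)) ≐ s ⋇ ε ⋇ (s ⋇ m ∔ s ⋇ n)) refl s ε m n)))))
  (trans (cong (λ a → 0ℚ ℚ.+ (F ℚ.* r ℚ.+ a ℚ.* (int s ℚ.* κ) ℚ.+ int (ℤ.+ 2 ℤ.* n) ℚ.* 0ℚ)) (int-* (ℤ.+ 2) m))
    (trans (solve 6 (λ F r m n s κ → con 0ℚ :+ (F :* r :+ (con 2ℚ :* m) :* (s :* κ) :+ n :* con 0ℚ) := F :* r :+ (s :* m) :* (con 2ℚ :* κ)) refl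
        F r (int m) (int (ℤ.+ 2 ℤ.* n)) (int s) κ)
      (trans (cong (λ a → F ℚ.* r ℚ.+ (int s ℚ.* int m) ℚ.* a) 2κ)
        (trans (solve 4 (λ F r t σ → F :* r :+ t :* (σ :* r) := (F :+ σ :* t) :* r) refl F r (int s ℚ.* int m) (int σ))
          (cong (ℚ._* r) (trans (cong₂ ℚ._+_ (cong (λ q → int (ℤ.+ 2 ℤ.* q)) form-sign)
              (trans (cong (int σ ℚ.*_) (sym (int-* s m))) (sym (int-* σ (s ℤ.* m)))))
            (sym (int-+ (ℤ.+ 2 ℤ.* form (s ℤ.* m) (s ℤ.* n)) (σ ℤ.* (s ℤ.* m))))))))))
  (trans (solve 4 (λ F m n s → con 0ℚ :+ (F :* con 0ℚ :+ m :* s :+ n :* con 0ℚ) := m :* s) refl F (int (ℤ.+ 2 ℤ.* m)) (int (ℤ.+ 2 ℤ.* n)) (int s))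
    (signed m))
  (trans (solve 4 (λ F m n s → con 0ℚ :+ (F :* con 0ℚ :+ m :* con 0ℚ :+ n :* s) := n :* s) refl F (int (ℤ.+ 2 ℤ.* m)) (int (ℤ.+ 2 ℤ.* n)) (int s))
    (signed n))
  (solve 3 (λ F m n → con 0ℚ :+ (F :* con 0ℚ :+ m :* con 0ℚ :+ n :* con 0ℚ) := con 0ℚ) refl F (int (ℤ.+ 2 ℤ.* m)) (int (ℤ.+ 2 ℤ.* n)))
  where
  F : ℚ
  F = int (ℤ.+ 2 ℤ.* form m n)
  form-sign : form m n ≡ form (s ℤ.* m) (s ℤ.* n)
  form-sign = trans (sym (ℤ.*-identityˡ (form m n))) (trans (cong (ℤ._* form m n) (sym s²))
    (solveℤ 3 (λ s m n → s ⋇ s ⋇ (m ⋇ m ∸ m ⋇ n ∔ n ⋇ n)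
      ≐ (s ⋇ m) ⋇ (s ⋇ m) ∸ (s ⋇ m) ⋇ (s ⋇ n) ∔ (s ⋇ n) ⋇ (s ⋇ n)) refl s m n))
  signed : ∀ m → int (ℤ.+ 2 ℤ.* m) ℚ.* int s ≡ int (ℤ.+ 2 ℤ.* (s ℤ.* m))
  signed m = trans (sym (int-* (ℤ.+ 2 ℤ.* m) s)) (cong int
    (solveℤ 2 (λ s m → # (ℤ.+ 2) ⋇ m ⋇ s ≐ # (ℤ.+ 2) ⋇ (s ⋇ m)) refl s m))

-- Convergence and values of the series in normalised form

module Series (A : ExponentialAlgebra) (arguments : Arguments A) where

  open ExponentialAlgebra A
  open Arguments arguments

  open AlgebraSolver algebra
  open Sums algebra
  open Domination A
  open Lattice A arguments public
  private
    module R = CommutativeRing commutativeRing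

  p≈⟦⟧ : p ≈ ⟦ p⟨ 1ℚ ⟩ ⟧
  p≈⟦⟧ = R.sym (R.trans (⟦p⟧ 1ℚ) (R.trans (R.*-congʳ ι-1) (R.*-identityˡ p)))

  θ-dominated : ∀ {r} → Decaying (ι r * u) → ∀ d δ x y z → Dominated (λ n → 𝐞 (θ-exponent d δ r x y z n))
  θ-dominated {r} D d δ x y z = dominated-𝐞-line D (θ-exponent d δ r x y z) _ _ (θ-line d δ r x y z)

  C-dominated : ∀ {r} → Decaying (ι r * u) → ∀ ε σ → Dominated (λ v → 𝐞 (C-exponent ε σ r v))
  C-dominated {r} D ε σ = dominated-𝐞-plane D (C-exponent ε σ r) _ _ (C-plane ε σ r)

  hasSum-unique : ∀ {I : Set} → DecidableEquality I → ∀ {f : I → Carrier} {s t} → HasSum f s → HasSum f t → s ≈ t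
  hasSum-unique _≟_ {f} = hasSum-transfer _≟_ _≟_ f f id id (λ _ → inj₂ (refl , R.refl)) (λ _ → inj₂ (refl , R.refl))

  -- A shift of the argument by δπ/3 multiplies the n-th term by e^(πiδ(2n + d)/3). Since (2n + d)/3
  -- = 2(n - d)/3 + d, this is ω^(δ(n - d)) times the constant e^(πiδd), the source of the minus
  -- signs in the formula for ϑ₁.
  θ-factor : ∀ d δ → Carrier
  θ-factor d δ = 𝐞 p⟨ int (δ ℤ.* d) ⟩

  module _ {r : ℚ} {v w : Carrier} (v≈ : v ≈ ι r * u) where

    θ-term : ∀ d δ x y z → w ≈ ⟦ lin (⅓ ℚ.* int δ) 0ℚ (int x) (int y) (int z) ⟧ → ∀ n →
      exp (ι (int n) * (ι (int d) * p) + ι (int (odd d n ℤ.* odd d n) ℚ.* ¼) * v + ι (int (odd d n)) * w)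
      ≈ θ-factor d δ * 𝐞 (θ-exponent d δ r x y z n)
    θ-term d δ x y z w≈ n = R.trans (exp-cong (R.sym (R.trans (⟦⟧-⊞ (a ⊞ b) c) (R.+-cong (R.trans (⟦⟧-⊞ a b) (R.+-cong
        (R.trans (⟦⟧-⊡ (int n) p⟨ int d ⟩) (R.*-congˡ (⟦p⟧ (int d))))
        (R.trans (⟦⟧-⊡ _ _) (R.*-congˡ (R.trans (⟦u⟧ r) (R.sym v≈))))))
        (R.trans (⟦⟧-⊡ _ _) (R.*-congˡ (R.sym w≈)))))))
      (R.trans (𝐞-≡ (θ-match d δ r x y z n)) (𝐞-⊞ p⟨ int (δ ℤ.* d) ⟩ _))
      where
      a b c : Lin
      a = int n ⊡ p⟨ int d ⟩
      b = (int (odd d n ℤ.* odd d n) ℚ.* ¼) ⊡ lin 0ℚ r 0ℚ 0ℚ 0ℚ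
      c = int (odd d n) ⊡ lin (⅓ ℚ.* int δ) 0ℚ (int x) (int y) (int z)

  module _ {r : ℚ} {v w w′ : Carrier} (v≈ : v ≈ ι r * u) (s : ℤ) (s² : s ℤ.* s ≡ ℤ.+ 1) (σ : ℤ) (κ′ : ℚ) (2κ : 2ℚ ℚ.* κ′ ≡ int σ ℚ.* r)
    (w≈ : w ≈ ⟦ lin 0ℚ (int s ℚ.* κ′) (int s) 0ℚ 0ℚ ⟧) (w′≈ : w′ ≈ ⟦ lin 0ℚ 0ℚ 0ℚ (int s) 0ℚ ⟧) where

    C-term : ∀ ε m n →
      exp (ι (⅔ ℚ.* int (ε ℤ.* (m ℤ.+ n))) * p)
        * exp (ι (int (ℤ.+ 2 ℤ.* form m n)) * v + ι (int (ℤ.+ 2 ℤ.* m)) * w + ι (int (ℤ.+ 2 ℤ.* n)) * w′)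
      ≈ 𝐞 (C-exponent (s ℤ.* ε) σ r (s ℤ.* m , s ℤ.* n))
    C-term ε m n = R.sym (R.trans (𝐞-≡ (sym (C-match s ε σ r κ′ m n s² 2κ)))
      (R.trans (𝐞-⊞ p⟨ ⅔ ℚ.* int (ε ℤ.* (m ℤ.+ n)) ⟩ _) (R.*-cong (exp-cong (⟦p⟧ _))
        (exp-cong (R.trans (⟦⟧-⊞ (a ⊞ b) c) (R.+-cong (R.trans (⟦⟧-⊞ a b) (R.+-cong
          (R.trans (⟦⟧-⊡ _ _) (R.*-congˡ (R.trans (⟦u⟧ r) (R.sym v≈))))
          (R.trans (⟦⟧-⊡ _ _) (R.*-congˡ (R.sym w≈)))))
          (R.trans (⟦⟧-⊡ _ _) (R.*-congˡ (R.sym w′≈)))))))))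
      where
      a b c : Lin
      a = int (ℤ.+ 2 ℤ.* form m n) ⊡ lin 0ℚ r 0ℚ 0ℚ 0ℚ
      b = int (ℤ.+ 2 ℤ.* m) ⊡ lin 0ℚ (int s ℚ.* κ′) (int s) 0ℚ 0ℚ
      c = int (ℤ.+ 2 ℤ.* n) ⊡ lin 0ℚ 0ℚ 0ℚ (int s) 0ℚ

    sign : V → V
    sign (m , n) = s ℤ.* m , s ℤ.* n

    sign-involutive : ∀ v → sign (sign v) ≡ v
    sign-involutive (m , n) = cong₂ _,_ (twice m) (twice n)
      where
      twice : ∀ m → s ℤ.* (s ℤ.* m) ≡ m
      twice m = trans (sym (ℤ.*-assoc s s m)) (trans (cong (ℤ._* m) s²) (ℤ.*-identityˡ m))

    C-sum : ∀ ε {f : V → Carrier} {S T} →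
      (∀ m n → f (m , n) ≈ exp (ι (⅔ ℚ.* int (ε ℤ.* (m ℤ.+ n))) * p)
        * exp (ι (int (ℤ.+ 2 ℤ.* form m n)) * v + ι (int (ℤ.+ 2 ℤ.* m)) * w + ι (int (ℤ.+ 2 ℤ.* n)) * w′)) →
      HasSum f S → HasSum (λ v → 𝐞 (C-exponent (s ℤ.* ε) σ r v)) T → S ≈ T
    C-sum ε {f} e = hasSum-transfer _≟ⱽ_ _≟ⱽ_ f (λ v → 𝐞 (C-exponent (s ℤ.* ε) σ r v)) sign sign
      (λ (m , n) → inj₂ (sign-involutive (m , n) , R.trans (e m n) (C-term ε m n)))
      (λ v → inj₂ (sign-involutive v , R.sym (R.trans (e _ _) (R.trans (C-term ε _ _)
        (𝐞-≡ (cong (C-exponent (s ℤ.* ε) σ r) (sign-involutive v)))))))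

open import Defs hiding (_⟶_)

-- Order and arithmetic of ℝ

Eventually : (ℕ → Set) → Set
Eventually P = ∃ λ N → ∀ n → N ℕ.≤ n → P n

always : {P : ℕ → Set} → (∀ n → P n) → Eventually P
always p = 0 , λ n _ → p n

eventually-map : {P Q : ℕ → Set} → (∀ n → P n → Q n) → Eventually P → Eventually Q
eventually-map f (N , p) = N , λ n h → f n (p n h)

eventually-zip : {P Q R : ℕ → Set} → (∀ n → P n → Q n → R n) →
                 Eventually P → Eventually Q → Eventually R
eventually-zip f (M , p) (N , q) = M ℕ.⊔ N , λ n h →
  f n (p n (ℕ.m⊔n≤o⇒m≤o M N h)) (q n (ℕ.m⊔n≤o⇒n≤o M N h))

-- The relations on ℝ and ℂ are wrapped in records so that their arguments
-- can be inferred.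
infix 4 _≈ᴿ_ _⊑_ _≈_

record _≈ᴿ_ (x y : ℝ) : Set where
  constructor mk
  field un : x ≃ᴿ y

record _⊑_ (x y : ℝ) : Set where
  constructor mk
  field un : x ≤ᴿ y

record _≈_ (z w : ℂ) : Set where
  constructor _,_
  field
    re≈ : re z ≈ᴿ re w
    im≈ : im z ≈ᴿ im w

open _≈ᴿ_ using (un)
open _⊑_ using (un)
open _≈_ public

≤-weaken : ∀ {a b ε} → 0ℚ ℚ.< ε → a ℚ.≤ b → a ℚ.≤ b ℚ.+ ε
≤-weaken {b = b} 0<ε p = ℚ.≤-trans p
  (≤-by (sym (ℚ.+-identityʳ b)) refl (ℚ.+-monoʳ-≤ b (ℚ.<⇒≤ 0<ε)))

p≤∣p∣ : ∀ p → p ℚ.≤ ℚ.∣ p ∣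
p≤∣p∣ p with ℚ.≤-total 0ℚ p
... | inj₁ q = ℚ.≤-reflexive (sym (ℚ.0≤p⇒∣p∣≡p q))
... | inj₂ q = ℚ.≤-trans q (ℚ.0≤∣p∣ p)

∣∣≤⇒≤ : ∀ {a b ε} → ℚ.∣ a ℚ.- b ∣ ℚ.≤ ε → a ℚ.≤ b ℚ.+ ε
∣∣≤⇒≤ {a} {b} {ε} p = ≤-by (solve 2 (λ a b → a := b :+ (a :- b)) refl a b) refl
  (ℚ.+-monoʳ-≤ b (ℚ.≤-trans (p≤∣p∣ (a ℚ.- b)) p))

≤⇒∣∣≤ : ∀ {a b ε} → a ℚ.≤ b ℚ.+ ε → b ℚ.≤ a ℚ.+ ε → ℚ.∣ a ℚ.- b ∣ ℚ.≤ ε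
≤⇒∣∣≤ {a} {b} {ε} p q = ∣∣-bound
  (≤-by refl (solve 2 (λ b e → e := (b :+ e) :- b) refl b ε) (ℚ.+-monoˡ-≤ (ℚ.- b) p))
  (≤-by (solve 2 (λ a b → :- (a :- b) := b :- a) refl a b)
        (solve 2 (λ b e → e := (b :+ e) :- b) refl a ε) (ℚ.+-monoˡ-≤ (ℚ.- a) q))

-- δ = ε / (C + ε) satisfies both bounds at once.
scale : ∀ C ε → 0ℚ ℚ.≤ C → 0ℚ ℚ.< ε → ∃ λ δ → 0ℚ ℚ.< δ × δ ℚ.≤ 1ℚ × C ℚ.* δ ℚ.≤ ε
scale C ε 0≤C 0<ε =
  let δ , 0<δ , e = quotient ε D 0<ε 0<D
  in δ , 0<δ
   , ℚ.*-cancelˡ-≤-pos D {{ℚ.positive 0<D}} (≤-by e (ℚ.*-identityʳ D) ε≤D)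
   , ≤-by refl (sym e) (ℚ.*-monoʳ-≤-nonNeg δ {{ℚ.nonNegative (ℚ.<⇒≤ 0<δ)}} C≤D)
  where
  D : ℚ
  D = C ℚ.+ ε
  0<D : 0ℚ ℚ.< D
  0<D = ℚ.+-mono-≤-< 0≤C 0<ε
  ε≤D : ε ℚ.≤ D
  ε≤D = ≤-by (sym (ℚ.+-identityˡ ε)) refl (ℚ.+-monoˡ-≤ ε 0≤C)
  C≤D : C ℚ.≤ D
  C≤D = ≤-by (sym (ℚ.+-identityʳ C)) refl (ℚ.+-monoʳ-≤ C (ℚ.<⇒≤ 0<ε))

≡⇒≈ᴿ : ∀ {x y} → (∀ n → seq x n ≡ seq y n) → x ≈ᴿ y
≡⇒≈ᴿ {x} {y} e .un ε 0<ε = always λ n → ≤-by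
  (cong ℚ.∣_∣ (trans (cong (ℚ._- seq y n) (e n)) (ℚ.+-inverseʳ (seq y n)))) refl (ℚ.<⇒≤ 0<ε)

pointwise-⊑ : ∀ {x y} → (∀ n → seq x n ℚ.≤ seq y n) → x ⊑ y
pointwise-⊑ p .un ε 0<ε = always λ n → ≤-weaken 0<ε (p n)

⊑-trans : ∀ {x y z} → x ⊑ y → y ⊑ z → x ⊑ z
⊑-trans {z = z} (mk p) (mk q) .un ε 0<ε = eventually-zip
  (λ n a b → ℚ.≤-trans a (≤-by refl
    (solve 2 (λ z e → z :+ e := z :+ con ½ :* e :+ con ½ :* e) refl (seq z n) ε)
    (ℚ.+-monoˡ-≤ (½ ℚ.* ε) b)))
  (p _ (halve 0<ε)) (q _ (halve 0<ε))

≈ᴿ⇒⊑ : ∀ {x y} → x ≈ᴿ y → x ⊑ y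
≈ᴿ⇒⊑ (mk p) .un ε 0<ε = eventually-map (λ n → ∣∣≤⇒≤) (p ε 0<ε)

⊑-antisym : ∀ {x y} → x ⊑ y → y ⊑ x → x ≈ᴿ y
⊑-antisym (mk p) (mk q) .un ε 0<ε = eventually-zip (λ n → ≤⇒∣∣≤) (p ε 0<ε) (q ε 0<ε)

≈ᴿ-refl : ∀ {x} → x ≈ᴿ x
≈ᴿ-refl = ≡⇒≈ᴿ λ n → refl

≈ᴿ-sym : ∀ {x y} → x ≈ᴿ y → y ≈ᴿ x
≈ᴿ-sym {x} {y} (mk p) .un ε 0<ε =
  eventually-map (λ n → ≤-by (∣∣-swap (seq y n) (seq x n)) refl) (p ε 0<ε)

≈ᴿ-trans : ∀ {x y z} → x ≈ᴿ y → y ≈ᴿ z → x ≈ᴿ z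
≈ᴿ-trans p q = ⊑-antisym (⊑-trans (≈ᴿ⇒⊑ p) (≈ᴿ⇒⊑ q))
  (⊑-trans (≈ᴿ⇒⊑ (≈ᴿ-sym q)) (≈ᴿ⇒⊑ (≈ᴿ-sym p)))

⊑-refl : ∀ {x} → x ⊑ x
⊑-refl = ≈ᴿ⇒⊑ ≈ᴿ-refl

≡⇒⊑ : ∀ {x y} → (∀ n → seq x n ≡ seq y n) → x ⊑ y
≡⇒⊑ e = pointwise-⊑ λ n → ℚ.≤-reflexive (e n)

+ᴿ-mono : ∀ {x y u v} → x ⊑ y → u ⊑ v → x +ᴿ u ⊑ y +ᴿ v
+ᴿ-mono {y = y} {v = v} (mk p) (mk q) .un ε 0<ε = eventually-zip
  (λ n a b → ≤-by refl
    (solve 3 (λ y v e → (y :+ v) :+ e := (y :+ con ½ :* e) :+ (v :+ con ½ :* e)) refl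
      (seq y n) (seq v n) ε)
    (ℚ.+-mono-≤ a b))
  (p _ (halve 0<ε)) (q _ (halve 0<ε))

⊑⇒0⊑- : ∀ {x y} → x ⊑ y → 0ᴿ ⊑ y -ᴿ x
⊑⇒0⊑- {x} {y} p = ⊑-trans (≡⇒⊑ λ n → sym (ℚ.+-inverseʳ (seq x n)))
  (+ᴿ-mono p (⊑-refl { -ᴿ x}))

0⊑-⇒⊑ : ∀ {x y} → 0ᴿ ⊑ y -ᴿ x → x ⊑ y
0⊑-⇒⊑ {x} {y} p = ⊑-trans (≡⇒⊑ λ n → sym (ℚ.+-identityˡ (seq x n)))
  (⊑-trans (+ᴿ-mono p (⊑-refl {x}))
    (≡⇒⊑ λ n → solve 2 (λ x y → (y :- x) :+ x := y) refl (seq x n) (seq y n)))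

-ᴿ-anti : ∀ {x y} → x ⊑ y → -ᴿ y ⊑ -ᴿ x
-ᴿ-anti {x} {y} p = 0⊑-⇒⊑ (⊑-trans (⊑⇒0⊑- p)
  (≡⇒⊑ λ n → solve 2 (λ x y → y :- x := :- x :- (:- y)) refl (seq x n) (seq y n)))

0⊑+ : ∀ {x y} → 0ᴿ ⊑ x → 0ᴿ ⊑ y → 0ᴿ ⊑ x +ᴿ y
0⊑+ p q = ⊑-trans (≡⇒⊑ λ n → refl) (+ᴿ-mono p q)

-- The hypotheses give x ≥ -δ and y ≥ -δ eventually; from (x + δ)(y + δ) ≥ 0 the product is at least
-- -(A + B + 1) δ.
0⊑* : ∀ {x y} → 0ᴿ ⊑ x → 0ᴿ ⊑ y → 0ᴿ ⊑ x *ᴿ y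
0⊑* {x} {y} (mk p) (mk q) .un ε 0<ε =
  let A , 0≤A , x≤A = bounded x
      B , 0≤B , y≤B = bounded y
      C = A ℚ.+ B ℚ.+ 1ℚ
      δ , 0<δ , δ≤1 , Cδ≤ε = scale C ε (0≤+ (0≤+ 0≤A 0≤B) (ℚ.nonNegative⁻¹ 1ℚ)) 0<ε
  in eventually-zip
    (λ n a b → ℚ.≤-trans (0≤* a b) (≤-by
      (solve 3 (λ x y d → (x :+ d) :* (y :+ d) := x :* y :+ (x :+ y :+ d) :* d) refl
        (seq x n) (seq y n) δ) refl
      (ℚ.+-monoʳ-≤ (seq x n ℚ.* seq y n)
        (ℚ.≤-trans
          (ℚ.*-monoʳ-≤-nonNeg δ {{ℚ.nonNegative (ℚ.<⇒≤ 0<δ)}}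
            (ℚ.+-mono-≤ (ℚ.+-mono-≤ (ℚ.≤-trans (p≤∣p∣ (seq x n)) (x≤A n))
              (ℚ.≤-trans (p≤∣p∣ (seq y n)) (y≤B n))) δ≤1))
          Cδ≤ε))))
    (p δ 0<δ) (q δ 0<δ)

*ᴿ-mono : ∀ {x y u v} → 0ᴿ ⊑ x → 0ᴿ ⊑ v → x ⊑ y → u ⊑ v → x *ᴿ u ⊑ y *ᴿ v
*ᴿ-mono {x} {y} {u} {v} 0⊑x 0⊑v x⊑y u⊑v = 0⊑-⇒⊑ (⊑-trans
  (0⊑+ (0⊑* 0⊑x (⊑⇒0⊑- u⊑v)) (0⊑* (⊑⇒0⊑- x⊑y) 0⊑v))
  (≡⇒⊑ λ n → solve 4
    (λ x y u v → x :* (v :- u) :+ (y :- x) :* v := y :* v :- x :* u) refl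
    (seq x n) (seq y n) (seq u n) (seq v n)))

fromℚ-mono : ∀ {r s} → r ℚ.≤ s → fromℚ r ⊑ fromℚ s
fromℚ-mono p = pointwise-⊑ λ n → p

x⊑∣x∣ : ∀ x → x ⊑ ∣ x ∣ᴿ
x⊑∣x∣ x = pointwise-⊑ λ n → p≤∣p∣ (seq x n)

∣∣ᴿ-least : ∀ {x y} → x ⊑ y → -ᴿ x ⊑ y → ∣ x ∣ᴿ ⊑ y
∣∣ᴿ-least (mk p) (mk q) .un ε 0<ε = eventually-zip (λ n → ∣∣-bound) (p ε 0<ε) (q ε 0<ε)

0⊑∣∣ : ∀ x → 0ᴿ ⊑ ∣ x ∣ᴿ
0⊑∣∣ x = pointwise-⊑ λ n → ℚ.0≤∣p∣ (seq x n)

∣∣⊑⇒≈ᴿ : ∀ {x y} → (∀ ε → 0ℚ ℚ.< ε → ∣ x -ᴿ y ∣ᴿ ⊑ fromℚ ε) → x ≈ᴿ y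
∣∣⊑⇒≈ᴿ {x} {y} p .un ε 0<ε = eventually-map
  (λ n → subst (ℚ.∣ seq x n ℚ.- seq y n ∣ ℚ.≤_) (halves ε))
  (un (p _ (halve 0<ε)) _ (halve 0<ε))

+ᴿ-cong : ∀ {x y u v} → x ≈ᴿ y → u ≈ᴿ v → x +ᴿ u ≈ᴿ y +ᴿ v
+ᴿ-cong {x} {y} {u} {v} p q = ⊑-antisym
  (+ᴿ-mono {x} {y} {u} {v} (≈ᴿ⇒⊑ p) (≈ᴿ⇒⊑ q))
  (+ᴿ-mono {y} {x} {v} {u} (≈ᴿ⇒⊑ (≈ᴿ-sym p)) (≈ᴿ⇒⊑ (≈ᴿ-sym q)))

-ᴿ-cong : ∀ {x y} → x ≈ᴿ y → -ᴿ x ≈ᴿ -ᴿ y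
-ᴿ-cong p = ⊑-antisym (-ᴿ-anti (≈ᴿ⇒⊑ (≈ᴿ-sym p))) (-ᴿ-anti (≈ᴿ⇒⊑ p))

∣∣ᴿ-cong : ∀ {x y} → x ≈ᴿ y → ∣ x ∣ᴿ ≈ᴿ ∣ y ∣ᴿ
∣∣ᴿ-cong p = ⊑-antisym (half p) (half (≈ᴿ-sym p))
  where
  half : ∀ {x y} → x ≈ᴿ y → ∣ x ∣ᴿ ⊑ ∣ y ∣ᴿ
  half {x} {y} p = ∣∣ᴿ-least (⊑-trans (≈ᴿ⇒⊑ p) (x⊑∣x∣ y))
    (⊑-trans (≈ᴿ⇒⊑ (-ᴿ-cong p)) (⊑-trans (x⊑∣x∣ (-ᴿ y))
      (≡⇒⊑ λ n → ℚ.∣-p∣≡∣p∣ (seq y n))))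

-- Equations over ℝ are derived from others with termwise the same difference, so that the ring
-- identities are solved in ℚ.
≈ᴿ-of-diff : ∀ {x y u v} → u ≈ᴿ v → (∀ n → seq x n ℚ.- seq y n ≡ seq u n ℚ.- seq v n) → x ≈ᴿ y
≈ᴿ-of-diff (mk p) e .un ε 0<ε = eventually-map (λ n → ≤-by (cong ℚ.∣_∣ (e n)) refl) (p ε 0<ε)

*ᴿ-zeroˡ : ∀ {x} y → x ≈ᴿ 0ᴿ → x *ᴿ y ≈ᴿ 0ᴿ
*ᴿ-zeroˡ {x} y (mk p) .un ε 0<ε =
  let B , 0≤B , y≤B = bounded y
      δ , 0<δ , _ , Bδ≤ε = scale B ε 0≤B 0<ε
  in eventually-map
    (λ n a → ℚ.≤-trans (≤-by
        (trans (cong ℚ.∣_∣ (ℚ.+-identityʳ (seq x n ℚ.* seq y n)))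
          (trans (ℚ.∣p*q∣≡∣p∣*∣q∣ (seq x n) (seq y n)) (ℚ.*-comm ℚ.∣ seq x n ∣ ℚ.∣ seq y n ∣)))
        refl
        (*-mono (ℚ.0≤∣p∣ (seq y n)) (ℚ.<⇒≤ 0<δ) (y≤B n)
          (≤-by (cong ℚ.∣_∣ (sym (ℚ.+-identityʳ (seq x n)))) refl a)))
      Bδ≤ε)
    (p δ 0<δ)

*ᴿ-congʳ : ∀ {x y} u → x ≈ᴿ y → x *ᴿ u ≈ᴿ y *ᴿ u
*ᴿ-congʳ {x} {y} u p = ≈ᴿ-of-diff (*ᴿ-zeroˡ {x -ᴿ y} u x-y≈0)
  (λ n → solve 3 (λ x y u → x :* u :- y :* u := (x :- y) :* u :- con 0ℚ) refl
    (seq x n) (seq y n) (seq u n))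
  where
  x-y≈0 : x -ᴿ y ≈ᴿ 0ᴿ
  x-y≈0 = ≈ᴿ-of-diff p
    (λ n → solve 2 (λ x y → x :- y :- con 0ℚ := x :- y) refl (seq x n) (seq y n))

*ᴿ-comm : ∀ x y → x *ᴿ y ≈ᴿ y *ᴿ x
*ᴿ-comm x y = ≡⇒≈ᴿ λ n → ℚ.*-comm (seq x n) (seq y n)

*ᴿ-cong : ∀ {x y u v} → x ≈ᴿ y → u ≈ᴿ v → x *ᴿ u ≈ᴿ y *ᴿ v
*ᴿ-cong {x} {y} {u} {v} p q =
  ≈ᴿ-trans {x *ᴿ u} {y *ᴿ u} {y *ᴿ v} (*ᴿ-congʳ {x} {y} u p)
    (≈ᴿ-trans {y *ᴿ u} {u *ᴿ y} {y *ᴿ v} (*ᴿ-comm y u)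
      (≈ᴿ-trans {u *ᴿ y} {v *ᴿ y} {y *ᴿ v} (*ᴿ-congʳ {u} {v} y q) (*ᴿ-comm v y)))

-- b is eventually at least some rational c > 0, so accuracy c ε for b x gives accuracy ε for x.
*ᴿ-cancelˡ : ∀ {b x} → 0ᴿ <ᴿ b → b *ᴿ x ≈ᴿ 0ᴿ → x ≈ᴿ 0ᴿ
*ᴿ-cancelˡ {b} {x} (c , 0<c , lower) (mk p) .un ε 0<ε = eventually-zip
  (λ n l a → ℚ.*-cancelˡ-≤-pos c {{ℚ.positive 0<c}} (ℚ.≤-trans
    (ℚ.*-monoʳ-≤-nonNeg ℚ.∣ seq x n ℚ.- 0ℚ ∣ {{ℚ.nonNegative (ℚ.0≤∣p∣ (seq x n ℚ.- 0ℚ))}}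
      (ℚ.≤-trans (≤-by (sym (ℚ.+-identityˡ c)) refl l) (p≤∣p∣ (seq b n))))
    (≤-by (trans (sym (ℚ.∣p*q∣≡∣p∣*∣q∣ (seq b n) (seq x n ℚ.- 0ℚ)))
        (cong ℚ.∣_∣ (solve 2 (λ b x → b :* (x :- con 0ℚ) := b :* x :- con 0ℚ) refl
          (seq b n) (seq x n)))) refl a)))
  lower (p (c ℚ.* ε) (0<* 0<c 0<ε))

-- No square root is taken: if |a| ≥ 1 + ε ≥ 1, then |a| ≤ a² ≤ 1 + ε.
square-⊑1 : ∀ {x} → x *ᴿ x ⊑ 1ᴿ → ∣ x ∣ᴿ ⊑ 1ᴿ
square-⊑1 {x} (mk p) .un ε 0<ε = eventually-map (λ n → root (seq x n)) (p ε 0<ε)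
  where
  ∣a∣² : ∀ a → ℚ.∣ a ∣ ℚ.* ℚ.∣ a ∣ ≡ a ℚ.* a
  ∣a∣² a with ℚ.∣p∣≡p∨∣p∣≡-p a
  ... | inj₁ e = cong₂ ℚ._*_ e e
  ... | inj₂ e = trans (cong₂ ℚ._*_ e e) (solve 1 (λ a → :- a :* (:- a) := a :* a) refl a)
  root : ∀ a → a ℚ.* a ℚ.≤ 1ℚ ℚ.+ ε → ℚ.∣ a ∣ ℚ.≤ 1ℚ ℚ.+ ε
  root a h with ℚ.≤-total ℚ.∣ a ∣ (1ℚ ℚ.+ ε)
  ... | inj₁ q = q
  ... | inj₂ q = ℚ.≤-trans
    (≤-by (sym (ℚ.*-identityʳ ℚ.∣ a ∣)) (sym (∣a∣² a))
      (ℚ.*-monoˡ-≤-nonNeg ℚ.∣ a ∣ {{ℚ.nonNegative (ℚ.0≤∣p∣ a)}}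
        (ℚ.≤-trans (≤-weaken 0<ε ℚ.≤-refl) q))) h

-- ℂ as a complete normed ℚ-algebra

≡⇒≈ : ∀ {z w} → (∀ n → seq (re z) n ≡ seq (re w) n) → (∀ n → seq (im z) n ≡ seq (im w) n) → z ≈ w
≡⇒≈ p q = ≡⇒≈ᴿ p , ≡⇒≈ᴿ q

≈⇒≃ : ∀ {z w} → z ≈ w → z ≃ w
≈⇒≃ (mk p , mk q) = p , q

≃⇒≈ : ∀ {z w} → z ≃ w → z ≈ w
≃⇒≈ (p , q) = mk p , mk q

ℂ-refl : ∀ {z} → z ≈ z
ℂ-refl = ≈ᴿ-refl , ≈ᴿ-refl

ℂ-sym : ∀ {z w} → z ≈ w → w ≈ z
ℂ-sym {z} {w} (p , q) = ≈ᴿ-sym {re z} {re w} p , ≈ᴿ-sym {im z} {im w} q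

ℂ-trans : ∀ {u v w} → u ≈ v → v ≈ w → u ≈ w
ℂ-trans {u} {v} {w} (p , q) (r , s) =
  ≈ᴿ-trans {re u} {re v} {re w} p r , ≈ᴿ-trans {im u} {im v} {im w} q s

+-cong : ∀ {u v w z} → u ≈ v → w ≈ z → u + w ≈ v + z
+-cong {u} {v} {w} {z} (p , q) (r , s) =
  +ᴿ-cong {re u} {re v} {re w} {re z} p r , +ᴿ-cong {im u} {im v} {im w} {im z} q s

neg-cong : ∀ {u v} → u ≈ v → - u ≈ - v
neg-cong {u} {v} (p , q) = -ᴿ-cong {re u} {re v} p , -ᴿ-cong {im u} {im v} q

*-cong : ∀ {u v w z} → u ≈ v → w ≈ z → u * w ≈ v * z
*-cong {u} {v} {w} {z} (p , q) (r , s) =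
  +ᴿ-cong {re u *ᴿ re w} {re v *ᴿ re z} { -ᴿ (im u *ᴿ im w)} { -ᴿ (im v *ᴿ im z)}
    (*ᴿ-cong {re u} {re v} {re w} {re z} p r)
    (-ᴿ-cong {im u *ᴿ im w} {im v *ᴿ im z} (*ᴿ-cong {im u} {im v} {im w} {im z} q s)) ,
  +ᴿ-cong {re u *ᴿ im w} {re v *ᴿ im z} {im u *ᴿ re w} {im v *ᴿ re z}
    (*ᴿ-cong {re u} {re v} {im w} {im z} p s)
    (*ᴿ-cong {im u} {im v} {re w} {re z} q r)

opaque

  ℂ-isCommutativeRing : IsCommutativeRing _≈_ _+_ _*_ -_ 0ℂ 1ℂ
  ℂ-isCommutativeRing = record
    { isRing = record
      { +-isAbelianGroup = record
        { isGroup = record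
          { isMonoid = record
            { isSemigroup = record
              { isMagma = record
                { isEquivalence = record { refl = ℂ-refl ; sym = ℂ-sym ; trans = ℂ-trans }
                ; ∙-cong = +-cong }
              ; assoc = λ u v w → ≡⇒≈ (λ n → ℚ.+-assoc (seq (re u) n) (seq (re v) n) (seq (re w) n))
                                      (λ n → ℚ.+-assoc (seq (im u) n) (seq (im v) n) (seq (im w) n)) }
            ; identity = (λ u → ≡⇒≈ (λ n → ℚ.+-identityˡ (seq (re u) n)) (λ n → ℚ.+-identityˡ (seq (im u) n)))
                       , (λ u → ≡⇒≈ (λ n → ℚ.+-identityʳ (seq (re u) n)) (λ n → ℚ.+-identityʳ (seq (im u) n))) }
          ; inverse = (λ u → ≡⇒≈ (λ n → ℚ.+-inverseˡ (seq (re u) n)) (λ n → ℚ.+-inverseˡ (seq (im u) n)))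
                    , (λ u → ≡⇒≈ (λ n → ℚ.+-inverseʳ (seq (re u) n)) (λ n → ℚ.+-inverseʳ (seq (im u) n)))
          ; ⁻¹-cong = neg-cong }
        ; comm = λ u v → ≡⇒≈ (λ n → ℚ.+-comm (seq (re u) n) (seq (re v) n))
                             (λ n → ℚ.+-comm (seq (im u) n) (seq (im v) n)) }
      ; *-cong = *-cong
      ; *-assoc = λ u v w → ≡⇒≈
          (λ n → solve 6 (λ a b c d e f →
            (a :* c :- b :* d) :* e :- (a :* d :+ b :* c) :* f := a :* (c :* e :- d :* f) :- b :* (c :* f :+ d :* e)) refl
            (seq (re u) n) (seq (im u) n) (seq (re v) n) (seq (im v) n) (seq (re w) n) (seq (im w) n))
          (λ n → solve 6 (λ a b c d e f →
            (a :* c :- b :* d) :* f :+ (a :* d :+ b :* c) :* e := a :* (c :* f :+ d :* e) :+ b :* (c :* e :- d :* f)) refl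
            (seq (re u) n) (seq (im u) n) (seq (re v) n) (seq (im v) n) (seq (re w) n) (seq (im w) n))
      ; *-identity =
          (λ u → ≡⇒≈
            (λ n → solve 2 (λ a b → con 1ℚ :* a :- con 0ℚ :* b := a) refl (seq (re u) n) (seq (im u) n))
            (λ n → solve 2 (λ a b → con 1ℚ :* b :+ con 0ℚ :* a := b) refl (seq (re u) n) (seq (im u) n)))
        , (λ u → ≡⇒≈
            (λ n → solve 2 (λ a b → a :* con 1ℚ :- b :* con 0ℚ := a) refl (seq (re u) n) (seq (im u) n))
            (λ n → solve 2 (λ a b → a :* con 0ℚ :+ b :* con 1ℚ := b) refl (seq (re u) n) (seq (im u) n)))
      ; distrib =
          (λ u v w → ≡⇒≈
            (λ n → solve 6 (λ a b c d e f → a :* (c :+ e) :- b :* (d :+ f) := (a :* c :- b :* d) :+ (a :* e :- b :* f)) refl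
              (seq (re u) n) (seq (im u) n) (seq (re v) n) (seq (im v) n) (seq (re w) n) (seq (im w) n))
            (λ n → solve 6 (λ a b c d e f → a :* (d :+ f) :+ b :* (c :+ e) := (a :* d :+ b :* c) :+ (a :* f :+ b :* e)) refl
              (seq (re u) n) (seq (im u) n) (seq (re v) n) (seq (im v) n) (seq (re w) n) (seq (im w) n)))
        , (λ u v w → ≡⇒≈
            (λ n → solve 6 (λ a b c d e f → (c :+ e) :* a :- (d :+ f) :* b := (c :* a :- d :* b) :+ (e :* a :- f :* b)) refl
              (seq (re u) n) (seq (im u) n) (seq (re v) n) (seq (im v) n) (seq (re w) n) (seq (im w) n))
            (λ n → solve 6 (λ a b c d e f → (c :+ e) :* b :+ (d :+ f) :* a := (c :* b :+ d :* a) :+ (e :* b :+ f :* a)) refl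
              (seq (re u) n) (seq (im u) n) (seq (re v) n) (seq (im v) n) (seq (re w) n) (seq (im w) n)))
      }
    ; *-comm = λ u v → ≡⇒≈
        (λ n → solve 4 (λ a b c d → a :* c :- b :* d := c :* a :- d :* b) refl
          (seq (re u) n) (seq (im u) n) (seq (re v) n) (seq (im v) n))
        (λ n → solve 4 (λ a b c d → a :* d :+ b :* c := c :* b :+ d :* a) refl
          (seq (re u) n) (seq (im u) n) (seq (re v) n) (seq (im v) n))
    }

record Small (ε : ℚ) (z : ℂ) : Set where
  constructor mk
  field norm⊑ : ‖ z ‖ ⊑ fromℚ ε

open Small

∣re∣⊑‖‖ : ∀ z → ∣ re z ∣ᴿ ⊑ ‖ z ‖
∣re∣⊑‖‖ z = pointwise-⊑ λ n → ≤-by (sym (ℚ.+-identityʳ ℚ.∣ seq (re z) n ∣)) refl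
  (ℚ.+-monoʳ-≤ ℚ.∣ seq (re z) n ∣ (ℚ.0≤∣p∣ (seq (im z) n)))

∣im∣⊑‖‖ : ∀ z → ∣ im z ∣ᴿ ⊑ ‖ z ‖
∣im∣⊑‖‖ z = pointwise-⊑ λ n → ≤-by (sym (ℚ.+-identityˡ ℚ.∣ seq (im z) n ∣)) refl
  (ℚ.+-monoˡ-≤ ℚ.∣ seq (im z) n ∣ (ℚ.0≤∣p∣ (seq (re z) n)))

0⊑‖‖ : ∀ z → 0ᴿ ⊑ ‖ z ‖
0⊑‖‖ z = 0⊑+ {∣ re z ∣ᴿ} {∣ im z ∣ᴿ} (0⊑∣∣ (re z)) (0⊑∣∣ (im z))

‖‖-cong : ∀ {z w} → z ≈ w → ‖ z ‖ ⊑ ‖ w ‖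
‖‖-cong {z} {w} (p , q) = +ᴿ-mono {∣ re z ∣ᴿ} {∣ re w ∣ᴿ} {∣ im z ∣ᴿ} {∣ im w ∣ᴿ}
  (≈ᴿ⇒⊑ (∣∣ᴿ-cong {re z} {re w} p)) (≈ᴿ⇒⊑ (∣∣ᴿ-cong {im z} {im w} q))

‖‖-* : ∀ z w → ‖ z * w ‖ ⊑ ‖ z ‖ *ᴿ ‖ w ‖
‖‖-* z w = pointwise-⊑ (exp-lemmas.nrm-* 0ℂ z w)

‖‖-+ : ∀ z w → ‖ z + w ‖ ⊑ ‖ z ‖ +ᴿ ‖ w ‖
‖‖-+ z w = pointwise-⊑ λ n → ≤-by refl
  (solve 4 (λ a b c d → (a :+ b) :+ (c :+ d) := (a :+ c) :+ (b :+ d)) refl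
    ℚ.∣ seq (re z) n ∣ ℚ.∣ seq (im z) n ∣ ℚ.∣ seq (re w) n ∣ ℚ.∣ seq (im w) n ∣)
  (ℚ.+-mono-≤ (ℚ.∣p+q∣≤∣p∣+∣q∣ (seq (re z) n) (seq (re w) n))
              (ℚ.∣p+q∣≤∣p∣+∣q∣ (seq (im z) n) (seq (im w) n)))

opaque

    small-+ : ∀ {δ ε z w} → Small δ z → Small ε w → Small (δ ℚ.+ ε) (z + w)
    small-+ {δ} {ε} {z} {w} (mk p) (mk q) .norm⊑ = ⊑-trans {‖ z + w ‖} {‖ z ‖ +ᴿ ‖ w ‖} (‖‖-+ z w)
      (⊑-trans {‖ z ‖ +ᴿ ‖ w ‖} {fromℚ δ +ᴿ fromℚ ε} {fromℚ (δ ℚ.+ ε)}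
        (+ᴿ-mono {‖ z ‖} {fromℚ δ} {‖ w ‖} {fromℚ ε} p q) (≡⇒⊑ λ n → refl))

    small-fromℚ : ∀ {r} → 0ℚ ℚ.≤ r → Small r (fromℝ (fromℚ r))
    small-fromℚ {r} 0≤r .norm⊑ = ≡⇒⊑ λ n → trans (ℚ.+-identityʳ ℚ.∣ r ∣) (ℚ.0≤p⇒∣p∣≡p 0≤r)

    small-≤ : ∀ {δ ε z} → δ ℚ.≤ ε → Small δ z → Small ε z
    small-≤ {δ} {ε} {z} h (mk p) .norm⊑ = ⊑-trans {‖ z ‖} {fromℚ δ} {fromℚ ε} p (fromℚ-mono h)

    small-neg : ∀ {ε z} → Small ε z → Small ε (- z)
    small-neg {ε} {z} (mk p) .norm⊑ = ⊑-trans {‖ - z ‖} {‖ z ‖} {fromℚ ε}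
      (≡⇒⊑ λ n → cong₂ ℚ._+_ (ℚ.∣-p∣≡∣p∣ (seq (re z) n)) (ℚ.∣-p∣≡∣p∣ (seq (im z) n))) p

    small-* : ∀ {δ ε z w} → 0ℚ ℚ.≤ δ → 0ℚ ℚ.≤ ε → Small δ z → Small ε w → Small (δ ℚ.* ε) (z * w)
    small-* {δ} {ε} {z} {w} 0≤δ 0≤ε (mk p) (mk q) .norm⊑ = ⊑-trans {‖ z * w ‖} {‖ z ‖ *ᴿ ‖ w ‖} (‖‖-* z w)
      (⊑-trans {‖ z ‖ *ᴿ ‖ w ‖} {fromℚ δ *ᴿ fromℚ ε} {fromℚ (δ ℚ.* ε)}
        (*ᴿ-mono {‖ z ‖} {fromℚ δ} {‖ w ‖} {fromℚ ε} (0⊑‖‖ z) (fromℚ-mono 0≤ε) p q) (≡⇒⊑ λ n → refl))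

    small⇒≈0 : ∀ {z} → (∀ ε → 0ℚ ℚ.< ε → Small ε z) → z ≈ 0ℂ
    small⇒≈0 {z} p = vanish re (∣re∣⊑‖‖ z) , vanish im (∣im∣⊑‖‖ z)
      where
      vanish : (π : ℂ → ℝ) → ∣ π z ∣ᴿ ⊑ ‖ z ‖ → π z ≈ᴿ 0ᴿ
      vanish π h = ∣∣⊑⇒≈ᴿ {π z} {0ᴿ} λ ε 0<ε →
        ⊑-trans {∣ π z -ᴿ 0ᴿ ∣ᴿ} {∣ π z ∣ᴿ} {fromℚ ε}
          (≡⇒⊑ λ n → cong ℚ.∣_∣ (ℚ.+-identityʳ (seq (π z) n)))
          (⊑-trans {∣ π z ∣ᴿ} {‖ z ‖} {fromℚ ε} h (norm⊑ {ε} {z} (p ε 0<ε)))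

    size : ∀ z → ∃ λ B → 0ℚ ℚ.≤ B × Small B z
    size z =
      let A , 0≤A , p = bounded (re z)
          B , 0≤B , q = bounded (im z)
      in A ℚ.+ B , 0≤+ 0≤A 0≤B , mk (pointwise-⊑ λ n → ℚ.+-mono-≤ (p n) (q n))

    small-components : ∀ {ε} z → ∣ re z ∣ᴿ ⊑ fromℚ (½ ℚ.* ε) → ∣ im z ∣ᴿ ⊑ fromℚ (½ ℚ.* ε) → Small ε z
    small-components {ε} z p q .norm⊑ = ⊑-trans {‖ z ‖} {fromℚ (½ ℚ.* ε) +ᴿ fromℚ (½ ℚ.* ε)} {fromℚ ε}
      (+ᴿ-mono {∣ re z ∣ᴿ} {fromℚ (½ ℚ.* ε)} {∣ im z ∣ᴿ} {fromℚ (½ ℚ.* ε)} p q)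
      (≡⇒⊑ λ n → halves ε)

    limit-ℂ : ∀ (X : ℕ → ℂ) l m → (λ n → re (X n)) ⟶ᴿ l → (λ n → im (X n)) ⟶ᴿ m →
      ∀ ε → 0ℚ ℚ.< ε → ∃ λ N → ∀ n → N ℕ.≤ n → Small ε (X n - (l +𝕚 m))
    limit-ℂ X l m f g ε 0<ε =
      let K , p = f (½ ℚ.* ε) (halve 0<ε)
          N , q = g (½ ℚ.* ε) (halve 0<ε)
      in K ℕ.⊔ N , λ n h → small-components {ε} (X n - (l +𝕚 m))
           (mk (p n (ℕ.m⊔n≤o⇒m≤o K N h))) (mk (q n (ℕ.m⊔n≤o⇒n≤o K N h)))

    complete-ℂ : ∀ (X : ℕ → ℂ) →
      (∀ ε → 0ℚ ℚ.< ε → ∃ λ N → ∀ m n → N ℕ.≤ m → N ℕ.≤ n → Small ε (X m - X n)) →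
      ∃ λ L → ∀ ε → 0ℚ ℚ.< ε → ∃ λ N → ∀ n → N ℕ.≤ n → Small ε (X n - L)
    complete-ℂ X cau =
      let l , f = complete (λ n → re (X n)) re-cauchy
          m , g = complete (λ n → im (X n)) im-cauchy
      in l +𝕚 m , limit-ℂ X l m f g
      where
      re-cauchy : Cauchyᴿ (λ n → re (X n))
      re-cauchy ε 0<ε = let N , p = cau ε 0<ε in N , λ m n N≤m N≤n →
        un (⊑-trans {∣ re (X m - X n) ∣ᴿ} {‖ X m - X n ‖} {fromℚ ε} (∣re∣⊑‖‖ (X m - X n)) (norm⊑ {ε} {X m - X n} (p m n N≤m N≤n)))
      im-cauchy : Cauchyᴿ (λ n → im (X n))
      im-cauchy ε 0<ε = let N , p = cau ε 0<ε in N , λ m n N≤m N≤n →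
        un (⊑-trans {∣ im (X m - X n) ∣ᴿ} {‖ X m - X n ‖} {fromℚ ε} (∣im∣⊑‖‖ (X m - X n)) (norm⊑ {ε} {X m - X n} (p m n N≤m N≤n)))

small-≈ : ∀ {ε z w} → z ≈ w → Small ε z → Small ε w
small-≈ {ε} {z} {w} e (mk p) .norm⊑ = ⊑-trans {‖ w ‖} {‖ z ‖} {fromℚ ε} (‖‖-cong {w} {z} (ℂ-sym {z} {w} e)) p

-- Opaque copies, since comparing terms over ℝ would otherwise unfold the
-- proofs of the Cauchy property.
opaque

  plus times : ℂ → ℂ → ℂ
  plus  = _+_
  times = _*_

  negate : ℂ → ℂ
  negate = -_

  0ᶜ 1ᶜ : ℂ
  0ᶜ = 0ℂ
  1ᶜ = 1ℂ

  scalar : ℚ → ℂ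
  scalar r = fromℝ (fromℚ r)

  plus≈ : ∀ z w → plus z w ≈ z + w
  plus≈ z w = ≡⇒≈ (λ n → refl) (λ n → refl)

  times≈ : ∀ z w → times z w ≈ z * w
  times≈ z w = ≡⇒≈ (λ n → refl) (λ n → refl)

  negate≈ : ∀ z → negate z ≈ - z
  negate≈ z = ≡⇒≈ (λ n → refl) (λ n → refl)

  minus≈ : ∀ z w → plus z (negate w) ≈ z - w
  minus≈ z w = ≡⇒≈ (λ n → refl) (λ n → refl)

  0ᶜ≈ : 0ᶜ ≈ 0ℂ
  0ᶜ≈ = ≡⇒≈ (λ n → refl) (λ n → refl)

  1ᶜ≈ : 1ᶜ ≈ 1ℂ
  1ᶜ≈ = ≡⇒≈ (λ n → refl) (λ n → refl)

  scalar≈ : ∀ r → scalar r ≈ fromℝ (fromℚ r)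
  scalar≈ r = ≡⇒≈ (λ n → refl) (λ n → refl)

  ℂ-isCommutativeRing′ : IsCommutativeRing _≈_ plus times negate 0ᶜ 1ᶜ
  ℂ-isCommutativeRing′ = ℂ-isCommutativeRing

  scalar-+ : ∀ r s → scalar (r ℚ.+ s) ≈ plus (scalar r) (scalar s)
  scalar-+ r s = ≡⇒≈ (λ n → refl) (λ n → refl)

  scalar-* : ∀ r s → scalar (r ℚ.* s) ≈ times (scalar r) (scalar s)
  scalar-* r s = ≡⇒≈
    (λ n → solve 2 (λ r s → r :* s := r :* s :- con 0ℚ :* con 0ℚ) refl r s)
    (λ n → solve 2 (λ r s → con 0ℚ := r :* con 0ℚ :+ con 0ℚ :* s) refl r s)

  scalar-neg : ∀ r → scalar (ℚ.- r) ≈ negate (scalar r)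
  scalar-neg r = ≡⇒≈ (λ n → refl) (λ n → refl)

  scalar-0 : scalar 0ℚ ≈ 0ᶜ
  scalar-0 = ≡⇒≈ (λ n → refl) (λ n → refl)

  scalar-1 : scalar 1ℚ ≈ 1ᶜ
  scalar-1 = ≡⇒≈ (λ n → refl) (λ n → refl)

small-minus : ∀ {ε} z w → Small ε (z - w) → Small ε (plus z (negate w))
small-minus {ε} z w = small-≈ {ε} {z - w} {plus z (negate w)} (ℂ-sym (minus≈ z w))

opaque

  complete-plus : ∀ (X : ℕ → ℂ) →
    (∀ ε → 0ℚ ℚ.< ε → ∃ λ N → ∀ m n → N ℕ.≤ m → N ℕ.≤ n → Small ε (plus (X m) (negate (X n)))) →
    ∃ λ L → ∀ ε → 0ℚ ℚ.< ε → ∃ λ N → ∀ n → N ℕ.≤ n → Small ε (plus (X n) (negate L))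
  complete-plus X cau =
    let L , p = complete-ℂ X λ ε 0<ε → let N , q = cau ε 0<ε in
                  N , λ m n h k → small-≈ {ε} {plus (X m) (negate (X n))} {X m - X n} (minus≈ (X m) (X n)) (q m n h k)
    in L , λ ε 0<ε → let N , q = p ε 0<ε in
         N , λ n h → small-minus {ε} (X n) L (q n h)

ℂ-algebra : NormedAlgebra
ℂ-algebra = record
  { commutativeRing = record
    { Carrier = ℂ ; _≈_ = _≈_ ; _+_ = plus ; _*_ = times ; -_ = negate ; 0# = 0ᶜ ; 1# = 1ᶜ
    ; isCommutativeRing = ℂ-isCommutativeRing′ }
  ; ι         = scalar
  ; ι-+       = scalar-+
  ; ι-*       = scalar-*
  ; ι-neg     = scalar-neg
  ; ι-0       = scalar-0
  ; ι-1       = scalar-1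
  ; Small     = Small
  ; ι-small   = λ {r} 0≤r → small-≈ {r} {fromℝ (fromℚ r)} {scalar r} (ℂ-sym (scalar≈ r)) (small-fromℚ {r} 0≤r)
  ; small-≈   = λ {ε} {z} {w} → small-≈ {ε} {z} {w}
  ; small-≤   = λ {δ} {ε} {z} → small-≤ {δ} {ε} {z}
  ; small-0   = small-≈ {0ℚ} {0ℂ} {0ᶜ} (ℂ-sym 0ᶜ≈) (small-fromℚ {0ℚ} ℚ.≤-refl)
  ; small-+   = λ {δ} {ε} {z} {w} p q → small-≈ {δ ℚ.+ ε} {z + w} {plus z w} (ℂ-sym (plus≈ z w)) (small-+ {δ} {ε} {z} {w} p q)
  ; small-neg = λ {ε} {z} p → small-≈ {ε} { - z} {negate z} (ℂ-sym (negate≈ z)) (small-neg {ε} {z} p)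
  ; small-*   = λ {δ} {ε} {z} {w} h k p q → small-≈ {δ ℚ.* ε} {z * w} {times z w} (ℂ-sym (times≈ z w)) (small-* {δ} {ε} {z} {w} h k p q)
  ; small⇒≈0  = λ {z} p → ℂ-trans {z} {0ℂ} {0ᶜ} (small⇒≈0 {z} p) (ℂ-sym 0ᶜ≈)
  ; size      = size
  ; complete  = complete-plus
  }

module ℂR = CommutativeRing (NormedAlgebra.commutativeRing ℂ-algebra)

-- The exponential function of ℂ

module ℂS = Sums ℂ-algebra
open ℂS using (_⟶_; ⟶-unique; ⟶-cong) renaming (∑ to ∑ᴷ)

-- In its uses `t` unfolds to `r · w`, but the two are compared through their rational sequences
-- only; comparing them as complex numbers would unfold the Cauchy proofs.
·≈ : ∀ {t : ℂ} r w {w′} → (∀ m → seq (re t) m ≡ r ℚ.* seq (re w) m) → (∀ m → seq (im t) m ≡ r ℚ.* seq (im w) m) →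
     w ≈ w′ → t ≈ times (scalar r) w′
·≈ {t} r w {w′} e f h = ℂ-trans {t} {fromℝ (fromℚ r) * w} {times (scalar r) w′}
  (≡⇒≈
    (λ m → trans (e m) (solve 3 (λ r a b → r :* a := r :* a :- con 0ℚ :* b) refl r (seq (re w) m) (seq (im w) m)))
    (λ m → trans (f m) (solve 3 (λ r a b → r :* b := r :* b :+ con 0ℚ :* a) refl r (seq (re w) m) (seq (im w) m))))
  (ℂ-sym {times (scalar r) w′} {fromℝ (fromℚ r) * w}
    (ℂ-trans {times (scalar r) w′} {scalar r * w′} {fromℝ (fromℚ r) * w} (times≈ (scalar r) w′)
      (*-cong {scalar r} {fromℝ (fromℚ r)} {w′} {w} (scalar≈ r) (ℂ-sym {w} {w′} h))))

expTerm-suc : ∀ z k → expTerm z (suc k) ≈ times (scalar (recip k)) (times z (expTerm z k))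
expTerm-suc z k = ·≈ {expTerm z (suc k)} (ℤ.+ 1 ℚ./ suc k) (z * expTerm z k) (λ m → refl) (λ m → refl)
  (ℂ-sym {times z (expTerm z k)} {z * expTerm z k} (times≈ z (expTerm z k)))

∑-expTerm : ∀ z n → expPartial z n ≈ ∑ᴷ (expTerm z) (downFrom n)
∑-expTerm z zero    = ℂ-sym 0ᶜ≈
∑-expTerm z (suc n) = ℂ-trans {expPartial z (suc n)} {expTerm z n + expPartial z n} {∑ᴷ (expTerm z) (downFrom (suc n))}
  (≡⇒≈ {expPartial z n + expTerm z n} {expTerm z n + expPartial z n}
    (λ m → ℚ.+-comm (seq (re (expPartial z n)) m) (seq (re (expTerm z n)) m))
    (λ m → ℚ.+-comm (seq (im (expPartial z n)) m) (seq (im (expTerm z n)) m)))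
  (ℂ-trans {expTerm z n + expPartial z n} {plus (expTerm z n) (expPartial z n)} {∑ᴷ (expTerm z) (downFrom (suc n))}
    (ℂ-sym {plus (expTerm z n) (expPartial z n)} {expTerm z n + expPartial z n} (plus≈ (expTerm z n) (expPartial z n)))
    (ℂR.+-congˡ {expTerm z n} (∑-expTerm z n)))

opaque

  expPartial-lim : ∀ z → expPartial z ⟶ exp z
  expPartial-lim z ε 0<ε = let N , p = exp-converges z ε 0<ε in
    N , λ n h → small-minus {ε} (expPartial z n) (exp z) (mk (mk (p n h)))

  exp-lim : ∀ z → (λ n → ∑ᴷ (expTerm z) (downFrom n)) ⟶ exp z
  exp-lim z = ⟶-cong {expPartial z} (∑-expTerm z) (expPartial-lim z)

ℂ-series : ExponentialSeries ℂ-algebra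
ℂ-series = record
  { E = expTerm ; E-zero = λ z → ℂ-sym 1ᶜ≈ ; E-suc = expTerm-suc ; exp = exp ; exp-lim = exp-lim }

module ℂE = Exponential ℂ-algebra ℂ-series

opaque

  exp-cong : ∀ {z w} → z ≈ w → exp z ≈ exp w
  exp-cong = ℂE.exp-cong

  exp-+ : ∀ z w → exp (z + w) ≈ exp z * exp w
  exp-+ z w = ℂ-trans {exp (z + w)} {exp (plus z w)} {exp z * exp w}
    (exp-cong {z + w} {plus z w} (ℂ-sym {plus z w} {z + w} (plus≈ z w)))
    (ℂ-trans {exp (plus z w)} {times (exp z) (exp w)} {exp z * exp w} (ℂE.exp-+ z w) (times≈ (exp z) (exp w)))

  exp-0 : exp 0ℂ ≈ 1ℂ
  exp-0 = ℂ-trans (exp-cong (ℂ-sym 0ᶜ≈)) (ℂ-trans ℂE.exp-0 1ᶜ≈)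

-- Complex conjugation

opaque

  conj : ℂ → ℂ
  conj z = re z +𝕚 (-ᴿ im z)

  conj≈ : ∀ z → conj z ≈ re z +𝕚 (-ᴿ im z)
  conj≈ z = ≡⇒≈ (λ n → refl) (λ n → refl)

  conj-cong : ∀ {z w} → z ≈ w → conj z ≈ conj w
  conj-cong {z} {w} (p , q) = p , -ᴿ-cong {im z} {im w} q

  conj-+ : ∀ z w → conj (z + w) ≈ conj z + conj w
  conj-+ z w = ≡⇒≈ (λ n → refl) (λ n → ℚ.neg-distrib-+ (seq (im z) n) (seq (im w) n))

  conj-* : ∀ z w → conj (z * w) ≈ conj z * conj w
  conj-* z w = ≡⇒≈
    (λ n → solve 4 (λ a b c d → a :* c :- b :* d := a :* c :- (:- b) :* (:- d)) refl
      (seq (re z) n) (seq (im z) n) (seq (re w) n) (seq (im w) n))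
    (λ n → solve 4 (λ a b c d → :- (a :* d :+ b :* c) := a :* (:- d) :+ (:- b) :* c) refl
      (seq (re z) n) (seq (im z) n) (seq (re w) n) (seq (im w) n))

  conj-· : ∀ r z → conj (r · z) ≈ r · conj z
  conj-· r z = ≡⇒≈ (λ n → refl)
    (λ n → solve 2 (λ r b → :- (r :* b) := r :* (:- b)) refl r (seq (im z) n))

  conj-0 : conj 0ℂ ≈ 0ℂ
  conj-0 = ≡⇒≈ (λ n → refl) (λ n → refl)

  conj-1 : conj 1ℂ ≈ 1ℂ
  conj-1 = ≡⇒≈ (λ n → refl) (λ n → refl)

  conj-minus : ∀ z w → conj (z - w) ≈ conj z - conj w
  conj-minus z w = ≡⇒≈ (λ n → refl) (λ n → ℚ.neg-distrib-+ (seq (im z) n) (ℚ.- seq (im w) n))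

  small-conj : ∀ {ε z} → Small ε z → Small ε (conj z)
  small-conj {ε} {z} (mk p) .norm⊑ = ⊑-trans {‖ conj z ‖} {‖ z ‖} {fromℚ ε}
    (≡⇒⊑ λ n → cong (ℚ.∣ seq (re z) n ∣ ℚ.+_) (ℚ.∣-p∣≡∣p∣ (seq (im z) n))) p

·-cong : ∀ r {z w} → z ≈ w → r · z ≈ r · w
·-cong r {z} {w} (p , q) =
  *ᴿ-cong {fromℚ r} {fromℚ r} {re z} {re w} ≈ᴿ-refl p , *ᴿ-cong {fromℚ r} {fromℚ r} {im z} {im w} ≈ᴿ-refl q

conj-expTerm : ∀ z k → conj (expTerm z k) ≈ expTerm (conj z) k
conj-expTerm z zero    = conj-1
conj-expTerm z (suc k) = ℂ-trans {conj (expTerm z (suc k))} {(ℤ.+ 1 ℚ./ suc k) · conj (z * expTerm z k)} {expTerm (conj z) (suc k)}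
  (conj-· (ℤ.+ 1 ℚ./ suc k) (z * expTerm z k))
  (·-cong (ℤ.+ 1 ℚ./ suc k) {conj (z * expTerm z k)} {conj z * expTerm (conj z) k}
    (ℂ-trans {conj (z * expTerm z k)} {conj z * conj (expTerm z k)} {conj z * expTerm (conj z) k}
      (conj-* z (expTerm z k))
      (*-cong {conj z} {conj z} {conj (expTerm z k)} {expTerm (conj z) k} (ℂ-refl {conj z}) (conj-expTerm z k))))

conj-expPartial : ∀ z n → conj (expPartial z n) ≈ expPartial (conj z) n
conj-expPartial z zero    = conj-0
conj-expPartial z (suc n) =
  ℂ-trans {conj (expPartial z (suc n))} {conj (expPartial z n) + conj (expTerm z n)} {expPartial (conj z) (suc n)}
    (conj-+ (expPartial z n) (expTerm z n))
    (+-cong {conj (expPartial z n)} {expPartial (conj z) n} {conj (expTerm z n)} {expTerm (conj z) n}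
      (conj-expPartial z n) (conj-expTerm z n))

opaque

  -- Conjugation commutes with the partial sums and preserves the norm, so both sides are limits of
  -- one sequence.
  exp-conj : ∀ z → exp (conj z) ≈ conj (exp z)
  exp-conj z = ⟶-unique {expPartial (conj z)} (expPartial-lim (conj z))
    (⟶-cong {λ n → conj (expPartial z n)} (conj-expPartial z) λ ε 0<ε →
      let N , p = exp-converges z ε 0<ε
      in N , λ n h → small-minus {ε} (conj (expPartial z n)) (conj (exp z))
           (small-≈ {ε} {conj (expPartial z n - exp z)} {conj (expPartial z n) - conj (exp z)} (conj-minus (expPartial z n) (exp z)) (small-conj {ε} {expPartial z n - exp z} (mk (mk (p n h))))))

x≈-x⇒x≈0 : ∀ {x} → x ≈ᴿ -ᴿ x → x ≈ᴿ 0ᴿ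
x≈-x⇒x≈0 {x} p = *ᴿ-cancelˡ {fromℚ (nat 2)} {x}
  (1ℚ , ℚ.positive⁻¹ 1ℚ , always {λ n → 0ℚ ℚ.+ 1ℚ ℚ.≤ nat 2} λ n → nat-mono (ℕ.s≤s ℕ.z≤n))
  (≈ᴿ-of-diff {fromℚ (nat 2) *ᴿ x} {0ᴿ} {x} { -ᴿ x} p
    (λ n → solve 1 (λ x → con (nat 2) :* x :- con 0ℚ := x :- (:- x)) refl (seq x n)))

square-nonneg : ∀ x → 0ᴿ ⊑ x *ᴿ x
square-nonneg x = pointwise-⊑ λ n → square (seq x n)
  where
  square : ∀ a → 0ℚ ℚ.≤ a ℚ.* a
  square a with ℚ.≤-total 0ℚ a
  ... | inj₁ p = 0≤* p p
  ... | inj₂ p = ≤-by refl (solve 1 (λ a → a :* a := (:- a) :* (:- a)) refl a)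
                   (0≤* (ℚ.neg-antimono-≤ p) (ℚ.neg-antimono-≤ p))

⊑-closed : ∀ {x y} → (∀ ε → 0ℚ ℚ.< ε → x ⊑ y +ᴿ fromℚ ε) → x ⊑ y
⊑-closed {x} {y} p .un ε 0<ε = eventually-map
  (λ n → subst (seq x n ℚ.≤_)
    (trans (ℚ.+-assoc (seq y n) (½ ℚ.* ε) (½ ℚ.* ε)) (cong (seq y n ℚ.+_) (halves ε))))
  (un (p (½ ℚ.* ε) (halve 0<ε)) (½ ℚ.* ε) (halve 0<ε))

-- The growth of the exponential function

opaque

  e^ : ℝ → ℝ
  e^ t = re (exp (fromℝ t))

  e^≈ : ∀ t → e^ t ≈ᴿ re (exp (fromℝ t))
  e^≈ t = ≈ᴿ-refl {re (exp (fromℝ t))}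

-- A real number is its own conjugate, hence so is its exponential: the imaginary part equals its
-- negative.
im-exp-real : ∀ t → im (exp (fromℝ t)) ≈ᴿ 0ᴿ
im-exp-real t = x≈-x⇒x≈0 {im (exp (fromℝ t))} (im≈ {exp (fromℝ t)} {re (exp (fromℝ t)) +𝕚 (-ᴿ im (exp (fromℝ t)))} (ℂ-trans {exp (fromℝ t)} {exp (conj (fromℝ t))} {re (exp (fromℝ t)) +𝕚 (-ᴿ im (exp (fromℝ t)))}
  (exp-cong {fromℝ t} {conj (fromℝ t)} (ℂ-sym {conj (fromℝ t)} {fromℝ t} (ℂ-trans {conj (fromℝ t)} {re (fromℝ t) +𝕚 (-ᴿ im (fromℝ t))} {fromℝ t} (conj≈ (fromℝ t)) (≡⇒≈ (λ n → refl) (λ n → refl)))))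
  (ℂ-trans {exp (conj (fromℝ t))} {conj (exp (fromℝ t))} {re (exp (fromℝ t)) +𝕚 (-ᴿ im (exp (fromℝ t)))}
    (exp-conj (fromℝ t)) (conj≈ (exp (fromℝ t))))))

re-* : ∀ a b → im a ≈ᴿ 0ᴿ → re (a * b) ≈ᴿ re a *ᴿ re b
re-* a b p = ≈ᴿ-of-diff {re (a * b)} {re a *ᴿ re b} {0ᴿ} {im a *ᴿ im b}
  (≈ᴿ-sym {im a *ᴿ im b} {0ᴿ} (*ᴿ-zeroˡ {im a} (im b) p))
  (λ n → solve 2 (λ x y → (x :- y) :- x := con 0ℚ :- y) refl
    (seq (re a) n ℚ.* seq (re b) n) (seq (im a) n ℚ.* seq (im b) n))

e^-+ : ∀ s t → e^ (s +ᴿ t) ≈ᴿ e^ s *ᴿ e^ t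
e^-+ s t = ≈ᴿ-trans {e^ (s +ᴿ t)} {re (exp (fromℝ (s +ᴿ t)))} {e^ s *ᴿ e^ t} (e^≈ (s +ᴿ t))
  (≈ᴿ-trans {re (exp (fromℝ (s +ᴿ t)))} {re (exp (fromℝ s) * exp (fromℝ t))} {e^ s *ᴿ e^ t}
    (re≈ {exp (fromℝ (s +ᴿ t))} {exp (fromℝ s) * exp (fromℝ t)}
      (ℂ-trans {exp (fromℝ (s +ᴿ t))} {exp (fromℝ s + fromℝ t)} {exp (fromℝ s) * exp (fromℝ t)}
        (exp-cong {fromℝ (s +ᴿ t)} {fromℝ s + fromℝ t} (≡⇒≈ (λ n → refl) (λ n → refl)))
        (exp-+ (fromℝ s) (fromℝ t))))
    (≈ᴿ-trans {re (exp (fromℝ s) * exp (fromℝ t))} {re (exp (fromℝ s)) *ᴿ re (exp (fromℝ t))} {e^ s *ᴿ e^ t}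
      (re-* (exp (fromℝ s)) (exp (fromℝ t)) (im-exp-real s))
      (≈ᴿ-sym {e^ s *ᴿ e^ t} {re (exp (fromℝ s)) *ᴿ re (exp (fromℝ t))}
        (*ᴿ-cong {e^ s} {re (exp (fromℝ s))} {e^ t} {re (exp (fromℝ t))} (e^≈ s) (e^≈ t)))))

e^-cong : ∀ {s t} → s ≈ᴿ t → e^ s ≈ᴿ e^ t
e^-cong {s} {t} p = ≈ᴿ-trans {e^ s} {re (exp (fromℝ s))} {e^ t} (e^≈ s)
  (≈ᴿ-trans {re (exp (fromℝ s))} {re (exp (fromℝ t))} {e^ t}
    (re≈ {exp (fromℝ s)} {exp (fromℝ t)} (exp-cong {fromℝ s} {fromℝ t} (p , ≈ᴿ-refl {0ᴿ})))
    (≈ᴿ-sym {e^ t} {re (exp (fromℝ t))} (e^≈ t)))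

e^-0 : e^ 0ᴿ ≈ᴿ 1ᴿ
e^-0 = ≈ᴿ-trans {e^ 0ᴿ} {re (exp 0ℂ)} {1ᴿ} (e^≈ 0ᴿ) (re≈ {exp 0ℂ} {1ℂ} exp-0)

-- e^t is the square of e^(t/2).
e^-nonneg : ∀ t → 0ᴿ ⊑ e^ t
e^-nonneg t = ⊑-trans {0ᴿ} {e^ h *ᴿ e^ h} {e^ t} (square-nonneg (e^ h))
  (≈ᴿ⇒⊑ (≈ᴿ-trans {e^ h *ᴿ e^ h} {e^ (h +ᴿ h)} {e^ t}
    (≈ᴿ-sym {e^ (h +ᴿ h)} {e^ h *ᴿ e^ h} (e^-+ h h))
    (e^-cong {h +ᴿ h} {t} (≡⇒≈ᴿ λ n → halves (seq t n)))))
  where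
  h : ℝ
  h = fromℚ ½ *ᴿ t

module _ (t : ℝ) (0⊑t : 0ᴿ ⊑ t) where

  private
    z : ℂ
    z = fromℝ t

  expTerm-nonneg : ∀ k → 0ᴿ ⊑ re (expTerm z k) × im (expTerm z k) ≈ᴿ 0ᴿ
  expTerm-nonneg zero    = fromℚ-mono (ℚ.nonNegative⁻¹ 1ℚ) , ≈ᴿ-refl {0ᴿ}
  expTerm-nonneg (suc k) =
    (⊑-trans {0ᴿ} {fromℚ (recip k) *ᴿ (t *ᴿ a)} {re (expTerm z (suc k))}
      (0⊑* {fromℚ (recip k)} {t *ᴿ a} (fromℚ-mono (ℚ.<⇒≤ (0<recip k))) (0⊑* {t} {a} 0⊑t (proj₁ ih)))
      (≡⇒⊑ λ n → solve 4 (λ r t a b → r :* (t :* a) := r :* (t :* a :- con 0ℚ :* b)) refl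
        (recip k) (seq t n) (seq a n) (seq b n))) ,
    ≈ᴿ-trans {im (expTerm z (suc k))} {b *ᴿ (fromℚ (recip k) *ᴿ t)} {0ᴿ}
      (≡⇒≈ᴿ λ n → solve 4 (λ r t a b → r :* (t :* b :+ con 0ℚ :* a) := b :* (r :* t)) refl
        (recip k) (seq t n) (seq a n) (seq b n))
      (*ᴿ-zeroˡ {b} (fromℚ (recip k) *ᴿ t) (proj₂ ih))
    where
    ih = expTerm-nonneg k
    a b : ℝ
    a = re (expTerm z k)
    b = im (expTerm z k)

  -- The first two terms give 1 + t and all later ones are non-negative.
  1+t⊑partial : ∀ n → 1ᴿ +ᴿ t ⊑ re (expPartial z (suc (suc n)))
  1+t⊑partial zero    = ≡⇒⊑ λ n → solve 1
    (λ t → con 1ℚ :+ t := (con 0ℚ :+ con 1ℚ) :+ con (recip 0) :* (t :* con 1ℚ :- con 0ℚ :* con 0ℚ)) refl (seq t n)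
  1+t⊑partial (suc n) = ⊑-trans {1ᴿ +ᴿ t} {re (expPartial z (suc (suc n)))} {re (expPartial z (suc (suc (suc n))))}
    (1+t⊑partial n)
    (⊑-trans {re (expPartial z (suc (suc n)))} {re (expPartial z (suc (suc n))) +ᴿ 0ᴿ}
      (≡⇒⊑ λ m → sym (ℚ.+-identityʳ (seq (re (expPartial z (suc (suc n)))) m)))
      (+ᴿ-mono {re (expPartial z (suc (suc n)))} {re (expPartial z (suc (suc n)))} {0ᴿ} {re (expTerm z (suc (suc n)))}
        ⊑-refl (proj₁ (expTerm-nonneg (suc (suc n))))))

  1+t⊑e^t : 1ᴿ +ᴿ t ⊑ e^ t
  1+t⊑e^t = ⊑-closed {1ᴿ +ᴿ t} {e^ t} λ ε 0<ε →
    let N , p = exp-converges z ε 0<ε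
    in close ε (expPartial z (suc (suc N))) (1+t⊑partial N)
         (mk (p (suc (suc N)) (ℕ.≤-trans (ℕ.n≤1+n N) (ℕ.n≤1+n (suc N)))))
    where
    close : ∀ ε S → 1ᴿ +ᴿ t ⊑ re S → ‖ S - exp z ‖ ⊑ fromℚ ε → 1ᴿ +ᴿ t ⊑ e^ t +ᴿ fromℚ ε
    close ε S h q = ⊑-trans {1ᴿ +ᴿ t} {re S} {e^ t +ᴿ fromℚ ε} h
      (⊑-trans {re S} {re (exp z) +ᴿ ∣ re (S - exp z) ∣ᴿ} {e^ t +ᴿ fromℚ ε}
        (pointwise-⊑ λ m → ≤-by (solve 2 (λ s e → s := e :+ (s :- e)) refl (seq (re S) m) (seq (re (exp z)) m)) refl
          (ℚ.+-monoʳ-≤ (seq (re (exp z)) m) (p≤∣p∣ (seq (re S) m ℚ.- seq (re (exp z)) m))))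
        (+ᴿ-mono {re (exp z)} {e^ t} {∣ re (S - exp z) ∣ᴿ} {fromℚ ε}
          (≈ᴿ⇒⊑ (≈ᴿ-sym {e^ t} {re (exp z)} (e^≈ t)))
          (⊑-trans {∣ re (S - exp z) ∣ᴿ} {‖ S - exp z ‖} {fromℚ ε} (∣re∣⊑‖‖ (S - exp z)) q)))

record Growth (r : ℚ) (w : ℂ) : Set where
  constructor mk
  field e^re⊑ : e^ (re w) ⊑ fromℚ r

open Growth

opaque

  growth-≈ : ∀ {r w v} → w ≈ v → Growth r w → Growth r v
  growth-≈ {r} {w} {v} e (mk p) .e^re⊑ = ⊑-trans {e^ (re v)} {e^ (re w)} {fromℚ r}
    (≈ᴿ⇒⊑ (e^-cong {re v} {re w} (≈ᴿ-sym {re w} {re v} (re≈ {w} {v} e)))) p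

  growth-+ : ∀ {r s w v} → 0ℚ ℚ.≤ r → 0ℚ ℚ.≤ s → Growth r w → Growth s v → Growth (r ℚ.* s) (w + v)
  growth-+ {r} {s} {w} {v} 0≤r 0≤s (mk p) (mk q) .e^re⊑ =
    ⊑-trans {e^ (re w +ᴿ re v)} {e^ (re w) *ᴿ e^ (re v)} {fromℚ (r ℚ.* s)}
      (≈ᴿ⇒⊑ (e^-+ (re w) (re v)))
      (⊑-trans {e^ (re w) *ᴿ e^ (re v)} {fromℚ r *ᴿ fromℚ s} {fromℚ (r ℚ.* s)}
        (*ᴿ-mono {e^ (re w)} {fromℚ r} {e^ (re v)} {fromℚ s}
          (e^-nonneg (re w)) (fromℚ-mono 0≤s) p q)
        (≡⇒⊑ λ n → refl))

  growth-exists : ∀ w → ∃ λ r → 0ℚ ℚ.≤ r × Growth r w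
  growth-exists w = let B , 0≤B , h = bounded (e^ (re w)) in
    B , 0≤B , mk (pointwise-⊑ λ n → ℚ.≤-trans (p≤∣p∣ (seq (e^ (re w)) n)) (h n))

  -- With t = -Re w ≥ δ, e^(-t) (1 + δ) ≤ e^(-t) e^t = 1, and r = 1/(1 + δ).
  growth-negative : ∀ {r δ w} → 0ℚ ℚ.≤ r → 0ℚ ℚ.≤ δ → (1ℚ ℚ.+ δ) ℚ.* r ≡ 1ℚ →
                    fromℚ δ ⊑ -ᴿ re w → Growth r w
  growth-negative {r} {δ} {w} 0≤r 0≤δ e δ⊑t .e^re⊑ =
    ⊑-trans {e^ s} {fromℚ r *ᴿ (e^ s *ᴿ (1ᴿ +ᴿ fromℚ δ))} {fromℚ r}
      (≡⇒⊑ λ n → trans (sym (ℚ.*-identityˡ (seq (e^ s) n)))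
        (trans (cong (ℚ._* seq (e^ s) n) (sym e))
          (solve 3 (λ r d x → (con 1ℚ :+ d) :* r :* x := r :* (x :* (con 1ℚ :+ d))) refl r δ (seq (e^ s) n))))
      (⊑-trans {fromℚ r *ᴿ (e^ s *ᴿ (1ᴿ +ᴿ fromℚ δ))} {fromℚ r *ᴿ 1ᴿ} {fromℚ r}
        (*ᴿ-mono {fromℚ r} {fromℚ r} {e^ s *ᴿ (1ᴿ +ᴿ fromℚ δ)} {1ᴿ}
          (fromℚ-mono 0≤r) (fromℚ-mono (ℚ.nonNegative⁻¹ 1ℚ)) ⊑-refl product⊑1)
        (≡⇒⊑ λ n → ℚ.*-identityʳ r))
    where
    s t : ℝ
    s = re w
    t = -ᴿ re w
    0⊑t : 0ᴿ ⊑ t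
    0⊑t = ⊑-trans {0ᴿ} {fromℚ δ} {t} (fromℚ-mono 0≤δ) δ⊑t
    1+δ⊑e^t : 1ᴿ +ᴿ fromℚ δ ⊑ e^ t
    1+δ⊑e^t = ⊑-trans {1ᴿ +ᴿ fromℚ δ} {1ᴿ +ᴿ t} {e^ t}
      (+ᴿ-mono {1ᴿ} {1ᴿ} {fromℚ δ} {t} ⊑-refl δ⊑t) (1+t⊑e^t t 0⊑t)
    product⊑1 : e^ s *ᴿ (1ᴿ +ᴿ fromℚ δ) ⊑ 1ᴿ
    product⊑1 = ⊑-trans {e^ s *ᴿ (1ᴿ +ᴿ fromℚ δ)} {e^ s *ᴿ e^ t} {1ᴿ}
      (*ᴿ-mono {e^ s} {e^ s} {1ᴿ +ᴿ fromℚ δ} {e^ t} (e^-nonneg s) (e^-nonneg t) ⊑-refl 1+δ⊑e^t)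
      (≈ᴿ⇒⊑ (≈ᴿ-trans {e^ s *ᴿ e^ t} {e^ (s +ᴿ t)} {1ᴿ}
        (≈ᴿ-sym {e^ (s +ᴿ t)} {e^ s *ᴿ e^ t} (e^-+ s t))
        (≈ᴿ-trans {e^ (s +ᴿ t)} {e^ 0ᴿ} {1ᴿ}
          (e^-cong {s +ᴿ t} {0ᴿ} (≡⇒≈ᴿ λ n → ℚ.+-inverseʳ (seq s n))) e^-0)))

-- Numbers of modulus one

circle : ∀ z → z * conj z ≈ 1ℂ → re z *ᴿ re z +ᴿ im z *ᴿ im z ≈ᴿ 1ᴿ
circle z h = ≈ᴿ-trans {re z *ᴿ re z +ᴿ im z *ᴿ im z} {re (z * (re z +𝕚 (-ᴿ im z)))} {1ᴿ}
  (≡⇒≈ᴿ λ n → solve 2 (λ a b → a :* a :+ b :* b := a :* a :- b :* (:- b)) refl (seq (re z) n) (seq (im z) n))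
  (≈ᴿ-trans {re (z * (re z +𝕚 (-ᴿ im z)))} {re (z * conj z)} {1ᴿ}
    (re≈ {z * (re z +𝕚 (-ᴿ im z))} {z * conj z}
      (*-cong {z} {z} {re z +𝕚 (-ᴿ im z)} {conj z} (ℂ-refl {z}) (ℂ-sym {conj z} {re z +𝕚 (-ᴿ im z)} (conj≈ z))))
    (re≈ {z * conj z} {1ℂ} h))

-- For purely imaginary w the conjugate is -w, so the product is e^0.
exp-unit : ∀ w → re w ≈ᴿ 0ᴿ → exp w * conj (exp w) ≈ 1ℂ
exp-unit w p = ℂ-trans {exp w * conj (exp w)} {exp w * exp (conj w)} {1ℂ}
  (*-cong {exp w} {exp w} {conj (exp w)} {exp (conj w)} (ℂ-refl {exp w}) (ℂ-sym (exp-conj w)))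
  (ℂ-trans {exp w * exp (conj w)} {exp (w + conj w)} {1ℂ}
    (ℂ-sym {exp (w + conj w)} {exp w * exp (conj w)} (exp-+ w (conj w)))
    (ℂ-trans {exp (w + conj w)} {exp 0ℂ} {1ℂ} (exp-cong {w + conj w} {0ℂ} w+w̄≈0) exp-0))
  where
  w+w̄≈0 : w + conj w ≈ 0ℂ
  w+w̄≈0 = ℂ-trans {w + conj w} {w + (re w +𝕚 (-ᴿ im w))} {0ℂ}
    (+-cong {w} {w} {conj w} {re w +𝕚 (-ᴿ im w)} (ℂ-refl {w}) (conj≈ w))
    (≈ᴿ-trans {re w +ᴿ re w} {0ᴿ +ᴿ 0ᴿ} {0ᴿ} (+ᴿ-cong {re w} {0ᴿ} {re w} {0ᴿ} p p) (≡⇒≈ᴿ λ n → refl) ,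
     ≡⇒≈ᴿ λ n → ℚ.+-inverseʳ (seq (im w) n))

small-circle : ∀ z → re z *ᴿ re z +ᴿ im z *ᴿ im z ≈ᴿ 1ᴿ → Small (nat 2) z
small-circle z h .norm⊑ = ⊑-trans {‖ z ‖} {1ᴿ +ᴿ 1ᴿ} {fromℚ (nat 2)}
  (+ᴿ-mono {∣ re z ∣ᴿ} {1ᴿ} {∣ im z ∣ᴿ} {1ᴿ}
    (square-⊑1 {re z} (square⊑ (re z) (im z) (≈ᴿ⇒⊑ h)))
    (square-⊑1 {im z} (square⊑ (im z) (re z)
      (⊑-trans {im z *ᴿ im z +ᴿ re z *ᴿ re z} {re z *ᴿ re z +ᴿ im z *ᴿ im z} {1ᴿ}
        (≡⇒⊑ λ n → ℚ.+-comm (seq (im z) n ℚ.* seq (im z) n) (seq (re z) n ℚ.* seq (re z) n)) (≈ᴿ⇒⊑ h)))))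
  (≡⇒⊑ λ n → refl)
  where
  square⊑ : ∀ x y → x *ᴿ x +ᴿ y *ᴿ y ⊑ 1ᴿ → x *ᴿ x ⊑ 1ᴿ
  square⊑ x y h = ⊑-trans {x *ᴿ x} {x *ᴿ x +ᴿ 0ᴿ} {1ᴿ}
    (≡⇒⊑ λ n → sym (ℚ.+-identityʳ (seq x n ℚ.* seq x n)))
    (⊑-trans {x *ᴿ x +ᴿ 0ᴿ} {x *ᴿ x +ᴿ y *ᴿ y} {1ᴿ}
      (+ᴿ-mono {x *ᴿ x} {x *ᴿ x} {0ᴿ} {y *ᴿ y} ⊑-refl (square-nonneg y)) h)

small-real : ∀ {r} z → 0ℚ ℚ.≤ r → 0ᴿ ⊑ re z → re z ⊑ fromℚ r → im z ≈ᴿ 0ᴿ → Small r z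
small-real {r} z 0≤r h p q .norm⊑ = ⊑-trans {‖ z ‖} {fromℚ r +ᴿ 0ᴿ} {fromℚ r}
  (+ᴿ-mono {∣ re z ∣ᴿ} {fromℚ r} {∣ im z ∣ᴿ} {0ᴿ}
    (∣∣ᴿ-least {re z} {fromℚ r} p
      (⊑-trans { -ᴿ re z} {0ᴿ} {fromℚ r}
        (⊑-trans { -ᴿ re z} { -ᴿ 0ᴿ} {0ᴿ} (-ᴿ-anti {0ᴿ} {re z} h) (≡⇒⊑ λ n → refl))
        (fromℚ-mono 0≤r)))
    (≈ᴿ⇒⊑ (≈ᴿ-trans {∣ im z ∣ᴿ} {∣ 0ᴿ ∣ᴿ} {0ᴿ} (∣∣ᴿ-cong {im z} {0ᴿ} q) (≡⇒≈ᴿ λ n → refl))))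
  (≡⇒⊑ λ n → ℚ.+-identityʳ r)

opaque

  -- e^w = e^(Re w) e^(i Im w): the first factor is real and in [0 , r], the second lies on the unit
  -- circle.
  growth-small : ∀ {r} w → 0ℚ ℚ.≤ r → Growth r w → Small (r ℚ.* nat 2) (exp w)
  growth-small {r} w 0≤r (mk p) = small-≈ {r ℚ.* nat 2} {exp (fromℝ (re w)) * exp (0ᴿ +𝕚 im w)} {exp w}
    (ℂ-trans {exp (fromℝ (re w)) * exp (0ᴿ +𝕚 im w)} {exp (fromℝ (re w) + (0ᴿ +𝕚 im w))} {exp w}
      (ℂ-sym {exp (fromℝ (re w) + (0ᴿ +𝕚 im w))} {exp (fromℝ (re w)) * exp (0ᴿ +𝕚 im w)}
        (exp-+ (fromℝ (re w)) (0ᴿ +𝕚 im w)))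
      (exp-cong {fromℝ (re w) + (0ᴿ +𝕚 im w)} {w} (≡⇒≈
        (λ n → ℚ.+-identityʳ (seq (re w) n)) (λ n → ℚ.+-identityˡ (seq (im w) n)))))
    (small-* {r} {nat 2} {exp (fromℝ (re w))} {exp (0ᴿ +𝕚 im w)} 0≤r (ℚ.nonNegative⁻¹ (nat 2))
      (small-real {r} (exp (fromℝ (re w))) 0≤r
        (⊑-trans {0ᴿ} {e^ (re w)} {re (exp (fromℝ (re w)))} (e^-nonneg (re w)) (≈ᴿ⇒⊑ (e^≈ (re w))))
        (⊑-trans {re (exp (fromℝ (re w)))} {e^ (re w)} {fromℚ r}
          (≈ᴿ⇒⊑ (≈ᴿ-sym {e^ (re w)} {re (exp (fromℝ (re w)))} (e^≈ (re w)))) p)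
        (im-exp-real (re w)))
      (small-circle (exp (0ᴿ +𝕚 im w)) (circle (exp (0ᴿ +𝕚 im w)) (exp-unit (0ᴿ +𝕚 im w) (≈ᴿ-refl {0ᴿ})))))

ℂ-exponential : ExponentialAlgebra
ℂ-exponential = record
  { algebra       = ℂ-algebra
  ; exp           = exp
  ; exp-cong      = λ {z} {w} → exp-cong {z} {w}
  ; exp-+         = ℂE.exp-+
  ; exp-0         = ℂE.exp-0
  ; Growth        = Growth
  ; growth-≈      = λ {r} {w} {v} → growth-≈ {r} {w} {v}
  ; growth-≤      = λ {r} {s} {w} h (mk p) → mk (⊑-trans {e^ (re w)} {fromℚ r} {fromℚ s} p (fromℚ-mono h))
  ; growth-0      = growth-≈ {1ℚ} {0ℂ} {0ᶜ} (ℂ-sym {0ᶜ} {0ℂ} 0ᶜ≈) (mk (≈ᴿ⇒⊑ {e^ 0ᴿ} {1ᴿ} e^-0))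
  ; growth-+      = λ {r} {s} {w} {v} 0≤r 0≤s p q →
      growth-≈ {r ℚ.* s} {w + v} {plus w v} (ℂ-sym {plus w v} {w + v} (plus≈ w v)) (growth-+ {r} {s} {w} {v} 0≤r 0≤s p q)
  ; growth-exists = growth-exists
  ; growth-small  = λ {r} w → growth-small {r} w
  }

-- The numbers e^{πi} and e^{2πi/3}

null-+ : ∀ {x y} → x ≈ᴿ 0ᴿ → y ≈ᴿ 0ᴿ → x +ᴿ y ≈ᴿ 0ᴿ
null-+ {x} {y} p q = ≈ᴿ-trans {x +ᴿ y} {0ᴿ +ᴿ 0ᴿ} {0ᴿ} (+ᴿ-cong {x} {0ᴿ} {y} {0ᴿ} p q) (≡⇒≈ᴿ λ n → refl)

null-* : ∀ {x} y → x ≈ᴿ 0ᴿ → y *ᴿ x ≈ᴿ 0ᴿ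
null-* {x} y p = ≈ᴿ-trans {y *ᴿ x} {x *ᴿ y} {0ᴿ} (*ᴿ-comm y x) (*ᴿ-zeroˡ {x} y p)

null-of : ∀ {x y} → x ≈ᴿ y → x -ᴿ y ≈ᴿ 0ᴿ
null-of {x} {y} p = ≈ᴿ-of-diff {x -ᴿ y} {0ᴿ} {x} {y} p (λ n → ℚ.+-identityʳ (seq x n ℚ.- seq y n))

of-null : ∀ {x y} → x -ᴿ y ≈ᴿ 0ᴿ → x ≈ᴿ y
of-null {x} {y} p = ≈ᴿ-of-diff {x} {y} {x -ᴿ y} {0ᴿ} p (λ n → sym (ℚ.+-identityʳ (seq x n ℚ.- seq y n)))

-- Used for ideal membership: x is rewritten termwise as a combination of quantities that are known
-- to vanish.
null-combination : ∀ {x y} → y ≈ᴿ 0ᴿ → (∀ n → seq x n ≡ seq y n) → x ≈ᴿ 0ᴿ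
null-combination {x} {y} p e = ≈ᴿ-trans {x} {y} {0ᴿ} (≡⇒≈ᴿ e) p

-- A unit complex number with vanishing sin 2t and positive sin t is i, whose square is −1.
square-of-half : ∀ z → 0ᴿ <ᴿ im z → re z *ᴿ re z +ᴿ im z *ᴿ im z ≈ᴿ 1ᴿ → im (z * z) ≈ᴿ 0ᴿ → z * z ≈ - 1ℂ
square-of-half z 0<b unit sin0 = real , imaginary
  where
  a b : ℝ
  a = re z
  b = im z
  a≈0 : a ≈ᴿ 0ᴿ
  a≈0 = *ᴿ-cancelˡ {b} {a} 0<b (null-combination {b *ᴿ a} {fromℚ ½ *ᴿ im (z * z)}
    (null-* {im (z * z)} (fromℚ ½) sin0)
    (λ n → solve 2 (λ a b → b :* a := con ½ :* (a :* b :+ b :* a)) refl (seq (re z) n) (seq (im z) n)))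
  real : re (z * z) ≈ᴿ re (- 1ℂ)
  real = of-null {re (z * z)} {re (- 1ℂ)} (null-combination
    {re (z * z) -ᴿ re (- 1ℂ)} {fromℚ (nat 2) *ᴿ a *ᴿ a +ᴿ (-ᴿ 1ᴿ) *ᴿ ((re z *ᴿ re z +ᴿ im z *ᴿ im z) -ᴿ 1ᴿ)}
    (null-+ {fromℚ (nat 2) *ᴿ a *ᴿ a} {(-ᴿ 1ᴿ) *ᴿ ((re z *ᴿ re z +ᴿ im z *ᴿ im z) -ᴿ 1ᴿ)}
      (null-* {a} (fromℚ (nat 2) *ᴿ a) a≈0)
      (null-* {(re z *ᴿ re z +ᴿ im z *ᴿ im z) -ᴿ 1ᴿ} (-ᴿ 1ᴿ) (null-of {re z *ᴿ re z +ᴿ im z *ᴿ im z} {1ᴿ} unit)))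
    (λ n → solve 2 (λ a b → (a :* a :- b :* b) :- (:- con 1ℚ)
        := con (nat 2) :* a :* a :+ (:- con 1ℚ) :* ((a :* a :+ b :* b) :- con 1ℚ)) refl (seq (re z) n) (seq (im z) n)))
  imaginary : im (z * z) ≈ᴿ im (- 1ℂ)
  imaginary = ≈ᴿ-trans {im (z * z)} {0ᴿ} {im (- 1ℂ)} sin0 (≡⇒≈ᴿ λ n → refl)

-- With z = a + bi, E₁ = 3a² − b², E₂ = a² + b² − 1 and E₃ = Re z³ − 1:
-- 1 + 2a = −E₃ + a (E₁ − 2E₂).
primitive-cube-root : ∀ z → 0ᴿ <ᴿ im z → re z *ᴿ re z +ᴿ im z *ᴿ im z ≈ᴿ 1ᴿ → z * (z * z) ≈ 1ℂ →
                      1ᴿ +ᴿ (re z +ᴿ re z) ≈ᴿ 0ᴿ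
primitive-cube-root z 0<b unit cube = null-combination
  {1ᴿ +ᴿ (re z +ᴿ re z)} {(-ᴿ 1ᴿ) *ᴿ E₃ +ᴿ a *ᴿ (E₁ +ᴿ fromℚ (ℚ.- nat 2) *ᴿ E₂)}
  (null-+ {(-ᴿ 1ᴿ) *ᴿ E₃} {a *ᴿ (E₁ +ᴿ fromℚ (ℚ.- nat 2) *ᴿ E₂)}
    (null-* {E₃} (-ᴿ 1ᴿ) (null-of {re (z * (z * z))} {1ᴿ} (re≈ {z * (z * z)} {1ℂ} cube)))
    (null-* {E₁ +ᴿ fromℚ (ℚ.- nat 2) *ᴿ E₂} a (null-+ {E₁} {fromℚ (ℚ.- nat 2) *ᴿ E₂} E₁≈0
      (null-* {E₂} (fromℚ (ℚ.- nat 2)) (null-of {re z *ᴿ re z +ᴿ im z *ᴿ im z} {1ᴿ} unit)))))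
  (λ n → solve 2 (λ a b → con 1ℚ :+ (a :+ a)
      := (:- con 1ℚ) :* ((a :* (a :* a :- b :* b) :- b :* (a :* b :+ b :* a)) :- con 1ℚ)
         :+ a :* ((con (nat 3) :* a :* a :- b :* b) :+ con (ℚ.- nat 2) :* ((a :* a :+ b :* b) :- con 1ℚ))) refl
    (seq (re z) n) (seq (im z) n))
  where
  a b E₁ E₂ E₃ : ℝ
  a  = re z
  b  = im z
  E₁ = fromℚ (nat 3) *ᴿ re z *ᴿ re z -ᴿ im z *ᴿ im z
  E₂ = (re z *ᴿ re z +ᴿ im z *ᴿ im z) -ᴿ 1ᴿ
  E₃ = re (z * (z * z)) -ᴿ 1ᴿ
  E₁≈0 : E₁ ≈ᴿ 0ᴿ
  -- Im z³ = b E₁ vanishes and b > 0.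
  E₁≈0 = *ᴿ-cancelˡ {b} {E₁} 0<b (null-combination {b *ᴿ E₁} {im (z * (z * z))}
    (≈ᴿ-trans {im (z * (z * z))} {im 1ℂ} {0ᴿ} (im≈ {z * (z * z)} {1ℂ} cube) (≡⇒≈ᴿ λ n → refl))
    (λ n → solve 2 (λ a b → b :* (con (nat 3) :* a :* a :- b :* b)
        := a :* (a :* b :+ b :* a) :+ b :* (a :* a :- b :* b)) refl (seq (re z) n) (seq (im z) n)))

opaque

  cis : ℝ → ℂ
  cis t = exp (𝕚 * fromℝ t)

  cis≈ : ∀ t → cis t ≈ exp (𝕚 * fromℝ t)
  cis≈ t = ℂ-refl {exp (𝕚 * fromℝ t)}

  im-cis : ∀ t → sin t ≡ im (cis t)
  im-cis t = refl

cis-cong : ∀ {s t} → s ≈ᴿ t → cis s ≈ cis t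
cis-cong {s} {t} p = ℂ-trans {cis s} {exp (𝕚 * fromℝ s)} {cis t} (cis≈ s)
  (ℂ-trans {exp (𝕚 * fromℝ s)} {exp (𝕚 * fromℝ t)} {cis t}
    (exp-cong {𝕚 * fromℝ s} {𝕚 * fromℝ t}
      (*-cong {𝕚} {𝕚} {fromℝ s} {fromℝ t} (ℂ-refl {𝕚}) (p , ≈ᴿ-refl {0ᴿ})))
    (ℂ-sym {cis t} {exp (𝕚 * fromℝ t)} (cis≈ t)))

cis-+ : ∀ s t → cis (s +ᴿ t) ≈ cis s * cis t
cis-+ s t = ℂ-trans {cis (s +ᴿ t)} {exp (𝕚 * fromℝ (s +ᴿ t))} {cis s * cis t} (cis≈ (s +ᴿ t))
  (ℂ-trans {exp (𝕚 * fromℝ (s +ᴿ t))} {exp (𝕚 * fromℝ s + 𝕚 * fromℝ t)} {cis s * cis t}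
    (exp-cong {𝕚 * fromℝ (s +ᴿ t)} {𝕚 * fromℝ s + 𝕚 * fromℝ t} (≡⇒≈
      (λ n → solve 2 (λ s t → con 0ℚ :* (s :+ t) :- con 1ℚ :* con 0ℚ
          := (con 0ℚ :* s :- con 1ℚ :* con 0ℚ) :+ (con 0ℚ :* t :- con 1ℚ :* con 0ℚ)) refl (seq s n) (seq t n))
      (λ n → solve 2 (λ s t → con 0ℚ :* con 0ℚ :+ con 1ℚ :* (s :+ t)
          := (con 0ℚ :* con 0ℚ :+ con 1ℚ :* s) :+ (con 0ℚ :* con 0ℚ :+ con 1ℚ :* t)) refl (seq s n) (seq t n))))
    (ℂ-trans {exp (𝕚 * fromℝ s + 𝕚 * fromℝ t)} {exp (𝕚 * fromℝ s) * exp (𝕚 * fromℝ t)} {cis s * cis t}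
      (exp-+ (𝕚 * fromℝ s) (𝕚 * fromℝ t))
      (*-cong {exp (𝕚 * fromℝ s)} {cis s} {exp (𝕚 * fromℝ t)} {cis t}
        (ℂ-sym {cis s} {exp (𝕚 * fromℝ s)} (cis≈ s)) (ℂ-sym {cis t} {exp (𝕚 * fromℝ t)} (cis≈ t)))))

cis-unit : ∀ t → re (cis t) *ᴿ re (cis t) +ᴿ im (cis t) *ᴿ im (cis t) ≈ᴿ 1ᴿ
cis-unit t = circle (cis t) (ℂ-trans {cis t * conj (cis t)} {exp (𝕚 * fromℝ t) * conj (exp (𝕚 * fromℝ t))} {1ℂ}
  (*-cong {cis t} {exp (𝕚 * fromℝ t)} {conj (cis t)} {conj (exp (𝕚 * fromℝ t))}
    (cis≈ t) (conj-cong {cis t} {exp (𝕚 * fromℝ t)} (cis≈ t)))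
  (exp-unit (𝕚 * fromℝ t) (≡⇒≈ᴿ λ n → solve 1 (λ t → con 0ℚ :* t :- con 1ℚ :* con 0ℚ := con 0ℚ) refl (seq t n))))

<ᴿ-scale : ∀ {π} r → 0ℚ ℚ.< r → 0ᴿ <ᴿ π → 0ᴿ <ᴿ fromℚ r *ᴿ π
<ᴿ-scale {π} r 0<r (ε , 0<ε , N , p) = r ℚ.* ε , 0<* 0<r 0<ε , N , λ n h →
  ≤-by (ℚ.+-identityˡ (r ℚ.* ε)) refl
    (ℚ.*-monoˡ-≤-nonNeg r {{ℚ.nonNegative (ℚ.<⇒≤ 0<r)}} (≤-by (sym (ℚ.+-identityˡ ε)) refl (p n h)))

<ᴿ-fraction : ∀ {π} r s → r ℚ.+ s ≡ 1ℚ → 0ℚ ℚ.< s → 0ᴿ <ᴿ π → fromℚ r *ᴿ π <ᴿ π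
<ᴿ-fraction {π} r s r+s≡1 0<s (ε , 0<ε , N , p) = s ℚ.* ε , 0<* 0<s 0<ε , N , λ n h →
  ≤-by refl (trans (sym (ℚ.*-identityˡ (seq π n))) (trans (cong (ℚ._* seq π n) (sym r+s≡1)) (ℚ.*-distribʳ-+ (seq π n) r s)))
    (ℚ.+-monoʳ-≤ (r ℚ.* seq π n)
      (ℚ.*-monoˡ-≤-nonNeg s {{ℚ.nonNegative (ℚ.<⇒≤ 0<s)}} (≤-by (sym (ℚ.+-identityˡ ε)) refl (p n h))))

module Pi (π : ℝ) (isPi : IsPi π) where

  open IsPi isPi

  -- sin π = 0 alone leaves e^(πi) = ±1; the sign is settled at the half angle, where the sine is
  -- positive.
  cis-π : cis π ≈ - 1ℂ
  cis-π = ℂ-trans {cis π} {cis h * cis h} { - 1ℂ} double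
    (square-of-half (cis h)
      (subst (0ᴿ <ᴿ_) (im-cis h) (sin-positive h (<ᴿ-scale {π} ½ 0<½ π-positive) (<ᴿ-fraction {π} ½ ½ refl 0<½ π-positive)))
      (cis-unit h)
      (≈ᴿ-trans {im (cis h * cis h)} {im (cis π)} {0ᴿ}
        (im≈ {cis h * cis h} {cis π} (ℂ-sym {cis π} {cis h * cis h} double)) (subst (_≈ᴿ 0ᴿ) (im-cis π) (mk sin-π))))
    where
    h : ℝ
    h = fromℚ ½ *ᴿ π
    double : cis π ≈ cis h * cis h
    double = ℂ-trans {cis π} {cis (h +ᴿ h)} {cis h * cis h}
      (cis-cong {π} {h +ᴿ h} (≡⇒≈ᴿ λ n → sym (halves (seq π n)))) (cis-+ h h)

  t : ℝ
  t = fromℚ ⅔ *ᴿ π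

  cis-2π : cis (π +ᴿ π) ≈ 1ℂ
  cis-2π = ℂ-trans {cis (π +ᴿ π)} {cis π * cis π} {1ℂ} (cis-+ π π)
    (ℂ-trans {cis π * cis π} {(- 1ℂ) * (- 1ℂ)} {1ℂ} (*-cong {cis π} { - 1ℂ} {cis π} { - 1ℂ} cis-π cis-π)
      (≡⇒≈ (λ n → refl) (λ n → refl)))

  cis-t-cube : cis t * (cis t * cis t) ≈ 1ℂ
  cis-t-cube = ℂ-trans {cis t * (cis t * cis t)} {cis (t +ᴿ (t +ᴿ t))} {1ℂ}
    (ℂ-sym {cis (t +ᴿ (t +ᴿ t))} {cis t * (cis t * cis t)}
      (ℂ-trans {cis (t +ᴿ (t +ᴿ t))} {cis t * cis (t +ᴿ t)} {cis t * (cis t * cis t)} (cis-+ t (t +ᴿ t))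
        (*-cong {cis t} {cis t} {cis (t +ᴿ t)} {cis t * cis t} (ℂ-refl {cis t}) (cis-+ t t))))
    (ℂ-trans {cis (t +ᴿ (t +ᴿ t))} {cis (π +ᴿ π)} {1ℂ}
      (cis-cong {t +ᴿ (t +ᴿ t)} {π +ᴿ π} (≡⇒≈ᴿ λ n →
        solve 1 (λ x → con ⅔ :* x :+ (con ⅔ :* x :+ con ⅔ :* x) := x :+ x) refl (seq π n)))
      cis-2π)

  -- The positive imaginary part rules out the trivial cube root of unity.
  1+2cos : 1ᴿ +ᴿ (re (cis t) +ᴿ re (cis t)) ≈ᴿ 0ᴿ
  1+2cos = primitive-cube-root (cis t)
    (subst (0ᴿ <ᴿ_) (im-cis t) (sin-positive t (<ᴿ-scale {π} ⅔ (ℚ.positive⁻¹ ⅔) π-positive) (<ᴿ-fraction {π} ⅔ ⅓ refl (ℚ.positive⁻¹ ⅓) π-positive)))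
    (cis-unit t) cis-t-cube

  p : ℂ
  p = times (fromℝ π) 𝕚

  opaque

    exp-p : exp p ≈ negate 1ᶜ
    exp-p = ℂ-trans {exp p} {cis π} {negate 1ᶜ}
      (ℂ-trans {exp p} {exp (𝕚 * fromℝ π)} {cis π} (exp-cong {p} {𝕚 * fromℝ π} (ℂ-trans {p} {fromℝ π * 𝕚} {𝕚 * fromℝ π} (times≈ (fromℝ π) 𝕚) (≡⇒≈
        (λ n → solve 1 (λ x → x :* con 0ℚ :- con 0ℚ :* con 1ℚ := con 0ℚ :* x :- con 1ℚ :* con 0ℚ) refl (seq π n))
        (λ n → solve 1 (λ x → x :* con 1ℚ :+ con 0ℚ :* con 0ℚ := con 0ℚ :* con 0ℚ :+ con 1ℚ :* x) refl (seq π n)))))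
        (ℂ-sym {cis π} {exp (𝕚 * fromℝ π)} (cis≈ π)))
      (ℂ-trans {cis π} { - 1ℂ} {negate 1ᶜ} cis-π
        (ℂ-sym {negate 1ᶜ} { - 1ℂ} (ℂ-trans {negate 1ᶜ} { - 1ᶜ} { - 1ℂ} (negate≈ 1ᶜ) (neg-cong {1ᶜ} {1ℂ} 1ᶜ≈))))

    exp-⅔p : exp (times (scalar ⅔) p) ≈ cis t
    exp-⅔p = ℂ-trans {exp (times (scalar ⅔) p)} {exp (𝕚 * fromℝ t)} {cis t} (exp-cong {times (scalar ⅔) p} {𝕚 * fromℝ t}
      (ℂ-trans {times (scalar ⅔) p} {scalar ⅔ * p} {𝕚 * fromℝ t} (times≈ (scalar ⅔) p)
        (ℂ-trans {scalar ⅔ * p} {fromℝ (fromℚ ⅔) * (fromℝ π * 𝕚)} {𝕚 * fromℝ t}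
          (*-cong {scalar ⅔} {fromℝ (fromℚ ⅔)} {p} {fromℝ π * 𝕚} (scalar≈ ⅔) (times≈ (fromℝ π) 𝕚)) (≡⇒≈
          (λ n → solve 1 (λ x → con ⅔ :* (x :* con 0ℚ :- con 0ℚ :* con 1ℚ) :- con 0ℚ :* (x :* con 1ℚ :+ con 0ℚ :* con 0ℚ)
              := con 0ℚ :* (con ⅔ :* x) :- con 1ℚ :* con 0ℚ) refl (seq π n))
          (λ n → solve 1 (λ x → con ⅔ :* (x :* con 1ℚ :+ con 0ℚ :* con 0ℚ) :+ con 0ℚ :* (x :* con 0ℚ :- con 0ℚ :* con 1ℚ)
              := con 0ℚ :* con 0ℚ :+ con 1ℚ :* (con ⅔ :* x)) refl (seq π n))))))
      (ℂ-sym {cis t} {exp (𝕚 * fromℝ t)} (cis≈ t))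

    exp-neg-⅔p : exp (times (scalar (ℚ.- ⅔)) p) ≈ conj (cis t)
    exp-neg-⅔p = ℂ-trans {exp (times (scalar (ℚ.- ⅔)) p)} {exp (conj (𝕚 * fromℝ t))} {conj (cis t)}
      (exp-cong {times (scalar (ℚ.- ⅔)) p} {conj (𝕚 * fromℝ t)}
        (ℂ-trans {times (scalar (ℚ.- ⅔)) p} {scalar (ℚ.- ⅔) * p} {conj (𝕚 * fromℝ t)} (times≈ (scalar (ℚ.- ⅔)) p)
          (ℂ-trans {scalar (ℚ.- ⅔) * p} {fromℝ (fromℚ (ℚ.- ⅔)) * (fromℝ π * 𝕚)} {conj (𝕚 * fromℝ t)}
            (*-cong {scalar (ℚ.- ⅔)} {fromℝ (fromℚ (ℚ.- ⅔))} {p} {fromℝ π * 𝕚} (scalar≈ (ℚ.- ⅔)) (times≈ (fromℝ π) 𝕚))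
            (ℂ-sym {conj (𝕚 * fromℝ t)} {fromℝ (fromℚ (ℚ.- ⅔)) * (fromℝ π * 𝕚)}
              (ℂ-trans {conj (𝕚 * fromℝ t)} {re (𝕚 * fromℝ t) +𝕚 (-ᴿ im (𝕚 * fromℝ t))} {fromℝ (fromℚ (ℚ.- ⅔)) * (fromℝ π * 𝕚)}
                (conj≈ (𝕚 * fromℝ t)) (≡⇒≈
                (λ n → solve 1 (λ x → con 0ℚ :* (con ⅔ :* x) :- con 1ℚ :* con 0ℚ
                    := con (ℚ.- ⅔) :* (x :* con 0ℚ :- con 0ℚ :* con 1ℚ) :- con 0ℚ :* (x :* con 1ℚ :+ con 0ℚ :* con 0ℚ)) refl (seq π n))
                (λ n → solve 1 (λ x → :- (con 0ℚ :* con 0ℚ :+ con 1ℚ :* (con ⅔ :* x))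
                    := con (ℚ.- ⅔) :* (x :* con 1ℚ :+ con 0ℚ :* con 0ℚ) :+ con 0ℚ :* (x :* con 0ℚ :- con 0ℚ :* con 1ℚ)) refl (seq π n))))))))
      (ℂ-trans {exp (conj (𝕚 * fromℝ t))} {conj (exp (𝕚 * fromℝ t))} {conj (cis t)} (exp-conj (𝕚 * fromℝ t))
        (conj-cong {exp (𝕚 * fromℝ t)} {cis t} (ℂ-sym {cis t} {exp (𝕚 * fromℝ t)} (cis≈ t))))

    -- The two roots are conjugate, so the sum is 1 + 2 Re ω.
    ω-sum : plus (plus 1ᶜ (exp (times (scalar ⅔) p))) (exp (times (scalar (ℚ.- ⅔)) p)) ≈ 0ᶜ
    ω-sum = ℂ-trans {plus (plus 1ᶜ (exp (times (scalar ⅔) p))) (exp (times (scalar (ℚ.- ⅔)) p))} {plus (plus 1ᶜ (cis t)) (conj (cis t))} {0ᶜ}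
      (ℂR.+-cong (ℂR.+-congˡ exp-⅔p) exp-neg-⅔p)
      (conjugates (cis t) 1+2cos)
      where
      conjugates : ∀ z → 1ᴿ +ᴿ (re z +ᴿ re z) ≈ᴿ 0ᴿ → plus (plus 1ᶜ z) (conj z) ≈ 0ᶜ
      conjugates z h = ℂ-trans {plus (plus 1ᶜ z) (conj z)} {(1ℂ + z) + (re z +𝕚 (-ᴿ im z))} {0ᶜ}
        (ℂ-trans {plus (plus 1ᶜ z) (conj z)} {plus 1ᶜ z + conj z} {(1ℂ + z) + (re z +𝕚 (-ᴿ im z))}
          (plus≈ (plus 1ᶜ z) (conj z))
          (+-cong {plus 1ᶜ z} {1ℂ + z} {conj z} {re z +𝕚 (-ᴿ im z)}
            (ℂ-trans {plus 1ᶜ z} {1ᶜ + z} {1ℂ + z} (plus≈ 1ᶜ z) (+-cong {1ᶜ} {1ℂ} {z} {z} 1ᶜ≈ (ℂ-refl {z})))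
            (conj≈ z)))
        (ℂ-trans {(1ℂ + z) + (re z +𝕚 (-ᴿ im z))} {0ℂ} {0ᶜ}
          (null-combination {re ((1ℂ + z) + (re z +𝕚 (-ᴿ im z)))} {1ᴿ +ᴿ (re z +ᴿ re z)} h (λ n → ℚ.+-assoc 1ℚ (seq (re z) n) (seq (re z) n)) ,
           ≡⇒≈ᴿ λ n → solve 1 (λ b → (con 0ℚ :+ b) :+ (:- b) := con 0ℚ) refl (seq (im z) n))
          (ℂ-sym {0ᶜ} {0ℂ} 0ᶜ≈))

  open Domination ℂ-exponential using (Decaying)

  -- The exponent πiτ of q, not q itself.
  nome : ℍ → ℂ
  nome τ = times p (point τ)

  re-nome : ∀ τ → π *ᴿ im τ ⊑ -ᴿ re (times p τ)
  re-nome τ = ⊑-trans {π *ᴿ im τ} { -ᴿ re (fromℝ π * 𝕚 * τ)} { -ᴿ re (times p τ)}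
    (≡⇒⊑ λ n → solve 3 (λ x a b → x :* b := :- ((x :* con 0ℚ :- con 0ℚ :* con 1ℚ) :* a :- (x :* con 1ℚ :+ con 0ℚ :* con 0ℚ) :* b)) refl
      (seq π n) (seq (re τ) n) (seq (im τ) n))
    (-ᴿ-anti {re (times p τ)} {re (fromℝ π * 𝕚 * τ)}
      (≈ᴿ⇒⊑ (re≈ {times p τ} {fromℝ π * 𝕚 * τ} (ℂ-trans {times p τ} {p * τ} {fromℝ π * 𝕚 * τ}
        (times≈ p τ) (*-cong {p} {fromℝ π * 𝕚} {τ} {τ} (times≈ (fromℝ π) 𝕚) (ℂ-refl {τ}))))))

  -- -Re(πiτ) = π Im τ is at least δ, the product of the rational lower bounds that the positivity
  -- proofs of π and Im τ contain.
  nome-decays : ∀ τ → Decaying (nome τ)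
  nome-decays τ =
    let ε , 0<ε , N , h  = π-positive
        ε′ , 0<ε′ , N′ , h′ = positive τ
        δ = ε ℚ.* ε′
        0<δ = 0<* 0<ε 0<ε′
        0≤δ = ℚ.<⇒≤ 0<δ
        ρ , 0<ρ , e = quotient 1ℚ (1ℚ ℚ.+ δ) (ℚ.positive⁻¹ 1ℚ) (ℚ.+-mono-<-≤ (ℚ.positive⁻¹ 1ℚ) 0≤δ)
    in record
      { ρ = ρ ; δ = δ ; 0≤ρ = ℚ.<⇒≤ 0<ρ ; 0<δ = 0<δ ; ρ-inv = e
      ; decay = growth-negative {ρ} {δ} {nome τ} (ℚ.<⇒≤ 0<ρ) 0≤δ e
          (⊑-trans {fromℚ δ} {π *ᴿ im (point τ)} { -ᴿ re (nome τ)}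
            (mk λ η 0<η → eventually-zip {λ n → 0ℚ ℚ.+ ε ℚ.≤ seq π n} {λ n → 0ℚ ℚ.+ ε′ ℚ.≤ seq (im (point τ)) n}
                {λ n → δ ℚ.≤ seq π n ℚ.* seq (im (point τ)) n ℚ.+ η}
              (λ n a b → ≤-weaken 0<η (*-mono (ℚ.<⇒≤ 0<ε) (ℚ.≤-trans (ℚ.<⇒≤ 0<ε′) (≤-by (sym (ℚ.+-identityˡ ε′)) refl b))
                (≤-by (sym (ℚ.+-identityˡ ε)) refl a) (≤-by (sym (ℚ.+-identityˡ ε′)) refl b)))
              (N , h) (N′ , h′))
            (re-nome (point τ)))
      }

-- The terms of the series as exponentials

open SetoidReasoning ℂR.setoid
open AlgebraSolver ℂ-algebra

-- The exponents z₀, z₁, ... are left to unification with the definition of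
-- the term, which compares the sequences of rationals only.
exp-product₂ : ∀ {z₀ z₁ : ℂ} t →
  (∀ m → seq (re t) m ≡ seq (re (exp z₀ * exp z₁)) m) → (∀ m → seq (im t) m ≡ seq (im (exp z₀ * exp z₁)) m) →
  ∀ {w₀ w₁} → z₀ ≈ w₀ → z₁ ≈ w₁ → t ≈ times (exp w₀) (exp w₁)
exp-product₂ {z₀} {z₁} t e f {w₀} {w₁} h₀ h₁ = ℂ-trans {t} {exp z₀ * exp z₁} {times (exp w₀) (exp w₁)} (≡⇒≈ e f)
  (ℂ-trans {exp z₀ * exp z₁} {times (exp z₀) (exp z₁)} {times (exp w₀) (exp w₁)}
    (ℂ-sym {times (exp z₀) (exp z₁)} {exp z₀ * exp z₁} (times≈ (exp z₀) (exp z₁)))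
    (ℂR.*-cong (exp-cong h₀) (exp-cong h₁)))

product₃-exp : ∀ {z₀ z₁ : ℂ} t a →
  (∀ m → seq (re t) m ≡ seq (re (a * exp z₀ * exp z₁)) m) → (∀ m → seq (im t) m ≡ seq (im (a * exp z₀ * exp z₁)) m) →
  ∀ {e₀ w₀ w₁} → a ≈ exp e₀ → z₀ ≈ w₀ → z₁ ≈ w₁ → t ≈ exp (plus (plus e₀ w₀) w₁)
product₃-exp {z₀} {z₁} t a e f {e₀} {w₀} {w₁} h h₀ h₁ = ℂ-trans {t} {a * exp z₀ * exp z₁} {exp (plus (plus e₀ w₀) w₁)}
  (≡⇒≈ e f)
  (ℂ-trans {a * exp z₀ * exp z₁} {times (times a (exp z₀)) (exp z₁)} {exp (plus (plus e₀ w₀) w₁)}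
    (ℂ-sym {times (times a (exp z₀)) (exp z₁)} {a * exp z₀ * exp z₁}
      (ℂ-trans {times (times a (exp z₀)) (exp z₁)} {times a (exp z₀) * exp z₁} {a * exp z₀ * exp z₁}
        (times≈ (times a (exp z₀)) (exp z₁))
        (*-cong {times a (exp z₀)} {a * exp z₀} {exp z₁} {exp z₁} (times≈ a (exp z₀)) (ℂ-refl {exp z₁}))))
    (ℂ-trans {times (times a (exp z₀)) (exp z₁)} {times (times (exp e₀) (exp w₀)) (exp w₁)} {exp (plus (plus e₀ w₀) w₁)}
      (ℂR.*-cong (ℂR.*-cong h (exp-cong h₀)) (exp-cong h₁))
      (ℂR.sym (ℂR.trans (ℂE.exp-+ (plus e₀ w₀) w₁) (ℂR.*-congʳ (ℂE.exp-+ e₀ w₀))))))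

exp-product₃ : ∀ {z₀ z₁ z₂ : ℂ} t →
  (∀ m → seq (re t) m ≡ seq (re (exp z₀ * exp z₁ * exp z₂)) m) → (∀ m → seq (im t) m ≡ seq (im (exp z₀ * exp z₁ * exp z₂)) m) →
  ∀ {w₀ w₁ w₂} → z₀ ≈ w₀ → z₁ ≈ w₁ → z₂ ≈ w₂ → t ≈ exp (plus (plus w₀ w₁) w₂)
exp-product₃ {z₀} t e f h₀ h₁ h₂ = product₃-exp t (exp z₀) e f (exp-cong h₀) h₁ h₂

exp-times : ∀ {z₀ : ℂ} t a →
  (∀ m → seq (re t) m ≡ seq (re (exp z₀ * a)) m) → (∀ m → seq (im t) m ≡ seq (im (exp z₀ * a)) m) →
  ∀ {w₀ b} → z₀ ≈ w₀ → a ≈ b → t ≈ times (exp w₀) b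
exp-times {z₀} t a e f {w₀} {b} h h′ = ℂ-trans {t} {exp z₀ * a} {times (exp w₀) b} (≡⇒≈ e f)
  (ℂ-trans {exp z₀ * a} {times (exp z₀) a} {times (exp w₀) b}
    (ℂ-sym {times (exp z₀) a} {exp z₀ * a} (times≈ (exp z₀) a)) (ℂR.*-cong (exp-cong h) h′))

module Terms (π : ℝ) (isPi : IsPi π) where

  open Pi π isPi public

  arguments : ℂ → ℂ → ℂ → ℂ → Arguments ℂ-exponential
  arguments u X Y Z = record { p = p ; u = u ; X = X ; Y = Y ; Z = Z ; exp-p = exp-p ; ω-sum = ω-sum }

  -- Both lemmas concern the exponential and the period 2p alone, so u, X, Y, Z are set to 0.
  open Lattice ℂ-exponential (arguments 0ᶜ 0ᶜ 0ᶜ 0ᶜ) using (period-nat; exp-inverse)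

  p≈ : fromℝ π * 𝕚 ≈ p
  p≈ = ℂ-sym {p} {fromℝ π * 𝕚} (times≈ (fromℝ π) 𝕚)

  nome≈ : ∀ τ → fromℝ π * 𝕚 * point τ ≈ nome τ
  nome≈ τ = ℂ-sym {nome τ} {fromℝ π * 𝕚 * point τ} (ℂ-trans {nome τ} {p * point τ} {fromℝ π * 𝕚 * point τ}
    (times≈ p (point τ)) (*-cong {p} {fromℝ π * 𝕚} {point τ} {point τ} (times≈ (fromℝ π) 𝕚) (ℂ-refl {point τ})))

  𝕚*≈ : ∀ z → 𝕚 * z ≈ times 𝕚 z
  𝕚*≈ z = ℂ-sym {times 𝕚 z} {𝕚 * z} (times≈ 𝕚 z)

  sign-power : ∀ k → (- 1ℂ) ^ k ≈ exp (times (scalar (nat k)) p)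
  sign-power zero    = ℂ-trans {1ℂ} {1ᶜ} {exp (times (scalar 0ℚ) p)} (ℂ-sym {1ᶜ} {1ℂ} 1ᶜ≈)
    (ℂR.sym (ℂR.trans (exp-cong (ℂR.trans (ℂR.*-congʳ scalar-0) (ℂR.zeroˡ p))) ℂE.exp-0))
  sign-power (suc k) = ℂ-trans {(- 1ℂ) * (- 1ℂ) ^ k} {exp p * exp (times (scalar (nat k)) p)} {exp (times (scalar (nat (suc k))) p)}
    (*-cong { - 1ℂ} {exp p} {(- 1ℂ) ^ k} {exp (times (scalar (nat k)) p)} -1≈ (sign-power k))
    (ℂ-trans {exp p * exp (times (scalar (nat k)) p)} {times (exp p) (exp (times (scalar (nat k)) p))} {exp (times (scalar (nat (suc k))) p)}
      (ℂ-sym {times (exp p) (exp (times (scalar (nat k)) p))} {exp p * exp (times (scalar (nat k)) p)} (times≈ (exp p) (exp (times (scalar (nat k)) p))))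
      (ℂR.trans (ℂR.sym (ℂE.exp-+ p (times (scalar (nat k)) p))) (exp-cong (ℂR.trans
        (solveᴷ 2 (λ k p → p ⊕ k ⊛ p ⊜ (κ 1ℚ ⊕ k) ⊛ p) ℂR.refl (scalar (nat k)) p)
        (ℂR.*-congʳ (ℂR.trans (ℂR.sym (scalar-+ 1ℚ (nat k))) (ℂR.reflexive (cong scalar (sym (nat-suc k))))))))))
    where
    -1≈ : - 1ℂ ≈ exp p
    -1≈ = ℂ-sym {exp p} { - 1ℂ} (ℂ-trans {exp p} {negate 1ᶜ} { - 1ℂ} exp-p
      (ℂ-trans {negate 1ᶜ} { - 1ᶜ} { - 1ℂ} (negate≈ 1ᶜ) (neg-cong {1ᶜ} {1ℂ} 1ᶜ≈)))

  -- `-1^` is defined through |n|; for negative n the exponents -w and w give the same value,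
  -- because e^(2w) = 1.
  sign≈ : ∀ n → -1^ π n ≈ exp (times (scalar (int n)) (times (scalar (int (ℤ.+ 1))) p))
  sign≈ n = ℂR.trans (signed n) (exp-cong (ℂR.*-congˡ (ℂR.sym (ℂR.trans (ℂR.*-congʳ scalar-1) (ℂR.*-identityˡ p)))))
    where
    signed : ∀ n → -1^ π n ≈ exp (times (scalar (int n)) p)
    signed (ℤ.+ k)    = ℂR.trans (sign-power k) (exp-cong (ℂR.*-congʳ (ℂR.reflexive (cong scalar (sym (nat≡ k))))))
    signed ℤ.-[1+ k ] = ℂR.trans (sign-power (suc k)) (ℂR.sym (begin
      exp (times (scalar (int ℤ.-[1+ k ])) p)
        ≈⟨ exp-cong (ℂR.trans (ℂR.*-congʳ (ℂR.trans (ℂR.reflexive (cong scalar (trans (int-neg (ℤ.+ suc k)) (cong ℚ.-_ (nat≡ (suc k))))))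
             (scalar-neg (nat (suc k))))) (solveᴷ 2 (λ k p → (⊝ k) ⊛ p ⊜ ⊝ (k ⊛ p)) ℂR.refl (scalar (nat (suc k))) p)) ⟩
      exp (negate w)
        ≈⟨ ℂR.*-identityʳ (exp (negate w)) ⟨
      times (exp (negate w)) 1ᶜ
        ≈⟨ ℂR.*-congˡ (ℂR.sym (ℂR.trans (ℂR.sym (ℂE.exp-+ w w)) (ℂR.trans (exp-cong
             (solveᴷ 2 (λ k p → k ⊛ p ⊕ k ⊛ p ⊜ k ⊛ (p ⊕ p)) ℂR.refl (scalar (nat (suc k))) p)) (period-nat (suc k))))) ⟩
      times (exp (negate w)) (times (exp w) (exp w))
        ≈⟨ ℂR.*-assoc (exp (negate w)) (exp w) (exp w) ⟨
      times (times (exp (negate w)) (exp w)) (exp w)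
        ≈⟨ ℂR.trans (ℂR.*-congʳ (exp-inverse w)) (ℂR.*-identityˡ (exp w)) ⟩
      exp w ∎))
      where
      w : ℂ
      w = times (scalar (nat (suc k))) p

  raw-θ : ℤ → ℤ → ℂ → ℂ → ℂ
  raw-θ d n v w = plus (plus (times (scalar (int n)) (times (scalar (int d)) p))
    (times (scalar (int (odd d n ℤ.* odd d n) ℚ.* ¼)) v)) (times (scalar (int (odd d n))) w)

  ϑ₁-raw : ∀ z τ n → ϑ₁-term π z τ n ≈ exp (raw-θ (ℤ.+ 1) n (nome τ) (times 𝕚 z))
  ϑ₁-raw z τ n = ℂR.trans
    (product₃-exp (ϑ₁-term π z τ n) (-1^ π n) (λ m → refl) (λ m → refl) (sign≈ n)
      (·≈ ((odd (ℤ.+ 1) n ℤ.* odd (ℤ.+ 1) n) ℚ./ 4) (fromℝ π * 𝕚 * point τ) (λ m → refl) (λ m → refl) (nome≈ τ))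
      (·≈ (int (odd (ℤ.+ 1) n)) (𝕚 * z) (λ m → refl) (λ m → refl) (𝕚*≈ z)))
    (exp-cong (ℂR.+-congʳ (ℂR.+-congˡ (ℂR.*-congʳ (ℂR.reflexive (cong scalar (quarter (odd (ℤ.+ 1) n ℤ.* odd (ℤ.+ 1) n))))))))

  -- The exponents n² and 2n are rewritten as (2n + 0)²/4 and 2n + 0, which puts ϑ₃ into the form of
  -- ϑ₁ with d = 0.
  ϑ₃-raw : ∀ z τ n → ϑ₃-term π z τ n ≈ exp (raw-θ (ℤ.+ 0) n (nome τ) (times 𝕚 z))
  ϑ₃-raw z τ n = ℂR.trans
    (exp-product₂ (ϑ₃-term π z τ n) (λ m → refl) (λ m → refl)
      (·≈ (int (n ℤ.* n)) (fromℝ π * 𝕚 * point τ) (λ m → refl) (λ m → refl) (nome≈ τ))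
      (·≈ (int (ℤ.+ 2 ℤ.* n)) (𝕚 * z) (λ m → refl) (λ m → refl) (𝕚*≈ z)))
    (ℂR.trans (ℂR.sym (ℂE.exp-+ (times (scalar (int (n ℤ.* n))) (nome τ)) (times (scalar (int (ℤ.+ 2 ℤ.* n))) (times 𝕚 z))))
      (exp-cong (ℂR.+-cong
        (ℂR.trans (ℂR.*-congʳ (ℂR.reflexive (cong scalar square)))
          (ℂR.sym (ℂR.trans (ℂR.+-congʳ (ℂR.trans (ℂR.*-congˡ (ℂR.trans (ℂR.*-congʳ scalar-0) (ℂR.zeroˡ p))) (ℂR.zeroʳ (scalar (int n)))))
            (ℂR.+-identityˡ _))))
        (ℂR.*-congʳ (ℂR.reflexive (cong (λ k → scalar (int k)) (sym (ℤ.+-identityʳ (ℤ.+ 2 ℤ.* n)))))))))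
    where
    square : int (n ℤ.* n) ≡ int (odd (ℤ.+ 0) n ℤ.* odd (ℤ.+ 0) n) ℚ.* ¼
    square = sym (trans (cong (λ k → int (k ℤ.* k) ℚ.* ¼) (ℤ.+-identityʳ (ℤ.+ 2 ℤ.* n)))
      (trans (cong (ℚ._* ¼) (trans (int-* (ℤ.+ 2 ℤ.* n) (ℤ.+ 2 ℤ.* n)) (cong₂ ℚ._*_ (int-* (ℤ.+ 2) n) (int-* (ℤ.+ 2) n))))
        (trans (solve 1 (λ n → (con 2ℚ :* n) :* (con 2ℚ :* n) :* con ¼ := n :* n) refl (int n)) (sym (int-* n n)))))

  raw-C : ℤ → ℂ → ℂ → ℂ → ℤ → ℤ → ℂ
  raw-C ε v w w′ m n = times (exp (times (scalar (⅔ ℚ.* int (ε ℤ.* (m ℤ.+ n)))) p))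
    (exp (plus (plus (times (scalar (int (ℤ.+ 2 ℤ.* form m n))) v) (times (scalar (int (ℤ.+ 2 ℤ.* m))) w)) (times (scalar (int (ℤ.+ 2 ℤ.* n))) w′)))

  A†-exp : ∀ x y τ m n → A†-term π x y τ (m , n) ≈
    exp (plus (plus (times (scalar (int (ℤ.+ 2 ℤ.* form m n))) (nome τ)) (times (scalar (int (ℤ.+ 2 ℤ.* m))) (times 𝕚 x)))
      (times (scalar (int (ℤ.+ 2 ℤ.* n))) (times 𝕚 y)))
  A†-exp x y τ m n = exp-product₃ (A†-term π x y τ (m , n)) (λ _ → refl) (λ _ → refl)
    (·≈ (int (ℤ.+ 2 ℤ.* form m n)) (fromℝ π * 𝕚 * point τ) (λ _ → refl) (λ _ → refl) (nome≈ τ))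
    (·≈ (int (ℤ.+ 2 ℤ.* m)) (𝕚 * x) (λ _ → refl) (λ _ → refl) (𝕚*≈ x))
    (·≈ (int (ℤ.+ 2 ℤ.* n)) (𝕚 * y) (λ _ → refl) (λ _ → refl) (𝕚*≈ y))

  A†-raw : ∀ x y τ m n → A†-term π x y τ (m , n) ≈ raw-C (ℤ.+ 0) (nome τ) (times 𝕚 x) (times 𝕚 y) m n
  A†-raw x y τ m n = ℂR.trans (A†-exp x y τ m n) (ℂR.sym (ℂR.trans (ℂR.*-congʳ
    (ℂR.trans (exp-cong (ℂR.trans (ℂR.*-congʳ scalar-0) (ℂR.zeroˡ p))) ℂE.exp-0)) (ℂR.*-identityˡ _)))

  C†-raw : ∀ x y τ m n → C†-term π x y τ (m , n) ≈ raw-C (ℤ.+ 1) (nome τ) (times 𝕚 x) (times 𝕚 y) m n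
  C†-raw x y τ m n = exp-times (C†-term π x y τ (m , n)) (A†-term π x y τ (m , n)) (λ _ → refl) (λ _ → refl)
    (ℂR.trans
      (·≈ (int (m ℤ.+ n)) (⅔ · (fromℝ π * 𝕚)) (λ _ → refl) (λ _ → refl) (·≈ ⅔ (fromℝ π * 𝕚) (λ _ → refl) (λ _ → refl) p≈))
      (ℂR.trans (ℂR.sym (ℂR.*-assoc (scalar (int (m ℤ.+ n))) (scalar ⅔) p)) (ℂR.*-congʳ
        (ℂR.trans (ℂR.sym (scalar-* (int (m ℤ.+ n)) ⅔)) (ℂR.reflexive (cong scalar
          (trans (ℚ.*-comm (int (m ℤ.+ n)) ⅔) (cong (λ k → ⅔ ℚ.* int k) (sym (ℤ.*-identityˡ (m ℤ.+ n)))))))))))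
    (A†-exp x y τ m n)

-- The identities for ϑ₁, ϑ₃, A† and C†

∑≈ : ∀ {I : Set} (f : I → ℂ) T → ∑ f T ≈ ∑ᴷ f T
∑≈ f []      = ℂ-sym {0ᶜ} {0ℂ} 0ᶜ≈
∑≈ f (i ∷ T) = ℂ-trans {∑ f (i ∷ T)} {f i + ∑ f T} {∑ᴷ f (i ∷ T)} (≡⇒≈ (λ m → refl) (λ m → refl))
  (step (f i) (∑ f T) (∑ᴷ f T) (∑≈ f T))
  where
  step : ∀ a s s′ → s ≈ s′ → a + s ≈ plus a s′
  step a s s′ h = ℂ-trans {a + s} {plus a s} {plus a s′} (ℂ-sym {plus a s} {a + s} (plus≈ a s)) (ℂR.+-congˡ h)

hasSum⁺ : ∀ {I : Set} {f : I → ℂ} {s} → HasSum f s → ℂS.HasSum f s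
hasSum⁺ {f = f} {s} H = ℂS.mk λ ε 0<ε →
  let S , h = H ε 0<ε
  in S , λ T uT S⊆T → small-≈ {ε} {plus (∑ f T) (negate s)} {plus (∑ᴷ f T) (negate s)} (ℂR.+-congʳ (∑≈ f T))
       (small-minus {ε} (∑ f T) s (mk (mk (h T uT S⊆T))))

hasSum⁻ : ∀ {I : Set} {f : I → ℂ} {s} → ℂS.HasSum f s → HasSum f s
hasSum⁻ {f = f} {s} (ℂS.mk H) ε 0<ε =
  let S , h = H ε 0<ε
  in S , λ T uT S⊆T → un (Small.norm⊑ {ε} {∑ f T - s} (small-≈ {ε} {plus (∑ f T) (negate s)} {∑ f T - s} (minus≈ (∑ f T) s)
       (small-≈ {ε} {plus (∑ᴷ f T) (negate s)} {plus (∑ f T) (negate s)} (ℂR.+-congʳ (ℂR.sym (∑≈ f T))) (h T uT S⊆T))))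

module _ where

  private
    minusᴷ : ∀ a b → a - b ≈ plus a (negate b)
    minusᴷ a b = ℂ-sym {plus a (negate b)} {a - b} (minus≈ a b)

  ⋅≈ : ∀ k z → k ⋅ z ≈ times (scalar (int k)) z
  ⋅≈ k z = ·≈ (int k) z (λ _ → refl) (λ _ → refl) (ℂ-refl {z})

  triple≈ : ∀ k a b c → k ⋅ (a * b * c) ≈ times (scalar (int k)) (times (times a b) c)
  triple≈ k a b c = ℂ-trans {k ⋅ (a * b * c)} {times (scalar (int k)) (a * b * c)} {times (scalar (int k)) (times (times a b) c)}
    (⋅≈ k (a * b * c))
    (ℂR.*-congˡ (ℂ-sym {times (times a b) c} {a * b * c} (ℂ-trans {times (times a b) c} {times a b * c} {a * b * c}
      (times≈ (times a b) c) (*-cong {times a b} {a * b} {c} {c} (times≈ a b) (ℂ-refl {c})))))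

  cube≈ : ∀ a → a ^ 3 ≈ times a (times a a)
  cube≈ a = ℂ-trans {a ^ 3} {a * (a * (a * 1ℂ))} {times a (times a a)} (≡⇒≈ (λ n → refl) (λ n → refl))
    (ℂ-sym {times a (times a a)} {a * (a * (a * 1ℂ))} (ℂ-trans {times a (times a a)} {a * times a a} {a * (a * (a * 1ℂ))}
      (times≈ a (times a a)) (*-cong {a} {a} {times a a} {a * (a * 1ℂ)} (ℂ-refl {a})
        (ℂ-trans {times a a} {a * a} {a * (a * 1ℂ)} (times≈ a a) (*-cong {a} {a} {a} {a * 1ℂ} (ℂ-refl {a})
          (≡⇒≈ (λ n → solve 2 (λ x y → x := x :* con 1ℚ :- y :* con 0ℚ) refl (seq (re a) n) (seq (im a) n))
               (λ n → solve 2 (λ x y → y := x :* con 0ℚ :+ y :* con 1ℚ) refl (seq (re a) n) (seq (im a) n))))))))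

  times⁻ : ∀ a b {c d} → a ≈ c → b ≈ d → a * b ≈ times c d
  times⁻ a b {c} {d} p q = ℂ-trans {a * b} {times a b} {times c d} (ℂ-sym {times a b} {a * b} (times≈ a b)) (ℂR.*-cong p q)

  minus⁻ : ∀ a b {c d} → a ≈ c → b ≈ d → a - b ≈ plus c (negate d)
  minus⁻ a b {c} {d} p q = ℂ-trans {a - b} {plus a (negate b)} {plus c (negate d)} (minusᴷ a b) (ℂR.+-cong p (ℂR.-‿cong q))

  plus⁻ : ∀ a b {c d} → a ≈ c → b ≈ d → a + b ≈ plus c d
  plus⁻ a b {c} {d} p q = ℂ-trans {a + b} {plus a b} {plus c d} (ℂ-sym {plus a b} {a + b} (plus≈ a b)) (ℂR.+-cong p q)

  difference-form : ∀ a b c A B C s t r →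
    times (scalar 3ℚ) (times (times a b) c) ≈ plus (plus (times A s) (negate (times B t))) (negate (times C r)) →
    pos 3 ⋅ (a * b * c) ≃ A * s - B * t - C * r
  difference-form a b c A B C s t r h = ≈⇒≃ (ℂ-trans {pos 3 ⋅ (a * b * c)} {times (scalar 3ℚ) (times (times a b) c)} {A * s - B * t - C * r}
    (triple≈ (pos 3) a b c)
    (ℂ-trans {times (scalar 3ℚ) (times (times a b) c)} {plus (plus (times A s) (negate (times B t))) (negate (times C r))} {A * s - B * t - C * r} h
      (ℂ-sym {A * s - B * t - C * r} {plus (plus (times A s) (negate (times B t))) (negate (times C r))}
        (minus⁻ (A * s - B * t) (C * r)
          (minus⁻ (A * s) (B * t) (times⁻ A s ℂR.refl ℂR.refl) (times⁻ B t ℂR.refl ℂR.refl)) (times⁻ C r ℂR.refl ℂR.refl)))))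

  sum-form : ∀ a b c A B C s t r →
    times (scalar 3ℚ) (times (times a b) c) ≈ plus (plus (times A s) (times B t)) (times C r) →
    pos 3 ⋅ (a * b * c) ≃ A * s + B * t + C * r
  sum-form a b c A B C s t r h = ≈⇒≃ (ℂ-trans {pos 3 ⋅ (a * b * c)} {times (scalar 3ℚ) (times (times a b) c)} {A * s + B * t + C * r}
    (triple≈ (pos 3) a b c)
    (ℂ-trans {times (scalar 3ℚ) (times (times a b) c)} {plus (plus (times A s) (times B t)) (times C r)} {A * s + B * t + C * r} h
      (ℂ-sym {A * s + B * t + C * r} {plus (plus (times A s) (times B t)) (times C r)}
        (plus⁻ (A * s + B * t) (C * r)
          (plus⁻ (A * s) (B * t) (times⁻ A s ℂR.refl ℂR.refl) (times⁻ B t ℂR.refl ℂR.refl)) (times⁻ C r ℂR.refl ℂR.refl)))))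

  -𝕚² : times (negate 𝕚) (negate 𝕚) ≈ negate (scalar 1ℚ)
  -𝕚² = ℂ-trans {times (negate 𝕚) (negate 𝕚)} {(- 𝕚) * (- 𝕚)} {negate (scalar 1ℚ)}
    (ℂ-sym {(- 𝕚) * (- 𝕚)} {times (negate 𝕚) (negate 𝕚)} (times⁻ (- 𝕚) (- 𝕚)
      (ℂ-sym {negate 𝕚} { - 𝕚} (negate≈ 𝕚)) (ℂ-sym {negate 𝕚} { - 𝕚} (negate≈ 𝕚))))
    (ℂ-sym {negate (scalar 1ℚ)} {(- 𝕚) * (- 𝕚)} (ℂ-trans {negate (scalar 1ℚ)} { - scalar 1ℚ} {(- 𝕚) * (- 𝕚)} (negate≈ (scalar 1ℚ))
      (ℂ-trans { - scalar 1ℚ} { - 1ℂ} {(- 𝕚) * (- 𝕚)} (neg-cong {scalar 1ℚ} {1ℂ} (scalar≈ 1ℚ))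
        (≡⇒≈ (λ _ → refl) (λ _ → refl)))))

  -- With i for the factor -i of ϑ₁, three such factors on the left leave i² = -1 times one of them,
  -- and this -1 is the m = e^(πi) of the product formula. The signs -1 of the arguments shifted by
  -- ±π/3 become the minus signs on the right.
  odd-assembly : ∀ {i m v₁ v₂ v₃ e e⁻ e⁺ A C D T₁ T₂ T₃ a c⁺ c⁻ t t⁺ t⁻} →
    times i i ≈ negate (scalar 1ℚ) → m ≈ negate (scalar 1ℚ) →
    v₁ ≈ times i (times (scalar 1ℚ) T₁) → v₂ ≈ times i (times (scalar 1ℚ) T₂) → v₃ ≈ times i (times (scalar 1ℚ) T₃) →
    e ≈ times i (times (scalar 1ℚ) t) →
    e⁻ ≈ times i (times (negate (scalar 1ℚ)) t⁻) → e⁺ ≈ times i (times (negate (scalar 1ℚ)) t⁺) →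
    A ≈ a → C ≈ c⁺ → D ≈ c⁻ →
    times (scalar 3ℚ) (times m (times T₁ (times T₂ T₃))) ≈ plus (plus (times a t) (times c⁺ t⁻)) (times c⁻ t⁺) →
    times (scalar 3ℚ) (times (times v₁ v₂) v₃) ≈ plus (plus (times A e) (negate (times C e⁻))) (negate (times D e⁺))
  odd-assembly {i} {m} {v₁} {v₂} {v₃} {e} {e⁻} {e⁺} {A} {C} {D} {T₁} {T₂} {T₃} {a} {c⁺} {c⁻} {t} {t⁺} {t⁻}
    i² m≈ p₁ p₂ p₃ q q⁻ q⁺ A≈ C≈ D≈ h = begin
    times (scalar 3ℚ) (times (times v₁ v₂) v₃)
      ≈⟨ ℂR.*-congˡ (ℂR.*-cong (ℂR.*-cong p₁ p₂) p₃) ⟩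
    times (scalar 3ℚ) (times (times (times i (times (scalar 1ℚ) T₁)) (times i (times (scalar 1ℚ) T₂))) (times i (times (scalar 1ℚ) T₃)))
      ≈⟨ solveᴷ 4 (λ i a b c → κ 3ℚ ⊛ (((i ⊛ (κ 1ℚ ⊛ a)) ⊛ (i ⊛ (κ 1ℚ ⊛ b))) ⊛ (i ⊛ (κ 1ℚ ⊛ c)))
           ⊜ (i ⊛ i) ⊛ (i ⊛ (κ 3ℚ ⊛ (a ⊛ (b ⊛ c))))) ℂR.refl i T₁ T₂ T₃ ⟩
    times (times i i) (times i (times (scalar 3ℚ) (times T₁ (times T₂ T₃))))
      ≈⟨ ℂR.*-congʳ i² ⟩
    times (negate (scalar 1ℚ)) (times i (times (scalar 3ℚ) (times T₁ (times T₂ T₃))))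
      ≈⟨ solveᴷ 4 (λ i a b c → (⊝ (κ 1ℚ)) ⊛ (i ⊛ (κ 3ℚ ⊛ (a ⊛ (b ⊛ c)))) ⊜ i ⊛ (κ 3ℚ ⊛ ((⊝ (κ 1ℚ)) ⊛ (a ⊛ (b ⊛ c))))) ℂR.refl i T₁ T₂ T₃ ⟩
    times i (times (scalar 3ℚ) (times (negate (scalar 1ℚ)) (times T₁ (times T₂ T₃))))
      ≈⟨ ℂR.*-congˡ (ℂR.trans (ℂR.*-congˡ (ℂR.*-congʳ (ℂR.sym m≈))) h) ⟩
    times i (plus (plus (times a t) (times c⁺ t⁻)) (times c⁻ t⁺))
      ≈⟨ solveᴷ 7 (λ i a t c t⁻ d t⁺ → i ⊛ ((a ⊛ t ⊕ c ⊛ t⁻) ⊕ d ⊛ t⁺)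
           ⊜ (a ⊛ (i ⊛ (κ 1ℚ ⊛ t)) ⊕ ⊝ (c ⊛ (i ⊛ ((⊝ (κ 1ℚ)) ⊛ t⁻)))) ⊕ ⊝ (d ⊛ (i ⊛ ((⊝ (κ 1ℚ)) ⊛ t⁺)))) ℂR.refl i a t c⁺ t⁻ c⁻ t⁺ ⟩
    plus (plus (times a (times i (times (scalar 1ℚ) t))) (negate (times c⁺ (times i (times (negate (scalar 1ℚ)) t⁻)))))
      (negate (times c⁻ (times i (times (negate (scalar 1ℚ)) t⁺))))
      ≈⟨ ℂR.+-cong (ℂR.+-cong (ℂR.*-cong A≈ q) (ℂR.-‿cong (ℂR.*-cong C≈ q⁻))) (ℂR.-‿cong (ℂR.*-cong D≈ q⁺)) ⟨
    plus (plus (times A e) (negate (times C e⁻))) (negate (times D e⁺)) ∎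

  cube : ℂ → ℂ
  cube a = times a (times a a)

  cube-form : ∀ a b Q c d {E} → Q ≈ E →
    plus (cube a) (times (negate 1ᶜ) (cube b)) ≈ times E (plus (cube c) (times (negate 1ᶜ) (cube d))) →
    a ^ 3 - b ^ 3 ≃ Q * c ^ 3 - Q * d ^ 3
  cube-form a b Q c d {E} q h = ≈⇒≃ (ℂ-trans {a ^ 3 - b ^ 3} {plus (cube a) (negate (cube b))} {Q * c ^ 3 - Q * d ^ 3}
    (minus⁻ (a ^ 3) (b ^ 3) (cube≈ a) (cube≈ b))
    (ℂ-trans {plus (cube a) (negate (cube b))} {plus (times E (cube c)) (negate (times E (cube d)))} {Q * c ^ 3 - Q * d ^ 3}
      (begin
        plus (cube a) (negate (cube b))
          ≈⟨ ℂR.+-congˡ (neg-one (cube b)) ⟨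
        plus (cube a) (times (negate 1ᶜ) (cube b))
          ≈⟨ h ⟩
        times E (plus (cube c) (times (negate 1ᶜ) (cube d)))
          ≈⟨ ℂR.*-congˡ (ℂR.+-congˡ (neg-one (cube d))) ⟩
        times E (plus (cube c) (negate (cube d)))
          ≈⟨ solveᴷ 3 (λ e c d → e ⊛ (c ⊕ ⊝ d) ⊜ e ⊛ c ⊕ ⊝ (e ⊛ d)) ℂR.refl E (cube c) (cube d) ⟩
        plus (times E (cube c)) (negate (times E (cube d))) ∎)
      (ℂ-sym {Q * c ^ 3 - Q * d ^ 3} {plus (times E (cube c)) (negate (times E (cube d)))}
        (minus⁻ (Q * c ^ 3) (Q * d ^ 3) (times⁻ Q (c ^ 3) q (cube≈ c)) (times⁻ Q (d ^ 3) q (cube≈ d))))))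
    where
    neg-one : ∀ x → times (negate 1ᶜ) x ≈ negate x
    neg-one x = ℂR.trans (solveᴷ 2 (λ o x → (⊝ o) ⊛ x ⊜ ⊝ (o ⊛ x)) ℂR.refl 1ᶜ x) (ℂR.-‿cong (ℂR.*-identityˡ x))

-- Values of the four functions and assembly of the identities

module Functions (π : ℝ) (isPi : IsPi π) (τ : ℍ) (x y z : ℂ) where

  open Terms π isPi
  open Domination ℂ-exponential
  X Y Z u : ℂ
  X = times 𝕚 x
  Y = times 𝕚 y
  Z = times 𝕚 z
  u = nome τ
  open Series ℂ-exponential (arguments u X Y Z)
  open Identities ℂ-exponential (arguments u X Y Z) using (product-identity; cube-identity)

  u≈ : u ≈ times (scalar 1ℚ) u
  u≈ = ℂR.sym (ℂR.trans (ℂR.*-congʳ scalar-1) (ℂR.*-identityˡ u))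

  third≈ : nome (τ /3) ≈ times (scalar ⅓) u
  third≈ = ℂR.trans (ℂR.*-congˡ (·≈ {point (τ /3)} ⅓ (point τ) (λ _ → refl) (λ _ → refl) (ℂ-refl {point τ})))
    (solveᴷ 3 (λ p r t → p ⊛ (r ⊛ t) ⊜ r ⊛ (p ⊛ t)) ℂR.refl p (scalar ⅓) (point τ))

  decaying-≈ : ∀ {v w} → v ≈ w → Decaying v → Decaying w
  decaying-≈ e D = record { ρ = ρ ; δ = δ ; 0≤ρ = 0≤ρ ; 0<δ = 0<δ ; ρ-inv = ρ-inv ; decay = growth-≈ e decay }
    where open Decaying D

  decays : Decaying (times (scalar 1ℚ) u)
  decays = decaying-≈ u≈ (nome-decays τ)

  third-decays : Decaying (times (scalar ⅓) u)
  third-decays = decaying-≈ third≈ (nome-decays (τ /3))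

  -- The counterpart of `⟦_⟧` on polynomials, with which the ring solver checks that an argument has
  -- the stated coordinates.
  combination : ∀ {n} → (P U X Y Z : Polynomial n) → Lin → Polynomial n
  combination P U X Y Z (lin a b c d e) = κ a ⊛ P ⊕ (κ b ⊛ U ⊕ (κ c ⊛ X ⊕ (κ d ⊛ Y ⊕ κ e ⊛ Z)))

  module Arg (l : Lin) where
    value : Polynomial 6 → Polynomial 6 → Polynomial 6 → Polynomial 6 → Polynomial 6 → Polynomial 6 → Polynomial 6
    value q i x y z t = combination (q ⊛ i) ((q ⊛ i) ⊛ t) (i ⊛ x) (i ⊛ y) (i ⊛ z) l

  arg-z : times 𝕚 z ≈ ⟦ lin 0ℚ 0ℚ 0ℚ 0ℚ 1ℚ ⟧
  arg-z = solveᴷ 6 (λ q i x y z t → i ⊛ z ⊜ Arg.value (lin 0ℚ 0ℚ 0ℚ 0ℚ 1ℚ) q i x y z t) ℂR.refl (fromℝ π) 𝕚 x y z (point τ)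

  arg-z+x : times 𝕚 (z + x) ≈ ⟦ lin 0ℚ 0ℚ 1ℚ 0ℚ 1ℚ ⟧
  arg-z+x = ℂR.trans (ℂR.*-congˡ (plus⁻ z x ℂR.refl ℂR.refl))
    (solveᴷ 6 (λ q i x y z t → i ⊛ (z ⊕ x) ⊜ Arg.value (lin 0ℚ 0ℚ 1ℚ 0ℚ 1ℚ) q i x y z t) ℂR.refl (fromℝ π) 𝕚 x y z (point τ))

  arg-z+y : times 𝕚 (z + y) ≈ ⟦ lin 0ℚ 0ℚ 0ℚ 1ℚ 1ℚ ⟧
  arg-z+y = ℂR.trans (ℂR.*-congˡ (plus⁻ z y ℂR.refl ℂR.refl))
    (solveᴷ 6 (λ q i x y z t → i ⊛ (z ⊕ y) ⊜ Arg.value (lin 0ℚ 0ℚ 0ℚ 1ℚ 1ℚ) q i x y z t) ℂR.refl (fromℝ π) 𝕚 x y z (point τ))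

  arg-z-x-y : times 𝕚 (z - x - y) ≈ ⟦ lin 0ℚ 0ℚ (ℚ.- 1ℚ) (ℚ.- 1ℚ) 1ℚ ⟧
  arg-z-x-y = ℂR.trans (ℂR.*-congˡ (minus⁻ (z - x) y (minus⁻ z x ℂR.refl ℂR.refl) ℂR.refl))
    (solveᴷ 6 (λ q i x y z t → i ⊛ ((z ⊕ ⊝ x) ⊕ ⊝ y) ⊜ Arg.value (lin 0ℚ 0ℚ (ℚ.- 1ℚ) (ℚ.- 1ℚ) 1ℚ) q i x y z t) ℂR.refl (fromℝ π) 𝕚 x y z (point τ))

  third-of-π : (pos 1 / 3) · fromℝ π ≈ times (scalar ⅓) (fromℝ π)
  third-of-π = ·≈ ⅓ (fromℝ π) (λ _ → refl) (λ _ → refl) (ℂ-refl {fromℝ π})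

  arg-z-π/3 : times 𝕚 (z - (pos 1 / 3) · fromℝ π) ≈ ⟦ lin (ℚ.- ⅓) 0ℚ 0ℚ 0ℚ 1ℚ ⟧
  arg-z-π/3 = ℂR.trans (ℂR.*-congˡ (minus⁻ z ((pos 1 / 3) · fromℝ π) ℂR.refl third-of-π))
    (solveᴷ 6 (λ q i x y z t → i ⊛ (z ⊕ ⊝ (κ ⅓ ⊛ q)) ⊜ Arg.value (lin (ℚ.- ⅓) 0ℚ 0ℚ 0ℚ 1ℚ) q i x y z t) ℂR.refl (fromℝ π) 𝕚 x y z (point τ))

  arg-z+π/3 : times 𝕚 (z + (pos 1 / 3) · fromℝ π) ≈ ⟦ lin ⅓ 0ℚ 0ℚ 0ℚ 1ℚ ⟧
  arg-z+π/3 = ℂR.trans (ℂR.*-congˡ (plus⁻ z ((pos 1 / 3) · fromℝ π) ℂR.refl third-of-π))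
    (solveᴷ 6 (λ q i x y z t → i ⊛ (z ⊕ (κ ⅓ ⊛ q)) ⊜ Arg.value (lin ⅓ 0ℚ 0ℚ 0ℚ 1ℚ) q i x y z t) ℂR.refl (fromℝ π) 𝕚 x y z (point τ))

  arg-x : times 𝕚 x ≈ ⟦ lin 0ℚ 0ℚ 1ℚ 0ℚ 0ℚ ⟧
  arg-x = solveᴷ 6 (λ q i x y z t → i ⊛ x ⊜ Arg.value (lin 0ℚ 0ℚ 1ℚ 0ℚ 0ℚ) q i x y z t) ℂR.refl (fromℝ π) 𝕚 x y z (point τ)

  arg-y : times 𝕚 y ≈ ⟦ lin 0ℚ 0ℚ 0ℚ 1ℚ 0ℚ ⟧
  arg-y = solveᴷ 6 (λ q i x y z t → i ⊛ y ⊜ Arg.value (lin 0ℚ 0ℚ 0ℚ 1ℚ 0ℚ) q i x y z t) ℂR.refl (fromℝ π) 𝕚 x y z (point τ)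

  arg-neg-x : times 𝕚 (- x) ≈ ⟦ lin 0ℚ 0ℚ (ℚ.- 1ℚ) 0ℚ 0ℚ ⟧
  arg-neg-x = ℂR.trans (ℂR.*-congˡ (ℂ-sym {negate x} { - x} (negate≈ x)))
    (solveᴷ 6 (λ q i x y z t → i ⊛ (⊝ x) ⊜ Arg.value (lin 0ℚ 0ℚ (ℚ.- 1ℚ) 0ℚ 0ℚ) q i x y z t) ℂR.refl (fromℝ π) 𝕚 x y z (point τ))

  arg-neg-y : times 𝕚 (- y) ≈ ⟦ lin 0ℚ 0ℚ 0ℚ (ℚ.- 1ℚ) 0ℚ ⟧
  arg-neg-y = ℂR.trans (ℂR.*-congˡ (ℂ-sym {negate y} { - y} (negate≈ y)))
    (solveᴷ 6 (λ q i x y z t → i ⊛ (⊝ y) ⊜ Arg.value (lin 0ℚ 0ℚ 0ℚ (ℚ.- 1ℚ) 0ℚ) q i x y z t) ℂR.refl (fromℝ π) 𝕚 x y z (point τ))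

  πτ≈ : fromℝ π * point τ ≈ times (fromℝ π) (point τ)
  πτ≈ = times⁻ (fromℝ π) (point τ) ℂR.refl ℂR.refl

  arg-x+πτ : times 𝕚 (x + fromℝ π * point τ) ≈ ⟦ lin 0ℚ 1ℚ 1ℚ 0ℚ 0ℚ ⟧
  arg-x+πτ = ℂR.trans (ℂR.*-congˡ (plus⁻ x (fromℝ π * point τ) ℂR.refl πτ≈))
    (solveᴷ 6 (λ q i x y z t → i ⊛ (x ⊕ q ⊛ t) ⊜ Arg.value (lin 0ℚ 1ℚ 1ℚ 0ℚ 0ℚ) q i x y z t) ℂR.refl (fromℝ π) 𝕚 x y z (point τ))

  arg-neg-x-πτ : times 𝕚 (- x - fromℝ π * point τ) ≈ ⟦ lin 0ℚ (ℚ.- 1ℚ) (ℚ.- 1ℚ) 0ℚ 0ℚ ⟧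
  arg-neg-x-πτ = ℂR.trans (ℂR.*-congˡ (minus⁻ (- x) (fromℝ π * point τ) (ℂ-sym {negate x} { - x} (negate≈ x)) πτ≈))
    (solveᴷ 6 (λ q i x y z t → i ⊛ (⊝ x ⊕ ⊝ (q ⊛ t)) ⊜ Arg.value (lin 0ℚ (ℚ.- 1ℚ) (ℚ.- 1ℚ) 0ℚ 0ℚ) q i x y z t) ℂR.refl (fromℝ π) 𝕚 x y z (point τ))

  θ-sum : ∀ {r v w} → v ≈ times (scalar r) u → ∀ d δ x y z → w ≈ ⟦ lin (⅓ ℚ.* int δ) 0ℚ (int x) (int y) (int z) ⟧ →
    ∀ {f : ℤ → ℂ} {s T} → (∀ n → f n ≈ exp (raw-θ d n v w)) → ℂS.HasSum f s →
    ℂS.HasSum (λ n → 𝐞 (θ-exponent d δ r x y z n)) T → s ≈ times (θ-factor d δ) T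
  θ-sum v≈ d δ x y z w≈ e h h′ = hasSum-unique ℤ._≟_ h
    (ℂS.hasSum-cong (λ n → ℂR.sym (ℂR.trans (e n) (θ-term v≈ d δ x y z w≈ n))) ℂR.refl (ℂS.hasSum-*ˡ (θ-factor d δ) h′))

  θ-exists : ∀ d {f : ℤ → ℂ} → (∀ n → f n ≈ exp (raw-θ d n u (times 𝕚 z))) → ∃ (ℂS.HasSum f)
  θ-exists d e =
    let T , (_ , h) = dominated⇒converges ℤ._≟_ (θ-dominated decays d (pos 0) (pos 0) (pos 0) (pos 1))
    in _ , ℂS.hasSum-cong (λ n → ℂR.sym (ℂR.trans (e n) (θ-term u≈ d (pos 0) (pos 0) (pos 0) (pos 1) arg-z n))) ℂR.refl
         (ℂS.hasSum-*ˡ (θ-factor d (pos 0)) h)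

  C-exists : ∀ ε {f : V → ℂ} → (∀ m n → f (m , n) ≈ raw-C ε u X Y m n) → ∃ (ℂS.HasSum f)
  C-exists ε e = dominated⇒hasSum′ (dominated-cong
      (λ (m , n) → ℂR.sym (ℂR.trans (e m n) (C-term u≈ (pos 1) refl (pos 0) 0ℚ refl arg-x arg-y ε m n)))
      (dominated-reindex (C-dominated decays (pos 1 ℤ.* ε) (pos 0))))
    where
    -- `C-term` with s = 1 yields the index (1 · m , 1 · n), which equals (m , n) only
    -- propositionally.
    dominated-reindex : ∀ {f : V → ℂ} → Dominated f → Dominated (λ (m , n) → f (pos 1 ℤ.* m , pos 1 ℤ.* n))
    dominated-reindex {f} D = dominated-cong (λ (m , n) → ℂR.reflexive (cong₂ (λ a b → f (a , b)) (sym (ℤ.*-identityˡ m)) (sym (ℤ.*-identityˡ n)))) D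
    dominated⇒hasSum′ : ∀ {f : V → ℂ} → Dominated f → ∃ (ℂS.HasSum f)
    dominated⇒hasSum′ D = let s , (_ , h) = dominated⇒converges _≟ⱽ_ D in s , h

  factor-0 : 𝐞 p⟨ 0ℚ ⟩ ≈ 1ᶜ
  factor-0 = ℂR.trans (exp-cong (ℂR.trans (⟦p⟧ 0ℚ) (ℂR.trans (ℂR.*-congʳ scalar-0) (ℂR.zeroˡ p)))) ℂE.exp-0

  factor-1 : 𝐞 p⟨ 1ℚ ⟩ ≈ negate 1ᶜ
  factor-1 = ℂR.trans (exp-cong (ℂR.sym p≈⟦⟧)) exp-p

  -- -1 = -2 + 1, and e^(-2πi) = 1.
  factor-neg-1 : 𝐞 p⟨ ℚ.- 1ℚ ⟩ ≈ negate 1ᶜ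
  factor-neg-1 = ℂR.trans (𝐞-≡ {p⟨ ℚ.- 1ℚ ⟩} {p⟨ 2ℚ ℚ.* int ℤ.-1ℤ ⟩ ⊞ p⟨ 1ℚ ⟩} refl) (ℂR.trans (𝐞-period ℤ.-1ℤ p⟨ 1ℚ ⟩) factor-1)

  module _ (Θ : ThetaFunctions π) where

    open ThetaFunctions Θ

    -- The series of the definition is the normalised one times `m`, the sign e^(πiδ) due to the
    -- shift by δπ/3.
    ϑ₁-value : ∀ {r w} τ′ → nome τ′ ≈ times (scalar r) u → ∀ δ x y z →
      times 𝕚 w ≈ ⟦ lin (⅓ ℚ.* int δ) 0ℚ (int x) (int y) (int z) ⟧ →
      ∀ {T} → Converges (λ n → 𝐞 (θ-exponent (pos 1) δ r x y z n)) T →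
      ∀ {m} → θ-factor (pos 1) δ ≈ m → ϑ₁ w τ′ ≈ times (negate 𝕚) (times m T)
    ϑ₁-value {r} {w} τ′ v≈ δ x y z w≈ {T} (_ , h) {m} m≈ =
      let s , H , e = ϑ₁-series w τ′
      in ℂ-trans {ϑ₁ w τ′} {(- 𝕚) * s} {times (negate 𝕚) (times m T)} (≃⇒≈ e)
           (times⁻ (- 𝕚) s (ℂ-sym {negate 𝕚} { - 𝕚} (negate≈ 𝕚))
             (ℂR.trans (θ-sum v≈ (pos 1) δ x y z w≈ (ϑ₁-raw w τ′) (hasSum⁺ H) h) (ℂR.*-congʳ m≈)))

    ϑ₃-value : ∀ {r w} τ′ → nome τ′ ≈ times (scalar r) u → ∀ δ x y z →
      times 𝕚 w ≈ ⟦ lin (⅓ ℚ.* int δ) 0ℚ (int x) (int y) (int z) ⟧ → θ-factor (pos 0) δ ≈ 1ᶜ →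
      ∀ {T} → Converges (λ n → 𝐞 (θ-exponent (pos 0) δ r x y z n)) T → ϑ₃ w τ′ ≈ T
    ϑ₃-value {r} {w} τ′ v≈ δ x y z w≈ m≈ {T} (_ , h) = ℂR.trans
      (θ-sum v≈ (pos 0) δ x y z w≈ (ϑ₃-raw w τ′) (hasSum⁺ (ϑ₃-series w τ′)) h)
      (ℂR.trans (ℂR.*-congʳ m≈) (ℂR.*-identityˡ T))

    module _ {r} τ′ (v≈ : nome τ′ ≈ times (scalar r) u) (s : ℤ) (s² : s ℤ.* s ≡ pos 1) (σ : ℤ) (κ′ : ℚ)
      (2κ : 2ℚ ℚ.* κ′ ≡ int σ ℚ.* r) {w w′}
      (w≈ : times 𝕚 w ≈ ⟦ lin 0ℚ (int s ℚ.* κ′) (int s) 0ℚ 0ℚ ⟧) (w′≈ : times 𝕚 w′ ≈ ⟦ lin 0ℚ 0ℚ 0ℚ (int s) 0ℚ ⟧) where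

      A†-value : ∀ {T} → Converges (λ v → 𝐞 (C-exponent (s ℤ.* pos 0) σ r v)) T → A† w w′ τ′ ≈ T
      A†-value (_ , h) = C-sum v≈ s s² σ κ′ 2κ w≈ w′≈ (pos 0) {A†-term π w w′ τ′} (A†-raw w w′ τ′) (hasSum⁺ (A†-series w w′ τ′)) h

      C†-value : ∀ {T} → Converges (λ v → 𝐞 (C-exponent (s ℤ.* pos 1) σ r v)) T → C† w w′ τ′ ≈ T
      C†-value (_ , h) = C-sum v≈ s s² σ κ′ 2κ w≈ w′≈ (pos 1) {C†-term π w w′ τ′} (C†-raw w w′ τ′) (hasSum⁺ (C†-series w w′ τ′)) h

    private

      θ-converges : ∀ {r} → Decaying (times (scalar r) u) → ∀ d δ x y z → ∃ (Converges (λ n → 𝐞 (θ-exponent d δ r x y z n)))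
      θ-converges D d δ x y z = dominated⇒converges ℤ._≟_ (θ-dominated D d δ x y z)

      C-converges : ∀ {r} → Decaying (times (scalar r) u) → ∀ ε σ → ∃ (Converges (λ v → 𝐞 (C-exponent ε σ r v)))
      C-converges D ε σ = dominated⇒converges _≟ⱽ_ (C-dominated D ε σ)

      module Product (d : ℤ) where
        c₁ = θ-converges decays d (pos 0) (pos 1) (pos 0) (pos 1)
        c₂ = θ-converges decays d (pos 0) (pos 0) (pos 1) (pos 1)
        c₃ = θ-converges decays d (pos 0) ℤ.-1ℤ ℤ.-1ℤ (pos 1)
        c₀ = θ-converges third-decays d (pos 0) (pos 0) (pos 0) (pos 1)
        c⁺ = θ-converges third-decays d (pos 1) (pos 0) (pos 0) (pos 1)
        c⁻ = θ-converges third-decays d ℤ.-1ℤ (pos 0) (pos 0) (pos 1)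
        a₀ = C-converges third-decays (pos 0) (pos 0)
        a⁺ = C-converges third-decays (pos 1) (pos 0)
        a⁻ = C-converges third-decays ℤ.-1ℤ (pos 0)

        identity : times (scalar 3ℚ) (times (𝐞 p⟨ int (d ℤ.* d) ⟩) (times (proj₁ c₁) (times (proj₁ c₂) (proj₁ c₃))))
          ≈ plus (plus (times (proj₁ a₀) (proj₁ c₀)) (times (proj₁ a⁺) (proj₁ c⁻))) (times (proj₁ a⁻) (proj₁ c⁺))
        identity = product-identity d (proj₂ c₁) (proj₂ c₂) (proj₂ c₃) (proj₂ a₀) (proj₂ a⁺) (proj₂ a⁻) (proj₂ c₀) (proj₂ c⁺) (proj₂ c⁻)

        A≈ : A† (- x) (- y) (τ /3) ≈ proj₁ a₀
        -- At s = -1 the twist 0 stays 0: A† is even, so its value at (-x , -y) is the sum in X and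
        -- Y.
        A≈ = A†-value (τ /3) third≈ ℤ.-1ℤ refl (pos 0) 0ℚ refl arg-neg-x arg-neg-y (proj₂ a₀)

        C⁺≈ : C† x y (τ /3) ≈ proj₁ a⁺
        C⁺≈ = C†-value (τ /3) third≈ (pos 1) refl (pos 0) 0ℚ refl arg-x arg-y (proj₂ a⁺)

        C⁻≈ : C† (- x) (- y) (τ /3) ≈ proj₁ a⁻
        C⁻≈ = C†-value (τ /3) third≈ ℤ.-1ℤ refl (pos 0) 0ℚ refl arg-neg-x arg-neg-y (proj₂ a⁻)

    ϑ₁-identity : pos 3 ⋅ (ϑ₁ (z + x) τ * ϑ₁ (z + y) τ * ϑ₁ (z - x - y) τ)
      ≃ A† (- x) (- y) (τ /3) * ϑ₁ z (τ /3)
        - C† x y (τ /3) * ϑ₁ (z - (pos 1 / 3) · fromℝ π) (τ /3)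
        - C† (- x) (- y) (τ /3) * ϑ₁ (z + (pos 1 / 3) · fromℝ π) (τ /3)
    ϑ₁-identity = difference-form (ϑ₁ (z + x) τ) (ϑ₁ (z + y) τ) (ϑ₁ (z - x - y) τ)
      (A† (- x) (- y) (τ /3)) (C† x y (τ /3)) (C† (- x) (- y) (τ /3))
      (ϑ₁ z (τ /3)) (ϑ₁ (z - (pos 1 / 3) · fromℝ π) (τ /3)) (ϑ₁ (z + (pos 1 / 3) · fromℝ π) (τ /3))
      (odd-assembly -𝕚² (ℂR.trans factor-1 -1≈)
        (ϑ₁-value τ u≈ (pos 0) (pos 1) (pos 0) (pos 1) arg-z+x (proj₂ c₁) 1≈)
        (ϑ₁-value τ u≈ (pos 0) (pos 0) (pos 1) (pos 1) arg-z+y (proj₂ c₂) 1≈)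
        (ϑ₁-value τ u≈ (pos 0) ℤ.-1ℤ ℤ.-1ℤ (pos 1) arg-z-x-y (proj₂ c₃) 1≈)
        (ϑ₁-value (τ /3) third≈ (pos 0) (pos 0) (pos 0) (pos 1) arg-z (proj₂ c₀) 1≈)
        (ϑ₁-value (τ /3) third≈ ℤ.-1ℤ (pos 0) (pos 0) (pos 1) arg-z-π/3 (proj₂ c⁻) (ℂR.trans factor-neg-1 -1≈))
        (ϑ₁-value (τ /3) third≈ (pos 1) (pos 0) (pos 0) (pos 1) arg-z+π/3 (proj₂ c⁺) (ℂR.trans factor-1 -1≈))
        A≈ C⁺≈ C⁻≈ identity)
      where
      open Product (pos 1)
      1≈ : 𝐞 p⟨ 0ℚ ⟩ ≈ scalar 1ℚ
      1≈ = ℂR.trans factor-0 (ℂR.sym scalar-1)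
      -1≈ : negate 1ᶜ ≈ negate (scalar 1ℚ)
      -1≈ = ℂR.-‿cong (ℂR.sym scalar-1)

    ϑ₃-identity : pos 3 ⋅ (ϑ₃ (z + x) τ * ϑ₃ (z + y) τ * ϑ₃ (z - x - y) τ)
      ≃ A† (- x) (- y) (τ /3) * ϑ₃ z (τ /3)
        + C† x y (τ /3) * ϑ₃ (z - (pos 1 / 3) · fromℝ π) (τ /3)
        + C† (- x) (- y) (τ /3) * ϑ₃ (z + (pos 1 / 3) · fromℝ π) (τ /3)
    ϑ₃-identity = sum-form (ϑ₃ (z + x) τ) (ϑ₃ (z + y) τ) (ϑ₃ (z - x - y) τ)
      (A† (- x) (- y) (τ /3)) (C† x y (τ /3)) (C† (- x) (- y) (τ /3))
      (ϑ₃ z (τ /3)) (ϑ₃ (z - (pos 1 / 3) · fromℝ π) (τ /3)) (ϑ₃ (z + (pos 1 / 3) · fromℝ π) (τ /3))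
      (begin
        times (scalar 3ℚ) (times (times (ϑ₃ (z + x) τ) (ϑ₃ (z + y) τ)) (ϑ₃ (z - x - y) τ))
          ≈⟨ ℂR.*-congˡ (ℂR.*-cong (ℂR.*-cong
               (ϑ₃-value τ u≈ (pos 0) (pos 1) (pos 0) (pos 1) arg-z+x factor-0 (proj₂ c₁))
               (ϑ₃-value τ u≈ (pos 0) (pos 0) (pos 1) (pos 1) arg-z+y factor-0 (proj₂ c₂)))
               (ϑ₃-value τ u≈ (pos 0) ℤ.-1ℤ ℤ.-1ℤ (pos 1) arg-z-x-y factor-0 (proj₂ c₃))) ⟩
        times (scalar 3ℚ) (times (times (proj₁ c₁) (proj₁ c₂)) (proj₁ c₃))
          ≈⟨ ℂR.*-congˡ (ℂR.trans (ℂR.*-assoc _ _ _) (ℂR.sym (ℂR.trans (ℂR.*-congʳ factor-0) (ℂR.*-identityˡ _)))) ⟩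
        times (scalar 3ℚ) (times (𝐞 p⟨ 0ℚ ⟩) (times (proj₁ c₁) (times (proj₁ c₂) (proj₁ c₃))))
          ≈⟨ identity ⟩
        plus (plus (times (proj₁ a₀) (proj₁ c₀)) (times (proj₁ a⁺) (proj₁ c⁻))) (times (proj₁ a⁻) (proj₁ c⁺))
          ≈⟨ ℂR.+-cong (ℂR.+-cong
               (ℂR.*-cong A≈ (ϑ₃-value (τ /3) third≈ (pos 0) (pos 0) (pos 0) (pos 1) arg-z factor-0 (proj₂ c₀)))
               (ℂR.*-cong C⁺≈ (ϑ₃-value (τ /3) third≈ ℤ.-1ℤ (pos 0) (pos 0) (pos 1) arg-z-π/3 factor-0 (proj₂ c⁻))))
               (ℂR.*-cong C⁻≈ (ϑ₃-value (τ /3) third≈ (pos 1) (pos 0) (pos 0) (pos 1) arg-z+π/3 factor-0 (proj₂ c⁺))) ⟨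
        plus (plus (times (A† (- x) (- y) (τ /3)) (ϑ₃ z (τ /3)))
                   (times (C† x y (τ /3)) (ϑ₃ (z - (pos 1 / 3) · fromℝ π) (τ /3))))
             (times (C† (- x) (- y) (τ /3)) (ϑ₃ (z + (pos 1 / 3) · fromℝ π) (τ /3))) ∎)
      where
      open Product (pos 0)

    prefactor≈ : q^ π (pos 2 / 1) τ * exp (pos 4 ⋅ (𝕚 * x) + pos 2 ⋅ (𝕚 * y)) ≈ 𝐞 prefactor
    prefactor≈ = ℂR.trans
      (exp-product₂ (q^ π (pos 2 / 1) τ * exp (pos 4 ⋅ (𝕚 * x) + pos 2 ⋅ (𝕚 * y))) (λ _ → refl) (λ _ → refl)
        (·≈ 2ℚ (fromℝ π * 𝕚 * point τ) (λ _ → refl) (λ _ → refl) (nome≈ τ))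
        (plus⁻ (pos 4 ⋅ (𝕚 * x)) (pos 2 ⋅ (𝕚 * y))
          (·≈ 4ℚ (𝕚 * x) (λ _ → refl) (λ _ → refl) (𝕚*≈ x)) (·≈ 2ℚ (𝕚 * y) (λ _ → refl) (λ _ → refl) (𝕚*≈ y))))
      (ℂR.trans (ℂR.sym (ℂE.exp-+ (times (scalar 2ℚ) u) (plus (times (scalar 4ℚ) X) (times (scalar 2ℚ) Y))))
        (exp-cong (solveᴷ 5 (λ p u X Y Z → κ 2ℚ ⊛ u ⊕ (κ 4ℚ ⊛ X ⊕ κ 2ℚ ⊛ Y) ⊜ combination p u X Y Z prefactor) ℂR.refl p u X Y Z)))

    private
      b₀ b⁺ b⁻ e₀ e⁺ e⁻ : ∃ _
      b₀ = C-converges decays (pos 0) (pos 0)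
      b⁺ = C-converges decays (pos 1) (pos 0)
      b⁻ = C-converges decays ℤ.-1ℤ (pos 0)
      e₀ = C-converges decays (pos 0) (pos 2)
      e⁺ = C-converges decays (pos 1) (pos 2)
      e⁻ = C-converges decays ℤ.-1ℤ (pos 2)

      cube-difference : ∀ {a b c d a′ b′ c′ d′ E} → a ≈ a′ → b ≈ b′ → c ≈ c′ → d ≈ d′ →
        plus (cube a′) (times (negate 1ᶜ) (cube b′)) ≈ times E (plus (cube c′) (times (negate 1ᶜ) (cube d′))) →
        plus (cube a) (times (negate 1ᶜ) (cube b)) ≈ times E (plus (cube c) (times (negate 1ᶜ) (cube d)))
      cube-difference p q r s h = ℂR.trans (ℂR.+-cong (cube-cong p) (ℂR.*-congˡ (cube-cong q)))
        (ℂR.trans h (ℂR.*-congˡ (ℂR.sym (ℂR.+-cong (cube-cong r) (ℂR.*-congˡ (cube-cong s))))))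
        where
        cube-cong : ∀ {a b} → a ≈ b → cube a ≈ cube b
        cube-cong e = ℂR.*-cong e (ℂR.*-cong e e)

    C†-identity : C† x y τ ^ 3 - C† (- x) (- y) τ ^ 3
      ≃ q^ π (pos 2 / 1) τ * exp (pos 4 ⋅ (𝕚 * x) + pos 2 ⋅ (𝕚 * y)) * C† (x + fromℝ π * point τ) y τ ^ 3
        - q^ π (pos 2 / 1) τ * exp (pos 4 ⋅ (𝕚 * x) + pos 2 ⋅ (𝕚 * y)) * C† (- x - fromℝ π * point τ) (- y) τ ^ 3
    C†-identity = cube-form (C† x y τ) (C† (- x) (- y) τ)
      (q^ π (pos 2 / 1) τ * exp (pos 4 ⋅ (𝕚 * x) + pos 2 ⋅ (𝕚 * y)))
      (C† (x + fromℝ π * point τ) y τ) (C† (- x - fromℝ π * point τ) (- y) τ) prefactor≈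
      (cube-difference
        (C†-value τ u≈ (pos 1) refl (pos 0) 0ℚ refl arg-x arg-y (proj₂ b⁺))
        (C†-value τ u≈ ℤ.-1ℤ refl (pos 0) 0ℚ refl arg-neg-x arg-neg-y (proj₂ b⁻))
        (C†-value τ u≈ (pos 1) refl (pos 2) 1ℚ refl arg-x+πτ arg-y (proj₂ e⁺))
        (C†-value τ u≈ ℤ.-1ℤ refl (pos 2) 1ℚ refl arg-neg-x-πτ arg-neg-y (proj₂ e⁻))
        (cube-identity (pos 1) ℤ.-1ℤ (proj₂ b⁺) (proj₂ b⁻) (proj₂ e⁺) (proj₂ e⁻)))

    A†-identity : A† x y τ ^ 3 - C† x y τ ^ 3
      ≃ q^ π (pos 2 / 1) τ * exp (pos 4 ⋅ (𝕚 * x) + pos 2 ⋅ (𝕚 * y)) * A† (x + fromℝ π * point τ) y τ ^ 3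
        - q^ π (pos 2 / 1) τ * exp (pos 4 ⋅ (𝕚 * x) + pos 2 ⋅ (𝕚 * y)) * C† (x + fromℝ π * point τ) y τ ^ 3
    A†-identity = cube-form (A† x y τ) (C† x y τ)
      (q^ π (pos 2 / 1) τ * exp (pos 4 ⋅ (𝕚 * x) + pos 2 ⋅ (𝕚 * y)))
      (A† (x + fromℝ π * point τ) y τ) (C† (x + fromℝ π * point τ) y τ) prefactor≈
      (cube-difference
        (A†-value τ u≈ (pos 1) refl (pos 0) 0ℚ refl arg-x arg-y (proj₂ b₀))
        (C†-value τ u≈ (pos 1) refl (pos 0) 0ℚ refl arg-x arg-y (proj₂ b⁺))
        (A†-value τ u≈ (pos 1) refl (pos 2) 1ℚ refl arg-x+πτ arg-y (proj₂ e₀))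
        (C†-value τ u≈ (pos 1) refl (pos 2) 1ℚ refl arg-x+πτ arg-y (proj₂ e⁺))
        (cube-identity (pos 0) (pos 1) (proj₂ b₀) (proj₂ b⁺) (proj₂ e₀) (proj₂ e⁺)))

-- Existence of the four functions and the theorem

thetaFunctions : ∀ π → IsPi π → ThetaFunctions π
thetaFunctions π isPi = record
  { ϑ₁        = λ z τ → (- 𝕚) * proj₁ (ϑ₁-sum z τ)
  ; ϑ₃        = λ z τ → proj₁ (ϑ₃-sum z τ)
  ; A†        = λ x y τ → proj₁ (A†-sum x y τ)
  ; C†        = λ x y τ → proj₁ (C†-sum x y τ)
  ; ϑ₁-series = λ z τ → proj₁ (ϑ₁-sum z τ) , hasSum⁻ {f = ϑ₁-term π z τ} {proj₁ (ϑ₁-sum z τ)} (proj₂ (ϑ₁-sum z τ)) ,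
      ≈⇒≃ {(- 𝕚) * proj₁ (ϑ₁-sum z τ)} {(- 𝕚) * proj₁ (ϑ₁-sum z τ)} (ℂ-refl {(- 𝕚) * proj₁ (ϑ₁-sum z τ)})
  ; ϑ₃-series = λ z τ → hasSum⁻ {f = ϑ₃-term π z τ} {proj₁ (ϑ₃-sum z τ)} (proj₂ (ϑ₃-sum z τ))
  ; A†-series = λ x y τ → hasSum⁻ {f = A†-term π x y τ} {proj₁ (A†-sum x y τ)} (proj₂ (A†-sum x y τ))
  ; C†-series = λ x y τ → hasSum⁻ {f = C†-term π x y τ} {proj₁ (C†-sum x y τ)} (proj₂ (C†-sum x y τ))
  }
  where
  open Terms π isPi
  opaque
    ϑ₁-sum : ∀ z τ → ∃ (ℂS.HasSum (ϑ₁-term π z τ))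
    -- The series involves z only; the places of x and y are filled with 0.
    ϑ₁-sum z τ = Functions.θ-exists π isPi τ 0ℂ 0ℂ z (pos 1) {ϑ₁-term π z τ} (ϑ₁-raw z τ)
    ϑ₃-sum : ∀ z τ → ∃ (ℂS.HasSum (ϑ₃-term π z τ))
    ϑ₃-sum z τ = Functions.θ-exists π isPi τ 0ℂ 0ℂ z (pos 0) {ϑ₃-term π z τ} (ϑ₃-raw z τ)
    A†-sum : ∀ x y τ → ∃ (ℂS.HasSum (A†-term π x y τ))
    A†-sum x y τ = Functions.C-exists π isPi τ x y 0ℂ (pos 0) {A†-term π x y τ} (A†-raw x y τ)
    C†-sum : ∀ x y τ → ∃ (ℂS.HasSum (C†-term π x y τ))
    C†-sum x y τ = Functions.C-exists π isPi τ x y 0ℂ (pos 1) {C†-term π x y τ} (C†-raw x y τ)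

theorem3p2 : ∀ (π : ℝ) → IsPi π →
  ThetaFunctions π ×
  (∀ (Θ : ThetaFunctions π) → let open ThetaFunctions Θ in
   ∀ (τ : ℍ) (x y z : ℂ) →
    (pos 3 ⋅ (ϑ₁ (z + x) τ * ϑ₁ (z + y) τ * ϑ₁ (z - x - y) τ)
      ≃ A† (- x) (- y) (τ /3) * ϑ₁ z (τ /3)
        - C† x y (τ /3) * ϑ₁ (z - (pos 1 / 3) · fromℝ π) (τ /3)
        - C† (- x) (- y) (τ /3) * ϑ₁ (z + (pos 1 / 3) · fromℝ π) (τ /3))
    × (pos 3 ⋅ (ϑ₃ (z + x) τ * ϑ₃ (z + y) τ * ϑ₃ (z - x - y) τ)
      ≃ A† (- x) (- y) (τ /3) * ϑ₃ z (τ /3)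
        + C† x y (τ /3) * ϑ₃ (z - (pos 1 / 3) · fromℝ π) (τ /3)
        + C† (- x) (- y) (τ /3) * ϑ₃ (z + (pos 1 / 3) · fromℝ π) (τ /3))
    × (C† x y τ ^ 3 - C† (- x) (- y) τ ^ 3
      ≃ q^ π (pos 2 / 1) τ * exp (pos 4 ⋅ (𝕚 * x) + pos 2 ⋅ (𝕚 * y))
          * C† (x + fromℝ π * point τ) y τ ^ 3
        - q^ π (pos 2 / 1) τ * exp (pos 4 ⋅ (𝕚 * x) + pos 2 ⋅ (𝕚 * y))
          * C† (- x - fromℝ π * point τ) (- y) τ ^ 3)
    × (A† x y τ ^ 3 - C† x y τ ^ 3
      ≃ q^ π (pos 2 / 1) τ * exp (pos 4 ⋅ (𝕚 * x) + pos 2 ⋅ (𝕚 * y))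
          * A† (x + fromℝ π * point τ) y τ ^ 3
        - q^ π (pos 2 / 1) τ * exp (pos 4 ⋅ (𝕚 * x) + pos 2 ⋅ (𝕚 * y))
          * C† (x + fromℝ π * point τ) y τ ^ 3))
theorem3p2 π isPi = thetaFunctions π isPi , λ Θ τ x y z → let open Functions π isPi τ x y z in
  ϑ₁-identity Θ , ϑ₃-identity Θ , C†-identity Θ , A†-identity Θ
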